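{- Let $u\le w$ be permutations in $\Sigma_n$. Then \[ \mathfrak{S}_{w/u}(x)\ =\ \sum_{\gamma} x^\delta/x^\gamma, \] the sum over all increasing chains $\gamma$ in the labeled Bruhat order from $u$ to $w$.
   Context: $\Sigma_n$ is the symmetric group on $\{1,\dots,n\}$, $\ell(w)$ the number of inversions, $w_0=n\cdots 21$. Bruhat covers: $u\lessdot w$ iff $w=u\cdot(k,l)$ (swapping the entries in positions $k<l$) with $u(k)<u(l)$ and for no $k<i<l$ is $u(k)<u(i)<u(l)$. The labeled Bruhat order is the directed multigraph with an edge $u\xrightarrow{(k,b)}w$ whenever $u\lessdot w$, $u^{ -1}w=(i,j)$ with $i\le k<j$ and $b=u(i)=w(j)$. A (saturated) chain $u_0\xrightarrow{(k_1,b_1)}u_1\to\cdots\xrightarrow{(k_m,b_m)}u_m$ is increasing if $(k_1,b_1)<(k_2,b_2)<\dots<(k_m,b_m)$ in lexicographic order; its monomial is $x^\gamma=\prod_{t=1}^m x_{k_t}$. Set $\delta=(n-1,n-2,\dots,1,0)$, so $x^\delta=x_1^{n-1}x_2^{n-2}\cdots x_{n-1}$. $\mathfrak{S}_w$ is the Schubert polynomial; $H^*\mathrm{F}\ell_n=\mathbb{Z}[x_1,\dots,x_n]/\langle e_1,\dots,e_n\rangle$ with $\sigma_w$ the class of $\mathfrak{S}_w$; normal form representatives are taken with respect to degree reverse lexicographic order with $x_1<\dots<x_n$; the skew Schubert polynomial $\mathfrak{S}_{w/u}(x)$ is the normal form representative of $\sigma_u\cdot\sigma_{w_0w}$. -}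

module Defs where

open import Data.Nat using (ℕ; zero; suc; _∸_; _<_; _≤_; _<ᵇ_; _≡ᵇ_; _*_)
import Data.Nat as N
open import Data.Nat.Properties using (_≟_)
open import Data.Integer using (ℤ; 0ℤ; 1ℤ; -_) renaming (_+_ to _+ℤ_; _*_ to _*ℤ_)
open import Data.Bool using (Bool; true; false; if_then_else_; _∧_; _∨_; not)
open import Data.Fin using (Fin; toℕ)
open import Data.Vec using (Vec; []; _∷_; tabulate; toList; zipWith)
import Data.Vec as V
open import Data.Vec.Properties using (≡-dec)
open import Data.List using (List; []; _∷_; map; concatMap; upTo; applyUpTo; filterᵇ; length; foldr; _++_; allFin)
open import Data.Bool.ListAction using (any)
open import Data.List.Relation.Binary.Permutation.Propositional using (_↭_)
open import Data.Maybe using (Maybe; just; nothing)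
open import Data.Product using (Σ; _×_; _,_; proj₁)
open import Data.Sum using (_⊎_)
open import Data.Empty using (⊥)
open import Relation.Nullary using (¬_; does)
open import Relation.Binary.PropositionalEquality using (_≡_)
open import Relation.Binary.Construct.Closure.ReflexiveTransitive using (Star)

-- Permutations of {1,…,n} in one-line notation: w = (w(1),…,w(n)).

-- entry at (1-indexed) position k; 0 outside 1..n
ent : ∀ {n} → Vec ℕ n → ℕ → ℕ
ent [] k = 0
ent (x ∷ v) zero = 0
ent (x ∷ v) (suc zero) = x
ent (x ∷ v) (suc (suc k)) = ent v (suc k)

pos : ∀ {n} → Fin n → ℕ
pos p = suc (toℕ p)

range : ℕ → ℕ → List ℕ
range a b = map (a N.+_) (upTo (suc b ∸ a))

IsPerm : ∀ {n} → Vec ℕ n → Set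
IsPerm {n} v = toList v ↭ applyUpTo suc n

swapPos : ∀ {n} → ℕ → ℕ → Vec ℕ n → Vec ℕ n
swapPos k l v = tabulate λ p →
  if pos p ≡ᵇ k then ent v l else if pos p ≡ᵇ l then ent v k else ent v (pos p)

len : ∀ {n} → Vec ℕ n → ℕ
len {n} v = length (filterᵇ (λ ij → ent v (Data.Product.proj₂ ij) <ᵇ ent v (proj₁ ij))
  (concatMap (λ i → map (λ j → (i , j)) (range (suc i) n)) (range 1 n)))

-- w₀ · w  (left multiplication by w₀ = n⋯21): value a ↦ n+1-a
w0mul : ∀ {n} → Vec ℕ n → Vec ℕ n
w0mul {n} w = V.map (λ a → suc n ∸ a) w

Cover : ∀ {n} → Vec ℕ n → Vec ℕ n → Set
Cover {n} u w = Σ ℕ λ k → Σ ℕ λ l →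
  1 ≤ k × k < l × l ≤ n × w ≡ swapPos k l u × ent u k < ent u l ×
  (∀ i → k < i → i < l → ¬ (ent u k < ent u i × ent u i < ent u l))

_≤B_ : ∀ {n} → Vec ℕ n → Vec ℕ n → Set
u ≤B w = Star Cover u w

coverᵇ : ∀ {n} → Vec ℕ n → ℕ → ℕ → Bool
coverᵇ u i j = (ent u i <ᵇ ent u j) ∧
  not (any (λ m → (ent u i <ᵇ ent u m) ∧ (ent u m <ᵇ ent u j)) (range (suc i) (j ∸ 1)))

Label : Set
Label = ℕ × ℕ

edges : ∀ {n} → Vec ℕ n → List (Label × Vec ℕ n)
edges {n} u = concatMap (λ i → concatMap (λ j →
    if coverᵇ u i j
    then map (λ k → ((k , ent u i) , swapPos i j u)) (range i (j ∸ 1))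
    else []) (range (suc i) n)) (range 1 n)

chains : ∀ {n} → ℕ → Vec ℕ n → List (List Label × Vec ℕ n)
chains zero u = ([] , u) ∷ []
chains (suc m) u = concatMap (λ e → map (λ c → (proj₁ e ∷ proj₁ c , Data.Product.proj₂ c))
  (chains m (Data.Product.proj₂ e))) (edges u)

lexLt : Label → Label → Bool
lexLt (a , b) (c , d) = (a <ᵇ c) ∨ ((a ≡ᵇ c) ∧ (b <ᵇ d))

increasing : List Label → Bool
increasing [] = true
increasing (x ∷ []) = true
increasing (x ∷ y ∷ r) = lexLt x y ∧ increasing (y ∷ r)

-- all increasing chains from u to w (every saturated chain u → w has length ℓ(w)-ℓ(u))
incChains : ∀ {n} → Vec ℕ n → Vec ℕ n → List (List Label)
incChains u w = map proj₁ (filterᵇ (λ c → increasing (proj₁ c) ∧ does (≡-dec _≟_ (Data.Product.proj₂ c) w))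
  (chains (len w ∸ len u) u))

Mono : ℕ → Set
Mono n = Vec ℕ n

Poly : ℕ → Set
Poly n = List (ℤ × Mono n)

coeff : ∀ {n} → Poly n → Mono n → ℤ
coeff p α = foldr (λ t acc → if does (≡-dec _≟_ (Data.Product.proj₂ t) α) then proj₁ t +ℤ acc else acc) 0ℤ p

_≈P_ : ∀ {n} → Poly n → Poly n → Set
p ≈P q = ∀ α → coeff p α ≡ coeff q α

_+P_ : ∀ {n} → Poly n → Poly n → Poly n
p +P q = p ++ q

-P_ : ∀ {n} → Poly n → Poly n
-P p = map (λ t → (- proj₁ t , Data.Product.proj₂ t)) p

_*P_ : ∀ {n} → Poly n → Poly n → Poly n
p *P q = concatMap (λ s → map (λ t → (proj₁ s *ℤ proj₁ t , zipWith N._+_ (Data.Product.proj₂ s) (Data.Product.proj₂ t))) q) p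

mono : ∀ {n} → Mono n → Poly n
mono α = (1ℤ , α) ∷ []

δ : (n : ℕ) → Mono n
δ n = tabulate λ p → n ∸ pos p

-- divided difference ∂ᵢ f = (f - sᵢ f)/(xᵢ - xᵢ₊₁), on monomials:
-- ∂ᵢ (xᵢ^a xᵢ₊₁^b) = Σ_{t<a-b} xᵢ^(a-1-t) xᵢ₊₁^(b+t) if a>b,
--                  = -Σ_{t<b-a} xᵢ^(b-1-t) xᵢ₊₁^(a+t) if a<b, 0 if a=b
set2 : ∀ {n} → Mono n → ℕ → ℕ → ℕ → Mono n
set2 α i x y = tabulate λ p →
  if pos p ≡ᵇ i then x else if pos p ≡ᵇ suc i then y else ent α (pos p)

∂term : ∀ {n} → ℕ → ℤ × Mono n → Poly n
∂term i (c , α) =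
  if b <ᵇ a then map (λ t → (c , set2 α i (a ∸ 1 ∸ t) (b N.+ t))) (upTo (a ∸ b))
  else if a <ᵇ b then map (λ t → (- c , set2 α i (b ∸ 1 ∸ t) (a N.+ t))) (upTo (b ∸ a))
  else []
  where
  a = ent α i
  b = ent α (suc i)

∂ : ∀ {n} → ℕ → Poly n → Poly n
∂ i p = concatMap (∂term i) p

firstAscent : ∀ {n} → Vec ℕ n → Maybe ℕ
firstAscent {n} w = go (range 1 (n ∸ 1))
  where
  go : List ℕ → Maybe ℕ
  go [] = nothing
  go (i ∷ is) = if ent w i <ᵇ ent w (suc i) then just i else go is

-- Schubert polynomials: 𝔖_{w₀} = x^δ and 𝔖_w = ∂ᵢ 𝔖_{w sᵢ} whenever ℓ(w sᵢ) > ℓ(w).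
-- (fuel n*n exceeds the ℓ(w₀)-ℓ(w) steps needed)
schubF : ∀ {n} → ℕ → Vec ℕ n → Poly n
schubF {n} zero w = mono (δ n)
schubF {n} (suc f) w with firstAscent w
... | just i = ∂ i (schubF f (swapPos i (suc i) w))
... | nothing = mono (δ n)

schub : ∀ {n} → Vec ℕ n → Poly n
schub {n} w = schubF (n * n) w

bits : (n : ℕ) → List (Vec ℕ n)
bits zero = [] ∷ []
bits (suc n) = map (0 ∷_) (bits n) ++ map (1 ∷_) (bits n)

esym : (n k : ℕ) → Poly n
esym n k = map (λ α → (1ℤ , α)) (filterᵇ (λ α → V.sum α ≡ᵇ k) (bits n))

InIdeal : ∀ {n} → Poly n → Set
InIdeal {n} f = Σ (Fin n → Poly n) λ cs →
  f ≈P foldr (λ p acc → (cs p *P esym n (pos p)) +P acc) [] (allFin n)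

-- α - β has first nonzero entry positive (x₁ is the smallest variable)
firstDiffGt : ∀ {n} → Mono n → Mono n → Set
firstDiffGt [] [] = ⊥
firstDiffGt (a ∷ α) (b ∷ β) = (b < a) ⊎ (a ≡ b × firstDiffGt α β)

-- α <ᵈ β in degree reverse lexicographic order with x₁ < ⋯ < xₙ
_<ᵈ_ : ∀ {n} → Mono n → Mono n → Set
α <ᵈ β = (V.sum α < V.sum β) ⊎ (V.sum α ≡ V.sum β × firstDiffGt α β)

IsLeading : ∀ {n} → Poly n → Mono n → Set
IsLeading f α = ¬ (coeff f α ≡ 0ℤ) × (∀ β → ¬ (coeff f β ≡ 0ℤ) → (β ≡ α) ⊎ (β <ᵈ α))

Standard : ∀ {n} → Mono n → Set
Standard {n} α = ¬ (Σ (Poly n) λ f → InIdeal f × IsLeading f α)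

IsNormalForm : ∀ {n} → Poly n → Poly n → Set
IsNormalForm g f = InIdeal (f +P (-P g)) × (∀ α → ¬ (coeff g α ≡ 0ℤ) → Standard α)

chainExp : ∀ {n} → List Label → Mono n
chainExp γ = tabulate λ p → length (filterᵇ (λ kb → proj₁ kb ≡ᵇ pos p) γ)

chainSum : ∀ {n} → Vec ℕ n → Vec ℕ n → Poly n
chainSum {n} u w = map (λ γ → (1ℤ , zipWith _∸_ (δ n) (chainExp γ))) (incChains u w)

{-# OPTIONS --safe #-}
module Submission where

-- Let permutations act on functions g with values in a commutative ring: M k is the Monk operator
-- Σ_{l>k} g(u(k,l)) - Σ_{l<k} g(u(l,k)) over covers, and d i the divided difference g(u sᵢ) at descents i.
-- The relation M k ∘ d i = d i ∘ M (sᵢ k) + ∂ᵢ(x_k) makes the M k commute and turns the recursion for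
-- Schubert polynomials into (𝔖_u(M) g)(id) = g(u) and 𝔖_{w₀w}(M) 1_{w₀} = 1_w.
-- Chains with a fixed first label k and increasing second labels are counted by h_m(M 1, …, M k) (Pieri),
-- so the sum over increasing chains from u to w is (K 1_w)(u) with
-- K = ∏_k Σ_m X_k^{n-k-m} h_m(M 1, …, M k).  Modulo the ideal, M k K = X_k K, because
-- h_{n-k+1}(X_1, …, X_k) ≡ 0; hence (K 1_w)(u) ≡ 𝔖_{w₀w}(X) 𝔖_u(X) (K 1_{w₀})(id), and the last factor is 1.
-- A monomial x^α dividing x^δ is standard because f ↦ (f(M) x^{δ-α}(M) 1_{w₀})(id) kills the ideal
-- and reads off the coefficient of x^α in any f with leading monomial x^α.

open import Defs
open import Algebra.Bundles using (CommutativeRing)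
import Algebra.Solver.Ring as RingSolver
import Algebra.Solver.Ring.AlmostCommutativeRing as ACR
open import Data.Bool using (Bool; true; false; T; _∧_; _∨_; not; if_then_else_)
open import Data.Bool.ListAction using (any)
open import Data.Bool.Properties using (T-∧; T-∨; T-not-≡; ∧-assoc; ∧-comm)
open import Data.Empty using (⊥; ⊥-elim)
open import Data.Fin using (Fin; toℕ; fromℕ<)
import Data.Fin.Properties as FinP
open import Data.Integer using (ℤ; 0ℤ; 1ℤ)
import Data.Integer as ℤ
import Data.Integer.Properties as ℤP
open import Data.List using (List; []; _∷_; map; upTo; applyUpTo; length; filterᵇ; concatMap; _++_; deduplicate; foldr; allFin)
import Data.List.Membership.DecPropositional as DecMem
open import Data.List.Membership.Propositional using (_∈_; find; lose)
open import Data.List.Membership.Propositional.Properties using (∈-map⁺; ∈-map⁻; ∈-upTo⁺; ∈-upTo⁻; ∈-applyUpTo⁻; ∈-filter⁺; ∈-concatMap⁻; ∈-deduplicate⁺; ∈-++⁺ˡ; ∈-++⁺ʳ; ∈-allFin)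
open import Data.List.Properties using (upTo-∷ʳ; map-upTo; length-map; length-++; length-filter; length-upTo)
open import Data.List.Relation.Binary.Permutation.Propositional using (↭-sym; ↭⇒↭ₛ)
open import Data.List.Relation.Binary.Permutation.Propositional.Properties using (∈-resp-↭)
import Data.List.Relation.Binary.Permutation.Setoid.Properties as PermS
open import Data.List.Relation.Unary.All as All using (All; []; _∷_)
open import Data.List.Relation.Unary.AllPairs using ([]; _∷_)
open import Data.List.Relation.Unary.Any using (any?; here; there)
open import Data.List.Relation.Unary.Any.Properties using (any⁺; any⁻)
import Data.List.Relation.Unary.Unique.DecPropositional.Properties as DecUniq
open import Data.List.Relation.Unary.Unique.Propositional using (Unique)
import Data.List.Relation.Unary.Unique.Propositional.Properties as UniqP
open import Data.Maybe using (Maybe; just; nothing)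
open import Data.Nat using (ℕ; zero; suc; _≤_; _<_; z≤n; s≤s; _∸_; _<ᵇ_; _≡ᵇ_)
import Data.Nat as ℕ
open import Data.Nat.Properties using (_≟_; _<?_; _≤?_; <-cmp; <-irrefl; <-asym; <-trans; ≤-trans; ≤-refl; ≤-pred; <⇒≤; <⇒≢; <⇒≱; <⇒<ᵇ; <ᵇ⇒<; ≡⇒≡ᵇ; ≡ᵇ⇒≡; ≤∧≢⇒<; ≮⇒≥; ≰⇒>; <-≤-trans; ≤-<-trans; n<1+n; n≮0; m≤n⇒m<n∨m≡n; m≤m+n; m+[n∸m]≡n; m∸n+n≡m; m≤n⇒m∸n≡0; suc-injective; ∸-monoˡ-≤; ∸-monoʳ-<; +-monoˡ-≤)
import Data.Nat.Properties as ℕP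
import Data.Nat.Solver
open import Data.Product using (Σ; _×_; _,_; proj₁; proj₂; ∃)
open import Data.Sum using (_⊎_; inj₁; inj₂)
open import Data.Unit using (⊤; tt)
open import Data.Vec using (Vec; []; _∷_; tabulate; lookup; zipWith; replicate; toList)
import Data.Vec as V
open import Data.Vec.Properties using (≡-dec; tabulate-cong; lookup∘tabulate)
open import Function using (_∘_)
open import Function.Bundles using (Equivalence)
open import Level using (0ℓ)
open import Relation.Binary.Definitions using (DecidableEquality; tri<; tri≈; tri>)
import Relation.Binary.PropositionalEquality as ≡
open ≡ using (_≡_; _≢_; refl; sym; trans; cong; cong₂; cong-app; subst; subst₂)
open import Relation.Nullary using (¬_; Dec; yes; no; does)
open import Relation.Nullary.Decidable using (T?)

-- A function g on permutations stands for the linear functional on cohomology that sends σ_u to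
-- g(u). In this reading `M k` is the transpose of multiplication by x_k (Monk's rule) and `d i` the
-- transpose of ∂_i. The reading is only a guide: neither that the Schubert classes form a basis nor
-- that the ideal acts by zero is available beforehand. Both operators are therefore defined by the
-- Bruhat order alone, and the commutation of the `M k` and the vanishing of their elementary
-- symmetric polynomials are derived from it. The values of g may themselves be polynomials modulo
-- the ideal, so K involves two copies of the variables, the operators M and the scalars X. The
-- exponent n-k-m is what x^δ/x^γ leaves of x_k after m labels k. K plays the part of the class of
-- the diagonal: multiplication by x_k in either copy has the same effect on it, and this turns a
-- sum over chains into a product of two classes. Over ℤ the same machinery, with other weights or
-- with x^(δ-α) in place of K, bounds the exponents and proves standardness.

∧-intro : ∀ {a b} → T a → T b → T (a ∧ b)
∧-intro x y = Equivalence.from T-∧ (x , y)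

∧-elim : ∀ {a b} → T (a ∧ b) → T a × T b
∧-elim = Equivalence.to T-∧

T-iff : ∀ {a b} → (T a → T b) → (T b → T a) → a ≡ b
T-iff {false} {false} f g = refl
T-iff {false} {true} f g = ⊥-elim (g tt)
T-iff {true} {false} f g = ⊥-elim (f tt)
T-iff {true} {true} f g = refl

T⇒≡ : ∀ {a} → T a → a ≡ true
T⇒≡ {true} _ = refl

¬T⇒≡ : ∀ {a} → ¬ T a → a ≡ false
¬T⇒≡ {true} f = ⊥-elim (f tt)
¬T⇒≡ {false} f = refl

∈-range⁺ : ∀ {a b m} → a ≤ m → m ≤ b → m ∈ range a b
∈-range⁺ {a} {b} {m} a≤m m≤b =
  subst (_∈ range a b) (m+[n∸m]≡n a≤m)
    (∈-map⁺ (a ℕ.+_) (∈-upTo⁺ (subst (m ∸ a <_) (sym (ℕP.+-∸-assoc 1 (≤-trans a≤m m≤b))) (s≤s (∸-monoˡ-≤ a m≤b)))))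

∈-range⁻ : ∀ {a b m} → m ∈ range a b → a ≤ m × m ≤ b
∈-range⁻ {a} {b} p with ∈-map⁻ (a ℕ.+_) p
... | t , t∈ , refl = m≤m+n a t , ≤-pred (subst (ℕ._≤ suc b) (trans (ℕP.+-comm (suc t) a) (ℕP.+-suc a t)) h)
  where
  lt : t < suc b ∸ a
  lt = ∈-upTo⁻ t∈
  h : suc t ℕ.+ a ≤ suc b
  h = m≤n∸o⇒m+o≤n′ lt
    where
    m≤n∸o⇒m+o≤n′ : suc t ≤ suc b ∸ a → suc t ℕ.+ a ≤ suc b
    m≤n∸o⇒m+o≤n′ q with a ≤? suc b
    ... | yes a≤ = subst (suc t ℕ.+ a ≤_) (m∸n+n≡m a≤) (+-monoˡ-≤ a q)
    ... | no a≰ = ⊥-elim (n≮0 (subst (t <_) (m≤n⇒m∸n≡0 (<⇒≤ (≰⇒> a≰))) q))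

-- Transpositions and covers in one-line notation

-- Serves for positions and for values. `ent` returns 0 at positions outside this range, so an
-- in-range hypothesis accompanies nearly every lookup.
In : ℕ → ℕ → Set
In n p = 1 ≤ p × p ≤ n

ent-tabulate : ∀ {n} (h : ℕ → ℕ) p → In n p → ent (tabulate {n = n} (λ q → h (pos q))) p ≡ h p
ent-tabulate {zero} h (suc p) (_ , ())
ent-tabulate {suc n} h (suc zero) _ = refl
ent-tabulate {suc n} h (suc (suc p)) (_ , s≤s p≤n) = ent-tabulate {n} (h ∘ suc) (suc p) (s≤s z≤n , p≤n)

ent-ext : ∀ {n} {u v : Vec ℕ n} → (∀ p → In n p → ent u p ≡ ent v p) → u ≡ v
ent-ext {u = []} {[]} h = refl
ent-ext {suc n} {x ∷ u} {y ∷ v} h = cong₂ _∷_ (h 1 (s≤s z≤n , s≤s z≤n))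
  (ent-ext (λ { (suc p) (q , r) → h (suc (suc p)) (s≤s z≤n , s≤s r) }))

fromFun : ∀ {n} → (ℕ → ℕ) → Vec ℕ n
fromFun h = tabulate (λ p → h (pos p))

Adjacent-In : ℕ → ℕ → Set
Adjacent-In n t = In n t × In n (suc t)

transp : ℕ → ℕ → ℕ → ℕ
transp k l p with p ≟ k | p ≟ l
... | yes _ | _ = l
... | no _ | yes _ = k
... | no _ | no _ = p

transpˡ : ∀ k l → transp k l k ≡ l
transpˡ k l with k ≟ k | k ≟ l
... | yes _ | _ = refl
... | no k≢k | _ = ⊥-elim (k≢k refl)

transpʳ : ∀ k l → transp k l l ≡ k
transpʳ k l with l ≟ k | l ≟ l
... | yes l≡k | _ = l≡k
... | no _ | yes _ = refl
... | no _ | no l≢l = ⊥-elim (l≢l refl)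

transpᵒ : ∀ k l p → p ≢ k → p ≢ l → transp k l p ≡ p
transpᵒ k l p a b with p ≟ k | p ≟ l
... | yes q | _ = ⊥-elim (a q)
... | no _ | yes q = ⊥-elim (b q)
... | no _ | no _ = refl

-- Matching on this view together with `transp k l p` replaces the value by `l`, `k` or `p` at once.
-- The cases exclude each other in the order in which they are tested.
data TranspView (k l p : ℕ) : ℕ → Set where
  isˡ : p ≡ k → TranspView k l p l
  isʳ : p ≢ k → p ≡ l → TranspView k l p k
  isᵒ : p ≢ k → p ≢ l → TranspView k l p p

transpView : ∀ k l p → TranspView k l p (transp k l p)
transpView k l p with p ≟ k | p ≟ l
... | yes q | _ = isˡ q
... | no r | yes q = isʳ r q
... | no r | no s = isᵒ r s

transp-In : ∀ {n k l} p → In n k → In n l → In n p → In n (transp k l p)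
transp-In {n} {k} {l} p Ik Il Ip with transp k l p | transpView k l p
... | _ | isˡ _ = Il
... | _ | isʳ _ _ = Ik
... | _ | isᵒ _ _ = Ip

transp-invol : ∀ k l p → transp k l (transp k l p) ≡ p
transp-invol k l p with transp k l p | transpView k l p
... | _ | isˡ refl = transpʳ p l
... | _ | isʳ _ refl = transpˡ k p
... | _ | isᵒ a b = transpᵒ k l p a b

transp-inj : ∀ k l {p q} → transp k l p ≡ transp k l q → p ≡ q
transp-inj k l {p} {q} e = trans (sym (transp-invol k l p)) (trans (cong (transp k l) e) (transp-invol k l q))

ent-swap : ∀ {n} k l (u : Vec ℕ n) p → In n p → ent (swapPos k l u) p ≡ ent u (transp k l p)
ent-swap k l u p Ip = trans (ent-tabulate (λ p → if p ≡ᵇ k then ent u l else if p ≡ᵇ l then ent u k else ent u p) p Ip) (lem p)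
  where
  lem : ∀ p → (if p ≡ᵇ k then ent u l else if p ≡ᵇ l then ent u k else ent u p) ≡ ent u (transp k l p)
  lem p with transp k l p | transpView k l p
  ... | _ | isˡ refl rewrite T⇒≡ (≡⇒≡ᵇ p p refl) = refl
  ... | _ | isʳ a refl rewrite ¬T⇒≡ (a ∘ ≡ᵇ⇒≡ p k) | T⇒≡ (≡⇒≡ᵇ p p refl) = refl
  ... | _ | isᵒ a b rewrite ¬T⇒≡ (a ∘ ≡ᵇ⇒≡ p k) | ¬T⇒≡ (b ∘ ≡ᵇ⇒≡ p l) = refl

-- Being a permutation, in the form that passes easily through `swapPos`: both fields speak of
-- single positions.
record Good {n} (u : Vec ℕ n) : Set where
  field
    bound : ∀ {p} → In n p → In n (ent u p)
    inj : ∀ {p q} → In n p → In n q → ent u p ≡ ent u q → p ≡ q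
open Good

Good-swap : ∀ {n k l} {u : Vec ℕ n} → In n k → In n l → Good u → Good (swapPos k l u)
Good-swap {n} {k} {l} {u} Ik Il G .bound {p} Ip =
  subst (In n) (sym (ent-swap k l u p Ip)) (G .bound (transp-In p Ik Il Ip))
Good-swap {n} {k} {l} {u} Ik Il G .inj {p} {q} Ip Iq e =
  transp-inj k l (G .inj (transp-In p Ik Il Ip) (transp-In q Ik Il Iq)
    (trans (sym (ent-swap k l u p Ip)) (trans e (ent-swap k l u q Iq))))

swap-invol : ∀ {n} k l (u : Vec ℕ n) → In n k → In n l → swapPos k l (swapPos k l u) ≡ u
swap-invol k l u Ik Il = ent-ext λ p Ip →
  trans (ent-swap k l (swapPos k l u) p Ip) (trans (ent-swap k l u _ (transp-In p Ik Il Ip)) (cong (ent u) (transp-invol k l p)))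

swap-swap : ∀ {n} k l i j (u : Vec ℕ n) p → In n k → In n l → In n i → In n j → In n p →
  ent (swapPos k l (swapPos i j u)) p ≡ ent u (transp i j (transp k l p))
swap-swap k l i j u p Ik Il Ii Ij Ip =
  trans (ent-swap k l (swapPos i j u) p Ip) (ent-swap i j u _ (transp-In p Ik Il Ip))

-- Conjugation of a transposition relabels its two positions. Every equality between the ends of
-- two-step paths below is an instance.
swap-conj : ∀ {n} i j x y (u : Vec ℕ n) → In n i → In n j → In n x → In n y →
  swapPos i j (swapPos x y u) ≡ swapPos (transp i j x) (transp i j y) (swapPos i j u)
swap-conj i j x y u Ii Ij Ix Iy = ent-ext λ p Ip →
  trans (swap-swap i j x y u p Ii Ij Ix Iy Ip)
    (trans (cong (ent u) (lem p))
      (sym (swap-swap _ _ i j u p (transp-In x Ii Ij Ix) (transp-In y Ii Ij Iy) Ii Ij Ip)))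
  where
  s = transp i j
  lem : ∀ p → transp x y (s p) ≡ s (transp (s x) (s y) p)
  lem p with transp (s x) (s y) p | transpView (s x) (s y) p
  ... | _ | isˡ refl rewrite transp-invol i j x | transp-invol i j y = transpˡ x y
  ... | _ | isʳ _ refl rewrite transp-invol i j x | transp-invol i j y = transpʳ x y
  ... | _ | isᵒ a b = transpᵒ x y (s p) (λ e → a (trans (sym (transp-invol i j p)) (cong s e)))
                                       (λ e → b (trans (sym (transp-invol i j p)) (cong s e)))

-- The value bounds are arguments of their own, so that the condition can be carried between vectors
-- that differ only at moved positions.
NoneBetween : ∀ {n} → Vec ℕ n → ℕ → ℕ → ℕ → ℕ → Set
NoneBetween u i j x y = ∀ m → i < m → m < j → x < ent u m → ent u m < y → ⊥

Cov : ∀ {n} → Vec ℕ n → ℕ → ℕ → Set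
Cov u i j = ent u i < ent u j × NoneBetween u i j (ent u i) (ent u j)

-- The order test is built in, so that later sums may run over all pairs of positions.
up : ∀ {n} → Vec ℕ n → ℕ → ℕ → Bool
up u i j = (i <ᵇ j) ∧ coverᵇ u i j

up⁺ : ∀ {n} (u : Vec ℕ n) {i j} → i < j → Cov u i j → T (up u i j)
up⁺ u {i} {j} i<j (lt , nb) = ∧-intro (<⇒<ᵇ i<j) (∧-intro (<⇒<ᵇ lt)
  (Equivalence.from T-not-≡ (¬T⇒≡ λ t → bad (find (any⁻ between (range (suc i) (j ∸ 1)) t)))))
  where
  between : ℕ → Bool
  between m = (ent u i <ᵇ ent u m) ∧ (ent u m <ᵇ ent u j)
  bad : ∃ (λ m → m ∈ range (suc i) (j ∸ 1) × T (between m)) → ⊥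
  bad (m , m∈ , t) with ∈-range⁻ {suc i} {j ∸ 1} m∈ | ∧-elim {ent u i <ᵇ ent u m} t
  ... | i<m , m≤ | t₁ , t₂ = nb m i<m (≤-<-trans m≤ (∸-monoʳ-< {j} {1} {0} (s≤s z≤n) (≤-trans (s≤s z≤n) i<j))) (<ᵇ⇒< _ _ t₁) (<ᵇ⇒< _ _ t₂)

up⁻ : ∀ {n} (u : Vec ℕ n) {i j} → T (up u i j) → i < j × Cov u i j
up⁻ u {i} {j} t with ∧-elim {i <ᵇ j} t
... | t₁ , t₂ with ∧-elim {ent u i <ᵇ ent u j} t₂
... | t₃ , t₄ = <ᵇ⇒< _ _ t₁ , <ᵇ⇒< _ _ t₃ , λ m i<m m<j x y →
  noT (Equivalence.to T-not-≡ t₄)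
    (any⁺ _ (lose (∈-range⁺ {suc i} {j ∸ 1} i<m (∸-monoˡ-≤ 1 m<j)) (∧-intro (<⇒<ᵇ x) (<⇒<ᵇ y))))
  where
  noT : ∀ {b} → b ≡ false → T b → ⊥
  noT refl ()

dsc : ∀ {n} → Vec ℕ n → ℕ → Bool
dsc u i = ent u (suc i) <ᵇ ent u i

swapˡ : ∀ {n} k l (u : Vec ℕ n) → In n k → ent (swapPos k l u) k ≡ ent u l
swapˡ k l u Ik = trans (ent-swap k l u k Ik) (cong (ent u) (transpˡ k l))

swapʳ : ∀ {n} k l (u : Vec ℕ n) → In n l → ent (swapPos k l u) l ≡ ent u k
swapʳ k l u Il = trans (ent-swap k l u l Il) (cong (ent u) (transpʳ k l))

swapᵒ : ∀ {n} k l (u : Vec ℕ n) {p} → In n p → p ≢ k → p ≢ l → ent (swapPos k l u) p ≡ ent u p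
swapᵒ k l u {p} Ip a b = trans (ent-swap k l u p Ip) (cong (ent u) (transpᵒ k l p a b))

ent≢ : ∀ {n} {u : Vec ℕ n} → Good u → ∀ {p q} → In n p → In n q → p ≢ q → ent u p ≢ ent u q
ent≢ G Ip Iq ne e = ne (G .inj Ip Iq e)

≮⇒< : ∀ {a b} → ¬ (a < b) → a ≢ b → b < a
≮⇒< p q = ≤∧≢⇒< (≮⇒≥ p) (q ∘ sym)

In-between : ∀ {n i j m} → In n i → In n j → i < m → m < j → In n m
In-between (a , _) (_ , b) x y = ≤-trans a (<⇒≤ x) , ≤-trans (<⇒≤ y) b

-- A two-step path through disjoint transpositions can be run in the opposite order. Entries away
-- from the moved positions do not change, so an obstruction in the new order could only sit at a
-- moved position; comparing positions and values there gives an obstruction to one of the two given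
-- covers.
module Disjoint {n : ℕ} (u : Vec ℕ n) (G : Good u) {i j k l : ℕ}
  (Ii : In n i) (Ij : In n j) (Ik : In n k) (Il : In n l)
  (i<j : i < j) (k<l : k < l)
  (k≢i : k ≢ i) (k≢j : k ≢ j) (l≢i : l ≢ i) (l≢j : l ≢ j) where

  private
    u₁ = swapPos i j u
    u₂ = swapPos k l u
    u₁k : ent u₁ k ≡ ent u k
    u₁k = swapᵒ i j u Ik k≢i k≢j
    u₁l : ent u₁ l ≡ ent u l
    u₁l = swapᵒ i j u Il l≢i l≢j

  Cov-after : Cov u i j → Cov u₁ k l → Cov u k l
  Cov-after (x<y , nb₁) (z<w′ , nb₂′) = z<w , nb
    where
    z<w : ent u k < ent u l
    z<w = subst₂ _<_ u₁k u₁l z<w′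
    nb₂ : ∀ m {a} → ent u₁ m ≡ a → k < m → m < l → ent u k < a → a < ent u l → ⊥
    nb₂ m refl k<m m<l p q = nb₂′ m k<m m<l (subst (_< ent u₁ m) (sym u₁k) p) (subst (ent u₁ m <_) (sym u₁l) q)
    nb : NoneBetween u k l (ent u k) (ent u l)
    nb m k<m m<l p q with m ≟ i | m ≟ j
    ... | no m≢i | no m≢j = nb₂ m (swapᵒ i j u (In-between Ik Il k<m m<l) m≢i m≢j) k<m m<l p q
    ... | yes refl | _ =
      let w<y = ≮⇒< (λ y<w → nb₂ m (swapˡ m j u Ii) k<m m<l (<-trans p x<y) y<w) (ent≢ G Ij Il (l≢j ∘ sym))
          l<j = ≮⇒< (λ j<l → nb₂ j (swapʳ m j u Ij) (<-trans k<m i<j) j<l p q) (l≢j ∘ sym)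
      in nb₁ l m<l l<j q w<y
    ... | no _ | yes refl =
      let x<z = ≮⇒< (λ z<x → nb₂ m (swapʳ i m u Ij) k<m m<l z<x (<-trans x<y q)) (ent≢ G Ik Ii k≢i)
          i<k = ≮⇒< (λ k<i → nb₂ i (swapˡ i m u Ii) k<i (<-trans i<j m<l) p q) k≢i
      in nb₁ k i<k k<m x<z p

  Cov-before : Cov u i j → Cov u₁ k l → Cov u₂ i j
  Cov-before (x<y , nb₁) (z<w′ , nb₂′) = subst₂ _<_ (sym u₂i) (sym u₂j) x<y ,
      λ m i<m m<j p q → nb m i<m m<j (subst (_< ent u₂ m) u₂i p) (subst (ent u₂ m <_) u₂j q)
    where
    u₂i : ent u₂ i ≡ ent u i
    u₂i = swapᵒ k l u Ii (k≢i ∘ sym) (l≢i ∘ sym)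
    u₂j : ent u₂ j ≡ ent u j
    u₂j = swapᵒ k l u Ij (k≢j ∘ sym) (l≢j ∘ sym)
    z<w : ent u k < ent u l
    z<w = subst₂ _<_ u₁k u₁l z<w′
    nb₂ : ∀ m {a} → ent u₁ m ≡ a → k < m → m < l → ent u k < a → a < ent u l → ⊥
    nb₂ m refl k<m m<l p q = nb₂′ m k<m m<l (subst (_< ent u₁ m) (sym u₁k) p) (subst (ent u₁ m <_) (sym u₁l) q)
    nb : ∀ m → i < m → m < j → ent u i < ent u₂ m → ent u₂ m < ent u j → ⊥
    nb m i<m m<j p q with m ≟ k | m ≟ l
    ... | no m≢k | no m≢l =
      let e = swapᵒ k l u (In-between Ii Ij i<m m<j) m≢k m≢l
      in nb₁ m i<m m<j (subst (ent u i <_) e p) (subst (_< ent u j) e q)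
    ... | yes refl | _ =
      let e = swapˡ m l u Ik
          x<w = subst (ent u i <_) e p
          w<y = subst (_< ent u j) e q
          j<l = ≮⇒< (λ l<j → nb₁ l (<-trans i<m k<l) l<j x<w w<y) l≢j
          x<z = ≮⇒< (λ z<x → nb₂ j (swapʳ i j u Ij) m<j j<l z<x x<w) (ent≢ G Ik Ii k≢i)
      in nb₁ m i<m m<j x<z (<-trans z<w w<y)
    ... | no _ | yes refl =
      let e = swapʳ k m u Il
          x<z = subst (ent u i <_) e p
          z<y = subst (_< ent u j) e q
          k<i = ≮⇒< (λ i<k → nb₁ k i<k (<-trans k<l m<j) x<z z<y) (k≢i ∘ sym)
          w<y = ≮⇒< (λ y<w → nb₂ i (swapˡ i j u Ii) k<i i<m z<y y<w) (ent≢ G Ij Il (l≢j ∘ sym))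
      in nb₁ m i<m m<j (<-trans x<z z<w) w<y

  swap-comm : swapPos k l u₁ ≡ swapPos i j u₂
  swap-comm = trans (swap-conj k l i j u Ik Il Ii Ij)
    (cong₂ (λ a b → swapPos a b u₂) (transpᵒ k l i (k≢i ∘ sym) (l≢i ∘ sym)) (transpᵒ k l j (k≢j ∘ sym) (l≢j ∘ sym)))

module ThreeTerm {n : ℕ} (u : Vec ℕ n) (G : Good u) {p k l : ℕ}
  (Ip : In n p) (Ik : In n k) (Il : In n l) (p<k : p < k) (k<l : k < l) where

  private
    b = ent u p
    a = ent u k
    e = ent u l
    p≢k : p ≢ k
    p≢k = <⇒≢ p<k
    k≢l : k ≢ l
    k≢l = <⇒≢ k<l
    p<l = <-trans p<k k<l
    p≢l : p ≢ l
    p≢l = <⇒≢ p<l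

  -- Describes exactly the paths (p k), (k l) out of u. Their end, a 3-cycle applied to u, is
  -- reached by one other path of covers: through `vB` if `a < e`, through `vE` if `e < a`. Hence
  -- one of the two terms on the right of the three-term relation always vanishes.
  Core : Set
  Core = b < a × b < e × NoneBetween u p k b a × NoneBetween u k l b e

  private
    transfer : ∀ {v : Vec ℕ n} {i j x y x′ y′} → x ≡ x′ → y ≡ y′ →
      (∀ m → i < m → m < j → ent v m ≡ ent u m) → NoneBetween v i j x y → NoneBetween u i j x′ y′
    transfer refl refl h nb m s t q r = nb m s t (subst (_ <_) (sym (h m s t)) q) (subst (_< _) (sym (h m s t)) r)

    transfer⁻ : ∀ {v : Vec ℕ n} {i j x y x′ y′} → x ≡ x′ → y ≡ y′ →
      (∀ m → i < m → m < j → ent v m ≡ ent u m) → NoneBetween u i j x′ y′ → NoneBetween v i j x y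
    transfer⁻ refl refl h nb m s t q r = nb m s t (subst (_ <_) (h m s t) q) (subst (_< _) (h m s t) r)

    vA = swapPos p k u
    vB = swapPos k l u
    vE = swapPos p l u
    Ak : ent vA k ≡ b
    Ak = swapʳ p k u Ik
    Al : ent vA l ≡ e
    Al = swapᵒ p k u Il (p≢l ∘ sym) (k≢l ∘ sym)
    Bp : ent vB p ≡ b
    Bp = swapᵒ k l u Ip p≢k p≢l
    Bk : ent vB k ≡ e
    Bk = swapˡ k l u Ik
    Bl : ent vB l ≡ a
    Bl = swapʳ k l u Il
    Ep : ent vE p ≡ e
    Ep = swapˡ p l u Ip
    Ek : ent vE k ≡ a
    Ek = swapᵒ p l u Ik (p≢k ∘ sym) k≢l
    offA : ∀ m → k < m → m < l → ent vA m ≡ ent u m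
    offA m s t = swapᵒ p k u (In-between Ik Il s t) (<⇒≢ (<-trans p<k s) ∘ sym) (<⇒≢ s ∘ sym)
    offB : ∀ m → p < m → m < l → m ≢ k → ent vB m ≡ ent u m
    offB m s t ne = swapᵒ k l u (In-between Ip Il s t) ne (<⇒≢ t)
    offE : ∀ m → p < m → m < l → ent vE m ≡ ent u m
    offE m s t = swapᵒ p l u (In-between Ip Il s t) (<⇒≢ s ∘ sym) (<⇒≢ t)

  coreA : Cov u p k → Cov vA k l → Core
  coreA (b<a , n₁) (b<e , n₂) = b<a , subst₂ _<_ Ak Al b<e , n₁ , transfer {v = vA} Ak Al offA n₂

  coreA⁻ : Core → Cov u p k × Cov vA k l
  coreA⁻ (b<a , b<e , n₁ , n₂) = (b<a , n₁) , (subst₂ _<_ (sym Ak) (sym Al) b<e , transfer⁻ {v = vA} Ak Al offA n₂)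

  coreB : Cov u k l → Cov vB p l → Core × a < e
  coreB (a<e , n₁) (b<a′ , n₂) = (b<a , <-trans b<a a<e , m₁ , m₂) , a<e
    where
    b<a : b < a
    b<a = subst₂ _<_ Bp Bl b<a′
    n₂′ : ∀ m → p < m → m < l → m ≢ k → b < ent u m → ent u m < a → ⊥
    n₂′ m s t ne q r = n₂ m s t (subst₂ _<_ (sym Bp) (sym (offB m s t ne)) q) (subst₂ _<_ (sym (offB m s t ne)) (sym Bl) r)
    m₁ : NoneBetween u p k b a
    m₁ m s t = n₂′ m s (<-trans t k<l) (<⇒≢ t)
    m₂ : NoneBetween u k l b e
    m₂ m s t q r with <-cmp (ent u m) a
    ... | tri< c _ _ = n₂′ m (<-trans p<k s) t (<⇒≢ s ∘ sym) q c
    ... | tri≈ _ c _ = ent≢ G (In-between Ik Il s t) Ik (<⇒≢ s ∘ sym) c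
    ... | tri> _ _ c = n₁ m s t c r

  coreB⁻ : Core → a < e → Cov u k l × Cov vB p l
  coreB⁻ (b<a , b<e , n₁ , n₂) a<e = (a<e , λ m s t q r → n₂ m s t (<-trans b<a q) r) ,
      (subst₂ _<_ (sym Bp) (sym Bl) b<a , λ m s t q r → nb m s t (subst (_< ent vB m) Bp q) (subst (ent vB m <_) Bl r))
    where
    nb : ∀ m → p < m → m < l → b < ent vB m → ent vB m < a → ⊥
    nb m s t q r with <-cmp m k
    ... | tri< c ne _ = n₁ m s c (subst (b <_) (offB m s t ne) q) (subst (_< a) (offB m s t ne) r)
    ... | tri≈ _ refl _ = <-asym a<e (subst (_< a) Bk r)
    ... | tri> _ ne c = n₂ m c t (subst (b <_) (offB m s t ne) q) (<-trans (subst (_< a) (offB m s t ne) r) a<e)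

  coreE : Cov u p l → Cov vE p k → Core × e < a
  coreE (b<e , n₁) (e<a′ , n₂) = (<-trans b<e e<a , b<e , m₁ , λ m s t → n₁ m (<-trans p<k s) t) , e<a
    where
    e<a : e < a
    e<a = subst₂ _<_ Ep Ek e<a′
    m₁ : NoneBetween u p k b a
    m₁ m s t q r with <-cmp (ent u m) e
    ... | tri< c _ _ = n₁ m s (<-trans t k<l) q c
    ... | tri≈ _ c _ = ent≢ G (In-between Ip Ik s t) Il (<⇒≢ (<-trans t k<l)) c
    ... | tri> _ _ c = n₂ m s t (subst₂ _<_ (sym Ep) (sym (offE m s (<-trans t k<l))) c)
                              (subst₂ _<_ (sym (offE m s (<-trans t k<l))) (sym Ek) r)

  coreE⁻ : Core → e < a → Cov u p l × Cov vE p k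
  coreE⁻ (b<a , b<e , n₁ , n₂) e<a = (b<e , nb) ,
      (subst₂ _<_ (sym Ep) (sym Ek) e<a ,
       transfer⁻ {v = vE} Ep Ek (λ m s t → offE m s (<-trans t k<l)) (λ m s t q r → n₁ m s t (<-trans b<e q) r))
    where
    nb : NoneBetween u p l b e
    nb m s t q r with <-cmp m k
    ... | tri< c _ _ = n₁ m s c q (<-trans r e<a)
    ... | tri≈ _ refl _ = <-asym e<a r
    ... | tri> _ _ c = n₂ m c t q r

  targetB : swapPos k l vA ≡ swapPos p l vB
  targetB = trans (swap-conj k l p k u Ik Il Ip Ik)
    (cong₂ (λ x y → swapPos x y vB) (transpᵒ k l p p≢k p≢l) (transpˡ k l))

  targetE : swapPos k l vA ≡ swapPos p k vE
  targetE = sym (trans (swap-conj p k p l u Ip Ik Ip Il)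
    (cong₂ (λ x y → swapPos x y vA) (transpˡ p k) (transpᵒ p k l (p≢l ∘ sym) (k≢l ∘ sym))))

-- A form of the lifting property of Bruhat order: the cover from u to `w` with a descent of `w` at
-- i corresponds to the conjugated cover of `v` with a descent of u at i. Since `s` reverses only
-- the pair i, i+1, the intervals of positions match except that i or i+1 may enter or leave; the
-- descent decides the value found there.
module Adjacent {n : ℕ} (u : Vec ℕ n) (G : Good u) {i x y : ℕ}
  (Ii : In n i) (Ii′ : In n (suc i)) (Ix : In n x) (Iy : In n y)
  (ne : ¬ (x ≡ i × y ≡ suc i)) (ne′ : ¬ (x ≡ suc i × y ≡ i)) where

  s : ℕ → ℕ
  s = transp i (suc i)

  private
    v = swapPos i (suc i) u
    w = swapPos x y u
    i≢si : i ≢ suc i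
    i≢si = <⇒≢ (n<1+n i)

  s-mono : ∀ {a b} → a < b → ¬ (a ≡ i × b ≡ suc i) → s a < s b
  s-mono {a} {b} a<b ne with s a | transpView i (suc i) a | s b | transpView i (suc i) b
  ... | _ | isˡ refl | _ | isˡ refl = ⊥-elim (<-irrefl refl a<b)
  ... | _ | isˡ refl | _ | isʳ _ refl = ⊥-elim (ne (refl , refl))
  ... | _ | isˡ refl | _ | isᵒ q r = ≤∧≢⇒< a<b (r ∘ sym)
  ... | _ | isʳ _ refl | _ | isˡ refl = ⊥-elim (<-asym a<b (n<1+n i))
  ... | _ | isʳ _ refl | _ | isʳ _ refl = ⊥-elim (<-irrefl refl a<b)
  ... | _ | isʳ _ refl | _ | isᵒ q r = <-trans (n<1+n i) a<b
  ... | _ | isᵒ q r | _ | isˡ refl = <-trans a<b (n<1+n i)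
  ... | _ | isᵒ q r | _ | isʳ _ refl = ≤∧≢⇒< (≤-pred a<b) q
  ... | _ | isᵒ q r | _ | isᵒ _ _ = a<b

  s-mono⁻ : ∀ {a b} → s a < s b → ¬ (a ≡ suc i × b ≡ i) → a < b
  s-mono⁻ {a} {b} lt ne = subst₂ _<_ (transp-invol i (suc i) a) (transp-invol i (suc i) b)
    (s-mono lt λ { (p , q) → ne (trans (sym (transp-invol i (suc i) a)) (trans (cong s p) (transpˡ i (suc i))) ,
                                  trans (sym (transp-invol i (suc i) b)) (trans (cong s q) (transpʳ i (suc i)))) })

  private
    vs : ∀ {m} → In n m → ent v (s m) ≡ ent u m
    vs {m} Im = trans (ent-swap i (suc i) u (s m) (transp-In m Ii Ii′ Im)) (cong (ent u) (transp-invol i (suc i) m))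

    dsc-w-i : ∀ a b → ent w i ≡ a → ent w (suc i) ≡ b → T (dsc w i) → b < a
    dsc-w-i _ _ refl refl t = <ᵇ⇒< _ _ t

    dsc-w-i⁺ : ∀ a b → ent w i ≡ a → ent w (suc i) ≡ b → b < a → T (dsc w i)
    dsc-w-i⁺ _ _ refl refl t = <⇒<ᵇ t

    fromBtw : ∀ {m} → s x < m → m < s y → ¬ (x ≡ suc i × s m ≡ i) → ¬ (s m ≡ suc i × y ≡ i) → x < s m × s m < y
    fromBtw {m} p q e₁ e₂ = s-mono⁻ (subst (s x <_) (sym (transp-invol i (suc i) m)) p) e₁ ,
                            s-mono⁻ (subst (_< s y) (sym (transp-invol i (suc i) m)) q) e₂

    entv : ∀ {m} → In n m → ent v m ≡ ent u (s m)
    entv {m} Im = ent-swap i (suc i) u m Im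

  data Case : Set where
    off : x ≢ i → x ≢ suc i → y ≢ i → y ≢ suc i → Case
    xi : x ≡ i → y ≢ i → y ≢ suc i → Case
    xs : x ≡ suc i → y ≢ i → y ≢ suc i → Case
    yi : y ≡ i → x ≢ i → x ≢ suc i → Case
    ys : y ≡ suc i → x ≢ i → x ≢ suc i → Case

  case : x < y → Case
  case x<y with x ≟ i | x ≟ suc i | y ≟ i | y ≟ suc i
  ... | yes refl | _ | yes e | _ = ⊥-elim (<⇒≢ x<y (sym e))
  ... | yes refl | _ | no _ | yes e = ⊥-elim (ne (refl , e))
  ... | yes refl | _ | no a | no b = xi refl a b
  ... | no _ | yes refl | yes e | _ = ⊥-elim (ne′ (refl , e))
  ... | no _ | yes refl | no _ | yes e = ⊥-elim (<⇒≢ x<y (sym e))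
  ... | no _ | yes refl | no a | no b = xs refl a b
  ... | no a | no b | yes e | _ = yi e a b
  ... | no a | no b | no _ | yes e = ys e a b
  ... | no a | no b | no c | no d = off a b c d

  forth-dsc : x < y → Cov u x y → T (dsc w i) → ent u (suc i) < ent u i
  forth-dsc x<y (lt , nb) t with case x<y
  ... | off a b c d = dsc-w-i _ _ (swapᵒ x y u Ii (a ∘ sym) (c ∘ sym)) (swapᵒ x y u Ii′ (b ∘ sym) (d ∘ sym)) t
  ... | xi refl c d = ≮⇒< (λ q → nb (suc i) (n<1+n i) (≤∧≢⇒< x<y (d ∘ sym)) q
        (dsc-w-i _ _ (swapˡ x y u Ii) (swapᵒ x y u Ii′ (i≢si ∘ sym) (d ∘ sym)) t)) (ent≢ G Ii Ii′ i≢si)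
  ... | xs refl c d = <-trans lt (dsc-w-i _ _ (swapᵒ x y u Ii i≢si (c ∘ sym)) (swapˡ x y u Ii′) t)
  ... | yi refl a b = <-trans (dsc-w-i _ _ (swapʳ x y u Ii) (swapᵒ x y u Ii′ (b ∘ sym) (i≢si ∘ sym)) t) lt
  ... | ys refl a b = ≮⇒< (λ q → nb i (≤∧≢⇒< (≤-pred x<y) a) (n<1+n i)
        (dsc-w-i _ _ (swapᵒ x y u Ii (a ∘ sym) i≢si) (swapʳ x y u Ii′) t) q) (ent≢ G Ii Ii′ i≢si)

  forth-cov : x < y → Cov u x y → T (dsc w i) → s x < s y × Cov v (s x) (s y)
  forth-cov x<y (lt , nb) t = s-mono x<y ne , subst₂ _<_ (sym (vs Ix)) (sym (vs Iy)) lt , none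
    where
    none : NoneBetween v (s x) (s y) (ent v (s x)) (ent v (s y))
    none m p q p′ q′ = go (x ≟ suc i) (y ≟ i) (s m ≟ i) (s m ≟ suc i)
      where
      Im = In-between (transp-In x Ii Ii′ Ix) (transp-In y Ii Ii′ Iy) p q
      lo : ent u x < ent u (s m)
      lo = subst₂ _<_ (vs Ix) (entv Im) p′
      hi : ent u (s m) < ent u y
      hi = subst₂ _<_ (entv Im) (vs Iy) q′
      go : Dec (x ≡ suc i) → Dec (y ≡ i) → Dec (s m ≡ i) → Dec (s m ≡ suc i) → ⊥
      go (yes refl) (yes refl) _ _ = <-asym x<y (n<1+n i)
      -- Here m = i+1 has newly entered the interval and carries the entry u(i). The descent of `w`
      -- at i puts u(y) below it, against `hi`.
      go (yes refl) (no c) (yes e) _ =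
            <-asym (subst (λ z → ent u z < ent u y) e hi)
                   (dsc-w-i _ _ (swapᵒ x y u Ii i≢si (c ∘ sym)) (swapˡ x y u Ii′) t)
      go (no b) (yes refl) _ (yes e) =
            <-asym (subst (λ z → ent u x < ent u z) e lo)
                   (dsc-w-i _ _ (swapʳ x y u Ii) (swapᵒ x y u Ii′ (b ∘ sym) (i≢si ∘ sym)) t)
      go (yes _) (no c) (no a) _ =
            let r = fromBtw {m} p q (λ z → a (proj₂ z)) (λ z → c (proj₂ z)) in nb (s m) (proj₁ r) (proj₂ r) lo hi
      go (no b) (yes _) _ (no a) =
            let r = fromBtw {m} p q (λ z → b (proj₁ z)) (λ z → a (proj₁ z)) in nb (s m) (proj₁ r) (proj₂ r) lo hi
      go (no b) (no c) _ _ =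
            let r = fromBtw {m} p q (λ z → b (proj₁ z)) (λ z → c (proj₂ z)) in nb (s m) (proj₁ r) (proj₂ r) lo hi

  private
    nb-v : NoneBetween v (s x) (s y) (ent v (s x)) (ent v (s y)) → ∀ m → In n m → s x < s m → s m < s y →
      ent u x < ent u m → ent u m < ent u y → ⊥
    nb-v nb m Im p q lo hi = nb (s m) p q (subst₂ _<_ (sym (vs Ix)) (sym (vs Im)) lo) (subst₂ _<_ (sym (vs Im)) (sym (vs Iy)) hi)

  back-cov : ent u (suc i) < ent u i → s x < s y → Cov v (s x) (s y) → x < y × Cov u x y
  back-cov d sx<sy (lt′ , nb) = x<y , lt , none
    where
    x<y = s-mono⁻ sx<sy ne′
    lt = subst₂ _<_ (vs Ix) (vs Iy) lt′
    none : NoneBetween u x y (ent u x) (ent u y)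
    none m p q lo hi = go (x ≟ i) (m ≟ suc i) (y ≟ suc i) (m ≟ i)
      where
      by : ¬ (x ≡ i × m ≡ suc i) → ¬ (m ≡ i × y ≡ suc i) → ⊥
      by α β = nb-v nb m (In-between Ix Iy p q) (s-mono p α) (s-mono q β) lo hi
      go : Dec (x ≡ i) → Dec (m ≡ suc i) → Dec (y ≡ suc i) → Dec (m ≡ i) → ⊥
      go (yes refl) (yes refl) _ _ = <-asym lo d
      go _ _ (yes refl) (yes refl) = <-asym hi d
      go (no a) _ (no c) _ = by (λ z → a (proj₁ z)) (λ z → c (proj₂ z))
      go (no a) _ (yes _) (no e) = by (λ z → a (proj₁ z)) (λ z → e (proj₁ z))
      go (yes _) (no b) (no c) _ = by (λ z → b (proj₂ z)) (λ z → c (proj₂ z))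
      go (yes _) (no b) (yes _) (no e) = by (λ z → b (proj₂ z)) (λ z → e (proj₁ z))

  back-dsc : ent u (suc i) < ent u i → s x < s y → Cov v (s x) (s y) → T (dsc w i)
  back-dsc d sx<sy (lt′ , nb) with case (s-mono⁻ sx<sy ne′)
  ... | off a b c e = dsc-w-i⁺ _ _ (swapᵒ x y u Ii (a ∘ sym) (c ∘ sym)) (swapᵒ x y u Ii′ (b ∘ sym) (e ∘ sym)) d
  ... | xi refl c e = dsc-w-i⁺ _ _ (swapˡ x y u Ii) (swapᵒ x y u Ii′ (i≢si ∘ sym) (e ∘ sym))
        (<-trans d (subst₂ _<_ (vs Ix) (vs Iy) lt′))
  ... | xs refl c e = dsc-w-i⁺ _ _ (swapᵒ x y u Ii i≢si (c ∘ sym)) (swapˡ x y u Ii′)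
        (≮⇒< (λ q → nb-v nb i Ii (subst₂ _<_ (sym (transpʳ i (suc i))) (sym (transpˡ i (suc i))) (n<1+n i))
               (s-mono (<-trans (n<1+n i) (s-mono⁻ sx<sy ne′)) (λ z → e (proj₂ z))) d q)
             (ent≢ G Ii Iy (c ∘ sym)))
  ... | yi refl a b = dsc-w-i⁺ _ _ (swapʳ x y u Ii) (swapᵒ x y u Ii′ (b ∘ sym) (i≢si ∘ sym))
        (≮⇒< (λ q → nb-v nb (suc i) Ii′ (s-mono (<-trans (s-mono⁻ sx<sy ne′) (n<1+n i)) (λ z → a (proj₁ z)))
               (subst₂ _<_ (sym (transpʳ i (suc i))) (sym (transpˡ i (suc i))) (n<1+n i)) q d)
             (ent≢ G Ix Ii′ b))
  ... | ys refl a b = dsc-w-i⁺ _ _ (swapᵒ x y u Ii (a ∘ sym) i≢si) (swapʳ x y u Ii′)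
        (<-trans (subst₂ _<_ (vs Ix) (vs Iy) lt′) d)

  target : swapPos i (suc i) w ≡ swapPos (s x) (s y) v
  target = swap-conj i (suc i) x y u Ii Ii′ Ix Iy

-- Finite sums in a commutative ring

-- Coefficients of polynomials are integers while the values of functions vary. The proof runs over
-- two rings: ℤ for lengths, exponent bounds and standard monomials, and the quotient by the ideal
-- for the identity of classes.
record RingOverℤ : Set₁ where
  field
    ring : CommutativeRing 0ℓ 0ℓ
  open CommutativeRing ring
  field
    ι : ℤ → Carrier
    ι-+ : ∀ a b → ι (a ℤ.+ b) ≈ ι a + ι b
    ι-* : ∀ a b → ι (a ℤ.* b) ≈ ι a * ι b
    ι-neg : ∀ a → ι (ℤ.- a) ≈ - ι a
    ι-0 : ι 0ℤ ≈ 0#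
    ι-1 : ι 1ℤ ≈ 1#

module Sums (A : RingOverℤ) where
  open RingOverℤ A public
  open CommutativeRing ring public
    renaming (refl to ≈-refl; sym to ≈-sym; trans to ≈-trans; reflexive to ≈-reflexive)
    hiding (zero; rawRing; _≉_; ring)
  open import Algebra.Properties.Ring (CommutativeRing.ring ring) public
    using (-0#≈0#; -‿+-comm; -‿involutive)
  open import Relation.Binary.Reasoning.Setoid setoid public

  ι-≟ : ∀ a b → Maybe (ι a ≈ ι b)
  ι-≟ a b with a ℤ.≟ b
  ... | yes e = just (≈-reflexive (cong ι e))
  ... | no _ = nothing

  ι-morphism : CommutativeRing.rawRing ℤP.+-*-commutativeRing ACR.-Raw-AlmostCommutative⟶ ACR.fromCommutativeRing ring
  ι-morphism = record { ⟦_⟧ = ι ; +-homo = ι-+ ; *-homo = ι-* ; -‿homo = ι-neg ; 0-homo = ι-0 ; 1-homo = ι-1 }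

  module Solver = RingSolver (CommutativeRing.rawRing ℤP.+-*-commutativeRing) (ACR.fromCommutativeRing ring) ι-morphism ι-≟
  open Solver public using (solve; con; _:=_; _:+_; _:*_; _:-_; :-_)

  x-0≈x : ∀ x → x - 0# ≈ x
  x-0≈x x = ≈-trans (+-congˡ -0#≈0#) (+-identityʳ x)

  *-swapˡ : ∀ x y z → x * (y * z) ≈ y * (x * z)
  *-swapˡ = solve 3 (λ x y z → x :* (y :* z) := y :* (x :* z)) ≈-refl

  infixr 9 _⊙_
  -- Iverson bracket. Conditions on covers and labels become gates inside sums over full ranges.
  _⊙_ : Bool → Carrier → Carrier
  true ⊙ x = x
  false ⊙ x = 0#

  ⊙-cong : ∀ b {x y} → x ≈ y → b ⊙ x ≈ b ⊙ y
  ⊙-cong true e = e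
  ⊙-cong false e = ≈-refl

  ⊙-congT : ∀ b {x y} → (T b → x ≈ y) → b ⊙ x ≈ b ⊙ y
  ⊙-congT true e = e tt
  ⊙-congT false e = ≈-refl

  ⊙-0 : ∀ b → b ⊙ 0# ≈ 0#
  ⊙-0 true = ≈-refl
  ⊙-0 false = ≈-refl

  ⊙-¬ : ∀ b {x} → ¬ T b → b ⊙ x ≈ 0#
  ⊙-¬ true f = ⊥-elim (f tt)
  ⊙-¬ false f = ≈-refl

  ⊙-T : ∀ b {x} → T b → b ⊙ x ≈ x
  ⊙-T true f = ≈-refl

  ⊙-zero : ∀ b {x} → (T b → x ≈ 0#) → b ⊙ x ≈ 0#
  ⊙-zero true f = f tt
  ⊙-zero false f = ≈-refl

  ⊙-+ : ∀ b x y → b ⊙ (x + y) ≈ b ⊙ x + b ⊙ y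
  ⊙-+ true x y = ≈-refl
  ⊙-+ false x y = ≈-sym (+-identityʳ 0#)

  ⊙-neg : ∀ b x → b ⊙ (- x) ≈ - (b ⊙ x)
  ⊙-neg true x = ≈-refl
  ⊙-neg false x = ≈-sym -0#≈0#

  ⊙-* : ∀ b c x → c * (b ⊙ x) ≈ b ⊙ (c * x)
  ⊙-* true c x = ≈-refl
  ⊙-* false c x = zeroʳ c

  ⊙-∧ : ∀ a b x → (a ∧ b) ⊙ x ≈ a ⊙ (b ⊙ x)
  ⊙-∧ true b x = ≈-refl
  ⊙-∧ false b x = ≈-refl

  ⊙-swap : ∀ a b x → a ⊙ (b ⊙ x) ≈ b ⊙ (a ⊙ x)
  ⊙-swap true true x = ≈-refl
  ⊙-swap true false x = ≈-refl
  ⊙-swap false true x = ≈-refl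
  ⊙-swap false false x = ≈-refl

  Σl : ∀ {X : Set} → List X → (X → Carrier) → Carrier
  Σl [] f = 0#
  Σl (x ∷ xs) f = f x + Σl xs f

  module _ {X : Set} where

    Σ-cong : ∀ (xs : List X) {f g : X → Carrier} → (∀ {x} → x ∈ xs → f x ≈ g x) → Σl xs f ≈ Σl xs g
    Σ-cong [] h = ≈-refl
    Σ-cong (x ∷ xs) h = +-cong (h (here refl)) (Σ-cong xs (h ∘ there))

    Σ-0 : ∀ (xs : List X) {f : X → Carrier} → (∀ {x} → x ∈ xs → f x ≈ 0#) → Σl xs f ≈ 0#
    Σ-0 [] h = ≈-refl
    Σ-0 (x ∷ xs) h = ≈-trans (+-cong (h (here refl)) (Σ-0 xs (h ∘ there))) (+-identityʳ 0#)

    Σ-+ : ∀ (xs : List X) (f g : X → Carrier) → Σl xs (λ x → f x + g x) ≈ Σl xs f + Σl xs g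
    Σ-+ [] f g = ≈-sym (+-identityʳ 0#)
    Σ-+ (x ∷ xs) f g = ≈-trans (+-congˡ (Σ-+ xs f g))
      (solve 4 (λ a b c d → (a :+ b) :+ (c :+ d) := (a :+ c) :+ (b :+ d)) ≈-refl _ _ _ _)

    Σ-neg : ∀ (xs : List X) (f : X → Carrier) → Σl xs (λ x → - f x) ≈ - Σl xs f
    Σ-neg [] f = ≈-sym -0#≈0#
    Σ-neg (x ∷ xs) f = ≈-trans (+-congˡ (Σ-neg xs f)) (-‿+-comm _ _)

    Σ-minus : ∀ (xs : List X) (f g : X → Carrier) → Σl xs (λ x → f x - g x) ≈ Σl xs f - Σl xs g
    Σ-minus xs f g = ≈-trans (Σ-+ xs f (λ x → - g x)) (+-congˡ (Σ-neg xs g))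

    Σ-* : ∀ c (xs : List X) (f : X → Carrier) → c * Σl xs f ≈ Σl xs (λ x → c * f x)
    Σ-* c [] f = zeroʳ c
    Σ-* c (x ∷ xs) f = ≈-trans (distribˡ c _ _) (+-congˡ (Σ-* c xs f))

    Σ-⊙ : ∀ b (xs : List X) (f : X → Carrier) → b ⊙ Σl xs f ≈ Σl xs (λ x → b ⊙ f x)
    Σ-⊙ true xs f = ≈-refl
    Σ-⊙ false xs f = ≈-sym (Σ-0 xs (λ _ → ≈-refl))

    Σ-++ : ∀ (xs ys : List X) (f : X → Carrier) → Σl (xs ++ ys) f ≈ Σl xs f + Σl ys f
    Σ-++ [] ys f = ≈-sym (+-identityˡ _)
    Σ-++ (x ∷ xs) ys f = ≈-trans (+-congˡ (Σ-++ xs ys f)) (≈-sym (+-assoc _ _ _))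

    Σ-filter : ∀ p (xs : List X) (f : X → Carrier) → Σl (filterᵇ p xs) f ≈ Σl xs (λ x → p x ⊙ f x)
    Σ-filter p [] f = ≈-refl
    Σ-filter p (x ∷ xs) f with p x
    ... | true = +-congˡ (Σ-filter p xs f)
    ... | false = ≈-trans (Σ-filter p xs f) (≈-sym (+-identityˡ _))

    Σ-map : ∀ {Y : Set} (h : Y → X) ys (f : X → Carrier) → Σl (map h ys) f ≈ Σl ys (f ∘ h)
    Σ-map h [] f = ≈-refl
    Σ-map h (y ∷ ys) f = +-congˡ (Σ-map h ys f)

    Σ-concatMap : ∀ {Y : Set} (h : Y → List X) ys (f : X → Carrier) →
      Σl (concatMap h ys) f ≈ Σl ys (λ y → Σl (h y) f)
    Σ-concatMap h [] f = ≈-refl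
    Σ-concatMap h (y ∷ ys) f = ≈-trans (Σ-++ (h y) (concatMap h ys) f) (+-congˡ (Σ-concatMap h ys f))

  Σ-swap : ∀ {X Y : Set} (xs : List X) (ys : List Y) (f : X → Y → Carrier) →
    Σl xs (λ x → Σl ys (f x)) ≈ Σl ys (λ y → Σl xs (λ x → f x y))
  Σ-swap [] ys f = ≈-sym (Σ-0 ys (λ _ → ≈-refl))
  Σ-swap (x ∷ xs) ys f = ≈-trans (+-congˡ (Σ-swap xs ys f)) (≈-sym (Σ-+ ys (f x) _))

  module _ {X : Set} where

    Σ-if : ∀ b (xs : List X) (f : X → Carrier) → Σl (if b then xs else []) f ≈ b ⊙ Σl xs f
    Σ-if true xs f = ≈-refl
    Σ-if false xs f = ≈-refl

    Σ-single : ∀ {xs : List X} {a} {f : X → Carrier} → Unique xs → a ∈ xs →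
      (∀ {x} → x ∈ xs → x ≢ a → f x ≈ 0#) → Σl xs f ≈ f a
    Σ-single {x ∷ xs} (d ∷ _) (here refl) h =
      ≈-trans (+-congˡ (Σ-0 xs (λ m → h (there m) (λ e → All.lookup d m (sym e))))) (+-identityʳ _)
    Σ-single {x ∷ xs} (d ∷ u) (there m) h =
      ≈-trans (+-cong (h (here refl) (All.lookup d m)) (Σ-single u m (h ∘ there))) (+-identityˡ _)

    Σ-bump : ∀ {xs : List X} {a c} {f g : X → Carrier} → Unique xs → a ∈ xs →
      (∀ {x} → x ∈ xs → x ≢ a → f x ≈ g x) → f a ≈ g a + c → Σl xs f ≈ Σl xs g + c
    Σ-bump {xs} {a} {c} {f} {g} u m h e = begin
      Σl xs f
        ≈⟨ Σ-cong xs (λ _ → solve 2 (λ p q → p := q :+ (p :- q)) ≈-refl _ _) ⟩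
      Σl xs (λ x → g x + (f x - g x)) ≈⟨ Σ-+ xs g _ ⟩
      Σl xs g + Σl xs (λ x → f x - g x)
        ≈⟨ +-congˡ (Σ-single u m λ i ne → ≈-trans (+-congʳ (h i ne)) (-‿inverseʳ _)) ⟩
      Σl xs g + (f a - g a)
        ≈⟨ +-congˡ (≈-trans (+-congʳ e) (solve 2 (λ p q → (p :+ q) :- p := q) ≈-refl _ _)) ⟩
      Σl xs g + c ∎

    module _ (_≟_ : DecidableEquality X) where

      -- The two exceptional summands have to match only together: in the three-term relation and in
      -- the count of inversions they need not match singly.
      Σ-bump₂ : ∀ {xs : List X} {a b c} {f g : X → Carrier} → Unique xs → a ∈ xs → b ∈ xs → a ≢ b →
        (∀ {x} → x ∈ xs → x ≢ a → x ≢ b → f x ≈ g x) → f a + f b ≈ g a + g b + c → Σl xs f ≈ Σl xs g + c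
      Σ-bump₂ {xs} {a} {b} {c} {f} {g} u ma mb ne h e = begin
        Σl xs f ≈⟨ Σ-bump {f = f} {g = g₁} u ma (λ m → off m) eqa ⟩
        Σl xs g₁ + (f a - g a) ≈⟨ +-congʳ (Σ-bump {f = g₁} {g = g} u mb (λ m → off′ m) eqb) ⟩
        Σl xs g + (f b - g b) + (f a - g a)
          ≈⟨ solve 5 (λ s p q p′ q′ → (s :+ (q :- q′)) :+ (p :- p′) := s :+ ((p :+ q) :- (p′ :+ q′))) ≈-refl _ _ _ _ _ ⟩
        Σl xs g + ((f a + f b) - (g a + g b))
          ≈⟨ +-congˡ (≈-trans (+-congʳ e) (solve 2 (λ p q → (p :+ q) :- p := q) ≈-refl _ _)) ⟩
        Σl xs g + c ∎
        where
        -- Interpolates between the sums: it equals `f` at `b` and `g` elsewhere, so that each half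
        -- of the comparison has one exceptional index.
        g₁ : X → Carrier
        g₁ x = if does (x ≟ b) then f x else g x
        off : ∀ {x} → x ∈ xs → x ≢ a → f x ≈ g₁ x
        off {x} m n with x ≟ b
        ... | yes _ = ≈-refl
        ... | no n′ = h m n n′
        eqa : f a ≈ g₁ a + (f a - g a)
        eqa with a ≟ b
        ... | yes q = ⊥-elim (ne q)
        ... | no _ = solve 2 (λ p q → p := q :+ (p :- q)) ≈-refl _ _
        off′ : ∀ {x} → x ∈ xs → x ≢ b → g₁ x ≈ g x
        off′ {x} m n with x ≟ b
        ... | yes q = ⊥-elim (n q)
        ... | no _ = ≈-refl
        eqb : g₁ b ≈ g b + (f b - g b)
        eqb with b ≟ b
        ... | yes _ = solve 2 (λ p q → p := q :+ (p :- q)) ≈-refl _ _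
        ... | no q = ⊥-elim (q refl)

      Σ-indicator : ∀ {xs : List X} {a} {f : X → Carrier} → Unique xs → a ∈ xs →
        Σl xs (λ x → does (x ≟ a) ⊙ f x) ≈ f a
      Σ-indicator {xs} {a} {f} u m = ≈-trans (Σ-single u m off) at
        where
        off : ∀ {x} → x ∈ xs → x ≢ a → does (x ≟ a) ⊙ f x ≈ 0#
        off {x} _ n with x ≟ a
        ... | yes e = ⊥-elim (n e)
        ... | no _ = ≈-refl
        at : does (a ≟ a) ⊙ f a ≈ f a
        at with a ≟ a
        ... | yes _ = ≈-refl
        ... | no n = ⊥-elim (n refl)

      does-sym : ∀ x y → does (x ≟ y) ≡ does (y ≟ x)
      does-sym x y with x ≟ y | y ≟ x
      ... | yes _ | yes _ = refl
      ... | yes e | no n = ⊥-elim (n (sym e))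
      ... | no n | yes e = ⊥-elim (n (sym e))
      ... | no _ | no _ = refl

      -- Each f (s x) is written as a sum over y with the indicator of y = s x. After exchanging the
      -- sums, the indicator is also that of x = s y, because s is an involution.
      Σ-involution : ∀ {xs : List X} {s : X → X} (f : X → Carrier) → Unique xs →
        (∀ {x} → x ∈ xs → s x ∈ xs) → (∀ x → s (s x) ≡ x) → Σl xs (f ∘ s) ≈ Σl xs f
      Σ-involution {xs} {s} f u cl inv = begin
        Σl xs (f ∘ s) ≈⟨ Σ-cong xs (λ m → ≈-sym (Σ-indicator {f = f} u (cl m))) ⟩
        Σl xs (λ x → Σl xs (λ y → does (y ≟ s x) ⊙ f y)) ≈⟨ Σ-swap xs xs _ ⟩
        Σl xs (λ y → Σl xs (λ x → does (y ≟ s x) ⊙ f y))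
          ≈⟨ Σ-cong xs (λ {y} m → ≈-trans (Σ-cong xs (λ {x} _ → ≈-reflexive (cong (_⊙ f y) (flip y x))))
                                          (Σ-indicator {f = λ _ → f y} u (cl m))) ⟩
        Σl xs f ∎
        where
        flip : ∀ y x → does (y ≟ s x) ≡ does (x ≟ s y)
        flip y x with y ≟ s x | x ≟ s y
        ... | yes _ | yes _ = refl
        ... | yes e | no n = ⊥-elim (n (sym (trans (cong s e) (inv x))))
        ... | no n | yes e = ⊥-elim (n (sym (trans (cong s e) (inv y))))
        ... | no _ | no _ = refl

      Σ-subset : ∀ {xs ys : List X} {f : X → Carrier} → Unique xs → Unique ys →
        (∀ {x} → x ∈ xs → x ∈ ys) → (∀ {y} → y ∈ ys → ¬ (y ∈ xs) → f y ≈ 0#) → Σl xs f ≈ Σl ys f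
      Σ-subset {xs} {ys} {f} ux uy sub out = begin
        Σl xs f ≈⟨ Σ-cong xs (λ m → ≈-sym (Σ-indicator {f = f} uy (sub m))) ⟩
        Σl xs (λ x → Σl ys (λ y → does (y ≟ x) ⊙ f y)) ≈⟨ Σ-swap xs ys _ ⟩
        Σl ys (λ y → Σl xs (λ x → does (y ≟ x) ⊙ f y)) ≈⟨ Σ-cong ys (λ {y} m → inner y m (y ∈? xs)) ⟩
        Σl ys f ∎
        where
        open DecMem _≟_ using (_∈?_)
        inner : ∀ y → y ∈ ys → Dec (y ∈ xs) → Σl xs (λ x → does (y ≟ x) ⊙ f y) ≈ f y
        inner y _ (yes m) = ≈-trans (Σ-cong xs (λ {x} _ → ≈-reflexive (cong (_⊙ f y) (does-sym y x))))
                                    (Σ-indicator {f = λ _ → f y} ux m)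
        inner y m (no n) = ≈-trans (Σ-0 xs (λ {x} _ → ⊙-zero (does (y ≟ x)) (λ _ → out m n))) (≈-sym (out m n))

-- The length function

Ps : ℕ → List ℕ
Ps n = range 1 n

Unique-range : ∀ a b → Unique (range a b)
Unique-range a b = UniqP.map⁺ (ℕP.+-cancelˡ-≡ a _ _) (UniqP.upTo⁺ _)

In⇒∈ : ∀ {n p} → In n p → p ∈ Ps n
In⇒∈ (a , b) = ∈-range⁺ a b

∈⇒In : ∀ {n p} → p ∈ Ps n → In n p
∈⇒In = ∈-range⁻

transp-∈ : ∀ {n k l p} → In n k → In n l → p ∈ Ps n → transp k l p ∈ Ps n
transp-∈ Ik Il m = In⇒∈ (transp-In _ Ik Il (∈⇒In m))

module RangeSums (A : RingOverℤ) where
  open Sums A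

  Σ-above : ∀ {n i} (f : ℕ → Carrier) → Σl (range (suc i) n) f ≈ Σl (Ps n) (λ j → (i <ᵇ j) ⊙ f j)
  Σ-above {n} {i} f = ≈-trans
    (Σ-cong (range (suc i) n) (λ {j} m → ≈-sym (⊙-T (i <ᵇ j) (<⇒<ᵇ (proj₁ (∈-range⁻ {suc i} {n} m))))))
    (Σ-subset _≟_ (Unique-range _ _) (Unique-range _ _)
      (λ m → let r = ∈-range⁻ {suc i} {n} m in ∈-range⁺ (≤-trans (s≤s z≤n) (proj₁ r)) (proj₂ r))
      (λ {j} m n∈ → ⊙-¬ (i <ᵇ j) (λ t → n∈ (∈-range⁺ (<ᵇ⇒< i j t) (proj₂ (∈⇒In m))))))

  transp-sum : ∀ {n k l} (f : ℕ → Carrier) → In n k → In n l →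
    Σl (Ps n) (f ∘ transp k l) ≈ Σl (Ps n) f
  transp-sum f Ik Il = Σ-involution _≟_ f (Unique-range _ _) (transp-∈ Ik Il) (transp-invol _ _)

ℤ-ring : RingOverℤ
ℤ-ring = record { ring = ℤP.+-*-commutativeRing ; ι = λ z → z ; ι-+ = λ _ _ → refl ; ι-* = λ _ _ → refl
                ; ι-neg = λ _ → refl ; ι-0 = refl ; ι-1 = refl }

module Length where
  open Sums ℤ-ring
  open RangeSums ℤ-ring

  length-filterᵇ : ∀ {X : Set} (p : X → Bool) xs → ℤ.+ length (filterᵇ p xs) ≡ Σl xs (λ x → p x ⊙ 1ℤ)
  length-filterᵇ p [] = refl
  length-filterᵇ p (x ∷ xs) with p x
  ... | true = cong (λ z → 1ℤ ℤ.+ z) (length-filterᵇ p xs)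
  ... | false = trans (length-filterᵇ p xs) (sym (ℤP.+-identityˡ _))

  abstract
    -- With a = u(j) and b = u(i) this is the indicator of an inversion. Positions and values are
    -- separate arguments, so that a transposition can be applied to the positions alone.
    inv : ℕ → ℕ → ℕ → ℕ → ℤ
    inv i j a b = ((i <ᵇ j) ∧ (a <ᵇ b)) ⊙ 1ℤ

    inv-def : ∀ i j a b → inv i j a b ≡ ((i <ᵇ j) ∧ (a <ᵇ b)) ⊙ 1ℤ
    inv-def i j a b = refl

  lenΣ : ∀ {n} (u : Vec ℕ n) → ℤ.+ len u ≡ Σl (Ps n) (λ i → Σl (Ps n) (λ j → inv i j (ent u j) (ent u i)))
  lenΣ {n} u = begin
    ℤ.+ len u ≈⟨ length-filterᵇ _ (concatMap (λ i → map (λ j → (i , j)) (range (suc i) n)) (range 1 n)) ⟩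
    Σl (concatMap (λ i → map (λ j → (i , j)) (range (suc i) n)) (range 1 n)) (λ ij → (ent u (proj₂ ij) <ᵇ ent u (proj₁ ij)) ⊙ 1ℤ)
      ≈⟨ Σ-concatMap _ (Ps n) _ ⟩
    Σl (Ps n) (λ i → Σl (map (λ j → (i , j)) (range (suc i) n)) (λ ij → (ent u (proj₂ ij) <ᵇ ent u (proj₁ ij)) ⊙ 1ℤ))
      ≈⟨ Σ-cong (Ps n) (λ {i} _ → ≈-trans (Σ-map _ (range (suc i) n) _) (≈-trans (Σ-above {n} {i} _)
           (Σ-cong (Ps n) (λ {j} _ → ≈-trans (≈-sym (⊙-∧ (i <ᵇ j) _ _)) (sym (inv-def i j _ _)))))) ⟩
    Σl (Ps n) (λ i → Σl (Ps n) (λ j → inv i j (ent u j) (ent u i))) ∎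

  inv0 : ∀ {i j a b} → ¬ (i < j × a < b) → inv i j a b ≡ 0ℤ
  inv0 {i} {j} h = trans (inv-def i j _ _) (⊙-¬ _ (λ t → h (let r = ∧-elim {i <ᵇ j} t in <ᵇ⇒< _ _ (proj₁ r) , <ᵇ⇒< _ _ (proj₂ r))))

  inv1 : ∀ {i j a b} → i < j → a < b → inv i j a b ≡ 1ℤ
  inv1 p q = trans (inv-def _ _ _ _) (⊙-T _ (∧-intro (<⇒<ᵇ p) (<⇒<ᵇ q)))

  inv≡ : ∀ {i j a b i′ j′ a′ b′} → (i < j → a < b → i′ < j′ × a′ < b′) → (i′ < j′ → a′ < b′ → i < j × a < b) →
    inv i j a b ≡ inv i′ j′ a′ b′
  inv≡ {i} {j} {a} {b} {i′} {j′} {a′} {b′} f g =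
    trans (inv-def i j a b) (trans (cong (_⊙ 1ℤ) (T-iff (to f) (to g))) (sym (inv-def i′ j′ a′ b′)))
    where
    to : ∀ {i j a b i′ j′ a′ b′} → (i < j → a < b → i′ < j′ × a′ < b′) → T ((i <ᵇ j) ∧ (a <ᵇ b)) → T ((i′ <ᵇ j′) ∧ (a′ <ᵇ b′))
    to {i} {j} f t = let r = ∧-elim {i <ᵇ j} t ; q = f (<ᵇ⇒< _ _ (proj₁ r)) (<ᵇ⇒< _ _ (proj₂ r)) in ∧-intro (<⇒<ᵇ (proj₁ q)) (<⇒<ᵇ (proj₂ q))

  module _ {n : ℕ} (u : Vec ℕ n) (G : Good u) {p q : ℕ} (Ip : In n p) (Iq : In n q) (p<q : p < q) (cov : Cov u p q) where
    private
      σ = transp p q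
      p≢q = <⇒≢ p<q
      up<uq = proj₁ cov
      H F : ℕ → ℕ → ℤ
      H a b = inv (σ a) (σ b) (ent u b) (ent u a)
      F a b = inv a b (ent u b) (ent u a)

      between⇒ : ∀ {m} → p < m → m < q → ent u p < ent u m → ent u q < ent u m
      between⇒ s t r = ≮⇒< (proj₂ cov _ s t r) (ent≢ G (In-between Ip Iq s t) Iq (<⇒≢ t))

      between⇒′ : ∀ {m} → p < m → m < q → ent u m < ent u q → ent u m < ent u p
      between⇒′ s t r = ≮⇒< (λ x → proj₂ cov _ s t x r) (ent≢ G Ip (In-between Ip Iq s t) (<⇒≢ s))

      σp : σ p ≡ q
      σp = transpˡ p q
      σq : σ q ≡ p
      σq = transpʳ p q
      σo : ∀ {m} → m ≢ p → m ≢ q → σ m ≡ m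
      σo = transpᵒ p q _

      row-off : ∀ {a} → In n a → a ≢ p → a ≢ q → H a p ℤ.+ H a q ≡ F a p ℤ.+ F a q
      row-off {a} Ia a≢p a≢q rewrite σp | σq | σo a≢p a≢q with <-cmp a p | <-cmp a q
      ... | tri< a<p _ _ | _ = cong₂ ℤ._+_ (inv≡ (λ _ x → a<p , x) (λ _ x → <-trans a<p p<q , x))
                                        (inv≡ (λ _ x → <-trans a<p p<q , x) (λ _ x → a<p , x))
      ... | tri≈ _ e _ | _ = ⊥-elim (a≢p e)
      ... | tri> _ _ _ | tri≈ _ e _ = ⊥-elim (a≢q e)
      ... | tri> _ _ p<a | tri< a<q _ _ =
        trans (ℤP.+-comm (inv a q (ent u p) (ent u a)) _)
          (cong₂ ℤ._+_ (trans (inv0 (λ r → <-asym p<a (proj₁ r))) (sym (inv0 (λ r → <-asym p<a (proj₁ r)))))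
            (inv≡ (λ _ x → a<q , between⇒ p<a a<q x) (λ _ x → a<q , <-trans up<uq x)))
      ... | tri> _ _ p<a | tri> _ _ q<a =
        cong₂ ℤ._+_ (trans (inv0 (λ r → <-asym q<a (proj₁ r))) (sym (inv0 (λ r → <-asym p<a (proj₁ r)))))
                  (trans (inv0 (λ r → <-asym p<a (proj₁ r))) (sym (inv0 (λ r → <-asym q<a (proj₁ r)))))

      col-off : ∀ {b} → In n b → b ≢ p → b ≢ q → H p b ℤ.+ H q b ≡ F p b ℤ.+ F q b
      col-off {b} Ib b≢p b≢q rewrite σp | σq | σo b≢p b≢q with <-cmp b p | <-cmp b q
      ... | tri≈ _ e _ | _ = ⊥-elim (b≢p e)
      ... | tri> _ _ _ | tri≈ _ e _ = ⊥-elim (b≢q e)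
      ... | tri< b<p _ _ | _ =
        cong₂ ℤ._+_ (trans (inv0 (λ r → <-asym (<-trans b<p p<q) (proj₁ r))) (sym (inv0 (λ r → <-asym b<p (proj₁ r)))))
                  (trans (inv0 (λ r → <-asym b<p (proj₁ r))) (sym (inv0 (λ r → <-asym (<-trans b<p p<q) (proj₁ r)))))
      ... | tri> _ _ p<b | tri< b<q _ _ =
        trans (ℤP.+-comm (inv q b (ent u b) (ent u p)) _)
          (cong₂ ℤ._+_ (inv≡ (λ _ x → p<b , between⇒′ p<b b<q x) (λ _ x → p<b , <-trans x up<uq))
            (trans (inv0 (λ r → <-asym b<q (proj₁ r))) (sym (inv0 (λ r → <-asym b<q (proj₁ r))))))
      ... | tri> _ _ p<b | tri> _ _ q<b = cong₂ ℤ._+_ (inv≡ (λ _ x → p<b , x) (λ _ x → q<b , x))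
                                                    (inv≡ (λ _ x → q<b , x) (λ _ x → p<b , x))

      corner : (H p p ℤ.+ H q p) ℤ.+ (H p q ℤ.+ H q q) ≡ (F p p ℤ.+ F q p) ℤ.+ (F p q ℤ.+ F q q) ℤ.+ 1ℤ
      corner rewrite σp | σq
        | inv0 {q} {q} {ent u p} {ent u p} (λ r → <-irrefl refl (proj₁ r))
        | inv1 {p} {q} {ent u p} {ent u q} p<q up<uq
        | inv0 {q} {p} {ent u q} {ent u p} (λ r → <-asym p<q (proj₁ r))
        | inv0 {p} {p} {ent u q} {ent u q} (λ r → <-irrefl refl (proj₁ r))
        | inv0 {p} {p} {ent u p} {ent u p} (λ r → <-irrefl refl (proj₁ r))
        | inv0 {q} {p} {ent u p} {ent u q} (λ r → <-asym p<q (proj₁ r))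
        | inv0 {p} {q} {ent u q} {ent u p} (λ r → <-asym up<uq (proj₂ r))
        | inv0 {q} {q} {ent u q} {ent u q} (λ r → <-irrefl refl (proj₁ r)) = refl

    -- Reindexing both sums by `σ` turns the new inversion count into the sum of `H`, to be compared
    -- with the sum of `F`. Away from rows and columns p and q the two agree. In those rows and
    -- columns they agree in pairs, since no value lies strictly between u(p) and u(q) at a position
    -- in between. The corner on p and q contributes the one new inversion.
    len-cover : len (swapPos p q u) ≡ suc (len u)
    len-cover = ℤP.+-injective (begin
      ℤ.+ len (swapPos p q u) ≈⟨ lenΣ (swapPos p q u) ⟩
      Σl (Ps n) (λ i → Σl (Ps n) (λ j → inv i j (ent (swapPos p q u) j) (ent (swapPos p q u) i)))
        ≈⟨ Σ-cong (Ps n) (λ {i} mi → Σ-cong (Ps n) (λ {j} mj → ≈-trans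
             (cong₂ (inv i j) (ent-swap p q u j (∈⇒In mj)) (ent-swap p q u i (∈⇒In mi)))
             (cong₂ (λ x y → inv x y (ent u (σ j)) (ent u (σ i))) (sym (transp-invol p q i)) (sym (transp-invol p q j))))) ⟩
      Σl (Ps n) (λ i → Σl (Ps n) (λ j → H (σ i) (σ j)))
        ≈⟨ Σ-cong (Ps n) (λ {i} _ → transp-sum (H (σ i)) Ip Iq) ⟩
      Σl (Ps n) (λ i → Σl (Ps n) (H (σ i))) ≈⟨ transp-sum (λ i → Σl (Ps n) (H i)) Ip Iq ⟩
      Σl (Ps n) (λ i → Σl (Ps n) (H i))
        ≈⟨ Σ-bump₂ _≟_ U (In⇒∈ Ip) (In⇒∈ Iq) p≢q off rows ⟩
      Σl (Ps n) (λ i → Σl (Ps n) (F i)) ℤ.+ 1ℤ ≈⟨ cong (ℤ._+ 1ℤ) (lenΣ u) ⟨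
      ℤ.+ len u ℤ.+ 1ℤ ≈⟨ ℤP.+-comm (ℤ.+ len u) 1ℤ ⟩
      ℤ.+ suc (len u) ∎)
      where
      U = Unique-range 1 n
      off : ∀ {a} → a ∈ Ps n → a ≢ p → a ≢ q → Σl (Ps n) (H a) ≡ Σl (Ps n) (F a)
      off {a} m a≢p a≢q = trans (Σ-bump₂ _≟_ {c = 0ℤ} U (In⇒∈ Ip) (In⇒∈ Iq) p≢q
          (λ {b} mb b≢p b≢q → cong₂ (λ x y → inv x y (ent u b) (ent u a)) (σo a≢p a≢q) (σo b≢p b≢q))
          (trans (row-off (∈⇒In m) a≢p a≢q) (sym (ℤP.+-identityʳ _))))
        (ℤP.+-identityʳ _)
      rows : Σl (Ps n) (H p) ℤ.+ Σl (Ps n) (H q) ≡ Σl (Ps n) (F p) ℤ.+ Σl (Ps n) (F q) ℤ.+ 1ℤ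
      rows = trans (sym (Σ-+ (Ps n) (H p) (H q)))
        (trans (Σ-bump₂ _≟_ U (In⇒∈ Ip) (In⇒∈ Iq) p≢q (λ mb → col-off (∈⇒In mb)) corner)
          (cong (ℤ._+ 1ℤ) (Σ-+ (Ps n) (F p) (F q))))

open Length public using (len-cover)

-- Bruhat operators and the Pieri formula

module Operators (A : RingOverℤ) (n : ℕ) where
  open Sums A
  open RangeSums A

  Fn : Set
  Fn = Vec ℕ n → Carrier

  infix 4 _≐_
  -- Agreement on permutations only. `Good` is closed under transposition of positions, so the
  -- operators never leave it.
  _≐_ : Fn → Fn → Set
  f ≐ g = ∀ {u} → Good u → f u ≈ g u

  record Linear (F : Fn → Fn) : Set where
    field
      congᴸ : ∀ {f g} → f ≐ g → F f ≐ F g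
      addᴸ : ∀ f g → F (λ u → f u + g u) ≐ (λ u → F f u + F g u)
      scaleᴸ : ∀ c f → F (λ u → c * f u) ≐ (λ u → c * F f u)

    zeroᴸ : ∀ {f} → f ≐ (λ _ → 0#) → F f ≐ (λ _ → 0#)
    zeroᴸ {f} e {u} G = ≈-trans (congᴸ (λ {v} H → ≈-trans (e H) (≈-sym (zeroˡ (f v)))) G)
      (≈-trans (scaleᴸ 0# f G) (zeroˡ _))

    negᴸ : ∀ f → F (λ u → - f u) ≐ (λ u → - F f u)
    negᴸ f G = ≈-trans (congᴸ (λ {u} _ → solve 1 (λ x → :- x := con (ℤ.- 1ℤ) :* x) ≈-refl _) G)
      (≈-trans (scaleᴸ (ι (ℤ.- 1ℤ)) f G) (solve 1 (λ x → con (ℤ.- 1ℤ) :* x := :- x) ≈-refl _))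

    minusᴸ : ∀ f g → F (λ u → f u - g u) ≐ (λ u → F f u - F g u)
    minusᴸ f g G = ≈-trans (addᴸ f (λ u → - g u) G) (+-congˡ (negᴸ g G))

    sumᴸ : ∀ {X : Set} (xs : List X) (f : X → Fn) → F (λ u → Σl xs (λ x → f x u)) ≐ (λ u → Σl xs (λ x → F (f x) u))
    sumᴸ [] f = zeroᴸ (λ _ → ≈-refl)
    sumᴸ (x ∷ xs) f G = ≈-trans (addᴸ (f x) _ G) (+-congˡ (sumᴸ xs f G))

  open Linear public

  Linear-∘ : ∀ {F H} → Linear F → Linear H → Linear (F ∘ H)
  Linear-∘ LF LH .congᴸ e = LF .congᴸ (LH .congᴸ e)
  Linear-∘ LF LH .addᴸ f g G = ≈-trans (LF .congᴸ (LH .addᴸ f g) G) (LF .addᴸ _ _ G)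
  Linear-∘ LF LH .scaleᴸ c f G = ≈-trans (LF .congᴸ (LH .scaleᴸ c f) G) (LF .scaleᴸ c _ G)

  Linear-id : Linear (λ f → f)
  Linear-id .congᴸ e = e
  Linear-id .addᴸ f g _ = ≈-refl
  Linear-id .scaleᴸ c f _ = ≈-refl

  Linear-0 : Linear (λ f u → 0#)
  Linear-0 .congᴸ e _ = ≈-refl
  Linear-0 .addᴸ f g _ = ≈-sym (+-identityʳ 0#)
  Linear-0 .scaleᴸ c f _ = ≈-sym (zeroʳ c)

  Linear-+ : ∀ {F H} → Linear F → Linear H → Linear (λ f u → F f u + H f u)
  Linear-+ LF LH .congᴸ e G = +-cong (LF .congᴸ e G) (LH .congᴸ e G)
  Linear-+ LF LH .addᴸ f g G = ≈-trans (+-cong (LF .addᴸ f g G) (LH .addᴸ f g G))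
    (solve 4 (λ a b c d → (a :+ b) :+ (c :+ d) := (a :+ c) :+ (b :+ d)) ≈-refl _ _ _ _)
  Linear-+ LF LH .scaleᴸ c f G = ≈-trans (+-cong (LF .scaleᴸ c f G) (LH .scaleᴸ c f G)) (≈-sym (distribˡ c _ _))

  Linear-scale : ∀ {F} c → Linear F → Linear (λ f u → c * F f u)
  Linear-scale c LF .congᴸ e G = *-congˡ (LF .congᴸ e G)
  Linear-scale c LF .addᴸ f g G = ≈-trans (*-congˡ (LF .addᴸ f g G)) (distribˡ c _ _)
  Linear-scale c LF .scaleᴸ a f G = ≈-trans (*-congˡ (LF .scaleᴸ a f G))
    (*-swapˡ _ _ _)

  Linear-neg : ∀ {F} → Linear F → Linear (λ f u → - F f u)
  Linear-neg LF .congᴸ e G = -‿cong (LF .congᴸ e G)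
  Linear-neg LF .addᴸ f g G = ≈-trans (-‿cong (LF .addᴸ f g G)) (≈-sym (-‿+-comm _ _))
  Linear-neg LF .scaleᴸ c f G = ≈-trans (-‿cong (LF .scaleᴸ c f G))
    (solve 2 (λ a b → :- (a :* b) := a :* (:- b)) ≈-refl _ _)

  Linear-gate : ∀ {F} (b : Vec ℕ n → Bool) → Linear F → Linear (λ f u → b u ⊙ F f u)
  Linear-gate b LF .congᴸ e {u} G = ⊙-cong (b u) (LF .congᴸ e G)
  Linear-gate b LF .addᴸ f g {u} G = ≈-trans (⊙-cong (b u) (LF .addᴸ f g G)) (⊙-+ (b u) _ _)
  Linear-gate b LF .scaleᴸ c f {u} G = ≈-trans (⊙-cong (b u) (LF .scaleᴸ c f G)) (≈-sym (⊙-* (b u) c _))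

  Linear-Σ : ∀ {X : Set} (xs : List X) {F : X → Fn → Fn} → (∀ {x} → x ∈ xs → Linear (F x)) →
    Linear (λ f u → Σl xs (λ x → F x f u))
  Linear-Σ xs L .congᴸ e G = Σ-cong xs (λ m → L m .congᴸ e G)
  Linear-Σ xs L .addᴸ f g G = ≈-trans (Σ-cong xs (λ m → L m .addᴸ f g G)) (Σ-+ xs _ _)
  Linear-Σ xs L .scaleᴸ c f G = ≈-trans (Σ-cong xs (λ m → L m .scaleᴸ c f G)) (≈-sym (Σ-* c xs _))

  Linear-swap : ∀ {i j} → In n i → In n j → Linear (λ g u → g (swapPos i j u))
  Linear-swap Ii Ij .congᴸ e G = e (Good-swap Ii Ij G)
  Linear-swap Ii Ij .addᴸ f g _ = ≈-refl
  Linear-swap Ii Ij .scaleᴸ c f _ = ≈-refl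

  gate₂ : ∀ {a b c d x y} → (T a → T b → T c × T d) → (T c → T d → T a × T b) → (T a → T b → x ≈ y) →
    a ⊙ b ⊙ x ≈ c ⊙ d ⊙ y
  gate₂ {a} {b} {c} {d} {x} {y} f g e = begin
    a ⊙ b ⊙ x ≈⟨ ⊙-congT a (λ ta → ⊙-congT b (λ tb → e ta tb)) ⟩
    a ⊙ b ⊙ y ≈⟨ ⊙-∧ a b y ⟨
    (a ∧ b) ⊙ y ≡⟨ cong (_⊙ y) (T-iff
        (λ t → let r = f (proj₁ (∧-elim {a} t)) (proj₂ (∧-elim {a} t)) in ∧-intro (proj₁ r) (proj₂ r))
        (λ t → let r = g (proj₁ (∧-elim {c} t)) (proj₂ (∧-elim {c} t)) in ∧-intro (proj₁ r) (proj₂ r))) ⟩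
    (c ∧ d) ⊙ y ≈⟨ ⊙-∧ c d y ⟩
    c ⊙ d ⊙ y ∎

  abstract
    -- One step along a cover. Composites are read from left to right along the path:
    -- `τ i j (τ k l g) u` steps from u first by (i j) and then by (k l).
    τ : ℕ → ℕ → Fn → Fn
    τ i j g u = up u i j ⊙ g (swapPos i j u)

    τ-def : ∀ i j g u → τ i j g u ≈ up u i j ⊙ g (swapPos i j u)
    τ-def i j g u = ≈-refl

    Linear-τ : ∀ {i j} → In n i → In n j → Linear (τ i j)
    Linear-τ {i} {j} Ii Ij = Linear-gate (λ u → up u i j) (Linear-swap Ii Ij)

    τ-zero : ∀ {i j g} {u : Vec ℕ n} → (i < j → ent u i < ent u j → ⊥) → τ i j g u ≈ 0#
    τ-zero {i} {j} {g} {u} h = ⊙-¬ (up u i j) (λ t → let r = up⁻ u t in h (proj₁ r) (proj₁ (proj₂ r)))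

    τ-comm : ∀ {i j k l g} {u : Vec ℕ n} → Good u → In n i → In n j → In n k → In n l →
      k ≢ i → k ≢ j → l ≢ i → l ≢ j → τ i j (τ k l g) u ≈ τ k l (τ i j g) u
    τ-comm {i} {j} {k} {l} {g} {u} G Ii Ij Ik Il ki kj li lj = gate₂
      (λ s t → let (i<j , c) = up⁻ u s ; (k<l , c′) = up⁻ (swapPos i j u) t
                   module X = Disjoint u G Ii Ij Ik Il i<j k<l ki kj li lj
               in up⁺ u k<l (X.Cov-after c c′) , up⁺ (swapPos k l u) i<j (X.Cov-before c c′))
      (λ s t → let (k<l , c) = up⁻ u s ; (i<j , c′) = up⁻ (swapPos k l u) t
                   module X = Disjoint u G Ik Il Ii Ij k<l i<j (ki ∘ sym) (li ∘ sym) (kj ∘ sym) (lj ∘ sym)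
               in up⁺ u i<j (X.Cov-after c c′) , up⁺ (swapPos i j u) k<l (X.Cov-before c c′))
      (λ s t → ≈-reflexive (cong g (Disjoint.swap-comm u G Ii Ij Ik Il
         (proj₁ (up⁻ u s)) (proj₁ (up⁻ (swapPos i j u) t)) ki kj li lj)))

    τ-triple : ∀ {p k l g} {u : Vec ℕ n} → Good u → In n p → In n k → In n l → p < k → k < l →
      τ p k (τ k l g) u ≈ τ k l (τ p l g) u + τ p l (τ p k g) u
    τ-triple {p} {k} {l} {g} {u} G Ip Ik Il p<k k<l with <-cmp (ent u k) (ent u l)
    ... | tri≈ _ e _ = ⊥-elim (ent≢ G Ik Il (<⇒≢ k<l) e)
    ... | tri< a<e _ _ = ≈-trans (gate₂ {up u p k} {up (swapPos p k u) k l} {up u k l} {up (swapPos k l u) p l}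
          (λ s t → let r = X.coreB⁻ (X.coreA (proj₂ (up⁻ u s)) (proj₂ (up⁻ (swapPos p k u) t))) a<e
                   in up⁺ u k<l (proj₁ r) , up⁺ (swapPos k l u) (<-trans p<k k<l) (proj₂ r))
          (λ s t → let r = X.coreA⁻ (proj₁ (X.coreB (proj₂ (up⁻ u s)) (proj₂ (up⁻ (swapPos k l u) t))))
                   in up⁺ u p<k (proj₁ r) , up⁺ (swapPos p k u) k<l (proj₂ r))
          (λ _ _ → ≈-reflexive (cong g X.targetB)))
        (≈-trans (≈-sym (+-identityʳ _)) (+-congˡ (≈-sym (⊙-zero (up u p l) (λ s → ⊙-¬ (up (swapPos p l u) p k) (λ t →
          <-asym a<e (proj₂ (X.coreE (proj₂ (up⁻ u s)) (proj₂ (up⁻ (swapPos p l u) t))))))))))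
      where module X = ThreeTerm u G Ip Ik Il p<k k<l
    ... | tri> _ _ e<a = ≈-trans (gate₂ {up u p k} {up (swapPos p k u) k l} {up u p l} {up (swapPos p l u) p k}
          (λ s t → let r = X.coreE⁻ (X.coreA (proj₂ (up⁻ u s)) (proj₂ (up⁻ (swapPos p k u) t))) e<a
                   in up⁺ u (<-trans p<k k<l) (proj₁ r) , up⁺ (swapPos p l u) p<k (proj₂ r))
          (λ s t → let r = X.coreA⁻ (proj₁ (X.coreE (proj₂ (up⁻ u s)) (proj₂ (up⁻ (swapPos p l u) t))))
                   in up⁺ u p<k (proj₁ r) , up⁺ (swapPos p k u) k<l (proj₂ r))
          (λ _ _ → ≈-reflexive (cong g X.targetE)))
        (≈-trans (≈-sym (+-identityˡ _)) (+-congʳ (≈-sym (⊙-zero (up u k l) (λ s → ⊙-¬ (up (swapPos k l u) p l) (λ t →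
          <-asym e<a (proj₂ (X.coreB (proj₂ (up⁻ u s)) (proj₂ (up⁻ (swapPos k l u) t))))))))))
      where module X = ThreeTerm u G Ip Ik Il p<k k<l

  -- Transpose of Monk's rule for x_k. The order test inside `up` keeps only l > k in the first term
  -- and only l < k in the second.
  M : ℕ → Fn → Fn
  M k g u = Σl (Ps n) (λ l → τ k l g u - τ l k g u)

  Linear-M : ∀ {k} → In n k → Linear (M k)
  Linear-M Ik = Linear-Σ (Ps n) (λ m → Linear-+ (Linear-τ Ik (∈⇒In m)) (Linear-neg (Linear-τ (∈⇒In m) Ik)))

  -- The label (k , b) acts by Tᵇ k b; scanning b upwards, S counts the increasing chains with a fixed k.
  T-gate : ℕ → ℕ → ℕ → ℕ → Vec ℕ n → Bool
  T-gate k b i j u = (i <ᵇ suc k) ∧ ((k <ᵇ j) ∧ (ent u i ≡ᵇ b))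

  Tᵇ : ℕ → ℕ → Fn → Fn
  Tᵇ k b g u = Σl (Ps n) (λ i → Σl (Ps n) (λ j → T-gate k b i j u ⊙ τ i j g u))

  Linear-T : ∀ k b → Linear (Tᵇ k b)
  Linear-T k b = Linear-Σ (Ps n) (λ {i} mi → Linear-Σ (Ps n) (λ {j} mj →
    Linear-gate (T-gate k b i j) (Linear-τ (∈⇒In mi) (∈⇒In mj))))

  S : ℕ → List ℕ → ℕ → Fn → Fn
  S k bs zero g = g
  S k [] (suc m) g = λ _ → 0#
  S k (b ∷ bs) (suc m) g = λ u → S k bs (suc m) g u + Tᵇ k b (S k bs m g) u

  -- The part of `M k` from covers whose smaller moved entry, the value in the edge label, exceeds
  -- b. It interpolates between `M k` at b = 0 and zero at b = n, which lets the Pieri formula be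
  -- proved one value at a time.
  D : ℕ → ℕ → Fn → Fn
  D k b g u = Σl (Ps n) (λ l → (b <ᵇ ent u k) ⊙ τ k l g u - (b <ᵇ ent u l) ⊙ τ l k g u)

  Linear-D : ∀ {k} b → In n k → Linear (D k b)
  Linear-D {k} b Ik = Linear-Σ (Ps n) (λ {l} m → Linear-+
    (Linear-gate (λ u → b <ᵇ ent u k) (Linear-τ Ik (∈⇒In m)))
    (Linear-neg (Linear-gate (λ u → b <ᵇ ent u l) (Linear-τ (∈⇒In m) Ik))))

  private
    U : ∀ {n} → _
    U {n} = Unique-range 1 n

  T-at : ∀ {k b p g} {u : Vec ℕ n} → Good u → In n p → ent u p ≡ b →
    Tᵇ k b g u ≈ Σl (Ps n) (λ j → ((p <ᵇ suc k) ∧ (k <ᵇ j)) ⊙ τ p j g u)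
  T-at {k} {b} {p} {g} {u} G Ip e = ≈-trans (Σ-single U (In⇒∈ Ip) off) (Σ-cong (Ps n) on)
    where
    off : ∀ {i} → i ∈ Ps n → i ≢ p → Σl (Ps n) (λ j → T-gate k b i j u ⊙ τ i j g u) ≈ 0#
    off {i} m ne = Σ-0 (Ps n) (λ {j} _ → ⊙-¬ (T-gate k b i j u) (λ t →
      ne (G .inj (∈⇒In m) Ip (trans (≡ᵇ⇒≡ _ _ (proj₂ (∧-elim {k <ᵇ j} (proj₂ (∧-elim {i <ᵇ suc k} t))))) (sym e)))))
    on : ∀ {j} → j ∈ Ps n → T-gate k b p j u ⊙ τ p j g u ≈ ((p <ᵇ suc k) ∧ (k <ᵇ j)) ⊙ τ p j g u
    on {j} _ = ≈-reflexive (cong (_⊙ τ p j g u) (T-iff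
      (λ t → let (x , y) = ∧-elim {p <ᵇ suc k} t in ∧-intro x (proj₁ (∧-elim {k <ᵇ j} y)))
      (λ t → let (x , y) = ∧-elim {p <ᵇ suc k} t in ∧-intro x (∧-intro y (≡⇒≡ᵇ _ _ e)))))

  T-none : ∀ {k b g} {u : Vec ℕ n} → (∀ {p} → In n p → p ≤ k → ent u p ≢ b) → Tᵇ k b g u ≈ 0#
  T-none {k} {b} {g} {u} h = Σ-0 (Ps n) (λ {i} mi → Σ-0 (Ps n) (λ {j} _ → ⊙-¬ (T-gate k b i j u) (λ t →
    let (x , y) = ∧-elim {i <ᵇ suc k} t in
    h (∈⇒In mi) (≤-pred (<ᵇ⇒< i (suc k) x)) (≡ᵇ⇒≡ _ _ (proj₂ (∧-elim {k <ᵇ j} y))))))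

  T-high : ∀ {k b p g} {u : Vec ℕ n} → Good u → In n p → ent u p ≡ b → k < p → Tᵇ k b g u ≈ 0#
  T-high G Ip e k<p = T-none (λ Iq q≤k e′ → <⇒≱ k<p (subst (_≤ _) (G .inj Iq Ip (trans e′ (sym e))) q≤k))

  T-low : ∀ {k b p g} {u : Vec ℕ n} → Good u → In n p → ent u p ≡ b → p ≤ k →
    Tᵇ k b g u ≈ Σl (Ps n) (λ j → (k <ᵇ j) ⊙ τ p j g u)
  T-low {k} {b} {p} {g} {u} G Ip e p≤k = ≈-trans (T-at G Ip e) (Σ-cong (Ps n) (λ {j} _ →
    ≈-trans (⊙-∧ (p <ᵇ suc k) (k <ᵇ j) (τ p j g u)) (⊙-T (p <ᵇ suc k) (<⇒<ᵇ (s≤s p≤k)))))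

  module PieriStep {k : ℕ} (IK : In n (suc k)) where
    private
      K = suc k

    D-0 : ∀ {b g} {u : Vec ℕ n} → ent u K ≤ b → D K b g u ≈ 0#
    D-0 {b} {g} {u} le = Σ-0 (Ps n) (λ {l} m → ≈-trans (+-cong
        (⊙-¬ (b <ᵇ ent u K) (λ t → <⇒≱ (<ᵇ⇒< b _ t) le))
        (-‿cong (⊙-zero (b <ᵇ ent u l) (λ t → τ-zero (λ _ lt → <⇒≱ (<-trans (<ᵇ⇒< b _ t) lt) le)))))
      (-‿inverseʳ 0#))

    -- Raising k to K admits the covers that start at position K and drops those that end there. For
    -- smaller entry `suc b` these are exactly the signed terms by which `D K b` exceeds
    -- `D K (suc b)`.
    T+D : ∀ b g {u : Vec ℕ n} → Tᵇ K (suc b) g u + D K (suc b) g u ≈ Tᵇ k (suc b) g u + D K b g u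
    T+D b g {u} = begin
      Tᵇ K b′ g u + D K b′ g u ≈⟨ +-congʳ T-split ⟩
      (Tᵇ k b′ g u + (α - β)) + D K b′ g u
        ≈⟨ solve 3 (λ p q r → (p :+ q) :+ r := p :+ (r :+ q)) ≈-refl _ _ _ ⟩
      Tᵇ k b′ g u + (D K b′ g u + (α - β)) ≈⟨ +-congˡ D-split ⟨
      Tᵇ k b′ g u + D K b g u ∎
      where
      b′ = suc b
      α = Σl (Ps n) (λ j → (ent u K ≡ᵇ b′) ⊙ τ K j g u)
      β = Σl (Ps n) (λ i → (ent u i ≡ᵇ b′) ⊙ τ i K g u)
      e : ℕ → ℕ → Carrier
      e i j = (ent u i ≡ᵇ b′) ⊙ τ i j g u
      step : ∀ i j → T-gate K b′ i j u ⊙ τ i j g u ≈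
        T-gate k b′ i j u ⊙ τ i j g u + (does (i ≟ K) ⊙ e i j - does (j ≟ K) ⊙ e i j)
      step i j with i <? j
      ... | no i≮j = ≈-trans (⊙-zero (T-gate K b′ i j u) (λ _ → z)) (≈-sym (≈-trans
              (+-cong (⊙-zero (T-gate k b′ i j u) (λ _ → z)) (+-cong (⊙-zero (does (i ≟ K)) (λ _ → z′)) (-‿cong (⊙-zero (does (j ≟ K)) (λ _ → z′)))))
              (≈-trans (+-identityˡ _) (x-0≈x 0#))))
        where
        z : τ i j g u ≈ 0#
        z = τ-zero (λ lt _ → i≮j lt)
        z′ : e i j ≈ 0#
        z′ = ⊙-zero (ent u i ≡ᵇ b′) (λ _ → z)
      ... | yes i<j = ≈-trans (pull K) (≈-trans (cases (i ≟ K) (j ≟ K)) (+-congʳ (≈-sym (pull k))))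
        where
        pull : ∀ c → T-gate c b′ i j u ⊙ τ i j g u ≈ ((i <ᵇ suc c) ∧ (c <ᵇ j)) ⊙ e i j
        pull c = ≈-trans (≈-reflexive (cong (_⊙ τ i j g u) (sym (∧-assoc (i <ᵇ suc c) _ _)))) (⊙-∧ ((i <ᵇ suc c) ∧ (c <ᵇ j)) _ _)
        yesᵍ : ∀ {c} → i ≤ c → c < j → ((i <ᵇ suc c) ∧ (c <ᵇ j)) ⊙ e i j ≈ e i j
        yesᵍ p q = ⊙-T _ (∧-intro (<⇒<ᵇ (s≤s p)) (<⇒<ᵇ q))
        noᵍ : ∀ {c} → (i ≤ c → c < j → ⊥) → ((i <ᵇ suc c) ∧ (c <ᵇ j)) ⊙ e i j ≈ 0#
        noᵍ {c} h = ⊙-¬ _ (λ t → let (x , y) = ∧-elim {i <ᵇ suc c} t in h (≤-pred (<ᵇ⇒< i (suc c) x)) (<ᵇ⇒< c j y))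
        cases : (di : Dec (i ≡ K)) (dj : Dec (j ≡ K)) → ((i <ᵇ suc K) ∧ (K <ᵇ j)) ⊙ e i j ≈
          ((i <ᵇ suc k) ∧ (k <ᵇ j)) ⊙ e i j + (does di ⊙ e i j - does dj ⊙ e i j)
        cases (yes refl) (yes refl) = ⊥-elim (<-irrefl refl i<j)
        cases (yes refl) (no ne) = ≈-trans (yesᵍ ≤-refl i<j)
          (≈-sym (≈-trans (+-congʳ (noᵍ (λ le _ → <-irrefl refl le)))
            (≈-trans (+-identityˡ _) (x-0≈x _))))
        cases (no ne) (yes refl) = ≈-trans (noᵍ (λ _ lt → <-irrefl refl lt))
          (≈-sym (≈-trans (+-congʳ (yesᵍ (≤-pred i<j) (n<1+n k)))
            (≈-trans (+-congˡ (+-identityˡ _)) (-‿inverseʳ _))))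
        cases (no ne) (no ne′) = ≈-trans (≈-reflexive (cong (_⊙ e i j) (T-iff
             (λ t → let (x , y) = ∧-elim {i <ᵇ suc K} t in ∧-intro (<⇒<ᵇ (≤∧≢⇒< (≤-pred (<ᵇ⇒< i (suc K) x)) ne)) (<⇒<ᵇ (<-trans (n<1+n k) (<ᵇ⇒< K j y))))
             (λ t → let (x , y) = ∧-elim {i <ᵇ suc k} t in ∧-intro (<⇒<ᵇ (<-trans (<ᵇ⇒< i (suc k) x) (n<1+n K))) (<⇒<ᵇ (≤∧≢⇒< (<ᵇ⇒< k j y) (ne′ ∘ sym)))))))
          (≈-sym (≈-trans (+-congˡ (x-0≈x 0#)) (+-identityʳ _)))
      T-split : Tᵇ K b′ g u ≈ Tᵇ k b′ g u + (α - β)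
      T-split = begin
        Tᵇ K b′ g u ≈⟨ Σ-cong (Ps n) (λ {i} _ → ≈-trans (Σ-cong (Ps n) (λ {j} _ → step i j)) (Σ-+ (Ps n) _ _)) ⟩
        Σl (Ps n) (λ i → Σl (Ps n) (λ j → T-gate k b′ i j u ⊙ τ i j g u) +
          Σl (Ps n) (λ j → does (i ≟ K) ⊙ e i j - does (j ≟ K) ⊙ e i j)) ≈⟨ Σ-+ (Ps n) _ _ ⟩
        Tᵇ k b′ g u + Σl (Ps n) (λ i → Σl (Ps n) (λ j → does (i ≟ K) ⊙ e i j - does (j ≟ K) ⊙ e i j))
          ≈⟨ +-congˡ (≈-trans (Σ-cong (Ps n) (λ {i} _ → ≈-trans (Σ-minus (Ps n) _ _)
               (+-cong (≈-sym (Σ-⊙ (does (i ≟ K)) (Ps n) (e i))) (-‿cong (Σ-indicator _≟_ {f = e i} U (In⇒∈ IK))))))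
               (≈-trans (Σ-minus (Ps n) _ _) (+-congʳ (Σ-indicator _≟_ {f = λ i → Σl (Ps n) (e i)} U (In⇒∈ IK))))) ⟩
        Tᵇ k b′ g u + (α - β) ∎
      thr : ∀ v x → (b <ᵇ v) ⊙ x ≈ (b′ <ᵇ v) ⊙ x + (v ≡ᵇ b′) ⊙ x
      thr v x with <-cmp v b′
      ... | tri< lt ne _ = ≈-trans (⊙-¬ (b <ᵇ v) (λ t → <⇒≱ (<ᵇ⇒< b v t) (≤-pred lt)))
              (≈-sym (≈-trans (+-cong (⊙-¬ (b′ <ᵇ v) (λ t → <-asym lt (<ᵇ⇒< b′ v t))) (⊙-¬ (v ≡ᵇ b′) (ne ∘ ≡ᵇ⇒≡ v b′))) (+-identityʳ 0#)))
      ... | tri≈ nlt refl _ = ≈-trans (⊙-T (b <ᵇ b′) (<⇒<ᵇ (n<1+n b)))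
              (≈-sym (≈-trans (+-cong (⊙-¬ (b′ <ᵇ b′) (λ t → <-irrefl refl (<ᵇ⇒< b′ b′ t))) (⊙-T (b′ ≡ᵇ b′) (≡⇒≡ᵇ b′ b′ refl))) (+-identityˡ _)))
      ... | tri> _ ne gt = ≈-trans (⊙-T (b <ᵇ v) (<⇒<ᵇ (<-trans (n<1+n b) gt)))
              (≈-sym (≈-trans (+-cong (⊙-T (b′ <ᵇ v) (<⇒<ᵇ gt)) (⊙-¬ (v ≡ᵇ b′) (ne ∘ ≡ᵇ⇒≡ v b′))) (+-identityʳ _)))
      D-split : D K b g u ≈ D K b′ g u + (α - β)
      D-split = begin
        D K b g u ≈⟨ Σ-cong (Ps n) (λ {l} _ → ≈-trans (+-cong (thr (ent u K) _) (-‿cong (thr (ent u l) _)))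
            (solve 4 (λ p q r s → (p :+ q) :- (r :+ s) := (p :- r) :+ (q :- s)) ≈-refl _ _ _ _)) ⟩
        Σl (Ps n) (λ l → ((b′ <ᵇ ent u K) ⊙ τ K l g u - (b′ <ᵇ ent u l) ⊙ τ l K g u) + (e K l - e l K)) ≈⟨ Σ-+ (Ps n) _ _ ⟩
        D K b′ g u + Σl (Ps n) (λ l → e K l - e l K) ≈⟨ +-congˡ (Σ-minus (Ps n) _ _) ⟩
        D K b′ g u + (α - β) ∎

module Pieri (A : RingOverℤ) (n : ℕ) where
  open Sums A
  open RangeSums A
  open Operators A n

  private
    U : ∀ {n} → _
    U {n} = Unique-range 1 n

  module _ {k : ℕ} (IK : In n (suc k)) where
    open PieriStep IK
    private
      K = suc k

    -- Both sides are sums over paths u → u′ → u″ of length two that move the value suc b;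
    -- they are matched by commutation of disjoint transpositions, except for the
    -- three-term relation among the positions p < K < j, where u(p) = suc b.
    D-T-exchange : ∀ b g {u : Vec ℕ n} → Good u → D K b (Tᵇ K (suc b) g) u ≈ Tᵇ k (suc b) (D K (suc b) g) u
    D-T-exchange b g {u} G with any? (λ p → ent u p ≟ suc b) (Ps n)
    ... | no none = ≈-trans
        (Σ-0 (Ps n) (λ {l} m → ≈-trans (+-cong (⊙-zero (b <ᵇ ent u K) (λ _ → zer IK (∈⇒In m)))
                                             (-‿cong (⊙-zero (b <ᵇ ent u l) (λ _ → zer (∈⇒In m) IK))))
                                     (-‿inverseʳ 0#)))
        (≈-sym (T-none (λ Iq _ e → none (lose (In⇒∈ Iq) e))))
      where
      zer : ∀ {x y} → In n x → In n y → τ x y (Tᵇ K (suc b) g) u ≈ 0#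
      zer {x} {y} Ix Iy = ≈-trans (τ-def x y _ u) (⊙-zero (up u x y) (λ _ → T-none (λ {q} Iq _ e →
        none (lose (In⇒∈ (transp-In q Ix Iy Iq)) (trans (sym (ent-swap x y u q Iq)) e)))))
    ... | yes some = found (find some)
      where
      b′ = suc b
      Tg = Tᵇ K b′ g
      a = ent u K

      found : ∃ (λ p → p ∈ Ps n × ent u p ≡ b′) → D K b Tg u ≈ Tᵇ k b′ (D K b′ g) u
      found (p , mp , up≡b) = main (<-cmp p K)
        where
        Ip = ∈⇒In mp
        at : ∀ {x y} → In n x → In n y → ent (swapPos x y u) (transp x y p) ≡ b′
        at {x} {y} Ix Iy = trans (ent-swap x y u _ (transp-In p Ix Iy Ip)) (trans (cong (ent u) (transp-invol x y p)) up≡b)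

        τT-high : ∀ {x y} → In n x → In n y → (x < y → ent u x < ent u y → K < transp x y p) → τ x y Tg u ≈ 0#
        τT-high {x} {y} Ix Iy h = ≈-trans (τ-def x y _ u) (⊙-zero (up u x y) (λ t →
          T-high (Good-swap Ix Iy G) (transp-In p Ix Iy Ip) (at Ix Iy) (let r = up⁻ u t in h (proj₁ r) (proj₁ (proj₂ r)))))

        -- With `suc b` at or to the right of K, every admissible step leaves it strictly to the
        -- right of K, where no edge labelled (K , suc b) starts.
        high : K ≤ p → D K b Tg u ≈ 0#
        high K≤p = Σ-0 (Ps n) (λ {l} m → ≈-trans (+-cong
            (⊙-zero (b <ᵇ a) (λ t → τT-high IK (∈⇒In m) (λ K<l a<ul → first l K<l (<ᵇ⇒< b a t) a<ul)))
            (-‿cong (⊙-zero (b <ᵇ ent u l) (λ t → τT-high (∈⇒In m) IK (λ l<K ul<a → second l l<K (<ᵇ⇒< b _ t) ul<a)))))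
          (-‿inverseʳ 0#))
          where
          first : ∀ l → K < l → b < a → a < ent u l → K < transp K l p
          first l K<l b<a a<ul with transp K l p | transpView K l p
          ... | _ | isˡ _ = K<l
          ... | _ | isʳ _ refl = ⊥-elim (<⇒≱ a<ul (subst (_≤ a) (sym up≡b) b<a))
          ... | _ | isᵒ ne _ = ≤∧≢⇒< K≤p (ne ∘ sym)
          second : ∀ l → l < K → b < ent u l → ent u l < a → K < transp l K p
          second l l<K b<ul ul<a with transp l K p | transpView l K p
          ... | _ | isˡ refl = ⊥-elim (<⇒≱ l<K K≤p)
          ... | _ | isʳ _ refl = ⊥-elim (<⇒≱ ul<a (subst (_≤ ent u l) (sym up≡b) b<ul))
          ... | _ | isᵒ _ ne = ≤∧≢⇒< K≤p (ne ∘ sym)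

        RHS-low : p ≤ k → Tᵇ k b′ (D K b′ g) u ≈ Σl (Ps n) (λ j → (k <ᵇ j) ⊙ τ p j (D K b′ g) u)
        RHS-low = T-low G Ip up≡b

        main : _ → D K b Tg u ≈ Tᵇ k b′ (D K b′ g) u
        main (tri> _ _ K<p) = ≈-trans (high (<⇒≤ K<p)) (≈-sym (T-high G Ip up≡b (<-trans (n<1+n k) K<p)))
        main (tri≈ _ refl _) = ≈-trans (high ≤-refl) (≈-sym (T-high G Ip up≡b (n<1+n k)))
        main (tri< p<K p≢K _) with <-cmp a b′
        ... | tri≈ _ e _ = ⊥-elim (p≢K (G .inj Ip IK (trans up≡b (sym e))))
        ... | tri< a<b′ _ _ = ≈-trans (D-0 {u = u} (≤-pred a<b′)) (≈-sym (≈-trans (RHS-low (≤-pred p<K))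
            (Σ-0 (Ps n) (λ {j} mj → ⊙-zero (k <ᵇ j) (λ _ → ≈-trans (τ-def p j _ u) (⊙-zero (up u p j) (λ _ → D-0 {u = swapPos p j u} (low j))))))))
          where
          low : ∀ j → ent (swapPos p j u) K ≤ b′
          low j with j ≟ K
          ... | yes refl = subst (_≤ b′) (sym (trans (swapʳ p K u IK) up≡b)) ≤-refl
          ... | no ne = subst (_≤ b′) (sym (swapᵒ p j u IK (p≢K ∘ sym) (ne ∘ sym))) (<⇒≤ a<b′)
        ... | tri> _ _ b′<a = begin
            D K b Tg u ≈⟨ Σ-cong (Ps n) (λ {l} m → termL l (∈⇒In m)) ⟩
            Σl (Ps n) (λ l → Σl (Ps n) (λ j → (K <ᵇ j) ⊙ X l j)) ≈⟨ Σ-swap (Ps n) (Ps n) _ ⟩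
            Σl (Ps n) (λ j → Σl (Ps n) (λ l → (K <ᵇ j) ⊙ X l j))
              ≈⟨ Σ-cong (Ps n) (λ {j} m → ≈-trans (≈-sym (Σ-⊙ (K <ᵇ j) (Ps n) (λ l → X l j)))
                   (⊙-congT (K <ᵇ j) (λ t → column j (∈⇒In m) (<ᵇ⇒< K j t)))) ⟩
            Σl (Ps n) (λ j → (K <ᵇ j) ⊙ τ p j (D K b′ g) u) ≈⟨ Σ-cong (Ps n) (λ {j} m → gateR j (∈⇒In m)) ⟩
            Σl (Ps n) (λ j → (k <ᵇ j) ⊙ τ p j (D K b′ g) u) ≈⟨ RHS-low (≤-pred p<K) ⟨
            Tᵇ k b′ (D K b′ g) u ∎
          where
          b<a : b < a
          b<a = <-trans (n<1+n b) b′<a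

          gateR : ∀ j → In n j → (K <ᵇ j) ⊙ τ p j (D K b′ g) u ≈ (k <ᵇ j) ⊙ τ p j (D K b′ g) u
          gateR j Ij with <-cmp j K
          ... | tri< j<K _ _ = ≈-trans (⊙-¬ (K <ᵇ j) (λ t → <-asym j<K (<ᵇ⇒< K j t)))
                (≈-sym (⊙-¬ (k <ᵇ j) (λ t → <⇒≱ j<K (<ᵇ⇒< k j t))))
          ... | tri> _ _ K<j = ≈-trans (⊙-T (K <ᵇ j) (<⇒<ᵇ K<j)) (≈-sym (⊙-T (k <ᵇ j) (<⇒<ᵇ (<-trans (n<1+n k) K<j))))
          -- The step (p K) puts `suc b` at position K, and `D K (suc b)` needs a larger entry
          -- there. So the one summand that the gate of k admits in excess is zero.
          ... | tri≈ _ refl _ = ≈-trans (⊙-¬ (K <ᵇ K) (λ t → <-irrefl refl (<ᵇ⇒< K K t)))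
                (≈-sym (⊙-zero (k <ᵇ K) (λ _ → ≈-trans (τ-def p K _ u) (⊙-zero (up u p K) (λ _ →
                  D-0 {u = swapPos p K u} (subst (_≤ b′) (sym (trans (swapʳ p K u IK) up≡b)) ≤-refl))))))

          -- For l = p the first step carries `suc b` from p to K, so the second step starts at K
          -- instead of p.
          N : ℕ → ℕ → Carrier
          N l j with l ≟ p
          ... | yes _ = τ p K (τ K j g) u
          ... | no _ = (b <ᵇ ent u l) ⊙ τ l K (τ p j g) u

          N-p : ∀ j → N p j ≈ τ p K (τ K j g) u
          N-p j with p ≟ p
          ... | yes _ = ≈-refl
          ... | no ne = ⊥-elim (ne refl)

          N-off : ∀ {l} j → l ≢ p → N l j ≈ (b <ᵇ ent u l) ⊙ τ l K (τ p j g) u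
          N-off {l} j ne with l ≟ p
          ... | yes e = ⊥-elim (ne e)
          ... | no _ = ≈-refl

          X : ℕ → ℕ → Carrier
          X l j = τ K l (τ p j g) u - N l j

          τT : ∀ {x y q} → In n x → In n y → (x < y → ent u x < ent u y → transp x y p ≡ q) → q ≤ K →
            τ x y Tg u ≈ Σl (Ps n) (λ j → (K <ᵇ j) ⊙ τ x y (τ q j g) u)
          τT {x} {y} {q} Ix Iy h q≤K = begin
            τ x y Tg u ≈⟨ τ-def x y _ u ⟩
            up u x y ⊙ Tg (swapPos x y u) ≈⟨ ⊙-congT (up u x y) (λ t →
                 let r = up⁻ u t ; e = h (proj₁ r) (proj₁ (proj₂ r)) in
                 T-low (Good-swap Ix Iy G) (subst (In n) e (transp-In p Ix Iy Ip)) (subst (λ z → ent (swapPos x y u) z ≡ b′) e (at Ix Iy)) q≤K) ⟩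
            up u x y ⊙ Σl (Ps n) (λ j → (K <ᵇ j) ⊙ τ q j g (swapPos x y u)) ≈⟨ Σ-⊙ (up u x y) (Ps n) _ ⟩
            Σl (Ps n) (λ j → up u x y ⊙ (K <ᵇ j) ⊙ τ q j g (swapPos x y u))
              ≈⟨ Σ-cong (Ps n) (λ {j} _ → ≈-trans (⊙-swap (up u x y) (K <ᵇ j) _) (⊙-cong (K <ᵇ j) (≈-sym (τ-def x y _ u)))) ⟩
            Σl (Ps n) (λ j → (K <ᵇ j) ⊙ τ x y (τ q j g) u) ∎

          termL : ∀ l → In n l → (b <ᵇ a) ⊙ τ K l Tg u - (b <ᵇ ent u l) ⊙ τ l K Tg u ≈ Σl (Ps n) (λ j → (K <ᵇ j) ⊙ X l j)
          termL l Il = begin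
            (b <ᵇ a) ⊙ τ K l Tg u - (b <ᵇ ent u l) ⊙ τ l K Tg u
              ≈⟨ +-cong (≈-trans (⊙-T (b <ᵇ a) (<⇒<ᵇ b<a)) (τT IK Il (λ K<l _ → transpᵒ K l p p≢K (<⇒≢ (<-trans p<K K<l))) (<⇒≤ p<K)))
                        (-‿cong (second (l ≟ p))) ⟩
            Σl (Ps n) (λ j → (K <ᵇ j) ⊙ τ K l (τ p j g) u) - Σl (Ps n) (λ j → (K <ᵇ j) ⊙ N l j) ≈⟨ Σ-minus (Ps n) _ _ ⟨
            Σl (Ps n) (λ j → (K <ᵇ j) ⊙ τ K l (τ p j g) u - (K <ᵇ j) ⊙ N l j)
              ≈⟨ Σ-cong (Ps n) (λ {j} _ → ≈-trans (+-congˡ (≈-sym (⊙-neg (K <ᵇ j) _))) (≈-sym (⊙-+ (K <ᵇ j) _ _))) ⟩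
            Σl (Ps n) (λ j → (K <ᵇ j) ⊙ X l j) ∎
            where
            second : Dec (l ≡ p) → (b <ᵇ ent u l) ⊙ τ l K Tg u ≈ Σl (Ps n) (λ j → (K <ᵇ j) ⊙ N l j)
            second (yes refl) = ≈-trans (⊙-T (b <ᵇ ent u l) (<⇒<ᵇ (subst (b <_) (sym up≡b) (n<1+n b))))
              (≈-trans (τT Il IK (λ _ _ → transpˡ l K) ≤-refl) (Σ-cong (Ps n) (λ {j} _ → ⊙-cong (K <ᵇ j) (≈-sym (N-p j)))))
            second (no ne) = ≈-trans (⊙-cong (b <ᵇ ent u l) (τT Il IK (λ _ _ → transpᵒ l K p (ne ∘ sym) p≢K) (<⇒≤ p<K)))
              (≈-trans (Σ-⊙ (b <ᵇ ent u l) (Ps n) _) (Σ-cong (Ps n) (λ {j} _ →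
                ≈-trans (⊙-swap (b <ᵇ ent u l) (K <ᵇ j) _) (⊙-cong (K <ᵇ j) (≈-sym (N-off j ne))))))

          column : ∀ j → In n j → K < j → Σl (Ps n) (λ l → X l j) ≈ τ p j (D K b′ g) u
          column j Ij K<j = ≈-trans (Σ-bump₂ _≟_ {c = 0#} U (In⇒∈ Ip) (In⇒∈ Ij) p≢j (λ m → off (∈⇒In m)) both)
              (≈-trans (+-identityʳ _) (≈-sym (≈-trans (τ-def p j _ u) (Σ-⊙ (up u p j) (Ps n) _))))
            where
            p<j = <-trans p<K K<j
            p≢j = <⇒≢ p<j
            K≢p = p≢K ∘ sym
            K≢j = <⇒≢ K<j
            v = swapPos p j u
            vK : ent v K ≡ a
            vK = swapᵒ p j u IK K≢p K≢j
            vj : ent v j ≡ b′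
            vj = trans (swapʳ p j u Ij) up≡b
            Y : ℕ → Carrier
            Y l = up u p j ⊙ ((b′ <ᵇ ent v K) ⊙ τ K l g v - (b′ <ᵇ ent v l) ⊙ τ l K g v)

            Y-split : ∀ {l c} → (up u p j ⊙ (b′ <ᵇ ent v l) ⊙ τ l K g v ≈ c) → Y l ≈ τ p j (τ K l g) u - c
            Y-split {l} {c} e = ≈-trans (⊙-+ (up u p j) _ _) (+-cong
              (≈-trans (⊙-cong (up u p j) (⊙-T (b′ <ᵇ ent v K) (<⇒<ᵇ (subst (b′ <_) (sym vK) b′<a)))) (≈-sym (τ-def p j _ u)))
              (≈-trans (⊙-neg (up u p j) _) (-‿cong e)))

            off : ∀ {l} → In n l → l ≢ p → l ≢ j → X l j ≈ Y l
            off {l} Il l≢p l≢j = ≈-trans (+-cong (pos-part (l ≟ K)) (-‿cong (≈-trans (N-off j l≢p) (neg-part (l ≟ K)))))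
                (≈-sym (Y-split {l} ≈-refl))
              where
              pos-part : Dec (l ≡ K) → τ K l (τ p j g) u ≈ τ p j (τ K l g) u
              pos-part (yes refl) = ≈-trans (τ-zero (λ lt _ → <-irrefl refl lt)) (≈-sym (≈-trans (τ-def p j _ u)
                (⊙-zero (up u p j) (λ _ → τ-zero (λ lt _ → <-irrefl refl lt)))))
              pos-part (no _) = τ-comm G IK Il Ip Ij p≢K (l≢p ∘ sym) (K≢j ∘ sym) (l≢j ∘ sym)
              vl : ent v l ≡ ent u l
              vl = swapᵒ p j u Il l≢p l≢j
              same-gate : (b <ᵇ ent u l) ≡ (b′ <ᵇ ent v l)
              same-gate = T-iff
                (λ t → <⇒<ᵇ (subst (b′ <_) (sym vl) (≤∧≢⇒< (<ᵇ⇒< b _ t) (λ e → l≢p (G .inj Il Ip (trans (sym e) (sym up≡b)))))))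
                (λ t → <⇒<ᵇ (<-trans (n<1+n b) (subst (b′ <_) vl (<ᵇ⇒< b′ _ t))))
              neg-part : Dec (l ≡ K) → (b <ᵇ ent u l) ⊙ τ l K (τ p j g) u ≈ up u p j ⊙ (b′ <ᵇ ent v l) ⊙ τ l K g v
              neg-part (yes refl) = ≈-trans (⊙-zero (b <ᵇ a) (λ _ → τ-zero (λ lt _ → <-irrefl refl lt))) (≈-sym
                (⊙-zero (up u p j) (λ _ → ⊙-zero (b′ <ᵇ ent v K) (λ _ → τ-zero (λ lt _ → <-irrefl refl lt)))))
              neg-part (no _) = begin
                (b <ᵇ ent u l) ⊙ τ l K (τ p j g) u
                  ≈⟨ ⊙-cong (b <ᵇ ent u l) (≈-trans (τ-comm G Il IK Ip Ij (l≢p ∘ sym) p≢K (l≢j ∘ sym) (K≢j ∘ sym)) (τ-def p j _ u)) ⟩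
                (b <ᵇ ent u l) ⊙ up u p j ⊙ τ l K g v ≈⟨ ⊙-swap (b <ᵇ ent u l) (up u p j) _ ⟩
                up u p j ⊙ (b <ᵇ ent u l) ⊙ τ l K g v ≡⟨ cong (λ z → up u p j ⊙ z ⊙ τ l K g v) same-gate ⟩
                up u p j ⊙ (b′ <ᵇ ent v l) ⊙ τ l K g v ∎

            X-p : X p j ≈ - τ p K (τ K j g) u
            X-p = ≈-trans (+-cong (τ-zero (λ lt _ → <-asym lt p<K)) (-‿cong (N-p j))) (+-identityˡ _)

            X-j : X j j ≈ τ K j (τ p j g) u
            X-j = ≈-trans (+-congˡ (-‿cong (≈-trans (N-off j (p≢j ∘ sym)) (⊙-zero (b <ᵇ ent u j) (λ _ → τ-zero (λ lt _ → <-asym lt K<j))))))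
                  (x-0≈x _)

            Y-p : Y p ≈ - τ p j (τ p K g) u
            Y-p = ≈-trans (Y-split {p} (≈-trans (⊙-congT (up u p j) (λ t → ⊙-T (b′ <ᵇ ent v p)
                    (<⇒<ᵇ (subst₂ _<_ up≡b (sym (swapˡ p j u Ip)) (proj₁ (proj₂ (up⁻ u t))))))) (≈-sym (τ-def p j _ u))))
                  (≈-trans (+-congʳ (≈-trans (τ-def p j _ u) (⊙-zero (up u p j) (λ _ → τ-zero (λ lt _ → <-asym lt p<K))))) (+-identityˡ _))

            Y-j : Y j ≈ 0#
            Y-j = ≈-trans (Y-split {j} (⊙-zero (up u p j) (λ _ → ⊙-zero (b′ <ᵇ ent v j) (λ _ → τ-zero (λ lt _ → <-asym lt K<j)))))
                  (≈-trans (x-0≈x _) (≈-trans (τ-def p j _ u) (⊙-zero (up u p j) (λ _ → τ-zero (λ _ lt →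
                     <-asym b′<a (subst₂ _<_ vK vj lt))))))

            both : X p j + X j j ≈ Y p + Y j + 0#
            both = begin
              X p j + X j j ≈⟨ +-cong X-p X-j ⟩
              - τ p K (τ K j g) u + τ K j (τ p j g) u ≈⟨ +-congʳ (-‿cong (τ-triple G Ip IK Ij p<K K<j)) ⟩
              - (τ K j (τ p j g) u + τ p j (τ p K g) u) + τ K j (τ p j g) u
                ≈⟨ solve 2 (λ x y → (:- (x :+ y)) :+ x := (:- y)) ≈-refl _ _ ⟩
              - τ p j (τ p K g) u ≈⟨ ≈-trans (+-identityʳ _) (+-identityʳ _) ⟨
              - τ p j (τ p K g) u + 0# + 0# ≈⟨ +-congʳ (+-cong (≈-sym Y-p) (≈-sym Y-j)) ⟩
              Y p + Y j + 0# ∎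

  scan : ℕ → ℕ → List ℕ
  scan zero b = []
  scan (suc r) b = suc b ∷ scan r (suc b)

  Linear-S : ∀ k bs m → Linear (S k bs m)
  Linear-S k [] zero = Linear-id
  Linear-S k (b ∷ bs) zero = Linear-id
  Linear-S k [] (suc m) = Linear-0
  Linear-S k (b ∷ bs) (suc m) = Linear-+ (Linear-S k bs (suc m)) (Linear-∘ (Linear-T k b) (Linear-S k bs m))

  module _ {k : ℕ} (IK : In n (suc k)) where
    open PieriStep IK
    private
      K = suc k

    -- The recursion for complete symmetric polynomials, truncated to label values above b;
    -- `b + r = n` makes the list end at the top value, where `D` vanishes. In the step, `T+D`
    -- absorbs the label value `suc b`, and `D-T-exchange` trades a `D` inside `Tᵇ k` for a `D`
    -- outside `Tᵇ K`.
    pieri-scan : ∀ r b → b ℕ.+ r ≡ n → ∀ m g →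
      S K (scan r b) (suc m) g ≐ (λ u → S k (scan r b) (suc m) g u + D K b (S K (scan r b) m g) u)
    pieri-scan zero b e m g {u} G = ≈-sym (≈-trans (+-identityˡ _) (D-0 {u = u} (subst (ent u K ≤_) (trans (sym e) (ℕP.+-identityʳ b)) (proj₂ (G .bound IK)))))
    pieri-scan (suc r) b e zero g {u} G = begin
      S K bs 1 g u + Tᵇ K b′ g u ≈⟨ +-congʳ (ih zero G) ⟩
      (S k bs 1 g u + D K b′ g u) + Tᵇ K b′ g u ≈⟨ solve 3 (λ x y z → (x :+ y) :+ z := x :+ (z :+ y)) ≈-refl _ _ _ ⟩
      S k bs 1 g u + (Tᵇ K b′ g u + D K b′ g u) ≈⟨ +-congˡ (T+D b g) ⟩
      S k bs 1 g u + (Tᵇ k b′ g u + D K b g u) ≈⟨ +-assoc _ _ _ ⟨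
      (S k bs 1 g u + Tᵇ k b′ g u) + D K b g u ∎
      where
      b′ = suc b
      bs = scan r b′
      ih : ∀ m → S K bs (suc m) g ≐ (λ u → S k bs (suc m) g u + D K b′ (S K bs m g) u)
      ih m = pieri-scan r b′ (trans (sym (ℕP.+-suc b r)) e) m g
    pieri-scan (suc r) b e (suc m) g {u} G = begin
      S K bs (2+ m) g u + Tᵇ K b′ f u ≈⟨ +-congʳ (ih (suc m) G) ⟩
      (S k bs (2+ m) g u + D K b′ f u) + Tᵇ K b′ f u
        ≈⟨ solve 3 (λ x y z → (x :+ y) :+ z := x :+ (z :+ y)) ≈-refl _ _ _ ⟩
      S k bs (2+ m) g u + (Tᵇ K b′ f u + D K b′ f u) ≈⟨ +-congˡ (T+D b f) ⟩
      S k bs (2+ m) g u + (Tᵇ k b′ f u + D K b f u)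
        ≈⟨ +-congˡ (+-congʳ (≈-trans (Linear-T k b′ .congᴸ (ih m) G) (Linear-T k b′ .addᴸ _ _ G))) ⟩
      S k bs (2+ m) g u + ((Tᵇ k b′ (S k bs (suc m) g) u + Tᵇ k b′ (D K b′ f′) u) + D K b f u)
        ≈⟨ +-congˡ (+-congʳ (+-congˡ (≈-sym (D-T-exchange IK b f′ G)))) ⟩
      S k bs (2+ m) g u + ((Tᵇ k b′ (S k bs (suc m) g) u + D K b (Tᵇ K b′ f′) u) + D K b f u)
        ≈⟨ solve 4 (λ x y z w → x :+ ((y :+ z) :+ w) := (x :+ y) :+ (w :+ z)) ≈-refl _ _ _ _ ⟩
      (S k bs (2+ m) g u + Tᵇ k b′ (S k bs (suc m) g) u) + (D K b f u + D K b (Tᵇ K b′ f′) u)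
        ≈⟨ +-congˡ (≈-sym (Linear-D b IK .addᴸ f (Tᵇ K b′ f′) G)) ⟩
      (S k bs (2+ m) g u + Tᵇ k b′ (S k bs (suc m) g) u) + D K b (λ v → f v + Tᵇ K b′ f′ v) u ∎
      where
      2+_ = λ m → suc (suc m)
      b′ = suc b
      bs = scan r b′
      f = S K bs (suc m) g
      f′ = S K bs m g
      ih : ∀ m → S K bs (suc m) g ≐ (λ u → S k bs (suc m) g u + D K b′ (S K bs m g) u)
      ih m = pieri-scan r b′ (trans (sym (ℕP.+-suc b r)) e) m g

    -- Operator form of h_{m+1}(x_1,...,x_K) = h_{m+1}(x_1,...,x_k) + x_K h_m(x_1,...,x_K). Entries
    -- of a permutation are positive, so the threshold 0 cuts nothing off and `D K 0` is `M K`.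
    pieri : ∀ m g → S K (scan n 0) (suc m) g ≐ (λ u → S k (scan n 0) (suc m) g u + M K (S K (scan n 0) m g) u)
    pieri m g {u} G = ≈-trans (pieri-scan n 0 refl m g G) (+-congˡ (Σ-cong (Ps n) (λ {l} ml →
      +-cong (⊙-T (0 <ᵇ ent u K) (<⇒<ᵇ (proj₁ (G .bound IK)))) (-‿cong (⊙-T (0 <ᵇ ent u l) (<⇒<ᵇ (proj₁ (G .bound (∈⇒In ml)))))))))

-- Divided differences and commutation of the Monk operators

module Hecke (A : RingOverℤ) (n : ℕ) where
  open Sums A
  open RangeSums A
  open Operators A n

  private
    U : ∀ {n} → _
    U {n} = Unique-range 1 n

  Adj : ℕ → Set
  Adj = Adjacent-In n

  d : ℕ → Fn → Fn
  d i g u = dsc u i ⊙ g (swapPos i (suc i) u)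

  Linear-d : ∀ {i} → Adj i → Linear (d i)
  Linear-d {i} (Ii , Ii′) = Linear-gate (λ u → dsc u i) (Linear-swap Ii Ii′)

  adjacent-cov : ∀ {i} {u : Vec ℕ n} → ent u i < ent u (suc i) → Cov u i (suc i)
  adjacent-cov lt = lt , λ m p q → ⊥-elim (<⇒≱ p (≤-pred q))

  τ-d : ∀ {i x y g} {u : Vec ℕ n} → Good u → Adj i → In n x → In n y →
    ¬ (x ≡ i × y ≡ suc i) → ¬ (x ≡ suc i × y ≡ i) →
    τ x y (d i g) u ≈ d i (τ (transp i (suc i) x) (transp i (suc i) y) g) u
  τ-d {i} {x} {y} {g} {u} G (Ii , Ii′) Ix Iy ne ne′ = begin
    τ x y (d i g) u ≈⟨ τ-def x y _ u ⟩
    up u x y ⊙ dsc w i ⊙ g (swapPos i (suc i) w) ≈⟨ gate₂ {up u x y} {dsc w i} {dsc u i} {up v (s x) (s y)}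
      (λ a b → let (x<y , c) = up⁻ u a ; r = X.forth-cov x<y c b in
               <⇒<ᵇ (X.forth-dsc x<y c b) , up⁺ v (proj₁ r) (proj₂ r))
      (λ a b → let (x<y , c) = up⁻ v b ; lt = <ᵇ⇒< _ _ a ; r = X.back-cov lt x<y c in
               up⁺ u (proj₁ r) (proj₂ r) , X.back-dsc lt x<y c)
      (λ _ _ → ≈-reflexive (cong g X.target)) ⟩
    dsc u i ⊙ up v (s x) (s y) ⊙ g (swapPos (s x) (s y) v) ≈⟨ ⊙-cong (dsc u i) (≈-sym (τ-def (s x) (s y) g v)) ⟩
    d i (τ (s x) (s y) g) u ∎
    where
    s = transp i (suc i)
    v = swapPos i (suc i) u
    w = swapPos x y u
    module X = Adjacent u G Ii Ii′ Ix Iy ne ne′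

  -- At an ascent only the first term survives, at a descent only the second. Either way the path
  -- goes once up and once down along the same edge and returns to u. This is the source of the
  -- constant term in `M-d`.
  τ-d-adjacent : ∀ {i g} {u : Vec ℕ n} → Good u → Adj i → τ i (suc i) (d i g) u + d i (τ i (suc i) g) u ≈ g u
  τ-d-adjacent {i} {g} {u} G (Ii , Ii′) with <-cmp (ent u i) (ent u (suc i))
  ... | tri≈ _ e _ = ⊥-elim (ent≢ G Ii Ii′ (<⇒≢ (n<1+n i)) e)
  ... | tri< lt _ _ = ≈-trans (+-cong
      (≈-trans (τ-def i (suc i) _ u) (≈-trans (⊙-T (up u i (suc i)) (up⁺ u (n<1+n i) (adjacent-cov {u = u} lt)))
        (≈-trans (⊙-T (dsc v i) (<⇒<ᵇ (subst₂ _<_ (sym (swapʳ i (suc i) u Ii′)) (sym (swapˡ i (suc i) u Ii)) lt)))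
          (≈-reflexive (cong g (swap-invol i (suc i) u Ii Ii′))))))
      (⊙-¬ (dsc u i) (λ t → <-asym lt (<ᵇ⇒< _ _ t)))) (+-identityʳ _)
    where v = swapPos i (suc i) u
  ... | tri> _ _ gt = ≈-trans (+-cong (τ-zero (λ _ lt → <-asym gt lt))
      (≈-trans (⊙-T (dsc u i) (<⇒<ᵇ gt)) (≈-trans (τ-def i (suc i) _ v)
        (≈-trans (⊙-T (up v i (suc i)) (up⁺ v (n<1+n i) (adjacent-cov {u = v}
            (subst₂ _<_ (sym (swapˡ i (suc i) u Ii)) (sym (swapʳ i (suc i) u Ii′)) gt))))
          (≈-reflexive (cong g (swap-invol i (suc i) u Ii Ii′))))))) (+-identityˡ _)
    where v = swapPos i (suc i) u

  d-M : ∀ {i} k g {u : Vec ℕ n} → Adj i →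
    d i (M k g) u ≈ Σl (Ps n) (λ l → d i (τ k (transp i (suc i) l) g) u - d i (τ (transp i (suc i) l) k g) u)
  d-M {i} k g {u} (Ii , Ii′) = ≈-trans (Σ-⊙ (dsc u i) (Ps n) _)
    (≈-trans (Σ-cong (Ps n) (λ {l} _ → ≈-trans (⊙-+ (dsc u i) _ _) (+-congˡ (⊙-neg (dsc u i) _))))
      (≈-sym (transp-sum (λ l → d i (τ k l g) u - d i (τ l k g) u) Ii Ii′)))

  ∂x : ℕ → ℕ → Carrier
  ∂x i k with k ≟ i | k ≟ suc i
  ... | yes _ | _ = 1#
  ... | no _ | yes _ = - 1#
  ... | no _ | no _ = 0#

  ∂xˡ : ∀ i → ∂x i i ≡ 1#
  ∂xˡ i with i ≟ i | i ≟ suc i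
  ... | yes _ | _ = refl
  ... | no ne | _ = ⊥-elim (ne refl)

  ∂xʳ : ∀ i → ∂x i (suc i) ≡ - 1#
  ∂xʳ i with suc i ≟ i | suc i ≟ suc i
  ... | yes e | _ = ⊥-elim (<⇒≢ (n<1+n i) (sym e))
  ... | no _ | yes _ = refl
  ... | no _ | no ne = ⊥-elim (ne refl)

  ∂xᵒ : ∀ i k → k ≢ i → k ≢ suc i → ∂x i k ≡ 0#
  ∂xᵒ i k a b with k ≟ i | k ≟ suc i
  ... | yes e | _ = ⊥-elim (a e)
  ... | no _ | yes e = ⊥-elim (b e)
  ... | no _ | no _ = refl

  -- Transpose of the Leibniz rule ∂_i(x_k f) = sᵢ(x_k) ∂_i f + ∂_i(x_k) f. The summands correspond
  -- under the reindexing by sᵢ, except that for k = i or k = i+1 the one with l = sᵢ(k) differs by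
  -- ± g(u).
  M-d : ∀ {i k} g {u : Vec ℕ n} → Good u → Adj i → In n k →
    M k (d i g) u ≈ d i (M (transp i (suc i) k) g) u + ∂x i k * g u
  M-d {i} {k} g {u} G Ai@(Ii , Ii′) Ik = ≈-trans (body (transp i (suc i) k) refl (transpView i (suc i) k)) (+-congʳ (≈-sym (d-M (transp i (suc i) k) g {u} Ai)))
    where
    s = transp i (suc i)
    i≢ : i ≢ suc i
    i≢ = <⇒≢ (n<1+n i)
    pair : ∀ {l} → In n l → ¬ (k ≡ i × l ≡ suc i) → ¬ (k ≡ suc i × l ≡ i) →
      τ k l (d i g) u - τ l k (d i g) u ≈ d i (τ (s k) (s l) g) u - d i (τ (s l) (s k) g) u
    pair Il ne ne′ = +-cong (τ-d G Ai Ik Il ne ne′) (-‿cong (τ-d G Ai Il Ik (λ r → ne′ (proj₂ r , proj₁ r)) (λ r → ne (proj₂ r , proj₁ r))))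
    body : ∀ k′ → s k ≡ k′ → TranspView i (suc i) k k′ → M k (d i g) u ≈
      Σl (Ps n) (λ l → d i (τ (s k) (s l) g) u - d i (τ (s l) (s k) g) u) + ∂x i k * g u
    body _ _ (isᵒ a b) = ≈-trans (Σ-cong (Ps n) (λ m → pair (∈⇒In m) (λ r → a (proj₁ r)) (λ r → b (proj₁ r))))
      (≈-sym (≈-trans (+-congˡ (≈-trans (*-congʳ (≈-reflexive (∂xᵒ i k a b))) (zeroˡ _))) (+-identityʳ _)))
    body _ _ (isˡ refl) = Σ-bump U (In⇒∈ Ii′) (λ m ne → pair (∈⇒In m) (λ r → ne (proj₂ r)) (λ r → i≢ (proj₁ r))) at
      where
      at : τ i (suc i) (d i g) u - τ (suc i) i (d i g) u ≈
        (d i (τ (s i) (s (suc i)) g) u - d i (τ (s (suc i)) (s i) g) u) + ∂x i i * g u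
      at rewrite transpˡ i (suc i) | transpʳ i (suc i) | ∂xˡ i = begin
        α - τ (suc i) i (d i g) u ≈⟨ +-congˡ (-‿cong (τ-zero (λ lt _ → <-asym lt (n<1+n i)))) ⟩
        α - 0# ≈⟨ x-0≈x _ ⟩
        α ≈⟨ solve 2 (λ a b → a := (:- b) :+ (a :+ b)) ≈-refl _ _ ⟩
        - β + (α + β) ≈⟨ +-cong (≈-sym (+-identityˡ _)) (τ-d-adjacent G Ai) ⟩
        (0# - β) + g u ≈⟨ +-cong (+-congʳ (≈-sym (⊙-zero (dsc u i) (λ _ → τ-zero (λ lt _ → <-asym lt (n<1+n i)))))) (≈-sym (*-identityˡ _)) ⟩
        (d i (τ (suc i) i g) u - β) + 1# * g u ∎
        where
        α = τ i (suc i) (d i g) u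
        β = d i (τ i (suc i) g) u
    body _ _ (isʳ _ refl) = Σ-bump U (In⇒∈ Ii) (λ m ne → pair (∈⇒In m) (λ r → i≢ (sym (proj₁ r))) (λ r → ne (proj₂ r))) at
      where
      at : τ (suc i) i (d i g) u - τ i (suc i) (d i g) u ≈
        (d i (τ (s (suc i)) (s i) g) u - d i (τ (s i) (s (suc i)) g) u) + ∂x i (suc i) * g u
      at rewrite transpˡ i (suc i) | transpʳ i (suc i) | ∂xʳ i = begin
        τ (suc i) i (d i g) u - α ≈⟨ +-congʳ (τ-zero (λ lt _ → <-asym lt (n<1+n i))) ⟩
        0# - α ≈⟨ +-identityˡ _ ⟩
        - α ≈⟨ solve 2 (λ a b → :- a := b :- (a :+ b)) ≈-refl _ _ ⟩
        β - (α + β) ≈⟨ +-cong (≈-sym (x-0≈x _)) (-‿cong (τ-d-adjacent G Ai)) ⟩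
        (β - 0#) - g u ≈⟨ +-cong (+-congˡ (-‿cong (≈-sym (⊙-zero (dsc u i) (λ _ → τ-zero (λ lt _ → <-asym lt (n<1+n i))))))) (≈-sym neg1) ⟩
        (β - d i (τ (suc i) i g) u) + (- 1#) * g u ∎
        where
        α = τ i (suc i) (d i g) u
        β = d i (τ i (suc i) g) u
        neg1 : (- 1#) * g u ≈ - g u
        neg1 = ≈-trans (solve 2 (λ a b → (:- a) :* b := :- (a :* b)) ≈-refl _ _) (-‿cong (*-identityˡ _))

  M-M-d : ∀ {i j k} g {u : Vec ℕ n} → Good u → Adj i → In n j → In n k →
    M j (M k (d i g)) u ≈ d i (M (transp i (suc i) j) (M (transp i (suc i) k) g)) u +
      (∂x i j * M (transp i (suc i) k) g u + ∂x i k * M j g u)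
  M-M-d {i} {j} {k} g {u} G Ai Ij Ik = begin
    M j (M k (d i g)) u ≈⟨ Linear-M Ij .congᴸ (λ H → M-d g H Ai Ik) G ⟩
    M j (λ v → d i (M k′ g) v + ∂x i k * g v) u ≈⟨ ≈-trans (Linear-M Ij .addᴸ _ _ G) (+-congˡ (Linear-M Ij .scaleᴸ _ g G)) ⟩
    M j (d i (M k′ g)) u + ∂x i k * M j g u ≈⟨ +-congʳ (M-d (M k′ g) G Ai Ij) ⟩
    (d i (M j′ (M k′ g)) u + ∂x i j * M k′ g u) + ∂x i k * M j g u ≈⟨ +-assoc _ _ _ ⟩
    d i (M j′ (M k′ g)) u + (∂x i j * M k′ g u + ∂x i k * M j g u) ∎
    where
    j′ = transp i (suc i) j
    k′ = transp i (suc i) k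

  -- Both sides are ∂_i(x_j x_k), expanded by the Leibniz rule in the two orders. If j or k is
  -- neither i nor i+1, its coefficient vanishes and sᵢ fixes it; in the mixed case j, k = i, i+1
  -- both sides are zero.
  symmetric-part : ∀ i j k g {u : Vec ℕ n} →
    ∂x i j * M (transp i (suc i) k) g u + ∂x i k * M j g u ≈ ∂x i k * M (transp i (suc i) j) g u + ∂x i j * M k g u
  symmetric-part i j k g {u} = go (transpView i (suc i) j) (transpView i (suc i) k)
    where
    zero-coeff : ∀ {a b c x y} → b ≈ 0# → a * x + b * y ≈ b * c + a * x
    zero-coeff {a} {b} {c} {x} {y} e = ≈-trans (+-congˡ (≈-trans (*-congʳ e) (zeroˡ y)))
      (≈-trans (+-comm _ _) (+-congʳ (≈-sym (≈-trans (*-congʳ e) (zeroˡ c)))))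
    go : ∀ {j′ k′} → TranspView i (suc i) j j′ → TranspView i (suc i) k k′ →
      ∂x i j * M k′ g u + ∂x i k * M j g u ≈ ∂x i k * M j′ g u + ∂x i j * M k g u
    go _ (isᵒ a b) = zero-coeff (≈-reflexive (∂xᵒ i k a b))
    go (isᵒ a b) _ = ≈-sym (zero-coeff (≈-reflexive (∂xᵒ i j a b)))
    go (isˡ refl) (isˡ refl) = ≈-refl
    go (isʳ _ refl) (isʳ _ refl) = ≈-refl
    go (isˡ refl) (isʳ _ refl) rewrite ∂xˡ i | ∂xʳ i = solve 3 (λ a x y → a :* x :+ (:- a) :* x := (:- a) :* y :+ a :* y) ≈-refl 1# (M i g u) (M (suc i) g u)
    go (isʳ _ refl) (isˡ refl) rewrite ∂xˡ i | ∂xʳ i = solve 3 (λ a x y → (:- a) :* x :+ a :* x := a :* y :+ (:- a) :* y) ≈-refl 1# (M (suc i) g u) (M i g u)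

  find-descent : ∀ (v : Vec ℕ n) r x → ent v (x ℕ.+ r) < ent v x → ∃ λ t → x ≤ t × t < x ℕ.+ r × T (dsc v t)
  find-descent v zero x lt = ⊥-elim (<-irrefl (cong (ent v) (ℕP.+-identityʳ x)) lt)
  find-descent v (suc r) x lt with ent v (suc x) <? ent v x
  ... | yes h = x , ≤-refl , ℕP.m<m+n x (s≤s z≤n) , <⇒<ᵇ h
  ... | no h with find-descent v r (suc x) (<-≤-trans (subst (λ z → ent v z < ent v x) (ℕP.+-suc x r) lt) (≮⇒≥ h))
  ...   | t , le , lt′ , td = t , <⇒≤ le , subst (t <_) (sym (ℕP.+-suc x r)) lt′ , td

  len-dsc : ∀ {t} {u : Vec ℕ n} → Good u → Adj t → T (dsc u t) → len u ≡ suc (len (swapPos t (suc t) u))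
  len-dsc {t} {u} G (It , It′) td = trans (cong len (sym (swap-invol t (suc t) u It It′)))
    (len-cover (swapPos t (suc t) u) (Good-swap It It′ G) It It′ (n<1+n t)
      (adjacent-cov {u = swapPos t (suc t) u} (subst₂ _<_ (sym (swapˡ t (suc t) u It)) (sym (swapʳ t (suc t) u It′)) (<ᵇ⇒< _ _ td))))

  -- After a cover by (x y) the entry at x exceeds the one at y, so the target has a descent
  -- somewhere from x to y, and g vanishes there.
  M-no-descent : ∀ {k g} → In n k → (∀ {v} → Good v → ∀ t → Adj t → T (dsc v t) → g v ≈ 0#) → M k g ≐ (λ _ → 0#)
  M-no-descent {k} {g} Ik h {u} G = Σ-0 (Ps n) (λ m → ≈-trans (+-cong (z Ik (∈⇒In m)) (-‿cong (z (∈⇒In m) Ik))) (-‿inverseʳ 0#))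
    where
    z : ∀ {x y} → In n x → In n y → τ x y g u ≈ 0#
    z {x} {y} Ix Iy = ≈-trans (τ-def x y g u) (⊙-zero (up u x y) (λ t →
      let (x<y , lt , _) = up⁻ u t
          v = swapPos x y u
          x+r≡y = ℕP.m+[n∸m]≡n (<⇒≤ x<y)
          (s , x≤s , s<y , sd) = find-descent v (y ∸ x) x (subst (λ q → ent v q < ent v x) (sym x+r≡y)
            (subst₂ _<_ (sym (swapʳ x y u Iy)) (sym (swapˡ x y u Ix)) lt))
          s<y′ = subst (s <_) x+r≡y s<y
      in h (Good-swap Ix Iy G) s ((≤-trans (proj₁ Ix) x≤s , ≤-trans (<⇒≤ s<y′) (proj₂ Iy)) , (s≤s z≤n , ≤-trans s<y′ (proj₂ Iy))) sd))

  -- Induction on the length of u.  Splitting g = [asc t] g + [dsc t] g for t = 1, 2, …,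
  -- the second part lies in the image of d t, where M-M-d moves u down.
  M-comm-below : ∀ N {j k} g {u : Vec ℕ n} → Good u → len u < N → In n j → In n k → M j (M k g) u ≈ M k (M j g) u
  M-comm-below (suc N) {j} {k} g {u} G lu Ij Ik = go n 0 refl g (λ _ t At le → ⊥-elim (<⇒≱ (proj₁ (proj₁ At)) le))
    where
    go : ∀ r i → i ℕ.+ r ≡ n → ∀ g → (∀ {v} → Good v → ∀ t → Adj t → t ≤ i → T (dsc v t) → g v ≈ 0#) →
      M j (M k g) u ≈ M k (M j g) u
    go zero i e g h = ≈-trans (zeroᴸ (Linear-M Ij) (M-no-descent Ik h′) G) (≈-sym (zeroᴸ (Linear-M Ik) (M-no-descent Ij h′) G))
      where
      h′ : ∀ {v} → Good v → ∀ t → Adj t → T (dsc v t) → g v ≈ 0#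
      h′ H t At = h H t At (subst (t ≤_) (trans (sym e) (ℕP.+-identityʳ i)) (proj₂ (proj₁ At)))
    go (suc r) i e g h with suc (suc i) ≤? n
    ... | no ¬le = go r (suc i) (trans (sym (ℕP.+-suc i r)) e) g
          (λ H t At le → h H t At (≤-pred (≤∧≢⇒< le (λ q → ¬le (subst (λ z → suc z ≤ n) q (proj₂ (proj₂ At)))))))
    ... | yes le = begin
      M j (M k g) u ≈⟨ split Ij Ik ⟩
      M j (M k g₁) u + M j (M k (d t g₂)) u ≈⟨ +-cong (go r (suc i) (trans (sym (ℕP.+-suc i r)) e) g₁ killed) lower ⟩
      M k (M j g₁) u + M k (M j (d t g₂)) u ≈⟨ split Ik Ij ⟨
      M k (M j g) u ∎
      where
      t = suc i
      At : Adj t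
      At = (s≤s z≤n , <⇒≤ le) , (s≤s z≤n , le)
      g₁ g₂ : Fn
      g₁ v = not (dsc v t) ⊙ g v
      g₂ v = g (swapPos t (suc t) v)
      decomp : g ≐ (λ v → g₁ v + d t g₂ v)
      decomp {v} H with dsc v t
      ... | true = ≈-trans (≈-reflexive (cong g (sym (swap-invol t (suc t) v (proj₁ At) (proj₂ At))))) (≈-sym (+-identityˡ _))
      ... | false = ≈-sym (+-identityʳ _)
      split : ∀ {a b} → In n a → In n b → M a (M b g) u ≈ M a (M b g₁) u + M a (M b (d t g₂)) u
      split Ia Ib = ≈-trans (L .congᴸ decomp G) (L .addᴸ _ _ G)
        where L = Linear-∘ (Linear-M Ia) (Linear-M Ib)
      killed : ∀ {v} → Good v → ∀ s → Adj s → s ≤ t → T (dsc v s) → g₁ v ≈ 0#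
      killed {v} H s As le′ td with s ≟ t
      ... | yes refl = ⊙-¬ (not (dsc v s)) (λ q → contra td q)
        where
        contra : ∀ {b} → T b → T (not b) → ⊥
        contra {true} _ ()
      ... | no ne = ⊙-zero (not (dsc v t)) (λ _ → h H s As (≤-pred (≤∧≢⇒< le′ ne)) td)
      σ = transp t (suc t)
      lower : M j (M k (d t g₂)) u ≈ M k (M j (d t g₂)) u
      lower = begin
        M j (M k (d t g₂)) u ≈⟨ M-M-d g₂ G At Ij Ik ⟩
        d t (M (σ j) (M (σ k) g₂)) u + _ ≈⟨ +-cong (⊙-congT (dsc u t) (λ td →
          M-comm-below N g₂ (Good-swap (proj₁ At) (proj₂ At) G) (≤-pred (subst (_< suc N) (len-dsc G At td) lu))
            (transp-In j (proj₁ At) (proj₂ At) Ij) (transp-In k (proj₁ At) (proj₂ At) Ik))) (symmetric-part t j k g₂) ⟩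
        d t (M (σ k) (M (σ j) g₂)) u + _ ≈⟨ M-M-d g₂ G At Ik Ij ⟨
        M k (M j (d t g₂)) u ∎

  M-comm : ∀ {j k} g → In n j → In n k → M j (M k g) ≐ M k (M j g)
  M-comm g Ij Ik {u} G = M-comm-below (suc (len u)) g G ≤-refl Ij Ik

-- The action of polynomials

_≟ᵛ_ : ∀ {n} (α β : Vec ℕ n) → Dec (α ≡ β)
_≟ᵛ_ = ≡-dec _≟_

module LinearForms (A : RingOverℤ) where
  open Sums A

  -- Linear extension of a function on monomials. Coefficients, substitution and the action on
  -- functions are all of this form, so compatibility with `≈P` and with products is proved once.
  lin : ∀ {n} → (Mono n → Carrier) → Poly n → Carrier
  lin χ p = Σl p (λ t → ι (proj₁ t) * χ (proj₂ t))

  ι-coeff : ∀ {n} (p : Poly n) β → ι (coeff p β) ≈ Σl p (λ t → does (proj₂ t ≟ᵛ β) ⊙ ι (proj₁ t))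
  ι-coeff [] β = ι-0
  ι-coeff ((c , α) ∷ p) β with α ≟ᵛ β
  ... | yes _ = ≈-trans (ι-+ c (coeff p β)) (+-congˡ (ι-coeff p β))
  ... | no _ = ≈-trans (ι-coeff p β) (≈-sym (+-identityˡ _))

  lin-support : ∀ {n} (χ : Mono n → Carrier) (p : Poly n) {supp} → Unique supp →
    (∀ {t} → t ∈ p → proj₂ t ∈ supp) → lin χ p ≈ Σl supp (λ β → ι (coeff p β) * χ β)
  lin-support χ p {supp} u sub = begin
    lin χ p ≈⟨ Σ-cong p (λ {t} m → ≈-sym (Σ-indicator _≟ᵛ_ {f = λ β → ι (proj₁ t) * χ β} u (sub m))) ⟩
    Σl p (λ t → Σl supp (λ β → does (β ≟ᵛ proj₂ t) ⊙ (ι (proj₁ t) * χ β))) ≈⟨ Σ-swap p supp _ ⟩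
    Σl supp (λ β → Σl p (λ t → does (β ≟ᵛ proj₂ t) ⊙ (ι (proj₁ t) * χ β)))
      ≈⟨ Σ-cong supp (λ {β} _ → ≈-trans (Σ-cong p (λ {t} _ → ≈-trans
           (≈-trans (≈-reflexive (cong (_⊙ (ι (proj₁ t) * χ β)) (does-sym _≟ᵛ_ β (proj₂ t)))) (⊙-cong (does (proj₂ t ≟ᵛ β)) (*-comm _ _)))
           (≈-sym (⊙-* (does (proj₂ t ≟ᵛ β)) (χ β) _))))
         (≈-trans (≈-sym (Σ-* (χ β) p _)) (≈-trans (*-congˡ (≈-sym (ι-coeff p β))) (*-comm _ _)))) ⟩
    Σl supp (λ β → ι (coeff p β) * χ β) ∎

  -- Polynomials are term lists that may repeat monomials. Both lists are regrouped over one common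
  -- support without duplicates, where equality of coefficients applies term by term.
  lin-resp : ∀ {n} (χ : Mono n → Carrier) {p q : Poly n} → p ≈P q → lin χ p ≈ lin χ q
  lin-resp χ {p} {q} e = ≈-trans (lin-support χ p u (λ m → ∈-deduplicate⁺ _≟ᵛ_ (∈-map⁺ proj₂ (∈-++⁺ˡ m))))
    (≈-trans (Σ-cong supp (λ {β} _ → *-congʳ (≈-reflexive (cong ι (e β)))))
      (≈-sym (lin-support χ q u (λ m → ∈-deduplicate⁺ _≟ᵛ_ (∈-map⁺ proj₂ (∈-++⁺ʳ p m))))))
    where
    supp = deduplicate _≟ᵛ_ (map proj₂ (p ++ q))
    u = DecUniq.deduplicate-! _≟ᵛ_ (map proj₂ (p ++ q))

  lin-*P : ∀ {n} (χ : Mono n → Carrier) (p q : Poly n) → lin χ (p *P q) ≈ lin (λ α → lin (λ β → χ (zipWith ℕ._+_ α β)) q) p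
  lin-*P χ p q = ≈-trans (Σ-concatMap _ p _) (Σ-cong p (λ {s} _ → ≈-trans (Σ-map _ q _)
    (≈-trans (Σ-cong q (λ {t} _ → ≈-trans (*-congʳ (ι-* _ _)) (*-assoc _ _ _))) (≈-sym (Σ-* (ι (proj₁ s)) q _)))))

  lin-neg : ∀ {n} (χ : Mono n → Carrier) (p : Poly n) → lin χ (-P p) ≈ - lin χ p
  lin-neg χ p = ≈-trans (Σ-map _ p _) (≈-trans (Σ-cong p (λ {t} _ →
      ≈-trans (*-congʳ (ι-neg _)) (solve 2 (λ a b → (:- a) :* b := :- (a :* b)) ≈-refl _ _)))
    (Σ-neg p _))

  lin-mono : ∀ {n} (χ : Mono n → Carrier) α → lin χ (mono α) ≈ χ α
  lin-mono χ α = ≈-trans (+-identityʳ _) (≈-trans (*-congʳ ι-1) (*-identityˡ _))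

module Substitution (A : RingOverℤ) (x : ℕ → Sums.Carrier A) where
  open Sums A
  open LinearForms A

  pw : ℕ → ℕ → Carrier
  pw k zero = 1#
  pw k (suc a) = x k * pw k a

  monomial : ∀ {r} → ℕ → Vec ℕ r → Carrier
  monomial o [] = 1#
  monomial o (a ∷ α) = pw (suc o) a * monomial (suc o) α

  eval : ∀ {n} → Poly n → Carrier
  eval = lin (monomial 0)

-- Used with `M`, and in `Kernel` also with multiplication by scalars X k. The second use computes
-- the value of elementary symmetric polynomials at X by the recursion already proved for operators.
module Action (A : RingOverℤ) (n : ℕ) (op : ℕ → Operators.Fn A n → Operators.Fn A n)
  (Linear-op : ∀ {k : ℕ} → In n k → Operators.Linear A n (op k))
  (op-comm : ∀ {j k : ℕ} (g : Operators.Fn A n) → In n j → In n k → Operators._≐_ A n (op j (op k g)) (op k (op j g))) where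
  open Sums A
  open LinearForms A
  open Operators A n

  pow : ℕ → ℕ → Fn → Fn
  pow k zero g = g
  pow k (suc a) g = op k (pow k a g)

  -- The offset `o` counts the variables already passed, so that the recursion on the exponent
  -- vector keeps their numbering.
  actM : ∀ {r} → ℕ → Vec ℕ r → Fn → Fn
  actM o [] g = g
  actM o (a ∷ α) g = pow (suc o) a (actM (suc o) α g)

  act : Poly n → Fn → Fn
  act p g u = lin (λ α → actM 0 α g u) p

  Linear-pow : ∀ {k} a → In n k → Linear (pow k a)
  Linear-pow zero Ik = Linear-id
  Linear-pow (suc a) Ik = Linear-∘ (Linear-op Ik) (Linear-pow a Ik)

  In-suc : ∀ {o r} → o ℕ.+ suc r ≤ n → In n (suc o) × suc o ℕ.+ r ≤ n
  In-suc {o} {r} le = (s≤s z≤n , ≤-trans (ℕP.m≤m+n (suc o) r) le′) , le′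
    where
    le′ : suc o ℕ.+ r ≤ n
    le′ = subst (_≤ n) (ℕP.+-suc o r) le

  Linear-actM : ∀ {r o} (α : Vec ℕ r) → o ℕ.+ r ≤ n → Linear (actM o α)
  Linear-actM [] le = Linear-id
  Linear-actM (a ∷ α) le = Linear-∘ (Linear-pow a (proj₁ (In-suc le))) (Linear-actM α (proj₂ (In-suc le)))

  Linear-act : ∀ p → Linear (act p)
  Linear-act p = Linear-Σ p (λ {t} _ → Linear-scale (ι (proj₁ t)) (Linear-actM (proj₂ t) ≤-refl))

  Commutes : (Fn → Fn) → Set
  Commutes F = ∀ {k} g → In n k → F (op k g) ≐ op k (F g)

  pow-commutes : ∀ {F k} a g → Commutes F → In n k → F (pow k a g) ≐ pow k a (F g)
  pow-commutes zero g C Ik G = ≈-refl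
  pow-commutes {F} {k} (suc a) g C Ik G = ≈-trans (C _ Ik G) (Linear-op Ik .congᴸ (pow-commutes {F} a g C Ik) G)

  actM-commutes : ∀ {F r o} (α : Vec ℕ r) g → o ℕ.+ r ≤ n → Commutes F → F (actM o α g) ≐ actM o α (F g)
  actM-commutes [] g le C G = ≈-refl
  actM-commutes {F} (a ∷ α) g le C G = ≈-trans (pow-commutes {F} a _ C (proj₁ (In-suc le)) G)
    (Linear-pow a (proj₁ (In-suc le)) .congᴸ (actM-commutes {F} α g (proj₂ (In-suc le)) C) G)

  act-commutes : ∀ {F} p g → Linear F → Commutes F → F (act p g) ≐ act p (F g)
  act-commutes {F} p g LF C {u} G = ≈-trans (sumᴸ LF p (λ t v → ι (proj₁ t) * actM 0 (proj₂ t) g v) G)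
    (Σ-cong p (λ {t} _ → ≈-trans (LF .scaleᴸ _ _ G) (*-congˡ (actM-commutes {F} (proj₂ t) g ≤-refl C G))))

  op-commutes : ∀ {j} → In n j → Commutes (op j)
  op-commutes Ij g Ik = op-comm g Ij Ik

  Commutes-pow : ∀ {j} a → In n j → Commutes (pow j a)
  Commutes-pow {j} a Ij {k} g Ik {u} G = ≈-sym (pow-commutes {op k} a g (op-commutes Ik) Ij G)

  pow-+ : ∀ {k} a b g → pow k (a ℕ.+ b) g ≡ pow k a (pow k b g)
  pow-+ zero b g = refl
  pow-+ {k} (suc a) b g = cong (op k) (pow-+ a b g)

  actM-+ : ∀ {r o} (α β : Vec ℕ r) g → o ℕ.+ r ≤ n → actM o (zipWith ℕ._+_ α β) g ≐ actM o α (actM o β g)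
  actM-+ [] [] g le G = ≈-refl
  actM-+ {_} {o} (a ∷ α) (b ∷ β) g le {u} G = begin
    pow k (a ℕ.+ b) (actM (suc o) (zipWith ℕ._+_ α β) g) u
      ≡⟨ cong-app (pow-+ a b _) u ⟩
    pow k a (pow k b (actM (suc o) (zipWith ℕ._+_ α β) g)) u
      ≈⟨ Linear-∘ (Linear-pow a Ik) (Linear-pow b Ik) .congᴸ (actM-+ α β g le′) G ⟩
    pow k a (pow k b (actM (suc o) α (actM (suc o) β g))) u
      ≈⟨ Linear-pow a Ik .congᴸ (actM-commutes {pow k b} α _ le′ (Commutes-pow b Ik)) G ⟩
    pow k a (actM (suc o) α (pow k b (actM (suc o) β g))) u ∎
    where
    k = suc o
    Ik = proj₁ (In-suc le)
    le′ = proj₂ (In-suc le)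

  act-*P : ∀ p q g → act (p *P q) g ≐ act p (act q g)
  act-*P p q g {u} G = ≈-trans (lin-*P _ p q) (Σ-cong p (λ {s} _ → *-congˡ (≈-sym
    (≈-trans (sumᴸ (L (proj₂ s)) q (λ t v → ι (proj₁ t) * actM 0 (proj₂ t) g v) G)
      (Σ-cong q (λ {t} _ → ≈-trans (L (proj₂ s) .scaleᴸ _ (actM 0 (proj₂ t) g) G) (*-congˡ (≈-sym (actM-+ (proj₂ s) (proj₂ t) g ≤-refl G)))))))))
    where
    L : ∀ (α : Mono n) → Linear (actM 0 α)
    L α = Linear-actM α ≤-refl

  sg : ℕ → Carrier
  sg zero = 1#
  sg (suc m) = - sg m

  sg-cancel : ∀ m x → sg m * (sg m * x) ≈ x
  sg-cancel zero x = ≈-trans (*-identityˡ _) (*-identityˡ x)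
  sg-cancel (suc m) x = ≈-trans
    (solve 2 (λ s x → (:- s) :* ((:- s) :* x) := s :* (s :* x)) ≈-refl _ _)
    (sg-cancel m x)

  -- (-1)ᵐ e_m in the variables o+1, …, o+r
  es : ℕ → ℕ → ℕ → Fn → Fn
  es r o zero g = g
  es zero o (suc m) g = λ _ → 0#
  es (suc r) o (suc m) g = λ u → es r (suc o) (suc m) g u - op (suc o) (es r (suc o) m g) u

  Linear-es : ∀ r o m → o ℕ.+ r ≤ n → Linear (es r o m)
  Linear-es r o zero le = Linear-id
  Linear-es zero o (suc m) le = Linear-0
  Linear-es (suc r) o (suc m) le = Linear-+ (Linear-es r (suc o) (suc m) (proj₂ (In-suc le)))
    (Linear-neg (Linear-∘ (Linear-op (proj₁ (In-suc le))) (Linear-es r (suc o) m (proj₂ (In-suc le)))))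

  -- Squarefree monomials are split by their first bit; the two halves are the two terms in the
  -- recursion of `es`, and the factor `sg m` accounts for its sign.
  e-bits : ∀ r o m g → o ℕ.+ r ≤ n →
    (λ u → Σl (bits r) (λ α → (V.sum α ≡ᵇ m) ⊙ actM o α g u)) ≐ (λ u → sg m * es r o m g u)
  e-bits zero o zero g le G = ≈-trans (+-identityʳ _) (≈-sym (*-identityˡ _))
  e-bits zero o (suc m) g le G = ≈-trans (+-identityʳ _) (≈-sym (zeroʳ _))
  e-bits (suc r) o m g le {u} G = ≈-trans (Σ-++ (map (0 ∷_) (bits r)) (map (1 ∷_) (bits r)) _)
    (≈-trans (+-cong (Σ-map (0 ∷_) (bits r) _) (Σ-map (1 ∷_) (bits r) _)) (split m))
    where
    Ik = proj₁ (In-suc le)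
    le′ = proj₂ (In-suc le)
    split : ∀ m → Σl (bits r) (λ α → (V.sum α ≡ᵇ m) ⊙ actM (suc o) α g u) +
      Σl (bits r) (λ α → (suc (V.sum α) ≡ᵇ m) ⊙ op (suc o) (actM (suc o) α g) u) ≈ sg m * es (suc r) o m g u
    split zero = ≈-trans (+-cong (e-bits r (suc o) zero g le′ G) (Σ-0 (bits r) (λ _ → ≈-refl))) (+-identityʳ _)
    split (suc m) = begin
      Σl (bits r) (λ α → (V.sum α ≡ᵇ suc m) ⊙ actM (suc o) α g u) + Σl (bits r) (λ α → (V.sum α ≡ᵇ m) ⊙ op (suc o) (actM (suc o) α g) u)
        ≈⟨ +-cong (e-bits r (suc o) (suc m) g le′ G) (≈-sym (sumᴸ′ m)) ⟩
      sg (suc m) * es r (suc o) (suc m) g u + op (suc o) (λ v → Σl (bits r) (λ α → (V.sum α ≡ᵇ m) ⊙ actM (suc o) α g v)) u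
        ≈⟨ +-congˡ (≈-trans (Linear-op Ik .congᴸ (e-bits r (suc o) m g le′) G) (Linear-op Ik .scaleᴸ _ _ G)) ⟩
      sg (suc m) * es r (suc o) (suc m) g u + sg m * op (suc o) (es r (suc o) m g) u
        ≈⟨ solve 3 (λ s a b → (:- s) :* a :+ s :* b := (:- s) :* (a :- b)) ≈-refl _ _ _ ⟩
      sg (suc m) * (es r (suc o) (suc m) g u - op (suc o) (es r (suc o) m g) u) ∎
      where
      gate-op : ∀ b f → op (suc o) (λ v → b ⊙ f v) u ≈ b ⊙ op (suc o) f u
      gate-op true f = ≈-refl
      gate-op false f = zeroᴸ (Linear-op Ik) (λ _ → ≈-refl) G
      sumᴸ′ : ∀ m → op (suc o) (λ v → Σl (bits r) (λ α → (V.sum α ≡ᵇ m) ⊙ actM (suc o) α g v)) u ≈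
        Σl (bits r) (λ α → (V.sum α ≡ᵇ m) ⊙ op (suc o) (actM (suc o) α g) u)
      sumᴸ′ m = ≈-trans (sumᴸ (Linear-op Ik) (bits r) (λ α v → (V.sum α ≡ᵇ m) ⊙ actM (suc o) α g v) G)
        (Σ-cong (bits r) (λ {α} _ → gate-op (V.sum α ≡ᵇ m) _))

  act-esym : ∀ m g → act (esym n m) g ≐ (λ u → sg m * es n 0 m g u)
  act-esym m g {u} G = begin
    act (esym n m) g u ≈⟨ Σ-map {X = ℤ × Mono n} (λ α → (1ℤ , α)) (filterᵇ (λ α → V.sum α ≡ᵇ m) (bits n)) _ ⟩
    Σl (filterᵇ (λ α → V.sum α ≡ᵇ m) (bits n)) (λ α → ι 1ℤ * actM 0 α g u) ≈⟨ Σ-filter _ (bits n) _ ⟩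
    Σl (bits n) (λ α → (V.sum α ≡ᵇ m) ⊙ (ι 1ℤ * actM 0 α g u))
      ≈⟨ Σ-cong (bits n) (λ {α} _ → ⊙-cong (V.sum α ≡ᵇ m) (≈-trans (*-congʳ ι-1) (*-identityˡ _))) ⟩
    Σl (bits n) (λ α → (V.sum α ≡ᵇ m) ⊙ actM 0 α g u) ≈⟨ e-bits n 0 m g ≤-refl G ⟩
    sg m * es n 0 m g u ∎

  module Eigenvector (x : ℕ → Carrier) (f : Fn) (eig : ∀ {k : ℕ} → In n k → op k f ≐ (λ u → x k * f u)) where

    open Substitution A x

    pow-eigen : ∀ {k} a → In n k → pow k a f ≐ (λ u → pw k a * f u)
    pow-eigen zero Ik G = ≈-sym (*-identityˡ _)
    pow-eigen (suc a) Ik G = ≈-trans (Linear-op Ik .congᴸ (pow-eigen a Ik) G) (≈-trans (Linear-op Ik .scaleᴸ _ f G)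
      (≈-trans (*-congˡ (eig Ik G)) (solve 3 (λ x y z → x :* (y :* z) := (y :* x) :* z) ≈-refl _ _ _)))

    actM-eigen : ∀ {r o} (α : Vec ℕ r) → o ℕ.+ r ≤ n → actM o α f ≐ (λ u → monomial o α * f u)
    actM-eigen [] le G = ≈-sym (*-identityˡ _)
    actM-eigen (a ∷ α) le G = ≈-trans (Linear-pow a Ik .congᴸ (actM-eigen α (proj₂ (In-suc le))) G)
      (≈-trans (Linear-pow a Ik .scaleᴸ _ f G) (≈-trans (*-congˡ (pow-eigen a Ik G))
        (solve 3 (λ x y z → x :* (y :* z) := (y :* x) :* z) ≈-refl _ _ _)))
      where Ik = proj₁ (In-suc le)

    act-eigen : ∀ p → act p f ≐ (λ u → eval p * f u)
    act-eigen p {u} G = ≈-trans (Σ-cong p (λ {t} _ → ≈-trans (*-congˡ (actM-eigen (proj₂ t) ≤-refl G))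
        (solve 3 (λ x y z → x :* (y :* z) := z :* (x :* y)) ≈-refl _ _ _)))
      (≈-trans (≈-sym (Σ-* (f u) p _)) (*-comm _ _))

-- Exponent vectors and the cases of the divided difference of a monomial

if-T : ∀ {X : Set} b {x y : X} → T b → (if b then x else y) ≡ x
if-T true _ = refl

if-¬T : ∀ {X : Set} b {x y : X} → ¬ T b → (if b then x else y) ≡ y
if-¬T true h = ⊥-elim (h tt)
if-¬T false _ = refl

ent-zipWith-+ : ∀ {n} (α β : Vec ℕ n) p → ent (zipWith ℕ._+_ α β) p ≡ ent α p ℕ.+ ent β p
ent-zipWith-+ [] [] p = refl
ent-zipWith-+ (a ∷ α) (b ∷ β) zero = refl
ent-zipWith-+ (a ∷ α) (b ∷ β) (suc zero) = refl
ent-zipWith-+ (a ∷ α) (b ∷ β) (suc (suc p)) = ent-zipWith-+ α β (suc p)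

single : ∀ {n} → ℕ → ℕ → Vec ℕ n
single k a = tabulate (λ p → if pos p ≡ᵇ k then a else 0)

ent-single-at : ∀ {n} k a → In n k → ent (single {n} k a) k ≡ a
ent-single-at k a Ik = trans (ent-tabulate (λ p → if p ≡ᵇ k then a else 0) k Ik)
  (if-T (k ≡ᵇ k) (≡⇒≡ᵇ k k refl))

ent-single-off : ∀ {n} k a {p} → In n p → p ≢ k → ent (single {n} k a) p ≡ 0
ent-single-off k a {p} Ip ne = trans (ent-tabulate (λ p → if p ≡ᵇ k then a else 0) p Ip)
  (if-¬T (p ≡ᵇ k) (ne ∘ ≡ᵇ⇒≡ p k))

module _ {n : ℕ} (α : Vec ℕ n) (i x y : ℕ) where
  private
    body : ℕ → ℕ
    body p = if p ≡ᵇ i then x else if p ≡ᵇ suc i then y else ent α p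

  ent-set2-i : In n i → ent (set2 α i x y) i ≡ x
  ent-set2-i Ii = trans (ent-tabulate body i Ii) (if-T (i ≡ᵇ i) (≡⇒≡ᵇ i i refl))

  ent-set2-si : In n (suc i) → ent (set2 α i x y) (suc i) ≡ y
  ent-set2-si Ii = trans (ent-tabulate body (suc i) Ii) (trans
    (if-¬T (suc i ≡ᵇ i) (λ t → <⇒≢ (n<1+n i) (sym (≡ᵇ⇒≡ (suc i) i t))))
    (if-T (i ≡ᵇ i) (≡⇒≡ᵇ i i refl)))

  ent-set2-off : ∀ {p} → In n p → p ≢ i → p ≢ suc i → ent (set2 α i x y) p ≡ ent α p
  ent-set2-off {p} Ip a b = trans (ent-tabulate body p Ip) (trans
    (if-¬T (p ≡ᵇ i) (a ∘ ≡ᵇ⇒≡ p i)) (if-¬T (p ≡ᵇ suc i) (b ∘ ≡ᵇ⇒≡ p (suc i))))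

module _ {n : ℕ} {i : ℕ} (Ii : In n i) (Ii′ : In n (suc i)) where
  private
    si≢i : suc i ≢ i
    si≢i e = <⇒≢ (n<1+n i) (sym e)

    byPos : ∀ {α β : Vec ℕ n} → ent α i ≡ ent β i → ent α (suc i) ≡ ent β (suc i) →
      (∀ {p} → In n p → p ≢ i → p ≢ suc i → ent α p ≡ ent β p) → α ≡ β
    byPos {α} {β} e e′ h = ent-ext λ p Ip → go p Ip (p ≟ i) (p ≟ suc i)
      where
      go : ∀ p → In n p → Dec (p ≡ i) → Dec (p ≡ suc i) → ent α p ≡ ent β p
      go p Ip (yes refl) _ = e
      go p Ip (no a) (yes refl) = e′
      go p Ip (no a) (no b) = h Ip a b

  -- Separates the powers of x_i and x_{i+1} from a factor free of both. That factor commutes with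
  -- `d i`, so the Leibniz rule is only needed for two variables.
  set2-split : ∀ α x y → set2 α i x y ≡ zipWith ℕ._+_ (set2 α i 0 0) (zipWith ℕ._+_ (single i x) (single (suc i) y))
  set2-split α x y = byPos
    (trans (ent-set2-i α i x y Ii) (sym (trans (sum i) (trans (cong₂ ℕ._+_ (ent-set2-i α i 0 0 Ii)
      (cong₂ ℕ._+_ (ent-single-at i x Ii) (ent-single-off (suc i) y Ii (si≢i ∘ sym)))) (ℕP.+-identityʳ x)))))
    (trans (ent-set2-si α i x y Ii′) (sym (trans (sum (suc i)) (cong₂ ℕ._+_ (ent-set2-si α i 0 0 Ii′)
      (cong₂ ℕ._+_ (ent-single-off i x Ii′ si≢i) (ent-single-at (suc i) y Ii′))))))
    (λ {p} Ip a b → trans (ent-set2-off α i x y Ip a b) (sym (trans (sum p) (trans (cong₂ ℕ._+_ (ent-set2-off α i 0 0 Ip a b)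
      (cong₂ ℕ._+_ (ent-single-off i x Ip a) (ent-single-off (suc i) y Ip b))) (ℕP.+-identityʳ _)))))
    where
    sum : ∀ p → ent {n} (zipWith ℕ._+_ (set2 α i 0 0) (zipWith ℕ._+_ (single i x) (single (suc i) y))) p ≡
      ent (set2 α i 0 0) p ℕ.+ (ent (single {n} i x) p ℕ.+ ent (single {n} (suc i) y) p)
    sum p = trans (ent-zipWith-+ (set2 α i 0 0) _ p) (cong (ent (set2 α i 0 0) p ℕ.+_) (ent-zipWith-+ {n} (single i x) (single (suc i) y) p))

  set2-self : ∀ α → set2 α i (ent α i) (ent α (suc i)) ≡ α
  set2-self α = byPos (ent-set2-i α i _ _ Ii) (ent-set2-si α i _ _ Ii′) (λ Ip a b → ent-set2-off α i _ _ Ip a b)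

  set2-set2 : ∀ α x y x′ y′ → set2 (set2 α i x y) i x′ y′ ≡ set2 α i x′ y′
  set2-set2 α x y x′ y′ = byPos
    (trans (ent-set2-i (set2 α i x y) i x′ y′ Ii) (sym (ent-set2-i α i x′ y′ Ii)))
    (trans (ent-set2-si (set2 α i x y) i x′ y′ Ii′) (sym (ent-set2-si α i x′ y′ Ii′)))
    (λ Ip a b → trans (ent-set2-off (set2 α i x y) i x′ y′ Ip a b) (trans (ent-set2-off α i x y Ip a b) (sym (ent-set2-off α i x′ y′ Ip a b))))

swapExp : ∀ {n} → ℕ → Mono n → Mono n
swapExp i α = set2 α i (ent α (suc i)) (ent α i)

module _ {n : ℕ} (i : ℕ) (c : ℤ) (α : Mono n) where
  private
    a = ent α i
    b = ent α (suc i)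

  ∂term-> : b < a → ∂term i (c , α) ≡ map (λ t → (c , set2 α i (a ∸ 1 ∸ t) (b ℕ.+ t))) (upTo (a ∸ b))
  ∂term-> lt rewrite T⇒≡ (<⇒<ᵇ lt) = refl

  ∂term-< : a < b → ∂term i (c , α) ≡ map (λ t → (ℤ.- c , set2 α i (b ∸ 1 ∸ t) (a ℕ.+ t))) (upTo (b ∸ a))
  ∂term-< lt rewrite ¬T⇒≡ (λ t → <-asym lt (<ᵇ⇒< b a t)) | T⇒≡ (<⇒<ᵇ lt) = refl

  ∂term-≡ : a ≡ b → ∂term i (c , α) ≡ []
  ∂term-≡ e rewrite e | ¬T⇒≡ (λ t → <-irrefl refl (<ᵇ⇒< b b t)) = refl

-- The Leibniz rule for powers of two adjacent variables

module HeckeAction (A : RingOverℤ) (n : ℕ) where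
  open Sums A
  open LinearForms A
  open Operators A n
  open Hecke A n
  open Action A n M Linear-M M-comm public

  d-M-off : ∀ {i k} g → Adj i → In n k → k ≢ i → k ≢ suc i → d i (M k g) ≐ M k (d i g)
  d-M-off {i} {k} g Ai Ik a b {u} G = ≈-sym (≈-trans (M-d g G Ai Ik) (≈-trans
    (+-cong (≈-reflexive (cong (λ z → d i (M z g) u) (transpᵒ i (suc i) k a b)))
            (≈-trans (*-congʳ (≈-reflexive (∂xᵒ i k a b))) (zeroˡ _)))
    (+-identityʳ _)))

  M-d-i : ∀ {i} g → Adj i → M i (d i g) ≐ (λ u → d i (M (suc i) g) u + g u)
  M-d-i {i} g Ai {u} G = ≈-trans (M-d g G Ai (proj₁ Ai)) (+-cong
    (≈-reflexive (cong (λ z → d i (M z g) u) (transpˡ i (suc i)))) (≈-trans (*-congʳ (≈-reflexive (∂xˡ i))) (*-identityˡ _)))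

  M-d-si : ∀ {i} g → Adj i → M (suc i) (d i g) ≐ (λ u → d i (M i g) u - g u)
  M-d-si {i} g Ai {u} G = ≈-trans (M-d g G Ai (proj₂ Ai)) (+-cong
    (≈-reflexive (cong (λ z → d i (M z g) u) (transpʳ i (suc i)))) (≈-trans (*-congʳ (≈-reflexive (∂xʳ i)))
      (≈-trans (solve 2 (λ a b → (:- a) :* b := :- (a :* b)) ≈-refl _ _) (-‿cong (*-identityˡ _)))))

  module _ {i : ℕ} (Ai : Adj i) where
    private
      Ii = proj₁ Ai
      Ii′ = proj₂ Ai
      x = M i
      y = M (suc i)
      X Y : ℕ → Fn → Fn
      X = pow i
      Y = pow (suc i)
      Lx = Linear-M Ii
      Ly = Linear-M Ii′
      LX : ∀ a → Linear (X a)
      LX a = Linear-pow a Ii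
      LY : ∀ a → Linear (Y a)
      LY a = Linear-pow a Ii′
      Ld = Linear-d Ai
      Q : ℕ → Fn → ℕ → Fn
      Q c g t = X (c ∸ 1 ∸ t) (Y t g)

    -- The rule for x_i applied c times. The correction is ∂_i(x_i^c) = h_{c-1}(x_i, x_{i+1}); each
    -- further application multiplies the old terms by x_i and adds x_{i+1}^c.
    pow-d : ∀ c g → X c (d i g) ≐ (λ u → d i (Y c g) u + Σl (upTo c) (λ t → Q c g t u))
    pow-d zero g G = ≈-sym (+-identityʳ _)
    pow-d (suc c) g {u} G = begin
      x (X c (d i g)) u ≈⟨ Lx .congᴸ (pow-d c g) G ⟩
      x (λ u → d i (Y c g) u + Σl (upTo c) (λ t → Q c g t u)) u
        ≈⟨ ≈-trans (Lx .addᴸ _ _ G) (+-cong (M-d-i (Y c g) Ai G) (sumᴸ Lx (upTo c) (Q c g) G)) ⟩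
      (d i (Y (suc c) g) u + Y c g u) + Σl (upTo c) (λ t → x (Q c g t) u) ≈⟨ +-assoc _ _ _ ⟩
      d i (Y (suc c) g) u + (Y c g u + Σl (upTo c) (λ t → x (Q c g t) u))
        ≈⟨ +-congˡ (≈-trans (+-comm _ _) (+-cong (Σ-cong (upTo c) shift) last)) ⟩
      d i (Y (suc c) g) u + (Σl (upTo c) (λ t → Q (suc c) g t u) + Σl (c ∷ []) (λ t → Q (suc c) g t u))
        ≈⟨ +-congˡ (≈-trans (≈-sym (Σ-++ (upTo c) (c ∷ []) _)) (≈-reflexive (cong (λ l → Σl l (λ t → Q (suc c) g t u)) (upTo-∷ʳ c)))) ⟩
      d i (Y (suc c) g) u + Σl (upTo (suc c)) (λ t → Q (suc c) g t u) ∎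
      where
      shift : ∀ {t} → t ∈ upTo c → x (Q c g t) u ≈ Q (suc c) g t u
      shift {t} m = ≈-reflexive (cong (λ z → X z (Y t g) u) (suc-pred c t (∈-upTo⁻ m)))
        where
        suc-pred : ∀ c t → t < c → suc (c ∸ 1 ∸ t) ≡ c ∸ t
        suc-pred (suc c) t (s≤s t≤c) = sym (ℕP.+-∸-assoc 1 t≤c)
      last : Y c g u ≈ Q (suc c) g c u + 0#
      last = ≈-trans (≈-reflexive (cong (λ z → X z (Y c g) u) (sym (ℕP.n∸n≡0 c)))) (≈-sym (+-identityʳ _))

    pow-d′ : ∀ c g → Y c (d i g) ≐ (λ u → d i (X c g) u - Σl (upTo c) (λ t → Q c g t u))
    pow-d′ zero g G = ≈-sym (x-0≈x _)
    pow-d′ (suc c) g {u} G = begin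
      y (Y c (d i g)) u ≈⟨ Ly .congᴸ (pow-d′ c g) G ⟩
      y (λ u → d i (X c g) u - Σl (upTo c) (λ t → Q c g t u)) u
        ≈⟨ ≈-trans (minusᴸ Ly (d i (X c g)) _ G) (+-cong (M-d-si (X c g) Ai G) (-‿cong (sumᴸ Ly (upTo c) (Q c g) G))) ⟩
      (d i (X (suc c) g) u - X c g u) - Σl (upTo c) (λ t → y (Q c g t) u)
        ≈⟨ solve 3 (λ a b c → (a :- b) :- c := a :- (b :+ c)) ≈-refl _ _ _ ⟩
      d i (X (suc c) g) u - (X c g u + Σl (upTo c) (λ t → y (Q c g t) u))
        ≈⟨ +-congˡ (-‿cong (+-congˡ (≈-trans (Σ-cong (upTo c) (λ {t} _ → shift t))
             (≈-trans (≈-sym (Σ-map suc (upTo c) _)) (≈-reflexive (cong (λ l → Σl l (λ t → Q (suc c) g t u)) (map-upTo suc c))))))) ⟩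
      d i (X (suc c) g) u - Σl (upTo (suc c)) (λ t → Q (suc c) g t u) ∎
      where
      shift : ∀ t → y (Q c g t) u ≈ Q (suc c) g (suc t) u
      shift t = ≈-trans (pow-commutes {y} (c ∸ 1 ∸ t) _ (op-commutes Ii′) Ii G)
        (≈-reflexive (cong (λ z → X z (Y (suc t) g) u) (ℕP.∸-+-assoc c 1 t)))

    -- The product x_i x_{i+1} is symmetric: the corrections for its two factors are opposite and
    -- cancel. Commutation of the Monk operators then restores the order of the factors.
    xy-d : ∀ g → x (y (d i g)) ≐ d i (x (y g))
    xy-d g {u} G = begin
      x (y (d i g)) u ≈⟨ Lx .congᴸ (M-d-si g Ai) G ⟩
      x (λ u → d i (x g) u - g u) u ≈⟨ minusᴸ Lx (d i (x g)) g G ⟩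
      x (d i (x g)) u - x g u ≈⟨ +-congʳ (M-d-i (x g) Ai G) ⟩
      (d i (y (x g)) u + x g u) - x g u
        ≈⟨ solve 2 (λ a b → (a :+ b) :- b := a) ≈-refl _ _ ⟩
      d i (y (x g)) u ≈⟨ Ld .congᴸ (M-comm g Ii′ Ii) G ⟩
      d i (x (y g)) u ∎

    XY-suc : ∀ b g → X (suc b) (Y (suc b) g) ≐ x (y (X b (Y b g)))
    XY-suc b g {u} G = Lx .congᴸ (λ H → ≈-sym (pow-commutes {y} b (Y b g) (op-commutes Ii′) Ii H)) G

    XY-d : ∀ b g → X b (Y b (d i g)) ≐ d i (X b (Y b g))
    XY-d zero g G = ≈-refl
    XY-d (suc b) g {u} G = begin
      X (suc b) (Y (suc b) (d i g)) u ≈⟨ XY-suc b (d i g) G ⟩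
      x (y (X b (Y b (d i g)))) u ≈⟨ Linear-∘ Lx Ly .congᴸ (XY-d b g) G ⟩
      x (y (d i (X b (Y b g)))) u ≈⟨ xy-d (X b (Y b g)) G ⟩
      d i (x (y (X b (Y b g)))) u ≈⟨ Ld .congᴸ (XY-suc b g) G ⟨
      d i (X (suc b) (Y (suc b) g)) u ∎

    YX : ∀ a b g → Y a (X b g) ≐ X b (Y a g)
    YX a b g = pow-commutes {Y a} b g (Commutes-pow a Ii′) Ii

    -- The symmetric factor (x_i x_{i+1})^b passes through `d i`, and `pow-d` treats the remaining
    -- x_i^c. The larger exponent is written b + c so that this factorisation is literal; the
    -- exponents in the sum are those of `∂term`.
    mono-d-≥ : ∀ b c g → X (b ℕ.+ c) (Y b (d i g)) ≐
      (λ u → d i (X b (Y (b ℕ.+ c) g)) u + Σl (upTo c) (λ t → X (b ℕ.+ c ∸ 1 ∸ t) (Y (b ℕ.+ t) g) u))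
    mono-d-≥ b c g {u} G = begin
      X (b ℕ.+ c) (Y b (d i g)) u ≡⟨ cong (λ z → X z (Y b (d i g)) u) (ℕP.+-comm b c) ⟩
      X (c ℕ.+ b) (Y b (d i g)) u ≡⟨ cong-app (pow-+ c b (Y b (d i g))) u ⟩
      X c (X b (Y b (d i g))) u ≈⟨ LX c .congᴸ (XY-d b g) G ⟩
      X c (d i (X b (Y b g))) u ≈⟨ pow-d c (X b (Y b g)) G ⟩
      d i (Y c (X b (Y b g))) u + Σl (upTo c) (λ t → X (c ∸ 1 ∸ t) (Y t (X b (Y b g))) u)
        ≈⟨ +-cong (Ld .congᴸ (λ H → regroup c H) G) (Σ-cong (upTo c) (λ {t} m → term t (∈-upTo⁻ m))) ⟩
      d i (X b (Y (b ℕ.+ c) g)) u + Σl (upTo c) (λ t → X (b ℕ.+ c ∸ 1 ∸ t) (Y (b ℕ.+ t) g) u) ∎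
      where
      regroup : ∀ t → Y t (X b (Y b g)) ≐ X b (Y (b ℕ.+ t) g)
      regroup t {v} H = ≈-trans (YX t b (Y b g) H) (≈-trans (LX b .congᴸ (λ {w} _ → ≈-reflexive (cong-app (sym (pow-+ t b g)) w)) H)
        (≈-reflexive (cong (λ z → X b (Y z g) v) (ℕP.+-comm t b))))
      term : ∀ t → t < c → X (c ∸ 1 ∸ t) (Y t (X b (Y b g))) u ≈ X (b ℕ.+ c ∸ 1 ∸ t) (Y (b ℕ.+ t) g) u
      term t t<c = ≈-trans (LX (c ∸ 1 ∸ t) .congᴸ (regroup t) G) (≈-trans
        (≈-reflexive (cong-app (sym (pow-+ (c ∸ 1 ∸ t) b (Y (b ℕ.+ t) g))) u))
        (≈-reflexive (cong (λ z → X z (Y (b ℕ.+ t) g) u) (arith c t<c))))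
        where
        arith : ∀ c → t < c → c ∸ 1 ∸ t ℕ.+ b ≡ b ℕ.+ c ∸ 1 ∸ t
        arith (suc c) (s≤s t≤c) rewrite ℕP.+-suc b c = trans (ℕP.+-comm (c ∸ t) b) (sym (ℕP.+-∸-assoc b t≤c))

    mono-d-≤ : ∀ a c g → X a (Y (a ℕ.+ c) (d i g)) ≐
      (λ u → d i (X (a ℕ.+ c) (Y a g)) u - Σl (upTo c) (λ t → X (a ℕ.+ c ∸ 1 ∸ t) (Y (a ℕ.+ t) g) u))
    mono-d-≤ a c g {u} G = begin
      X a (Y (a ℕ.+ c) (d i g)) u
        ≈⟨ LX a .congᴸ (λ {v} _ → ≈-reflexive (cong-app (trans (cong (λ z → Y z (d i g)) (ℕP.+-comm a c)) (pow-+ c a (d i g))) v)) G ⟩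
      X a (Y c (Y a (d i g))) u ≈⟨ YX c a (Y a (d i g)) G ⟨
      Y c (X a (Y a (d i g))) u ≈⟨ LY c .congᴸ (XY-d a g) G ⟩
      Y c (d i (X a (Y a g))) u ≈⟨ pow-d′ c (X a (Y a g)) G ⟩
      d i (X c (X a (Y a g))) u - Σl (upTo c) (λ t → X (c ∸ 1 ∸ t) (Y t (X a (Y a g))) u)
        ≈⟨ +-cong (Ld .congᴸ (λ {v} _ → ≈-reflexive (cong-app (trans (sym (pow-+ c a (Y a g))) (cong (λ z → X z (Y a g)) (ℕP.+-comm c a))) v)) G)
                  (-‿cong (Σ-cong (upTo c) (λ {t} m → term t (∈-upTo⁻ m)))) ⟩
      d i (X (a ℕ.+ c) (Y a g)) u - Σl (upTo c) (λ t → X (a ℕ.+ c ∸ 1 ∸ t) (Y (a ℕ.+ t) g) u) ∎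
      where
      regroup : ∀ t → Y t (X a (Y a g)) ≐ X a (Y (a ℕ.+ t) g)
      regroup t {v} H = ≈-trans (YX t a (Y a g) H) (≈-trans (LX a .congᴸ (λ {w} _ → ≈-reflexive (cong-app (sym (pow-+ t a g)) w)) H)
        (≈-reflexive (cong (λ z → X a (Y z g) v) (ℕP.+-comm t a))))
      term : ∀ t → t < c → X (c ∸ 1 ∸ t) (Y t (X a (Y a g))) u ≈ X (a ℕ.+ c ∸ 1 ∸ t) (Y (a ℕ.+ t) g) u
      term t t<c = ≈-trans (LX (c ∸ 1 ∸ t) .congᴸ (regroup t) G) (≈-trans
        (≈-reflexive (cong-app (sym (pow-+ (c ∸ 1 ∸ t) a (Y (a ℕ.+ t) g))) u))
        (≈-reflexive (cong (λ z → X z (Y (a ℕ.+ t) g) u) (arith c t<c))))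
        where
        arith : ∀ c → t < c → c ∸ 1 ∸ t ℕ.+ a ≡ a ℕ.+ c ∸ 1 ∸ t
        arith (suc c) (s≤s t≤c) rewrite ℕP.+-suc a c = trans (ℕP.+-comm (c ∸ t) a) (sym (ℕP.+-∸-assoc a t≤c))

-- The Leibniz rule for polynomials

module NilHecke (A : RingOverℤ) (n : ℕ) where
  open Sums A
  open LinearForms A
  open Operators A n
  open Hecke A n
  open HeckeAction A n

  actM-zero : ∀ {r o} (α : Vec ℕ r) g → (∀ {p} → In r p → ent α p ≡ 0) → actM o α g ≡ g
  actM-zero [] g h = refl
  actM-zero {o = o} (a ∷ α) g h = trans (cong (λ z → pow (suc o) z (actM (suc o) α g)) (h (s≤s z≤n , s≤s z≤n)))
    (actM-zero α g (λ { {suc p} (_ , le) → h {suc (suc p)} (s≤s z≤n , s≤s le) }))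

  actM-single : ∀ {r o} (α : Vec ℕ r) j g → In r j → (∀ {p} → In r p → p ≢ j → ent α p ≡ 0) →
    actM o α g ≡ pow (o ℕ.+ j) (ent α j) g
  actM-single {o = o} (a ∷ α) (suc zero) g _ h =
    trans (cong (pow (suc o) a) (actM-zero α g (λ { {suc p} (_ , le) → h {suc (suc p)} (s≤s z≤n , s≤s le) (λ ()) })))
      (cong (λ z → pow z a g) (ℕP.+-comm 1 o))
  actM-single {o = o} (a ∷ α) (suc (suc j)) g (_ , s≤s le) h =
    trans (cong (λ z → pow (suc o) z (actM (suc o) α g)) (h {1} (s≤s z≤n , s≤s z≤n) (λ ())))
      (trans (actM-single α (suc j) g (s≤s z≤n , le) (λ { {suc p} (_ , le′) ne → h {suc (suc p)} (s≤s z≤n , s≤s le′) (λ e → ne (suc-injective e)) }))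
        (cong (λ z → pow z (ent α (suc j)) g) (sym (ℕP.+-suc o (suc j)))))

  actM-cong : ∀ {α β} g {u} → α ≡ β → actM {n} 0 α g u ≈ actM 0 β g u
  actM-cong g {u} e = ≈-reflexive (cong (λ z → actM 0 z g u) e)

  module _ {i : ℕ} (Ai : Adj i) where
    private
      Ii = proj₁ Ai
      Ii′ = proj₂ Ai

    actM-d-off : ∀ {r o} (β : Vec ℕ r) g → o ℕ.+ r ≤ n → (∀ {p} → In r p → o ℕ.+ p ≡ i ⊎ o ℕ.+ p ≡ suc i → ent β p ≡ 0) →
      d i (actM o β g) ≐ actM o β (d i g)
    actM-d-off [] g le h G = ≈-refl
    actM-d-off {r = suc r} {o} (b ∷ β) g le h {u} G = ≈-trans (head b refl)
        (Linear-pow b (proj₁ (In-suc le)) .congᴸ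
          (actM-d-off β g (proj₂ (In-suc le)) (λ { {suc p} (_ , q) e → h {suc (suc p)} (s≤s z≤n , s≤s q) (shift e) })) G)
      where
      shift : ∀ {p} → suc o ℕ.+ p ≡ i ⊎ suc o ℕ.+ p ≡ suc i → o ℕ.+ suc p ≡ i ⊎ o ℕ.+ suc p ≡ suc i
      shift {p} (inj₁ e) = inj₁ (trans (ℕP.+-suc o p) e)
      shift {p} (inj₂ e) = inj₂ (trans (ℕP.+-suc o p) e)
      f = actM (suc o) β g
      pow-off : ∀ a → suc o ≢ i → suc o ≢ suc i → d i (pow (suc o) a f) ≐ pow (suc o) a (d i f)
      pow-off zero p q G = ≈-refl
      pow-off (suc a) p q G = ≈-trans (d-M-off _ Ai (proj₁ (In-suc le)) p q G) (Linear-M (proj₁ (In-suc le)) .congᴸ (pow-off a p q) G)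
      head : ∀ b′ → b ≡ b′ → d i (pow (suc o) b f) u ≈ pow (suc o) b (d i f) u
      head zero refl = ≈-refl
      head (suc b′) refl = pow-off b
        (λ e → nz (h {1} (s≤s z≤n , s≤s z≤n) (inj₁ (trans (ℕP.+-comm o 1) e))))
        (λ e → nz (h {1} (s≤s z≤n , s≤s z≤n) (inj₂ (trans (ℕP.+-comm o 1) e)))) G
        where
        nz : suc b′ ≢ 0
        nz ()

    actM-set2 : ∀ α x y g → actM 0 (set2 α i x y) g ≐ actM 0 (set2 α i 0 0) (pow i x (pow (suc i) y g))
    actM-set2 α x y g {u} G = begin
      actM 0 (set2 α i x y) g u ≈⟨ actM-cong g (set2-split Ii Ii′ α x y) ⟩
      actM 0 (zipWith ℕ._+_ (set2 α i 0 0) (zipWith ℕ._+_ (single i x) (single (suc i) y))) g u ≈⟨ actM-+ (set2 α i 0 0) _ g ≤-refl G ⟩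
      actM 0 (set2 α i 0 0) (actM {n} 0 (zipWith ℕ._+_ (single i x) (single (suc i) y)) g) u
        ≈⟨ Linear-actM (set2 α i 0 0) ≤-refl .congᴸ (λ {v} H → ≈-trans (actM-+ {n} {0} (single i x) (single (suc i) y) g ≤-refl H)
             (≈-reflexive (cong-app (trans (one i x Ii _) (cong (pow i x) (one (suc i) y Ii′ g))) v))) G ⟩
      actM 0 (set2 α i 0 0) (pow i x (pow (suc i) y g)) u ∎
      where
      one : ∀ k x → In n k → ∀ g → actM {n} 0 (single k x) g ≡ pow k x g
      one k x Ik g = trans (actM-single (single k x) k g Ik (λ Ip ne → ent-single-off k x Ip ne)) (cong (λ z → pow k z g) (ent-single-at k x Ik))

    module _ (α : Mono n) (g : Fn) where
      private
        α₀ = set2 α i 0 0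
        L₀ = Linear-actM {n} {0} α₀ ≤-refl
        a = ent α i
        b = ent α (suc i)
        Ld = Linear-d Ai

        d-α₀ : ∀ f → d i (actM 0 α₀ f) ≐ actM 0 α₀ (d i f)
        d-α₀ f = actM-d-off α₀ f ≤-refl (λ { _ (inj₁ refl) → ent-set2-i α i 0 0 Ii ; _ (inj₂ refl) → ent-set2-si α i 0 0 Ii′ })

        split-off : actM 0 α (d i g) ≐ actM 0 α₀ (pow i a (pow (suc i) b (d i g)))
        split-off G = ≈-trans (actM-cong (d i g) (sym (set2-self Ii Ii′ α))) (actM-set2 α a b (d i g) G)

        swapped : d i (actM 0 (swapExp i α) g) ≐ actM 0 α₀ (d i (pow i b (pow (suc i) a g)))
        swapped G = ≈-trans (Ld .congᴸ (actM-set2 α b a g) G) (d-α₀ _ G)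

      actM-d-> : b < a → actM 0 α (d i g) ≐ (λ u → d i (actM 0 (swapExp i α) g) u +
        Σl (upTo (a ∸ b)) (λ t → actM 0 (set2 α i (a ∸ 1 ∸ t) (b ℕ.+ t)) g u))
      actM-d-> lt {u} G = begin
        actM 0 α (d i g) u ≈⟨ split-off G ⟩
        actM 0 α₀ (pow i a (pow (suc i) b (d i g))) u ≈⟨ L₀ .congᴸ step G ⟩
        actM 0 α₀ (λ u → d i (pow i b (pow (suc i) a g)) u + Σl (upTo (a ∸ b)) (λ t → pow i (a ∸ 1 ∸ t) (pow (suc i) (b ℕ.+ t) g) u)) u
          ≈⟨ ≈-trans (L₀ .addᴸ _ _ G) (+-cong (≈-sym (swapped G)) (≈-trans (sumᴸ L₀ (upTo (a ∸ b)) _ G)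
               (Σ-cong (upTo (a ∸ b)) (λ {t} _ → ≈-sym (actM-set2 α (a ∸ 1 ∸ t) (b ℕ.+ t) g G))))) ⟩
        d i (actM 0 (swapExp i α) g) u + Σl (upTo (a ∸ b)) (λ t → actM 0 (set2 α i (a ∸ 1 ∸ t) (b ℕ.+ t)) g u) ∎
        where
        step : pow i a (pow (suc i) b (d i g)) ≐ (λ u → d i (pow i b (pow (suc i) a g)) u +
          Σl (upTo (a ∸ b)) (λ t → pow i (a ∸ 1 ∸ t) (pow (suc i) (b ℕ.+ t) g) u))
        step {v} H = subst (λ z → pow i z (pow (suc i) b (d i g)) v ≈ d i (pow i b (pow (suc i) z g)) v +
          Σl (upTo (a ∸ b)) (λ t → pow i (z ∸ 1 ∸ t) (pow (suc i) (b ℕ.+ t) g) v)) (ℕP.m+[n∸m]≡n (<⇒≤ lt)) (mono-d-≥ Ai b (a ∸ b) g H)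

      actM-d-≤ : a ≤ b → actM 0 α (d i g) ≐ (λ u → d i (actM 0 (swapExp i α) g) u -
        Σl (upTo (b ∸ a)) (λ t → actM 0 (set2 α i (b ∸ 1 ∸ t) (a ℕ.+ t)) g u))
      actM-d-≤ le {u} G = begin
        actM 0 α (d i g) u ≈⟨ split-off G ⟩
        actM 0 α₀ (pow i a (pow (suc i) b (d i g))) u ≈⟨ L₀ .congᴸ step G ⟩
        actM 0 α₀ (λ u → d i (pow i b (pow (suc i) a g)) u - Σl (upTo (b ∸ a)) (λ t → pow i (b ∸ 1 ∸ t) (pow (suc i) (a ℕ.+ t) g) u)) u
          ≈⟨ ≈-trans (minusᴸ L₀ (d i (pow i b (pow (suc i) a g))) _ G) (+-cong (≈-sym (swapped G)) (-‿cong (≈-trans (sumᴸ L₀ (upTo (b ∸ a)) _ G)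
               (Σ-cong (upTo (b ∸ a)) (λ {t} _ → ≈-sym (actM-set2 α (b ∸ 1 ∸ t) (a ℕ.+ t) g G)))))) ⟩
        d i (actM 0 (swapExp i α) g) u - Σl (upTo (b ∸ a)) (λ t → actM 0 (set2 α i (b ∸ 1 ∸ t) (a ℕ.+ t)) g u) ∎
        where
        step : pow i a (pow (suc i) b (d i g)) ≐ (λ u → d i (pow i b (pow (suc i) a g)) u -
          Σl (upTo (b ∸ a)) (λ t → pow i (b ∸ 1 ∸ t) (pow (suc i) (a ℕ.+ t) g) u))
        step {v} H = subst (λ z → pow i a (pow (suc i) z (d i g)) v ≈ d i (pow i z (pow (suc i) a g)) v -
          Σl (upTo (b ∸ a)) (λ t → pow i (z ∸ 1 ∸ t) (pow (suc i) (a ℕ.+ t) g) v)) (ℕP.m+[n∸m]≡n le) (mono-d-≤ Ai a (b ∸ a) g H)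

    ∂-sum : ∀ c (ts : List ℕ) (m : ℕ → Mono n) g {u} →
      act (map (λ t → (c , m t)) ts) g u ≈ ι c * Σl ts (λ t → actM 0 (m t) g u)
    ∂-sum c ts m g = ≈-trans (Σ-map {X = ℤ × Mono n} (λ t → (c , m t)) ts _) (≈-sym (Σ-* (ι c) ts _))

    Σ> Σ< : Mono n → Fn → Vec ℕ n → Carrier
    Σ> α g u = Σl (upTo (ent α i ∸ ent α (suc i))) (λ t → actM 0 (set2 α i (ent α i ∸ 1 ∸ t) (ent α (suc i) ℕ.+ t)) g u)
    Σ< α g u = Σl (upTo (ent α (suc i) ∸ ent α i)) (λ t → actM 0 (set2 α i (ent α (suc i) ∸ 1 ∸ t) (ent α i ℕ.+ t)) g u)

    act-∂term-> : ∀ c α g {u} → ent α (suc i) < ent α i → act (∂term i (c , α)) g u ≈ ι c * Σ> α g u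
    act-∂term-> c α g {u} gt = ≈-trans (≈-reflexive (cong (λ p → act p g u) (∂term-> i c α gt)))
      (∂-sum c (upTo (ent α i ∸ ent α (suc i))) (λ t → set2 α i (ent α i ∸ 1 ∸ t) (ent α (suc i) ℕ.+ t)) g)

    act-∂term-< : ∀ c α g {u} → ent α i < ent α (suc i) → act (∂term i (c , α)) g u ≈ (- ι c) * Σ< α g u
    act-∂term-< c α g {u} lt = ≈-trans (≈-reflexive (cong (λ p → act p g u) (∂term-< i c α lt)))
      (≈-trans (∂-sum (ℤ.- c) (upTo (ent α (suc i) ∸ ent α i)) (λ t → set2 α i (ent α (suc i) ∸ 1 ∸ t) (ent α i ℕ.+ t)) g)
        (*-congʳ (ι-neg c)))

    term-d : ∀ c α g {u} → Good u →
      ι c * actM 0 α (d i g) u ≈ ι c * d i (actM 0 (swapExp i α) g) u + act (∂term i (c , α)) g u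
    term-d c α g {u} G with <-cmp (ent α i) (ent α (suc i))
    ... | tri> _ _ gt = ≈-trans (*-congˡ (actM-d-> α g gt G)) (≈-trans (distribˡ _ _ _) (+-congˡ (≈-sym (act-∂term-> c α g gt))))
    ... | tri< lt _ _ = ≈-trans (*-congˡ (actM-d-≤ α g (<⇒≤ lt) G)) (≈-trans (distribˡ _ _ _) (+-congˡ (≈-sym
        (≈-trans (act-∂term-< c α g lt)
          (solve 2 (λ a b → (:- a) :* b := a :* (:- b)) ≈-refl _ _)))))
    ... | tri≈ _ e _ = ≈-trans (*-congˡ (≈-trans (actM-d-≤ α g (ℕP.≤-reflexive e) G)
          (≈-trans (+-congˡ (-‿cong (≈-reflexive (cong (λ z → Σl (upTo z) (λ t → actM 0 (set2 α i (ent α (suc i) ∸ 1 ∸ t) (ent α i ℕ.+ t)) g u))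
             (ℕP.m≤n⇒m∸n≡0 (ℕP.≤-reflexive (sym e))))))) (x-0≈x _))))
        (≈-sym (≈-trans (+-congˡ (≈-reflexive (cong (λ p → act p g u) (∂term-≡ i c α e)))) (+-identityʳ _)))

    swapP : Poly n → Poly n
    swapP p = map (λ t → (proj₁ t , swapExp i (proj₂ t))) p

    -- Transpose of ∂_i(p f) = sᵢ(p) ∂_i f + ∂_i(p) f. It will be evaluated where the first term
    -- vanishes, and then expresses `∂ i p` through `p`.
    act-d : ∀ p g {u} → Good u → act p (d i g) u ≈ d i (act (swapP p) g) u + act (∂ i p) g u
    act-d p g {u} G = begin
      act p (d i g) u ≈⟨ Σ-cong p (λ {t} _ → term-d (proj₁ t) (proj₂ t) g G) ⟩
      Σl p (λ t → ι (proj₁ t) * d i (actM 0 (swapExp i (proj₂ t)) g) u + act (∂term i t) g u) ≈⟨ Σ-+ p _ _ ⟩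
      Σl p (λ t → ι (proj₁ t) * d i (actM 0 (swapExp i (proj₂ t)) g) u) + Σl p (λ t → act (∂term i t) g u)
        ≈⟨ +-cong (≈-sym lhs) (≈-sym (Σ-concatMap (∂term i) p _)) ⟩
      d i (act (swapP p) g) u + act (∂ i p) g u ∎
      where
      lhs : d i (act (swapP p) g) u ≈ Σl p (λ t → ι (proj₁ t) * d i (actM 0 (swapExp i (proj₂ t)) g) u)
      lhs = ≈-trans (sumᴸ (Linear-d Ai) (swapP p) (λ t v → ι (proj₁ t) * actM 0 (proj₂ t) g v) G)
        (≈-trans (Σ-cong (swapP p) (λ {t} _ → Linear-d Ai .scaleᴸ (ι (proj₁ t)) (actM 0 (proj₂ t) g) G)) (Σ-map {X = ℤ × Mono n} (λ t → (proj₁ t , swapExp i (proj₂ t))) p _))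

    swapExp-invol : ∀ (α : Mono n) → swapExp i (swapExp i α) ≡ α
    swapExp-invol α = trans (cong₂ (set2 (swapExp i α) i) (ent-set2-si α i _ _ Ii′) (ent-set2-i α i _ _ Ii))
      (trans (set2-set2 Ii Ii′ α _ _ _ _) (set2-self Ii Ii′ α))

    swapP-invol : ∀ p → swapP (swapP p) ≡ p
    swapP-invol [] = refl
    swapP-invol ((c , α) ∷ p) = cong₂ _∷_ (cong (c ,_) (swapExp-invol α)) (swapP-invol p)

    ∂term-swapExp : ∀ c (α : Mono n) g {u} → act (∂term i (c , swapExp i α)) g u ≈ - act (∂term i (c , α)) g u
    ∂term-swapExp c α g {u} with <-cmp (ent α i) (ent α (suc i))
    ... | tri≈ _ e _ = ≈-trans (≈-reflexive (cong (λ p → act p g u) (∂term-≡ i c (swapExp i α)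
            (trans (ent-set2-i α i _ _ Ii) (trans (sym e) (sym (ent-set2-si α i _ _ Ii′)))))))
          (≈-sym (≈-trans (-‿cong (≈-reflexive (cong (λ p → act p g u) (∂term-≡ i c α e)))) -0#≈0#))
    ... | tri< lt _ _ = ≈-trans (act-∂term-> c α′ g (subst₂ _<_ (sym (ent-set2-si α i _ _ Ii′)) (sym (ent-set2-i α i _ _ Ii)) lt))
        (≈-trans (*-congˡ same) (≈-trans (solve 2 (λ a b → a :* b := :- ((:- a) :* b)) ≈-refl _ _)
          (-‿cong (≈-sym (act-∂term-< c α g lt)))))
      where
      α′ = swapExp i α
      same : Σ> α′ g u ≈ Σ< α g u
      same rewrite ent-set2-i α i (ent α (suc i)) (ent α i) Ii | ent-set2-si α i (ent α (suc i)) (ent α i) Ii′ =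
        Σ-cong (upTo (ent α (suc i) ∸ ent α i)) (λ {t} _ → actM-cong g (set2-set2 Ii Ii′ α (ent α (suc i)) (ent α i) _ _))
    ... | tri> _ _ gt = ≈-trans (act-∂term-< c α′ g (subst₂ _<_ (sym (ent-set2-i α i _ _ Ii)) (sym (ent-set2-si α i _ _ Ii′)) gt))
        (≈-trans (*-congˡ same) (≈-trans (solve 2 (λ a b → (:- a) :* b := :- (a :* b)) ≈-refl _ _)
          (-‿cong (≈-sym (act-∂term-> c α g gt)))))
      where
      α′ = swapExp i α
      same : Σ< α′ g u ≈ Σ> α g u
      same rewrite ent-set2-i α i (ent α (suc i)) (ent α i) Ii | ent-set2-si α i (ent α (suc i)) (ent α i) Ii′ =
        Σ-cong (upTo (ent α i ∸ ent α (suc i))) (λ {t} _ → actM-cong g (set2-set2 Ii Ii′ α (ent α (suc i)) (ent α i) _ _))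

    ∂-swapP : ∀ p g {u} → act (∂ i (swapP p)) g u ≈ - act (∂ i p) g u
    ∂-swapP p g {u} = begin
      act (∂ i (swapP p)) g u ≈⟨ Σ-concatMap (∂term i) (swapP p) _ ⟩
      Σl (swapP p) (λ t → act (∂term i t) g u) ≈⟨ Σ-map {X = ℤ × Mono n} (λ t → (proj₁ t , swapExp i (proj₂ t))) p _ ⟩
      Σl p (λ t → act (∂term i (proj₁ t , swapExp i (proj₂ t))) g u) ≈⟨ Σ-cong p (λ {t} _ → ∂term-swapExp (proj₁ t) (proj₂ t) g) ⟩
      Σl p (λ t → - act (∂term i t) g u) ≈⟨ Σ-neg p _ ⟩
      - Σl p (λ t → act (∂term i t) g u) ≈⟨ -‿cong (Σ-concatMap (∂term i) p _) ⟨
      - act (∂ i p) g u ∎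

    -- The same rule with `d i` outside. It follows from `act-d` for sᵢ(p), since sᵢ is an
    -- involution and ∂_i changes sign under it.
    d-act : ∀ p g {u} → Good u → d i (act p g) u ≈ act (swapP p) (d i g) u + act (∂ i p) g u
    d-act p g {u} G = begin
      d i (act p g) u ≡⟨ cong (λ q → d i (act q g) u) (swapP-invol p) ⟨
      d i (act (swapP (swapP p)) g) u
        ≈⟨ solve 2 (λ a b → a := (a :+ b) :- b) ≈-refl _ _ ⟩
      (d i (act (swapP (swapP p)) g) u + act (∂ i (swapP p)) g u) - act (∂ i (swapP p)) g u
        ≈⟨ +-cong (≈-sym (act-d (swapP p) g G)) (≈-trans (-‿cong (∂-swapP p g)) (-‿involutive _)) ⟩
      act (swapP p) (d i g) u + act (∂ i p) g u ∎

-- Evaluation at the identity permutation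

idPerm : ∀ {n} → Vec ℕ n
idPerm = fromFun (λ p → p)

w₀ : ∀ {n} → Vec ℕ n
w₀ {n} = fromFun (λ p → suc n ∸ p)

ent-map : ∀ {n} (f : ℕ → ℕ) (v : Vec ℕ n) {p} → In n p → ent (V.map f v) p ≡ f (ent v p)
ent-map f (x ∷ v) {suc zero} _ = refl
ent-map f (x ∷ v) {suc (suc p)} (_ , s≤s le) = ent-map f v {suc p} (s≤s z≤n , le)

refl-In : ∀ {n a} → In n a → In n (suc n ∸ a)
refl-In {n} {suc a} (_ , le) = ℕP.m<n⇒0<n∸m {a} {n} le , ℕP.m∸n≤m n a

refl-invol : ∀ {n a} → In n a → suc n ∸ (suc n ∸ a) ≡ a
refl-invol {n} {a} (_ , le) = ℕP.m∸[m∸n]≡n (ℕP.m≤n⇒m≤1+n le)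

refl-< : ∀ {n a b} → In n a → In n b → a < b → suc n ∸ b < suc n ∸ a
refl-< {n} {a} {b} Ia (_ , le) lt = ℕP.∸-monoʳ-< lt (ℕP.m≤n⇒m≤1+n le)

Good-id : ∀ {n} → Good (idPerm {n})
Good-id .bound {p} Ip = subst (In _) (sym (ent-tabulate (λ p → p) p Ip)) Ip
Good-id .inj {p} {q} Ip Iq e = trans (sym (ent-tabulate (λ p → p) p Ip)) (trans e (ent-tabulate (λ p → p) q Iq))

Good-w0mul : ∀ {n} {v : Vec ℕ n} → Good v → Good (w0mul v)
Good-w0mul {n} {v} G .bound Ip = subst (In n) (sym (ent-map _ v Ip)) (refl-In (G .bound Ip))
Good-w0mul {n} {v} G .inj {p} {q} Ip Iq e = G .inj Ip Iq
  (trans (sym (refl-invol (G .bound Ip))) (trans (cong (suc n ∸_)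
    (trans (sym (ent-map _ v Ip)) (trans e (ent-map _ v Iq)))) (refl-invol (G .bound Iq))))

w0mul-invol : ∀ {n} {v : Vec ℕ n} → Good v → w0mul (w0mul v) ≡ v
w0mul-invol {n} {v} G = ent-ext λ p Ip → trans (ent-map _ (w0mul v) Ip)
  (trans (cong (suc n ∸_) (ent-map _ v Ip)) (refl-invol (G .bound Ip)))

w0mul-id : ∀ {n} → w0mul (idPerm {n}) ≡ w₀
w0mul-id {n} = ent-ext λ p Ip → trans (ent-map _ idPerm Ip)
  (trans (cong (suc n ∸_) (ent-tabulate (λ p → p) p Ip)) (sym (ent-tabulate (λ p → suc n ∸ p) p Ip)))

w0mul-w₀ : ∀ {n} → w0mul (w₀ {n}) ≡ idPerm
w0mul-w₀ = trans (cong w0mul (sym w0mul-id)) (w0mul-invol Good-id)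

w0mul-swap : ∀ {n} k l (v : Vec ℕ n) → In n k → In n l → w0mul (swapPos k l v) ≡ swapPos k l (w0mul v)
w0mul-swap {n} k l v Ik Il = ent-ext λ p Ip → trans (ent-map _ (swapPos k l v) Ip)
  (trans (cong (suc n ∸_) (ent-swap k l v p Ip)) (sym (trans (ent-swap k l (w0mul v) p Ip) (ent-map _ v (transp-In p Ik Il Ip)))))

-- Counting up from the left end gives v(p) ≥ p; counting down from the right end gives v(p) ≤ p.
increasing⇒id : ∀ {n} {v : Vec ℕ n} → Good v → (∀ {t} → Adjacent-In n t → ent v t < ent v (suc t)) → v ≡ idPerm
increasing⇒id {n} {v} G h = ent-ext λ p Ip → trans (ℕP.≤-antisym (upper (n ∸ p) p (ℕP.m+[n∸m]≡n (proj₂ Ip)) Ip) (lower p Ip)) (sym (ent-tabulate (λ p → p) p Ip))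
  where
  lower : ∀ p → In n p → p ≤ ent v p
  lower (suc zero) Ip = proj₁ (G .bound Ip)
  lower (suc (suc p)) Ip@(_ , le) = ≤-trans (s≤s (lower (suc p) (s≤s z≤n , <⇒≤ le))) (h ((s≤s z≤n , <⇒≤ le) , Ip))
  upper : ∀ r p → p ℕ.+ r ≡ n → In n p → ent v p ≤ p
  upper zero p e Ip = subst (ent v p ≤_) (trans (sym e) (ℕP.+-identityʳ p)) (proj₂ (G .bound Ip))
  upper (suc r) p e Ip = ≤-pred (≤-trans (h (Ip , Isp)) (upper r (suc p) e′ Isp))
    where
    e′ : suc p ℕ.+ r ≡ n
    e′ = trans (sym (ℕP.+-suc p r)) e
    Isp : In n (suc p)
    Isp = s≤s z≤n , subst (suc p ≤_) e′ (ℕP.m≤m+n (suc p) r)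

decreasing⇒w₀ : ∀ {n} {v : Vec ℕ n} → Good v → (∀ {t} → Adjacent-In n t → ent v (suc t) < ent v t) → v ≡ w₀
decreasing⇒w₀ {n} {v} G h = trans (sym (w0mul-invol G)) (trans (cong w0mul (increasing⇒id (Good-w0mul G)
  (λ (It , It′) → subst₂ _<_ (sym (ent-map _ v It)) (sym (ent-map _ v It′)) (refl-< (G .bound It′) (G .bound It) (h (It , It′)))))) w0mul-id)

len-id : ∀ {n} → len (idPerm {n}) ≡ 0
len-id {n} = ℤP.+-injective (trans (lenΣ (idPerm {n})) (Σ-0 (Ps n) (λ {i} mi → Σ-0 (Ps n) (λ {j} mj →
  inv0 (λ (i<j , lt) → <-asym i<j (subst₂ _<_ (ent-tabulate (λ p → p) j (∈⇒In mj)) (ent-tabulate (λ p → p) i (∈⇒In mi)) lt))))))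
  where
  open Length
  open Sums ℤ-ring using (Σ-0)

-- staircase j a has first entries n, n-1, …, then a at position j, then the remaining values in increasing order
module Staircase (n : ℕ) where
  stairFun : ℕ → ℕ → ℕ → ℕ
  stairFun j a i = if i <ᵇ j then suc n ∸ i else if i ≡ᵇ j then a else if (i ∸ j) <ᵇ a then i ∸ j else suc (i ∸ j)

  staircase : ℕ → ℕ → Vec ℕ n
  staircase j a = fromFun (stairFun j a)

  module _ {j a p : ℕ} (Ip : In n p) where
    stair< : p < j → ent (staircase j a) p ≡ suc n ∸ p
    stair< lt = trans (ent-tabulate (stairFun j a) p Ip) (if-T (p <ᵇ j) (<⇒<ᵇ lt))

    stair> : j < p → ent (staircase j a) p ≡ (if (p ∸ j) <ᵇ a then p ∸ j else suc (p ∸ j))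
    stair> lt = trans (ent-tabulate (stairFun j a) p Ip) (trans (if-¬T (p <ᵇ j) (λ t → <-asym lt (<ᵇ⇒< p j t)))
      (if-¬T (p ≡ᵇ j) (λ t → <-irrefl (sym (≡ᵇ⇒≡ p j t)) lt)))

    stair>< : j < p → p ∸ j < a → ent (staircase j a) p ≡ p ∸ j
    stair>< lt h = trans (stair> lt) (if-T ((p ∸ j) <ᵇ a) (<⇒<ᵇ h))

    stair>≥ : j < p → a ≤ p ∸ j → ent (staircase j a) p ≡ suc (p ∸ j)
    stair>≥ lt h = trans (stair> lt) (if-¬T ((p ∸ j) <ᵇ a) (λ t → <⇒≱ (<ᵇ⇒< (p ∸ j) a t) h))

  stair≡ : ∀ {j a} → In n j → ent (staircase j a) j ≡ a
  stair≡ {j} {a} Ij = trans (ent-tabulate (stairFun j a) j Ij) (trans (if-¬T (j <ᵇ j) (λ t → <-irrefl refl (<ᵇ⇒< j j t)))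
    (if-T (j ≡ᵇ j) (≡⇒≡ᵇ j j refl)))

  staircase-id : staircase 1 1 ≡ idPerm
  staircase-id = ent-ext λ p Ip → trans (go p Ip) (sym (ent-tabulate (λ p → p) p Ip))
    where
    go : ∀ p → In n p → ent (staircase 1 1) p ≡ p
    go (suc zero) Ip = stair≡ Ip
    go (suc (suc p)) Ip = stair>≥ {1} {1} {suc (suc p)} Ip (s≤s (s≤s z≤n)) (s≤s z≤n)

  staircase-w₀ : staircase (suc n) 1 ≡ w₀
  staircase-w₀ = ent-ext λ p Ip → trans (stair< Ip (s≤s (proj₂ Ip))) (sym (ent-tabulate (λ p → suc n ∸ p) p Ip))

  -- Links the rows: with a running from 1 to n+1-j in row j, the staircases form one chain from the
  -- identity to w₀ with n-j steps in row j, the exponent of x_j in x^δ.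
  staircase-next : ∀ {j} → In n j → staircase j (suc n ∸ j) ≡ staircase (suc j) 1
  staircase-next {j} Ij = ent-ext go
    where
    go : ∀ p → In n p → ent (staircase j (suc n ∸ j)) p ≡ ent (staircase (suc j) 1) p
    go p Ip with <-cmp p j
    ... | tri< lt _ _ = trans (stair< Ip lt) (sym (stair< Ip (<-trans lt (n<1+n j))))
    ... | tri≈ _ refl _ = trans (stair≡ Ip) (sym (stair< Ip (n<1+n j)))
    ... | tri> _ _ gt = trans (stair>< {j} Ip gt (ℕP.∸-monoˡ-< (s≤s (proj₂ Ip)) (<⇒≤ gt))) (rest (p ≟ suc j))
      where
      rest : Dec (p ≡ suc j) → p ∸ j ≡ ent (staircase (suc j) 1) p
      rest (yes refl) = trans (ℕP.m+n∸n≡m 1 j) (sym (stair≡ Ip))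
      rest (no ne) = sym (trans (stair>≥ {suc j} {1} Ip (≤∧≢⇒< gt (ne ∘ sym)) (ℕP.m<n⇒0<n∸m (≤∧≢⇒< gt (ne ∘ sym))))
        (sym (ℕP.+-∸-assoc 1 {p} {suc j} gt)))

  module _ {j a : ℕ} (1≤j : 1 ≤ j) (1≤a : 1 ≤ a) (le : j ℕ.+ a ≤ n) where
    private
      u = staircase j a
      l = j ℕ.+ a
      Ij : In n j
      Ij = 1≤j , ≤-trans (ℕP.m≤m+n j a) le
      j<l : j < l
      j<l = ℕP.m<m+n j 1≤a
      Il : In n l
      Il = ≤-trans 1≤j (<⇒≤ j<l) , le
      l∸j : l ∸ j ≡ a
      l∸j = ℕP.m+n∸m≡n j a
      ul : ent u l ≡ suc a
      ul = trans (stair>≥ {j} {a} Il j<l (ℕP.≤-reflexive (sym l∸j))) (cong suc l∸j)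

    staircase-cov : Cov u j l
    staircase-cov = subst₂ _<_ (sym (stair≡ Ij)) (sym ul) (n<1+n a) , λ m j<m m<l lo hi →
      let Im = In-between Ij Il j<m m<l
          small = subst (m ∸ j <_) l∸j (ℕP.∸-monoˡ-< m<l (<⇒≤ j<m))
      in <-asym small (subst₂ _<_ (stair≡ Ij) (stair>< {j} Im j<m small) lo)

    -- Entries between positions j and `l` are below a, and the entry a+1 at `l` obstructs every
    -- position further right. Thus `l` gives the only cover upwards from position j.
    staircase-up : ∀ {m} → In n m → j < m → m ≢ l → ¬ Cov u j m
    staircase-up {m} Im j<m m≢l (lt , nb) with (m ∸ j) <? a
    ... | yes small = <-asym small (subst₂ _<_ (stair≡ Ij) (stair>< {j} Im j<m small) lt)
    ... | no large = nb l j<l l<m (subst₂ _<_ (sym (stair≡ Ij)) (sym ul) (n<1+n a))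
          (subst₂ _<_ (sym ul) (sym (stair>≥ {j} {a} Im j<m (≮⇒≥ large))) (s≤s (subst (_< m ∸ j) l∸j (ℕP.∸-monoˡ-< l<m (<⇒≤ j<l)))))
      where
      l<m : l < m
      l<m = ≤∧≢⇒< (subst (l ≤_) (ℕP.m+[n∸m]≡n (<⇒≤ j<m)) (ℕP.+-monoʳ-≤ j (≮⇒≥ large))) (m≢l ∘ sym)

    staircase-step : swapPos j l u ≡ staircase j (suc a)
    staircase-step = ent-ext go
      where
      go : ∀ p → In n p → ent (swapPos j l u) p ≡ ent (staircase j (suc a)) p
      go p Ip with <-cmp p j
      ... | tri≈ _ refl _ = trans (swapˡ j l u Ij) (trans ul (sym (stair≡ Ij)))
      ... | tri< lt _ _ = trans (swapᵒ j l u Ip (<⇒≢ lt) (<⇒≢ (<-trans lt j<l))) (trans (stair< Ip lt) (sym (stair< Ip lt)))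
      ... | tri> _ _ gt with p ≟ l
      ...   | yes refl = trans (swapʳ j l u Il) (trans (stair≡ Ij) (sym (trans (stair>< {j} {suc a} Il j<l (s≤s (ℕP.≤-reflexive l∸j))) l∸j)))
      ...   | no ne = trans (swapᵒ j l u Ip (<⇒≢ gt ∘ sym) ne) (cases ((p ∸ j) <? a))
        where
        cases : Dec (p ∸ j < a) → ent u p ≡ ent (staircase j (suc a)) p
        cases (yes s) = trans (stair>< {j} Ip gt s) (sym (stair>< {j} Ip gt (<-trans s (n<1+n a))))
        cases (no s) = trans (stair>≥ {j} Ip gt (≮⇒≥ s)) (sym (stair>≥ {j} Ip gt (≤∧≢⇒< (≮⇒≥ s)
          (λ e → ne (trans (sym (ℕP.m+[n∸m]≡n (<⇒≤ gt))) (cong (j ℕ.+_) (sym e)))))))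

  no-larger-left : ∀ {j a l} → In n j → j ℕ.+ a ≤ suc n → In n l → l < j → ¬ (ent (staircase j a) l < ent (staircase j a) j)
  no-larger-left {j} {a} {l} Ij le Il l<j lt = <⇒≱ lt (subst₂ _≤_ (sym (stair≡ Ij)) (sym (stair< Il l<j))
    (≤-trans (ℕP.m+n≤o⇒m≤o∸n a (subst (_≤ suc n) (ℕP.+-comm j a) le)) (ℕP.∸-monoʳ-≤ (suc n) (<⇒≤ l<j))))

  no-larger-right : ∀ {j a m} → In n j → j ℕ.+ a ≡ suc n → In n m → j < m → ¬ (ent (staircase j a) j < ent (staircase j a) m)
  no-larger-right {j} {a} {m} Ij e Im j<m lt = <-asym small (subst₂ _<_ (stair≡ Ij) (stair>< {j} {a} Im j<m small) lt)
    where
    small : m ∸ j < a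
    small = subst (m ∸ j <_) (trans (cong (_∸ j) (sym e)) (ℕP.m+n∸m≡n j a)) (ℕP.∸-monoˡ-< (s≤s (proj₂ Im)) (<⇒≤ j<m))

length-concatMap-≤ : ∀ {X Y : Set} (h : X → List Y) k xs → (∀ {x} → x ∈ xs → length (h x) ≤ k) → length (concatMap h xs) ≤ length xs ℕ.* k
length-concatMap-≤ h k [] b = z≤n
length-concatMap-≤ h k (x ∷ xs) b = subst (_≤ k ℕ.+ length xs ℕ.* k) (sym (length-++ (h x)))
  (ℕP.+-mono-≤ (b (here refl)) (length-concatMap-≤ h k xs (b ∘ there)))

length-range : ∀ a b → length (range a b) ≡ suc b ∸ a
length-range a b = trans (length-map (a ℕ.+_) (upTo (suc b ∸ a))) (length-upTo (suc b ∸ a))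

-- Each of the n+1 rows of pairs has at most n members. This shows that the fuel of `schub` suffices
-- in positive size.
len-bound : ∀ {n} (v : Vec ℕ (suc n)) → len v < suc n ℕ.* suc n
len-bound {n} v = ≤-<-trans (≤-trans (length-filter _ pairs) (length-concatMap-≤ (λ i → map (λ j → (i , j)) (range (suc i) (suc n))) n (range 1 (suc n)) row))
  (subst (λ z → z ℕ.* n < suc n ℕ.* suc n) (sym (length-range 1 (suc n))) (ℕP.*-monoʳ-< (suc n) (n<1+n n)))
  where
  pairs = concatMap (λ i → map (λ j → (i , j)) (range (suc i) (suc n))) (range 1 (suc n))
  row : ∀ {i} → i ∈ range 1 (suc n) → length (map (λ j → (i , j)) (range (suc i) (suc n))) ≤ n
  row {i} m = subst (_≤ n) (sym (trans (length-map _ (range (suc i) (suc n))) (length-range (suc i) (suc n)))) (ℕP.∸-monoʳ-≤ (suc n) (proj₁ (∈-range⁻ {1} {suc n} m)))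

AscentSpec : ∀ {n} → Vec ℕ n → List ℕ → Maybe ℕ → Set
AscentSpec w is (just i) = i ∈ is × ent w i < ent w (suc i)
AscentSpec w is nothing = ∀ {i} → i ∈ is → ¬ (ent w i < ent w (suc i))

mutual
  -- Abstracting the range replaces the goal by one about the local search on an arbitrary list,
  -- which is what determines the underscore in the next type.
  firstAscent-spec : ∀ {n} (w : Vec ℕ n) → AscentSpec w (range 1 (n ∸ 1)) (firstAscent w)
  firstAscent-spec {n} w with range 1 (n ∸ 1)
  ... | is = search-spec w is

  -- The underscore is the local search function of firstAscent, which has no name here.
  search-spec : ∀ {n} (w : Vec ℕ n) (is : List ℕ) → AscentSpec w is _
  search-spec w [] ()
  search-spec w (i ∷ is) with ent w i <ᵇ ent w (suc i) in eq
  ... | true = here refl , <ᵇ⇒< _ _ (subst T (sym eq) tt)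
  ... | false = push (search-spec w is)
    where
    push : ∀ {r} → AscentSpec w is r → AscentSpec w (i ∷ is) r
    push {just j} (m , lt) = there m , lt
    push {nothing} h (here refl) lt = subst T eq (<⇒<ᵇ lt)
    push {nothing} h (there m) lt = h m lt

below⇒Adjacent : ∀ {n i} → i ∈ range 1 (n ∸ 1) → Adjacent-In n i
below⇒Adjacent {suc n} m = let (a , b) = ∈-range⁻ {1} {n} m in (a , ℕP.m≤n⇒m≤1+n b) , (s≤s z≤n , s≤s b)
below⇒Adjacent {zero} m = let (a , b) = ∈-range⁻ {1} {0} m in ⊥-elim (<⇒≱ a b)

module Evaluation (A : RingOverℤ) (n : ℕ) where
  open Sums A
  open LinearForms A
  open Operators A n
  open Hecke A n
  open HeckeAction A n
  open NilHecke A n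
  open Staircase n
  private module R = ≡.≡-Reasoning

  module _ {j a : ℕ} (Ij : In n j) (1≤a : 1 ≤ a) (g : Fn) where
    private
      u = staircase j a
      kill : ∀ {x y} → (x < y → ¬ Cov u x y) → τ x y g u ≈ 0#
      kill {x} {y} h = ≈-trans (τ-def x y g u) (⊙-¬ (up u x y) (λ t → let (p , c) = up⁻ u t in h p c))
      left-zero : j ℕ.+ a ≤ suc n → ∀ {l} → In n l → τ l j g u ≈ 0#
      left-zero le Il = kill (λ l<j c → no-larger-left Ij le Il l<j (proj₁ c))

    M-staircase : j ℕ.+ a ≤ n → M j g u ≈ g (staircase j (suc a))
    M-staircase le = begin
      M j g u ≈⟨ Σ-single (Unique-range 1 n) (In⇒∈ Il) off ⟩
      τ j l g u - τ l j g u ≈⟨ ≈-trans (+-congˡ (-‿cong (left-zero (ℕP.m≤n⇒m≤1+n le) Il))) (x-0≈x _) ⟩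
      τ j l g u ≈⟨ τ-def j l g u ⟩
      up u j l ⊙ g (swapPos j l u) ≈⟨ ⊙-T (up u j l) (up⁺ u (ℕP.m<m+n j 1≤a) (staircase-cov (proj₁ Ij) 1≤a le)) ⟩
      g (swapPos j l u) ≡⟨ cong g (staircase-step (proj₁ Ij) 1≤a le) ⟩
      g (staircase j (suc a)) ∎
      where
      l = j ℕ.+ a
      Il : In n l
      Il = ≤-trans (proj₁ Ij) (ℕP.m≤m+n j a) , le
      off : ∀ {m} → m ∈ Ps n → m ≢ l → τ j m g u - τ m j g u ≈ 0#
      off m∈ ne = ≈-trans (+-cong (kill (λ j<m → staircase-up (proj₁ Ij) 1≤a le (∈⇒In m∈) j<m ne)) (-‿cong (left-zero (ℕP.m≤n⇒m≤1+n le) (∈⇒In m∈)))) (-‿inverseʳ 0#)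

    M-staircase-top : j ℕ.+ a ≡ suc n → M j g u ≈ 0#
    M-staircase-top e = Σ-0 (Ps n) (λ m → ≈-trans (+-cong (kill (λ j<m c → no-larger-right Ij e (∈⇒In m) j<m (proj₁ c)))
      (-‿cong (left-zero (ℕP.≤-reflexive e) (∈⇒In m)))) (-‿inverseʳ 0#))

  pow-staircase : ∀ {j} b {a} g → In n j → 1 ≤ a → j ℕ.+ (a ℕ.+ b) ≤ suc n →
    pow j b g (staircase j a) ≈ g (staircase j (a ℕ.+ b))
  pow-staircase {j} zero {a} g Ij 1≤a le = ≈-reflexive (cong (λ z → g (staircase j z)) (sym (ℕP.+-identityʳ a)))
  pow-staircase {j} (suc b) {a} g Ij 1≤a le = ≈-trans (M-staircase Ij 1≤a (pow j b g) small)
    (≈-trans (pow-staircase b g Ij (s≤s z≤n) (subst (λ z → j ℕ.+ z ≤ suc n) (ℕP.+-suc a b) le))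
      (≈-reflexive (cong (λ z → g (staircase j z)) (sym (ℕP.+-suc a b)))))
    where
    small : j ℕ.+ a ≤ n
    small = ≤-pred (≤-trans (subst (suc (j ℕ.+ a) ≤_) (sym (trans (cong (j ℕ.+_) (ℕP.+-suc a b)) (ℕP.+-suc j (a ℕ.+ b))))
      (s≤s (ℕP.+-monoʳ-≤ j (ℕP.m≤m+n a b)))) le)

  pow-staircase-0 : ∀ {j} b {a} g → In n j → 1 ≤ a → j ℕ.+ a ≤ suc n → suc n < j ℕ.+ (a ℕ.+ b) → pow j b g (staircase j a) ≈ 0#
  pow-staircase-0 {j} zero {a} g Ij 1≤a le lt = ⊥-elim (<⇒≱ lt (subst (λ z → j ℕ.+ z ≤ suc n) (sym (ℕP.+-identityʳ a)) le))
  pow-staircase-0 {j} (suc b) {a} g Ij 1≤a le lt with m≤n⇒m<n∨m≡n le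
  ... | inj₂ e = M-staircase-top Ij 1≤a (pow j b g) e
  ... | inj₁ lt′ = ≈-trans (M-staircase Ij 1≤a (pow j b g) (≤-pred lt′))
    (pow-staircase-0 b g Ij (s≤s z≤n) (subst (_≤ suc n) (sym (ℕP.+-suc j a)) lt′) (subst (λ z → suc n < j ℕ.+ z) (ℕP.+-suc a b) lt))

  private
    first-In : ∀ {o r} → o ℕ.+ suc r ≡ n → In n (suc o)
    first-In {o} {r} e = s≤s z≤n , subst (suc o ≤_) (trans (sym (ℕP.+-suc o r)) e) (ℕP.m≤m+n (suc o) r)

    next-stair : ∀ {o r} → o ℕ.+ suc r ≡ n → staircase (suc o) (suc r) ≡ staircase (suc (suc o)) 1
    next-stair {o} {r} e = trans (cong (staircase (suc o)) (sym (trans (cong (_∸ o) (sym e)) (ℕP.m+n∸m≡n o (suc r)))))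
      (staircase-next (first-In e))

    shift : ∀ {o r} → o ℕ.+ suc r ≡ n → suc o ℕ.+ r ≡ n
    shift {o} {r} e = trans (sym (ℕP.+-suc o r)) e

  -- On a staircase `M` has a single summand, so each power walks one row. Since `δ (suc r)` unfolds
  -- to `r ∷ δ r`, the power ends exactly at the start of the next row.
  actM-δ : ∀ {o} r g → o ℕ.+ r ≡ n → actM o (δ r) g (staircase (suc o) 1) ≈ g w₀
  actM-δ {o} zero g e = ≈-reflexive (cong g (trans (cong (λ z → staircase (suc z) 1) (trans (sym (ℕP.+-identityʳ o)) e)) staircase-w₀))
  actM-δ {o} (suc r) g e = ≈-trans (pow-staircase r (actM (suc o) (δ r) g) (first-In e) (s≤s z≤n) (ℕP.≤-reflexive (cong suc e)))
    (≈-trans (≈-reflexive (cong (actM (suc o) (δ r) g) (next-stair e))) (actM-δ r g (shift e)))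

  -- Rows before the first difference are walked to their ends. The first exponent beyond δ then
  -- drives its row past the top, where `M` is zero, whatever the later exponents are.
  actM-above-δ : ∀ {o r} (β : Mono r) g → o ℕ.+ r ≡ n → firstDiffGt β (δ r) → actM o β g (staircase (suc o) 1) ≈ 0#
  actM-above-δ [] g e ()
  actM-above-δ {o} {suc r} (b ∷ β) g e (inj₁ r<b) = pow-staircase-0 b (actM (suc o) β g) (first-In e) (s≤s z≤n)
    (subst (_≤ suc n) (sym (ℕP.+-comm (suc o) 1)) (s≤s (proj₂ (first-In e))))
    (subst (_< suc (o ℕ.+ suc b)) (cong suc e) (s≤s (ℕP.+-monoʳ-< o (s≤s r<b))))
  actM-above-δ {o} {suc r} (b ∷ β) g e (inj₂ (refl , h)) =
    ≈-trans (pow-staircase b (actM (suc o) β g) (first-In e) (s≤s z≤n) (ℕP.≤-reflexive (cong suc e)))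
      (≈-trans (≈-reflexive (cong (actM (suc o) β g) (next-stair e))) (actM-above-δ β g (shift e) h))

  Off : (ℕ → Set) → Fn → Set
  Off P g = ∀ {u} → Good u → P (len u) → g u ≈ 0#

  Off-M : ∀ {P k g} → In n k → Off P g → Off (λ l → P (suc l)) (M k g)
  Off-M {P} {k} {g} Ik h {u} G p = Σ-0 (Ps n) (λ m → ≈-trans (+-cong (z Ik (∈⇒In m)) (-‿cong (z (∈⇒In m) Ik))) (-‿inverseʳ 0#))
    where
    z : ∀ {x y} → In n x → In n y → τ x y g u ≈ 0#
    z {x} {y} Ix Iy = ≈-trans (τ-def x y g u) (⊙-zero (up u x y) (λ t → let (x<y , c) = up⁻ u t in
      h (Good-swap Ix Iy G) (subst P (sym (len-cover u G Ix Iy x<y c)) p)))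

  -- Homogeneity stated without subtraction: g lives in length ℓ - a, and every `M` moves this down
  -- by one.
  Supp : ℕ → ℕ → Fn → Set
  Supp a ℓ = Off (λ l → l ℕ.+ a ≢ ℓ)

  Supp-M : ∀ {a ℓ k g} → In n k → Supp a ℓ g → Supp (suc a) ℓ (M k g)
  Supp-M {a} {ℓ} {k} {g} Ik h {u} G ne = Off-M {λ l → l ℕ.+ a ≢ ℓ} {k} {g} Ik h G (λ e → ne (trans (ℕP.+-suc (len u) a) e))

  Supp-pow : ∀ {a ℓ k g} b → In n k → Supp a ℓ g → Supp (b ℕ.+ a) ℓ (pow k b g)
  Supp-pow zero Ik h = h
  Supp-pow {g = g} (suc b) Ik h = Supp-M {g = pow _ b g} Ik (Supp-pow {g = g} b Ik h)

  Supp-actM : ∀ {r o a ℓ g} (α : Vec ℕ r) → o ℕ.+ r ≤ n → Supp a ℓ g → Supp (V.sum α ℕ.+ a) ℓ (actM o α g)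
  Supp-actM [] le h = h
  Supp-actM {o = o} {a} {ℓ} {g} (b ∷ α) le h = subst (λ z → Supp z ℓ (actM o (b ∷ α) g)) (sym (ℕP.+-assoc b (V.sum α) a))
    (Supp-pow {g = actM (suc o) α g} b (proj₁ (In-suc le)) (Supp-actM {g = g} α (proj₂ (In-suc le)) h))

  stairs : ∀ {j} b → In n j → j ℕ.+ b ≤ n → Good (staircase j 1) →
    Good (staircase j (suc b)) × len (staircase j (suc b)) ≡ len (staircase j 1) ℕ.+ b
  stairs {j} zero Ij le G = G , sym (ℕP.+-identityʳ (len (staircase j 1)))
  stairs {j} (suc b) Ij le G = subst Good st (Good-swap Ij Il (proj₁ ih)) , len-eq
    where
    st : swapPos j (j ℕ.+ suc b) (staircase j (suc b)) ≡ staircase j (suc (suc b))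
    st = staircase-step {j} {suc b} (proj₁ Ij) (s≤s z≤n) le
    Il : In n (j ℕ.+ suc b)
    Il = ≤-trans (proj₁ Ij) (ℕP.m≤m+n j (suc b)) , le
    ih : Good (staircase j (suc b)) × len (staircase j (suc b)) ≡ len (staircase j 1) ℕ.+ b
    ih = stairs b Ij (≤-trans (ℕP.+-monoʳ-≤ j (ℕP.n≤1+n b)) le) G
    len-eq : len (staircase j (suc (suc b))) ≡ len (staircase j 1) ℕ.+ suc b
    len-eq = R.begin
      len (staircase j (suc (suc b))) R.≡⟨ cong len st ⟨
      len (swapPos j (j ℕ.+ suc b) (staircase j (suc b)))
        R.≡⟨ len-cover (staircase j (suc b)) (proj₁ ih) Ij Il (ℕP.m<m+n j (s≤s z≤n)) (staircase-cov (proj₁ Ij) (s≤s z≤n) le) ⟩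
      suc (len (staircase j (suc b))) R.≡⟨ cong suc (proj₂ ih) ⟩
      suc (len (staircase j 1) ℕ.+ b) R.≡⟨ ℕP.+-suc (len (staircase j 1)) b ⟨
      len (staircase j 1) ℕ.+ suc b R.∎

  staircase-len : ∀ {o} r → o ℕ.+ r ≡ n → Good (staircase (suc o) 1) → len (w₀ {n}) ≡ len (staircase (suc o) 1) ℕ.+ V.sum (δ r)
  staircase-len {o} zero e G = trans (cong len (sym eq)) (sym (ℕP.+-identityʳ (len (staircase (suc o) 1))))
    where
    eq : staircase (suc o) 1 ≡ w₀
    eq = trans (cong (λ z → staircase (suc z) 1) (trans (sym (ℕP.+-identityʳ o)) e)) staircase-w₀
  staircase-len {o} (suc r) e G = len-eq
    where
    top : Good (staircase (suc o) (suc r)) × len (staircase (suc o) (suc r)) ≡ len (staircase (suc o) 1) ℕ.+ r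
    top = stairs r (first-In e) (ℕP.≤-reflexive (shift e)) G
    rest : len (w₀ {n}) ≡ len (staircase (suc (suc o)) 1) ℕ.+ V.sum (δ r)
    rest = staircase-len r (shift e) (subst Good (next-stair e) (proj₁ top))
    len-eq : len (w₀ {n}) ≡ len (staircase (suc o) 1) ℕ.+ (r ℕ.+ V.sum (δ r))
    len-eq = R.begin
      len (w₀ {n}) R.≡⟨ rest ⟩
      len (staircase (suc (suc o)) 1) ℕ.+ V.sum (δ r) R.≡⟨ cong (λ z → len z ℕ.+ V.sum (δ r)) (next-stair e) ⟨
      len (staircase (suc o) (suc r)) ℕ.+ V.sum (δ r) R.≡⟨ cong (ℕ._+ V.sum (δ r)) (proj₂ top) ⟩
      len (staircase (suc o) 1) ℕ.+ r ℕ.+ V.sum (δ r) R.≡⟨ ℕP.+-assoc (len (staircase (suc o) 1)) r (V.sum (δ r)) ⟩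
      len (staircase (suc o) 1) ℕ.+ (r ℕ.+ V.sum (δ r)) R.∎

  private
    Good-first : Good (staircase 1 1)
    Good-first = subst Good (sym staircase-id) Good-id

  -- Counted along the staircase chain from the identity: row j consists of n-j covers, and each
  -- raises the length by one.
  len-w₀ : len (w₀ {n}) ≡ V.sum (δ n)
  len-w₀ = R.begin
    len (w₀ {n}) R.≡⟨ staircase-len {0} n refl Good-first ⟩
    len (staircase 1 1) ℕ.+ V.sum (δ n) R.≡⟨ cong (λ z → len z ℕ.+ V.sum (δ n)) staircase-id ⟩
    len (idPerm {n}) ℕ.+ V.sum (δ n) R.≡⟨ cong (ℕ._+ V.sum (δ n)) (len-id {n}) ⟩
    V.sum (δ n) R.∎

  len≡0⇒id : ∀ {u} → Good u → len u ≡ 0 → u ≡ idPerm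
  len≡0⇒id {u} G e = increasing⇒id G (λ {t} (It , It′) → ≮⇒< (λ lt → pos-len It It′ lt) (ent≢ G It′ It (λ q → <⇒≢ (n<1+n t) (sym q))))
    where
    pos-len : ∀ {t} → In n t → In n (suc t) → ent u (suc t) < ent u t → ⊥
    pos-len {t} It It′ lt = ℕP.0≢1+n {len (swapPos t (suc t) u)} (trans {i = 0} {j = len u} (sym e) (len-dsc {t} {u} G (It , It′) (<⇒<ᵇ lt)))

  indicator : Vec ℕ n → Fn
  indicator w u = does (u ≟ᵛ w) ⊙ 1#

  indicator-at : ∀ w → indicator w w ≈ 1#
  indicator-at w with w ≟ᵛ w
  ... | yes _ = ≈-refl
  ... | no ne = ⊥-elim (ne refl)

  indicator-off : ∀ w u → u ≢ w → indicator w u ≈ 0#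
  indicator-off w u ne with u ≟ᵛ w
  ... | yes e = ⊥-elim (ne e)
  ... | no _ = ≈-refl

  Supp-indicator : ∀ w → Supp 0 (len w) (indicator w)
  Supp-indicator w {u} G ne = indicator-off w u (λ e → ne (trans (ℕP.+-identityʳ (len u)) (cong len {u} {w} e)))

  xδ-at-id : ∀ g → actM 0 (δ n) g idPerm ≈ g w₀
  xδ-at-id g = ≈-trans (≈-reflexive (cong (actM 0 (δ n) g) (sym staircase-id))) (actM-δ n g refl)

  -- At the identity the staircase walk arrives at w₀. Elsewhere homogeneity decides: x^δ has degree
  -- ℓ(w₀), so the result lives in length 0.
  xδ-indicator : ∀ {u} → Good u → actM 0 (δ n) (indicator w₀) u ≈ indicator idPerm u
  xδ-indicator {u} G with u ≟ᵛ idPerm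
  ... | yes refl = ≈-trans (xδ-at-id (indicator w₀)) (indicator-at w₀)
  ... | no ne = Supp-actM {g = indicator w₀} (δ n) ≤-refl (Supp-indicator w₀) G
    (λ e → ne (len≡0⇒id G (ℕP.+-cancelʳ-≡ (V.sum (δ n)) (len u) 0
      (trans (cong (len u ℕ.+_) (sym (ℕP.+-identityʳ _))) (trans e len-w₀)))))

  act-mono : ∀ α g {u} → act (mono α) g u ≈ actM 0 α g u
  act-mono α g {u} = lin-mono (λ β → actM 0 β g u) α

  private
    ascent-step : ∀ {i} {w : Vec ℕ n} → Good w → Adjacent-In n i → ent w i < ent w (suc i) →
      let v = swapPos i (suc i) w in Good v × T (dsc v i) × len v ≡ suc (len w)
    ascent-step {i} {w} G (Ii , Ii′) lt = Good-swap Ii Ii′ G ,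
      <⇒<ᵇ (subst₂ _<_ (sym (swapʳ i (suc i) w Ii′)) (sym (swapˡ i (suc i) w Ii)) lt) ,
      len-cover w G Ii Ii′ (n<1+n i) (adjacent-cov {u = w} lt)

    no-ascent : ∀ {w : Vec ℕ n} → Good w → AscentSpec w (range 1 (n ∸ 1)) nothing → w ≡ w₀
    no-ascent G h = decreasing⇒w₀ G (λ {t} (It , It′) → ≮⇒< (h (∈-range⁺ (proj₁ It) (below It′))) (ent≢ G It It′ (<⇒≢ (n<1+n t))))
      where
      below : ∀ {t n} → In n (suc t) → t ≤ n ∸ 1
      below {n = suc n} (_ , s≤s le) = le

    -- The fuel can be exhausted only in size 0, where the empty vector is itself `w₀`.
    no-fuel : ∀ {m} (w : Vec ℕ m) → m ℕ.* m ≤ len w → w ≡ w₀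
    no-fuel [] _ = refl
    no-fuel (x ∷ w) le = ⊥-elim (<⇒≱ (len-bound (x ∷ w)) le)

    lower-fuel : ∀ {N f a b} → b ≡ suc a → N ≤ suc f ℕ.+ a → N ≤ f ℕ.+ b
    lower-fuel {N} {f} {a} refl le = subst (N ≤_) (sym (ℕP.+-suc f a)) le

  -- A polynomial is recorded by its action on functions, read off at the identity permutation.
  schub-at-id : ∀ f {w} → Good w → n ℕ.* n ≤ f ℕ.+ len w → ∀ g → act (schubF f w) g idPerm ≈ g w
  schub-at-id zero {w} G le g = ≈-trans (act-mono (δ n) _) (≈-trans (xδ-at-id g) (≈-reflexive (cong g (sym (no-fuel w le)))))
  schub-at-id (suc f) {w} G le g with firstAscent w | firstAscent-spec w
  ... | nothing | h = ≈-trans (act-mono (δ n) _) (≈-trans (xδ-at-id g) (≈-reflexive (cong g (sym (no-ascent G h)))))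
  ... | just i | m , lt = begin
    act (∂ i p) g idPerm ≈⟨ +-identityˡ _ ⟨
    -- The identity has no descent, so the `d i` term of the Leibniz rule is zero there.
    0# + act (∂ i p) g idPerm ≈⟨ +-congʳ (⊙-¬ (dsc (idPerm {n}) i) no-dsc) ⟨
    d i (act (swapP Ai p) g) idPerm + act (∂ i p) g idPerm ≈⟨ act-d Ai p g Good-id ⟨
    act p (d i g) idPerm ≈⟨ schub-at-id f Gv (lower-fuel {f = f} lv le) (d i g) ⟩
    d i g v ≈⟨ ⊙-T (dsc v i) dv ⟩
    g (swapPos i (suc i) v) ≡⟨ cong g (swap-invol i (suc i) w (proj₁ Ai) (proj₂ Ai)) ⟩
    g w ∎
    where
    Ai : Adj i
    Ai = below⇒Adjacent {n} m
    v = swapPos i (suc i) w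
    p = schubF f v
    step = ascent-step G Ai lt
    Gv = proj₁ step
    dv = proj₁ (proj₂ step)
    lv = proj₂ (proj₂ step)
    no-dsc : ¬ T (dsc (idPerm {n}) i)
    no-dsc t = <-asym (n<1+n i) (subst₂ _<_ (ent-tabulate {n} (λ p → p) (suc i) (proj₂ Ai)) (ent-tabulate {n} (λ p → p) i (proj₁ Ai)) (<ᵇ⇒< _ _ t))

  -- The same recursion used from the other side, with `d-act` in place of `act-d`. The term
  -- containing `d i (indicator w₀)` vanishes: where x has a descent at i, x sᵢ has an ascent there,
  -- and w₀ has none.
  schub-dual : ∀ f {v} → Good v → n ℕ.* n ≤ f ℕ.+ len v → act (schubF f v) (indicator w₀) ≐ indicator (w0mul v)
  schub-dual zero {v} G le {u} H = ≈-trans (act-mono (δ n) _) (≈-trans (xδ-indicator H)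
    (≈-reflexive (cong (λ z → indicator z u) (sym (trans (cong w0mul (no-fuel v le)) w0mul-w₀)))))
  schub-dual (suc f) {v} G le {u} H with firstAscent v | firstAscent-spec v
  ... | nothing | h = ≈-trans (act-mono (δ n) _) (≈-trans (xδ-indicator H)
    (≈-reflexive (cong (λ z → indicator z u) (sym (trans (cong w0mul (no-ascent G h)) w0mul-w₀)))))
  ... | just i | m , lt = begin
    act (∂ i p) (indicator w₀) u ≈⟨ +-identityˡ _ ⟨
    0# + act (∂ i p) (indicator w₀) u ≈⟨ +-congʳ (zeroᴸ (Linear-act (swapP Ai p)) dw₀ H) ⟨
    act (swapP Ai p) (d i (indicator w₀)) u + act (∂ i p) (indicator w₀) u ≈⟨ d-act Ai p (indicator w₀) H ⟨
    d i (act p (indicator w₀)) u ≈⟨ Linear-d Ai .congᴸ (schub-dual f (proj₁ step) (lower-fuel {f = f} (proj₂ (proj₂ step)) le)) H ⟩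
    d i (indicator (w0mul v′)) u ≈⟨ final (u ≟ᵛ w0mul v) ⟩
    indicator (w0mul v) u ∎
    where
    Ai : Adj i
    Ai = below⇒Adjacent {n} m
    Ii = proj₁ Ai
    Ii′ = proj₂ Ai
    v′ = swapPos i (suc i) v
    p = schubF f v′
    step = ascent-step G Ai lt
    dw₀ : d i (indicator w₀) ≐ (λ _ → 0#)
    dw₀ {x} X = ⊙-zero (dsc x i) (λ t → indicator-off w₀ (swapPos i (suc i) x) (λ e → <-asym (<ᵇ⇒< _ _ t)
      (subst₂ _<_ (swapʳ i (suc i) x Ii′) (swapˡ i (suc i) x Ii)
        (subst (λ z → ent z (suc i) < ent z i) (sym e)
          (subst₂ _<_ (sym (ent-tabulate {n} (λ p → suc n ∸ p) (suc i) Ii′)) (sym (ent-tabulate {n} (λ p → suc n ∸ p) i Ii)) (refl-< Ii Ii′ (n<1+n i)))))))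
    w0v′ : w0mul v′ ≡ swapPos i (suc i) (w0mul v)
    w0v′ = w0mul-swap i (suc i) v Ii Ii′
    final : Dec (u ≡ w0mul v) → d i (indicator (w0mul v′)) u ≈ indicator (w0mul v) u
    final (yes refl) = ≈-trans (⊙-T (dsc (w0mul v) i) (<⇒<ᵇ (subst₂ _<_ (sym (ent-map _ v Ii′)) (sym (ent-map _ v Ii)) (refl-< (G .bound Ii) (G .bound Ii′) lt))))
      (≈-trans (≈-reflexive (cong (indicator (w0mul v′)) (sym w0v′))) (≈-trans (indicator-at (w0mul v′)) (≈-sym (indicator-at (w0mul v)))))
    final (no ne) = ≈-trans (⊙-zero (dsc u i) (λ _ → indicator-off (w0mul v′) (swapPos i (suc i) u) (λ e → ne
        (trans (sym (swap-invol i (suc i) u Ii Ii′)) (trans (cong (swapPos i (suc i)) (trans e w0v′)) (swap-invol i (suc i) (w0mul v) Ii Ii′))))))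
      (≈-sym (indicator-off (w0mul v) u ne))

-- Complete symmetric polynomials and the kernel

module Complete (A : RingOverℤ) (n : ℕ) where
  open Sums A
  open LinearForms A
  open Operators A n
  open Pieri A n
  open Hecke A n
  open HeckeAction A n
  open Evaluation A n
  open Staircase n

  -- C k m acts as the complete symmetric polynomial h_m(x₁, …, x_k).
  C : ℕ → ℕ → Fn → Fn
  C k = S k (scan n 0)

  Linear-C : ∀ k m → Linear (C k m)
  Linear-C k m = Linear-S k (scan n 0) m

  S-zero : ∀ {k u} → (∀ b g → Tᵇ k b g u ≈ 0#) → ∀ bs m g → S k bs (suc m) g u ≈ 0#
  S-zero h [] m g = ≈-refl
  S-zero h (b ∷ bs) m g = ≈-trans (+-cong (S-zero h bs m g) (h b _)) (+-identityʳ 0#)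

  C-first : ∀ m g {u} → C 0 (suc m) g u ≈ 0#
  C-first m g = S-zero (λ b f → T-none (λ Ip le _ → <⇒≱ (proj₁ Ip) le)) (scan n 0) m g

  -- No transposition reaches beyond position n, so no edge has index n. This is how the relations
  -- h_m(x_1,...,x_n) = 0 enter.
  C-last : ∀ m g {u} → C n (suc m) g u ≈ 0#
  C-last m g {u} = S-zero (λ b f → Σ-0 (Ps n) (λ {i} _ → Σ-0 (Ps n) (λ {j} mj → ⊙-¬ (T-gate n b i j u)
    (λ t → <⇒≱ (<ᵇ⇒< n j (proj₁ (∧-elim {n <ᵇ j} (proj₂ (∧-elim {i <ᵇ suc n} t))))) (proj₂ (∈⇒In mj)))))) (scan n 0) m g

  C-step : ∀ {k} → In n (suc k) → ∀ m g → C (suc k) (suc m) g ≐ (λ u → C k (suc m) g u + M (suc k) (C (suc k) m g) u)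
  C-step Ik m g = pieri Ik m g

  -- The recursion h_m(x_1,...,x_k) = h_m(x_1,...,x_{k+1}) - x_{k+1} h_{m-1}(x_1,...,x_{k+1}), run
  -- downwards from k = n.
  C-vanish : ∀ r k m → k ℕ.+ r ≡ n → r < m → ∀ g → C k m g ≐ (λ _ → 0#)
  C-vanish zero k (suc m) e _ g {u} G = ≈-trans (≈-reflexive (cong (λ z → C z (suc m) g u) (trans (sym (ℕP.+-identityʳ k)) e))) (C-last m g)
  C-vanish (suc r) k (suc m) e (s≤s lt) g {u} G = begin
    C k (suc m) g u ≈⟨ solve 2 (λ a b → a := (a :+ b) :- b) ≈-refl _ _ ⟩
    (C k (suc m) g u + M (suc k) (C (suc k) m g) u) - M (suc k) (C (suc k) m g) u ≈⟨ +-congʳ (C-step Ik m g G) ⟨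
    C (suc k) (suc m) g u - M (suc k) (C (suc k) m g) u
      ≈⟨ +-cong (C-vanish r (suc k) (suc m) e′ (≤-trans lt (ℕP.n≤1+n m)) g G) (-‿cong (zeroᴸ (Linear-M Ik) (C-vanish r (suc k) m e′ lt g) G)) ⟩
    0# - 0# ≈⟨ -‿inverseʳ 0# ⟩
    0# ∎
    where
    e′ : suc k ℕ.+ r ≡ n
    e′ = trans (sym (ℕP.+-suc k r)) e
    Ik : In n (suc k)
    Ik = s≤s z≤n , subst (suc k ≤_) e′ (ℕP.m≤m+n (suc k) r)

  C-commutes : ∀ {F} → Linear F → Commutes F → ∀ k m g → k ≤ n → F (C k m g) ≐ C k m (F g)
  C-commutes LF CF k zero g le G = ≈-refl
  C-commutes LF CF zero (suc m) g le G = ≈-trans (zeroᴸ LF (λ _ → C-first m g) G) (≈-sym (C-first m _))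
  C-commutes {F} LF CF (suc k) (suc m) g le {u} G = begin
    F (C (suc k) (suc m) g) u ≈⟨ LF .congᴸ (C-step Ik m g) G ⟩
    F (λ u → C k (suc m) g u + M (suc k) (C (suc k) m g) u) u ≈⟨ LF .addᴸ (C k (suc m) g) (M (suc k) (C (suc k) m g)) G ⟩
    F (C k (suc m) g) u + F (M (suc k) (C (suc k) m g)) u ≈⟨ +-cong (C-commutes LF CF k (suc m) g (<⇒≤ le) G) (CF (C (suc k) m g) Ik G) ⟩
    C k (suc m) (F g) u + M (suc k) (F (C (suc k) m g)) u ≈⟨ +-congˡ (Linear-M Ik .congᴸ (C-commutes LF CF (suc k) m g le) G) ⟩
    C k (suc m) (F g) u + M (suc k) (C (suc k) m (F g)) u ≈⟨ C-step Ik m (F g) G ⟨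
    C (suc k) (suc m) (F g) u ∎
    where
    Ik : In n (suc k)
    Ik = s≤s z≤n , le

  -- The complete polynomials in the first k variables equal, up to sign, the elementary ones in the
  -- others, because the generating function of all n variables acts as 1. Both sides satisfy the
  -- same recursion downwards from k = n.
  es-C : ∀ r k m → k ℕ.+ r ≡ n → ∀ g → es r k m g ≐ C k m g
  es-C r k zero e g G = ≈-refl
  es-C zero k (suc m) e g G = ≈-sym (C-vanish zero k (suc m) e (s≤s z≤n) g G)
  es-C (suc r) k (suc m) e g {u} G = begin
    es r (suc k) (suc m) g u - M (suc k) (es r (suc k) m g) u
      ≈⟨ +-cong (≈-trans (es-C r (suc k) (suc m) e′ g G) (C-step Ik m g G)) (-‿cong (Linear-M Ik .congᴸ (es-C r (suc k) m e′ g) G)) ⟩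
    (C k (suc m) g u + M (suc k) (C (suc k) m g) u) - M (suc k) (C (suc k) m g) u
      ≈⟨ solve 2 (λ a b → (a :+ b) :- b := a) ≈-refl _ _ ⟩
    C k (suc m) g u ∎
    where
    e′ : suc k ℕ.+ r ≡ n
    e′ = trans (sym (ℕP.+-suc k r)) e
    Ik : In n (suc k)
    Ik = s≤s z≤n , subst (suc k ≤_) e′ (ℕP.m≤m+n (suc k) r)

  -- At k = 0 the previous lemma turns elementary polynomials in all variables into complete ones in
  -- none. So functions on permutations are a module over the quotient ring.
  act-esym-zero : ∀ m g → act (esym n (suc m)) g ≐ (λ _ → 0#)
  act-esym-zero m g G = ≈-trans (act-esym (suc m) g G) (≈-trans (*-congˡ (≈-trans (es-C n 0 (suc m) refl g G) (C-first m g))) (zeroʳ _))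

  Off-C : ∀ {P} k m g → k ≤ n → Off P g → Off (λ l → P (m ℕ.+ l)) (C k m g)
  Off-C k zero g le h = h
  Off-C zero (suc m) g le h G p = C-first m g
  Off-C {P} (suc k) (suc m) g le h {u} G p = ≈-trans (C-step (s≤s z≤n , le) m g G)
    (≈-trans (+-cong (Off-C {P} k (suc m) g (<⇒≤ le) h G p)
      (Off-M {λ l → P (m ℕ.+ l)} {suc k} {C (suc k) m g} (s≤s z≤n , le) (Off-C {P} (suc k) m g le h) G (subst P (sym (ℕP.+-suc m (len u))) p))) (+-identityʳ 0#))

  staircase-small : ∀ {k a p} → In n (suc k) → a ℕ.+ k ≤ n → In n p → k < p → ent (staircase (suc k) a) p ≤ n ∸ k
  staircase-small {k} {a} {p} Ik le Ip k<p with p ≟ suc k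
  ... | yes refl = subst (_≤ n ∸ k) (sym (stair≡ Ik)) (ℕP.m+n≤o⇒m≤o∸n a le)
  ... | no ne = go ((p ∸ suc k) <? a)
    where
    sk<p : suc k < p
    sk<p = ≤∧≢⇒< k<p (ne ∘ sym)
    go : Dec (p ∸ suc k < a) → ent (staircase (suc k) a) p ≤ n ∸ k
    go (yes s) = subst (_≤ n ∸ k) (sym (stair>< {suc k} Ip sk<p s)) (ℕP.∸-mono (proj₂ Ip) (ℕP.n≤1+n k))
    go (no s) = subst (_≤ n ∸ k) (sym (trans (stair>≥ {suc k} Ip sk<p (≮⇒≥ s)) (sym (ℕP.+-∸-assoc 1 {p} {suc k} k<p)))) (ℕP.∸-monoˡ-≤ k (proj₂ Ip))

  T-staircase : ∀ {k a} → In n (suc k) → a ℕ.+ k ≤ n → ∀ b g → Tᵇ k b g (staircase (suc k) a) ≈ 0#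
  T-staircase {k} {a} Ik le b g = Σ-0 (Ps n) (λ {i} mi → Σ-0 (Ps n) (λ {j} mj → ⊙-zero (T-gate k b i j (staircase (suc k) a)) (λ t →
    let (x , y) = ∧-elim {i <ᵇ suc k} t
        i≤k = ≤-pred (<ᵇ⇒< i (suc k) x)
        k<j = <ᵇ⇒< k j (proj₁ (∧-elim {k <ᵇ j} y))
    in τ-zero (λ _ lt → <⇒≱ lt (≤-trans (staircase-small Ik le (∈⇒In mj) k<j)
         (subst (n ∸ k ≤_) (sym (stair< (∈⇒In mi) (s≤s i≤k))) (≤-trans (ℕP.∸-monoʳ-≤ n i≤k) (ℕP.∸-monoˡ-≤ i (ℕP.n≤1+n n)))))))))

  -- The first k entries of such a staircase are larger than all later ones, so no cover crosses
  -- from the first k positions and `C k` contributes nothing. The recursion then leaves only m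
  -- single steps along the row.
  C-staircase : ∀ {k} m a g → In n (suc k) → suc k ℕ.+ (a ℕ.+ m) ≤ n → Good (staircase (suc k) 1) →
    C (suc k) m g (staircase (suc k) (suc a)) ≈ g (staircase (suc k) (suc (a ℕ.+ m)))
  C-staircase {k} zero a g Ik le G = ≈-reflexive (cong (λ z → g (staircase (suc k) (suc z))) (sym (ℕP.+-identityʳ a)))
  C-staircase {k} (suc m) a g Ik le G = begin
    C (suc k) (suc m) g u ≈⟨ C-step Ik m g (proj₁ (stairs a Ik (≤-trans (ℕP.+-monoʳ-≤ (suc k) (ℕP.m≤m+n a (suc m))) le) G)) ⟩
    C k (suc m) g u + M (suc k) (C (suc k) m g) u ≈⟨ +-cong (S-zero (T-staircase Ik (subst (_≤ n) (cong suc (ℕP.+-comm k a)) small′)) (scan n 0) m g) (M-staircase Ik (s≤s z≤n) _ small) ⟩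
    0# + C (suc k) m g (staircase (suc k) (suc (suc a))) ≈⟨ +-identityˡ _ ⟩
    C (suc k) m g (staircase (suc k) (suc (suc a))) ≈⟨ C-staircase m (suc a) g Ik (subst (λ z → suc k ℕ.+ z ≤ n) (ℕP.+-suc a m) le) G ⟩
    g (staircase (suc k) (suc (suc a ℕ.+ m))) ≡⟨ cong (λ z → g (staircase (suc k) (suc z))) (ℕP.+-suc a m) ⟨
    g (staircase (suc k) (suc (a ℕ.+ suc m))) ∎
    where
    u = staircase (suc k) (suc a)
    small : suc k ℕ.+ suc a ≤ n
    small = ≤-trans (ℕP.+-monoʳ-≤ (suc k) (subst (suc a ≤_) (sym (ℕP.+-suc a m)) (s≤s (ℕP.m≤m+n a m)))) le
    small′ : suc k ℕ.+ a ≤ n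
    small′ = ≤-trans (ℕP.+-monoʳ-≤ (suc k) (ℕP.n≤1+n a)) small

  -- Y x k N = Σ_{m ≤ N} x^{N-m} C k m.
  Y : Carrier → ℕ → ℕ → Fn → Fn
  Y x k zero f = f
  Y x k (suc N) f u = x * Y x k N f u + C k (suc N) f u

  Linear-Y : ∀ x k N → Linear (Y x k N)
  Linear-Y x k zero = Linear-id
  Linear-Y x k (suc N) = Linear-+ (Linear-scale x (Linear-Y x k N)) (Linear-C k (suc N))

  Y-commutes : ∀ {F} → Linear F → Commutes F → ∀ x k N g → k ≤ n → F (Y x k N g) ≐ Y x k N (F g)
  Y-commutes LF CF x k zero g le G = ≈-refl
  Y-commutes LF CF x k (suc N) g le G = ≈-trans (LF .addᴸ _ _ G) (+-cong
    (≈-trans (LF .scaleᴸ x _ G) (*-congˡ (Y-commutes LF CF x k N g le G))) (C-commutes LF CF k (suc N) g le G))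

  -- Homogeneous form of (1 - x_{k+1} t) H_{k+1}(t) = H_k(t) for the generating functions of
  -- complete polynomials, cut off in degree N+1. The subtracted `C` is the truncation error.
  Y-step : ∀ {k} → In n (suc k) → ∀ x N f {u} → Good u →
    x * Y x (suc k) N f u - M (suc k) (Y x (suc k) N f) u ≈ Y x k (suc N) f u - C (suc k) (suc N) f u
  Y-step {k} Ik x zero f {u} G = ≈-trans
    (solve 3 (λ a b c → a :- c := (a :+ b) :- (b :+ c)) ≈-refl _ (C k 1 f u) _)
    (+-congˡ (-‿cong (≈-sym (C-step Ik zero f G))))
  Y-step {k} Ik x (suc N) f {u} G = begin
    x * (x * y u + c u) - M (suc k) (λ v → x * y v + c v) u
      ≈⟨ +-congˡ (-‿cong (≈-trans (Linear-M Ik .addᴸ _ c G) (+-congʳ (Linear-M Ik .scaleᴸ x y G)))) ⟩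
    x * (x * y u + c u) - (x * M (suc k) y u + M (suc k) c u)
      ≈⟨ solve 5 (λ x y c my mc → x :* (x :* y :+ c) :- (x :* my :+ mc) := x :* ((x :* y :- my) :+ c) :- mc) ≈-refl _ _ _ _ _ ⟩
    x * ((x * y u - M (suc k) y u) + c u) - M (suc k) c u ≈⟨ +-congʳ (*-congˡ (+-congʳ (Y-step Ik x N f G))) ⟩
    x * ((Y x k (suc N) f u - c u) + c u) - M (suc k) c u
      ≈⟨ solve 5 (λ x z c mc e → x :* ((z :- c) :+ c) :- mc := (x :* z :+ e) :- (e :+ mc)) ≈-refl _ _ _ _ (C k (suc (suc N)) f u) ⟩
    (x * Y x k (suc N) f u + C k (suc (suc N)) f u) - (C k (suc (suc N)) f u + M (suc k) c u)
      ≈⟨ +-congˡ (-‿cong (≈-sym (C-step Ik (suc N) f G))) ⟩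
    Y x k (suc (suc N)) f u - C (suc k) (suc (suc N)) f u ∎
    where
    y = Y x (suc k) N f
    c = C (suc k) (suc N) f

  Y-0 : ∀ x k N f {u} → (∀ m → m ≤ N → C k m f u ≈ 0#) → Y x k N f u ≈ 0#
  Y-0 x k zero f h = h 0 z≤n
  Y-0 x k (suc N) f h = ≈-trans (+-cong (≈-trans (*-congˡ (Y-0 x k N f (λ m le → h m (≤-trans le (ℕP.n≤1+n N))))) (zeroʳ x)) (h (suc N) ≤-refl)) (+-identityʳ 0#)

  module Kernel (X : ℕ → Carrier) where
    esX : ℕ → ℕ → ℕ → Carrier
    esX r o zero = 1#
    esX zero o (suc m) = 0#
    esX (suc r) o (suc m) = esX r (suc o) (suc m) - X (suc o) * esX r (suc o) m

    h : ℕ → ℕ → Carrier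
    h k zero = 1#
    h zero (suc m) = 0#
    h (suc k) (suc m) = h k (suc m) + X (suc k) * h (suc k) m

    P : ℕ → Fn → Fn
    P k = Y (X k) k (n ∸ k)

    Tl : ℕ → ℕ → Fn → Fn
    Tl k zero f = f
    Tl k (suc r) f = P (suc k) (Tl (suc k) r f)

    -- `Tl` and `Q` describe the same product of `P 1`, ..., `P n`. `Tl` peels off the first factor,
    -- as a chain uses its smallest index first; `Q` peels off the last, as the eigenvector argument
    -- adds one variable at a time.
    Q : ℕ → Fn → Fn
    Q zero f = f
    Q (suc k) f = Q k (P (suc k) f)

    Q-Tl : ∀ k r f → k ℕ.+ r ≡ n → Q k (Tl k r f) ≡ Q n f
    Q-Tl k zero f e = cong (λ z → Q z f) (trans (sym (ℕP.+-identityʳ k)) e)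
    Q-Tl k (suc r) f e = Q-Tl (suc k) r f (trans (sym (ℕP.+-suc k r)) e)

    Linear-Q : ∀ k → Linear (Q k)
    Linear-Q zero = Linear-id
    Linear-Q (suc k) = Linear-∘ (Linear-Q k) (Linear-Y (X (suc k)) (suc k) (n ∸ suc k))

    Commutes-Q : ∀ k → k ≤ n → Commutes (Q k)
    Commutes-Q zero le g Ij G = ≈-refl
    Commutes-Q (suc k) le {j} g Ij G = ≈-trans
      (Linear-Q k .congᴸ (λ H → ≈-sym (Y-commutes (Linear-M Ij) (op-commutes Ij) (X (suc k)) (suc k) (n ∸ suc k) g le H)) G)
      (Commutes-Q k (<⇒≤ le) (P (suc k) g) Ij G)

    -- `P (suc k)` climbs at most n-k-1 steps, so the remaining factors together climb at most the
    -- sum of `δ r`.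
    Tl-off : ∀ k r f → k ℕ.+ r ≡ n → Off (λ l → l < len (w₀ {n})) f → Off (λ l → l ℕ.+ V.sum (δ r) < len (w₀ {n})) (Tl k r f)
    Tl-off k zero f e h {u} G lt = h G (subst (_< len (w₀ {n})) (ℕP.+-identityʳ (len u)) lt)
    Tl-off k (suc r) f e h {u} G lt = Y-0 (X (suc k)) (suc k) (n ∸ suc k) g (λ m le →
        Off-C {λ l → l ℕ.+ V.sum (δ r) < len (w₀ {n})} (suc k) m g k<n (Tl-off (suc k) r f e′ h) G
          (≤-<-trans (subst₂ _≤_ (cong (ℕ._+ V.sum (δ r)) (ℕP.+-comm (len u) m)) (ℕP.+-assoc (len u) r _)
            (ℕP.+-monoˡ-≤ (V.sum (δ r)) (ℕP.+-monoʳ-≤ (len u) (subst (m ≤_) n∸k le)))) lt))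
      where
      g = Tl (suc k) r f
      e′ : suc k ℕ.+ r ≡ n
      e′ = trans (sym (ℕP.+-suc k r)) e
      k<n : suc k ≤ n
      k<n = subst (suc k ≤_) e′ (ℕP.m≤m+n (suc k) r)
      n∸k : n ∸ suc k ≡ r
      n∸k = trans (cong (_∸ suc k) (sym e′)) (ℕP.m+n∸m≡n (suc k) r)

    -- From a staircase, w₀ is within reach only if every factor climbs as far as it can. So each
    -- `Y` contributes its top term alone, which carries no power of X.
    Tl-staircase : ∀ k r f → k ℕ.+ r ≡ n → Off (λ l → l < len (w₀ {n})) f → Good (staircase (suc k) 1) →
      Tl k r f (staircase (suc k) 1) ≈ f w₀
    Tl-staircase k zero f e off G = ≈-reflexive (cong f (trans (cong (λ z → staircase (suc z) 1) (trans (sym (ℕP.+-identityʳ k)) e)) staircase-w₀))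
    Tl-staircase k (suc r) f e off G = ≈-trans (≈-reflexive (cong (λ z → Y (X (suc k)) (suc k) z g u) n∸k))
        (≈-trans (top r ≤-refl) (≈-trans (C-staircase r 0 g Ik (ℕP.≤-reflexive e′) G)
          (≈-trans (≈-reflexive (cong g st)) (Tl-staircase (suc k) r f e′ off (subst Good st (proj₁ (stairs r Ik (ℕP.≤-reflexive e′) G)))))))
      where
      g = Tl (suc k) r f
      u = staircase (suc k) 1
      e′ : suc k ℕ.+ r ≡ n
      e′ = trans (sym (ℕP.+-suc k r)) e
      Ik : In n (suc k)
      Ik = s≤s z≤n , subst (suc k ≤_) e′ (ℕP.m≤m+n (suc k) r)
      n∸k : n ∸ suc k ≡ r
      n∸k = trans (cong (_∸ suc k) (sym e′)) (ℕP.m+n∸m≡n (suc k) r)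
      st : staircase (suc k) (suc r) ≡ staircase (suc (suc k)) 1
      st = trans (cong (staircase (suc k)) (sym (trans (cong (_∸ k) (sym e)) (ℕP.m+n∸m≡n k (suc r))))) (staircase-next Ik)
      total : len (w₀ {n}) ≡ len u ℕ.+ (r ℕ.+ V.sum (δ r))
      total = staircase-len (suc r) e G
      low : ∀ m → m < r → C (suc k) m g u ≈ 0#
      low m m<r = Off-C {λ l → l ℕ.+ V.sum (δ r) < len (w₀ {n})} (suc k) m g (proj₂ Ik) (Tl-off (suc k) r f e′ off) G
        (subst₂ _<_ (cong (ℕ._+ V.sum (δ r)) (ℕP.+-comm (len u) m)) (trans (ℕP.+-assoc (len u) r _) (sym total))
          (ℕP.+-monoˡ-< (V.sum (δ r)) (ℕP.+-monoʳ-< (len u) m<r)))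
      top : ∀ N → N ≤ r → Y (X (suc k)) (suc k) N g u ≈ C (suc k) N g u
      top zero le = ≈-refl
      top (suc N) le = ≈-trans (+-congʳ (≈-trans (*-congˡ (Y-0 (X (suc k)) (suc k) N g (λ m m≤N → low m (≤-trans (s≤s m≤N) le)))) (zeroʳ _))) (+-identityˡ _)

    Tl-id : Tl 0 n (indicator w₀) idPerm ≈ 1#
    Tl-id = ≈-trans (≈-reflexive (cong (Tl 0 n (indicator w₀)) (sym staircase-id)))
      (≈-trans (Tl-staircase 0 n (indicator w₀) refl (λ {u} G lt → indicator-off w₀ u (λ e → <-irrefl (cong len {u} {w₀} e) lt))
        (subst Good (sym staircase-id) Good-id)) (indicator-at w₀))

    esX-large : ∀ r o m → r < m → esX r o m ≈ 0#
    esX-large zero o (suc m) lt = ≈-refl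
    esX-large (suc r) o (suc m) (s≤s lt) = ≈-trans (+-cong (esX-large r (suc o) (suc m) (≤-trans lt (ℕP.n≤1+n m)))
      (-‿cong (≈-trans (*-congˡ (esX-large r (suc o) m lt)) (zeroʳ _)))) (-‿inverseʳ 0#)

    private
      scalar : ℕ → Fn → Fn
      scalar k f u = X k * f u

      module Scalar = Action A n scalar (λ {k : ℕ} _ → Linear-scale (X k) Linear-id)
        (λ {j} {k} g _ _ _ → *-swapˡ (X j) (X k) _)

      es-scalar : ∀ r o m u → Scalar.es r o m (λ _ → 1#) u ≈ esX r o m
      es-scalar r o zero u = ≈-refl
      es-scalar zero o (suc m) u = ≈-refl
      es-scalar (suc r) o (suc m) u = +-cong (es-scalar r (suc o) (suc m) u) (-‿cong (*-congˡ (es-scalar r (suc o) m u)))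

    open Substitution A X

    eval-esym : ∀ m → sg m * esX n 0 m ≈ eval (esym n m)
    eval-esym m = begin
      sg m * esX n 0 m ≈⟨ *-cong (same m) (≈-sym (es-scalar n 0 m idPerm)) ⟩
      Scalar.sg m * Scalar.es n 0 m (λ _ → 1#) idPerm ≈⟨ Scalar.act-esym m (λ _ → 1#) Good-id ⟨
      Scalar.act (esym n m) (λ _ → 1#) idPerm ≈⟨ Scalar.Eigenvector.act-eigen X (λ _ → 1#) (λ _ _ → ≈-refl) (esym n m) Good-id ⟩
      eval (esym n m) * 1# ≈⟨ *-identityʳ _ ⟩
      eval (esym n m) ∎
      where
      same : ∀ m → sg m ≈ Scalar.sg m
      same zero = ≈-refl
      same (suc m) = -‿cong (same m)

    esX-vanish : (∀ m → m < n → eval (esym n (suc m)) ≈ 0#) → ∀ m → esX n 0 (suc m) ≈ 0#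
    esX-vanish h m with suc m ≤? n
    ... | no ¬le = esX-large n 0 (suc m) (≰⇒> ¬le)
    ... | yes le = begin
      esX n 0 (suc m) ≈⟨ sg-cancel (suc m) _ ⟨
      sg (suc m) * (sg (suc m) * esX n 0 (suc m)) ≈⟨ *-congˡ (≈-trans (eval-esym (suc m)) (h m le)) ⟩
      sg (suc m) * 0# ≈⟨ zeroʳ _ ⟩
      0# ∎

    module _ (esX-zero : ∀ m → esX n 0 (suc m) ≈ 0#) where
      -- Scalar twin of `es-C`, in the opposite direction. For the operators the vanishing is known
      -- at k = n; for the scalars the hypothesis gives it at k = 0, so the recursion runs upwards.
      h-esX : ∀ k r m → k ℕ.+ r ≡ n → h k m ≈ esX r k m
      h-esX k r zero e = ≈-refl
      h-esX zero r (suc m) refl = ≈-sym (esX-zero m)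
      h-esX (suc k) r (suc m) e = ≈-trans (+-cong (h-esX k (suc r) (suc m) (trans (ℕP.+-suc k r) e)) (*-congˡ (h-esX (suc k) r m e)))
        (solve 2 (λ a b → (a :- b) :+ b := a) ≈-refl _ _)

      C-eigen : ∀ {f} k m → k ≤ n → (∀ {j} → In k j → M j f ≐ (λ u → X j * f u)) → C k m f ≐ (λ u → h k m * f u)
      C-eigen k zero le eig G = ≈-sym (*-identityˡ _)
      C-eigen zero (suc m) le eig G = ≈-trans (C-first m _) (≈-sym (zeroˡ _))
      C-eigen {f} (suc k) (suc m) le eig {u} G = begin
        C (suc k) (suc m) f u ≈⟨ C-step Ik m f G ⟩
        C k (suc m) f u + M (suc k) (C (suc k) m f) u
          ≈⟨ +-cong (C-eigen k (suc m) (<⇒≤ le) (λ (a , b) → eig (a , ≤-trans b (ℕP.n≤1+n k))) G)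
               (≈-trans (Linear-M Ik .congᴸ (C-eigen (suc k) m le eig) G) (≈-trans (Linear-M Ik .scaleᴸ (h (suc k) m) f G) (*-congˡ (eig (s≤s z≤n , ≤-refl) G)))) ⟩
        h k (suc m) * f u + h (suc k) m * (X (suc k) * f u)
          ≈⟨ solve 4 (λ a b c d → (a :* d) :+ (b :* (c :* d)) := (a :+ (c :* b)) :* d) ≈-refl _ _ _ _ ⟩
        h (suc k) (suc m) * f u ∎
        where
        Ik : In n (suc k)
        Ik = s≤s z≤n , le

      -- Grouping h_N(X_1,...,X_{k+1}) by powers of X_{k+1} gives the sum over m of X_{k+1}^{N-m}
      -- h_m(X_1,...,X_k).
      Y-eigen : ∀ {f} k N → k ≤ n → (∀ {j} → In k j → M j f ≐ (λ u → X j * f u)) → Y (X (suc k)) k N f ≐ (λ u → h (suc k) N * f u)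
      Y-eigen k zero le eig G = ≈-sym (*-identityˡ _)
      Y-eigen {f} k (suc N) le eig {u} G = ≈-trans (+-cong (*-congˡ (Y-eigen k N le eig G)) (C-eigen k (suc N) le eig G))
        (solve 4 (λ x a b d → (x :* (a :* d)) :+ (b :* d) := (b :+ (x :* a)) :* d) ≈-refl _ _ _ _)

      -- In the new case j = k+1, `Y-step` rewrites X - M applied to the last factor as a `Y` in k
      -- variables, the truncation error vanishing by `C-vanish`. Moved outside `Q k`, it meets a
      -- function on which the first k operators are already scalars. There it acts as
      -- h_{n-k}(X_1,...,X_{k+1}), which is zero.
      Q-eigen : ∀ k → k ≤ n → ∀ {j} f → In k j → M j (Q k f) ≐ (λ u → X j * Q k f u)
      Q-eigen zero le f (a , b) = ⊥-elim (<⇒≱ a b)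
      Q-eigen (suc k) le {j} f (1≤j , j≤) {u} G with m≤n⇒m<n∨m≡n j≤
      ... | inj₁ lt = Q-eigen k (<⇒≤ le) (P (suc k) f) (1≤j , ≤-pred lt) G
      ... | inj₂ refl = begin
        M (suc k) (Q k Pf) u ≈⟨ Commutes-Q k (<⇒≤ le) Pf Ik G ⟨
        Q k (M (suc k) Pf) u ≈⟨ solve 2 (λ a b → a := b :- (b :- a)) ≈-refl _ (Q k (λ v → X (suc k) * Pf v) u) ⟩
        Q k (λ v → X (suc k) * Pf v) u - (Q k (λ v → X (suc k) * Pf v) u - Q k (M (suc k) Pf) u)
          ≈⟨ +-cong (Linear-Q k .scaleᴸ _ Pf G) (-‿cong (≈-trans (≈-sym (minusᴸ (Linear-Q k) _ (M (suc k) Pf) G)) difference)) ⟩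
        X (suc k) * Q k Pf u - 0# ≈⟨ x-0≈x _ ⟩
        X (suc k) * Q k Pf u ∎
        where
        Pf = P (suc k) f
        Ik : In n (suc k)
        Ik = s≤s z≤n , le
        N = n ∸ suc k
        sucN : suc k ℕ.+ N ≡ n
        sucN = ℕP.m+[n∸m]≡n le
        h-zero : h (suc k) (suc N) ≈ 0#
        h-zero = ≈-trans (h-esX (suc k) N (suc N) sucN) (esX-large N (suc k) (suc N) ≤-refl)
        difference : Q k (λ v → X (suc k) * Pf v - M (suc k) Pf v) u ≈ 0#
        difference = begin
          Q k (λ v → X (suc k) * Pf v - M (suc k) Pf v) u
            ≈⟨ Linear-Q k .congᴸ (λ {v} H → ≈-trans (Y-step Ik (X (suc k)) N f H)
                 (≈-trans (+-congˡ (-‿cong (C-vanish N (suc k) (suc N) sucN ≤-refl f H))) (x-0≈x _))) G ⟩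
          Q k (Y (X (suc k)) k (suc N) f) u ≈⟨ Y-commutes (Linear-Q k) (Commutes-Q k (<⇒≤ le)) (X (suc k)) k (suc N) f (<⇒≤ le) G ⟩
          Y (X (suc k)) k (suc N) (Q k f) u ≈⟨ Y-eigen k (suc N) (<⇒≤ le) (λ Ij → Q-eigen k (<⇒≤ le) f Ij) G ⟩
          h (suc k) (suc N) * Q k f u ≈⟨ ≈-trans (*-congʳ h-zero) (zeroˡ _) ⟩
          0# ∎

      -- The kernel turns chains into products: all multiplication operators act on its image as scalars.
      kernel-formula : ∀ {u w} → Good u → Good w →
        Tl 0 n (indicator w) u ≈ eval (schub (w0mul w)) * eval (schub u)
      kernel-formula {u} {w} G H = begin
        Tl 0 n (indicator w) u ≡⟨ cong-app (Q-Tl 0 n (indicator w) refl) u ⟩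
        Q n (indicator w) u ≈⟨ Linear-Q n .congᴸ (λ {v} V → ≈-trans (≈-reflexive (cong (λ z → indicator z v) (sym (w0mul-invol H))))
                                 (≈-sym (schub-dual (n ℕ.* n) (Good-w0mul H) (ℕP.m≤m+n (n ℕ.* n) _) V))) G ⟩
        Q n (act (schub (w0mul w)) (indicator w₀)) u ≈⟨ act-commutes (schub (w0mul w)) (indicator w₀) (Linear-Q n) (Commutes-Q n ≤-refl) G ⟩
        act (schub (w0mul w)) K u ≈⟨ act-eigen (schub (w0mul w)) G ⟩
        eval (schub (w0mul w)) * K u
          -- `K u` is read off at the identity: it is `schub u` acting on `K` there, hence
          -- `eval (schub u)` times the value 1 of `K` at the identity.
          ≈⟨ *-congˡ (≈-trans (≈-sym (schub-at-id (n ℕ.* n) G (ℕP.m≤m+n (n ℕ.* n) _) K)) (≈-trans (act-eigen (schub u) Good-id)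
               (≈-trans (*-congˡ (≈-trans (≈-reflexive (cong-app (sym (Q-Tl 0 n (indicator w₀) refl)) idPerm)) Tl-id)) (*-identityʳ _)))) ⟩
        eval (schub (w0mul w)) * eval (schub u) ∎
        where
        K = Q n (indicator w₀)
        open Eigenvector X K (Q-eigen n ≤-refl (indicator w₀))

-- Increasing chains

∈-concatMap : ∀ {X Y : Set} (h : X → List Y) {xs y} → y ∈ concatMap h xs → ∃ λ x → x ∈ xs × y ∈ h x
∈-concatMap h {xs} m = find (∈-concatMap⁻ h {xs} m)

labelEq : Label → Label → Bool
labelEq (k , b) (l , c) = (k ≡ᵇ l) ∧ (b ≡ᵇ c)

labelEq⇒≡ : ∀ x y → T (labelEq x y) → x ≡ y
labelEq⇒≡ (k , b) (l , c) t = let (p , q) = ∧-elim {k ≡ᵇ l} t in cong₂ _,_ (≡ᵇ⇒≡ k l p) (≡ᵇ⇒≡ b c q)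

labelEq-refl : ∀ x → T (labelEq x x)
labelEq-refl (k , b) = ∧-intro (≡⇒≡ᵇ k k refl) (≡⇒≡ᵇ b b refl)

_∈ᵇ_ : Label → List Label → Bool
x ∈ᵇ Λ = any (labelEq x) Λ

headIn : List Label → List Label → Bool
headIn Λ [] = true
headIn Λ (x ∷ _) = x ∈ᵇ Λ

count : ℕ → List Label → ℕ
count k γ = length (filterᵇ (λ kb → proj₁ kb ≡ᵇ k) γ)

module Chains (A : RingOverℤ) (n : ℕ) where
  open Sums A
  open RangeSums A
  open LinearForms A
  open Operators A n
  open Pieri A n
  open Evaluation A n
  open Complete A n

  InGrid : Label → Set
  InGrid (k , b) = In n k × In n b

  -- Closed Λ: consecutive labels of Λ leave no gap, so "larger than the head" means "in the tail".
  data Closed : List Label → Set where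
    [] : Closed []
    _∷_ : ∀ {x Λ} → (∀ {y} → InGrid y → lexLt x y ≡ y ∈ᵇ Λ) → Closed Λ → Closed (x ∷ Λ)

  edges-good : ∀ {u} → Good u → ∀ {e} → e ∈ edges u → InGrid (proj₁ e) × Good (proj₂ e)
  edges-good {u} G {e} m = outer (∈-concatMap row m)
    where
    cell : ℕ → ℕ → List (Label × Vec ℕ n)
    cell i j = map (λ k → ((k , ent u i) , swapPos i j u)) (range i (j ∸ 1))
    row : ℕ → List (Label × Vec ℕ n)
    row i = concatMap (λ j → if coverᵇ u i j then cell i j else []) (range (suc i) n)
    inner : ∀ i j b → In n i → j ∈ range (suc i) n → e ∈ (if b then cell i j else []) → InGrid (proj₁ e) × Good (proj₂ e)
    inner i j true Ii mj m′ with ∈-map⁻ (λ k → ((k , ent u i) , swapPos i j u)) m′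
    ... | k , mk , refl =
      let (i<j , j≤n) = ∈-range⁻ {suc i} {n} mj
          (i≤k , k≤) = ∈-range⁻ {i} {j ∸ 1} mk
          Ij = ≤-trans (s≤s z≤n) i<j , j≤n
      in ((≤-trans (proj₁ Ii) i≤k , ≤-trans k≤ (≤-trans (ℕP.m∸n≤m j 1) j≤n)) , G .bound Ii) , Good-swap Ii Ij G
    outer : ∃ (λ i → i ∈ range 1 n × e ∈ row i) → InGrid (proj₁ e) × Good (proj₂ e)
    outer (i , mi , m₁) = let (j , mj , m₂) = ∈-concatMap (λ j → if coverᵇ u i j then cell i j else []) m₁
      in inner i j (coverᵇ u i j) (∈⇒In mi) mj m₂

  chains-head : ∀ {u} → Good u → ∀ m {c} → c ∈ chains m u → proj₁ c ≡ [] ⊎ ∃ λ x → ∃ λ γ → proj₁ c ≡ x ∷ γ × InGrid x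
  chains-head G zero (here refl) = inj₁ refl
  chains-head {u} G (suc m) {c} mc = go (∈-concatMap extend mc)
    where
    extend : Label × Vec ℕ n → List (List Label × Vec ℕ n)
    extend e = map (λ c → (proj₁ e ∷ proj₁ c , proj₂ c)) (chains m (proj₂ e))
    go : ∃ (λ e → e ∈ edges u × c ∈ extend e) → proj₁ c ≡ [] ⊎ ∃ λ x → ∃ λ γ → proj₁ c ≡ x ∷ γ × InGrid x
    go (e , me , m′) with ∈-map⁻ (λ c → (proj₁ e ∷ proj₁ c , proj₂ c)) m′
    ... | c′ , _ , refl = inj₂ (proj₁ e , proj₁ c′ , refl , proj₁ (edges-good G me))

  -- A cover by (i j) has j - i parallel edges. Exactly one carries the index k when i ≤ k < j, and
  -- none otherwise.
  edge-sum : ∀ k b h u → Σl (edges u) (λ e → labelEq (proj₁ e) (k , b) ⊙ h (proj₂ e)) ≈ Tᵇ k b h u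
  edge-sum k b h u = ≈-trans (Σ-concatMap _ (range 1 n) _) (Σ-cong (Ps n) (λ {i} _ →
      ≈-trans (Σ-concatMap _ (range (suc i) n) _) (≈-trans (Σ-above {n} {i} _) (Σ-cong (Ps n) (λ {j} _ → cell i j)))))
    where
    labels : ∀ i j c x → i < j → Σl (range i (j ∸ 1)) (λ l → ((l ≡ᵇ k) ∧ c) ⊙ x) ≈ ((i <ᵇ suc k) ∧ ((k <ᵇ j) ∧ c)) ⊙ x
    labels i (suc j) c x _ with i ≤? k | k ≤? j
    ... | yes le | yes le′ = ≈-trans (Σ-single (Unique-range i j) (∈-range⁺ le le′)
            (λ {l} _ ne → ⊙-¬ ((l ≡ᵇ k) ∧ c) (λ t → ne (≡ᵇ⇒≡ l k (proj₁ (∧-elim {l ≡ᵇ k} t))))))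
          (≈-reflexive (cong (_⊙ x) (T-iff (λ t → ∧-intro (<⇒<ᵇ (s≤s le)) (∧-intro (<⇒<ᵇ (s≤s le′)) (proj₂ (∧-elim {k ≡ᵇ k} t))))
            (λ t → ∧-intro (≡⇒≡ᵇ k k refl) (proj₂ (∧-elim {k <ᵇ suc j} (proj₂ (∧-elim {i <ᵇ suc k} t))))))))
    ... | no nle | _ = ≈-trans (Σ-0 (range i j) (λ {l} m → ⊙-¬ ((l ≡ᵇ k) ∧ c) (λ t →
            nle (subst (i ≤_) (≡ᵇ⇒≡ l k (proj₁ (∧-elim {l ≡ᵇ k} t))) (proj₁ (∈-range⁻ {i} {j} m))))))
          (≈-sym (⊙-¬ ((i <ᵇ suc k) ∧ ((k <ᵇ suc j) ∧ c)) (λ t → nle (≤-pred (<ᵇ⇒< i (suc k) (proj₁ (∧-elim {i <ᵇ suc k} t)))))))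
    ... | yes _ | no nle = ≈-trans (Σ-0 (range i j) (λ {l} m → ⊙-¬ ((l ≡ᵇ k) ∧ c) (λ t →
            nle (subst (_≤ j) (≡ᵇ⇒≡ l k (proj₁ (∧-elim {l ≡ᵇ k} t))) (proj₂ (∈-range⁻ {i} {j} m))))))
          (≈-sym (⊙-¬ ((i <ᵇ suc k) ∧ ((k <ᵇ suc j) ∧ c)) (λ t → nle (≤-pred (<ᵇ⇒< k (suc j) (proj₁ (∧-elim {k <ᵇ suc j} (proj₂ (∧-elim {i <ᵇ suc k} t)))))))))
    cell : ∀ i j → (i <ᵇ j) ⊙ Σl (if coverᵇ u i j then map (λ l → ((l , ent u i) , swapPos i j u)) (range i (j ∸ 1)) else [])
        (λ e → labelEq (proj₁ e) (k , b) ⊙ h (proj₂ e)) ≈ T-gate k b i j u ⊙ τ i j h u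
    cell i j = begin
      (i <ᵇ j) ⊙ Σl (if cv then map (λ l → ((l , ent u i) , swapPos i j u)) (range i (j ∸ 1)) else []) (λ e → labelEq (proj₁ e) (k , b) ⊙ h (proj₂ e))
        ≈⟨ ⊙-congT (i <ᵇ j) (λ t → ≈-trans (Σ-if cv _ _) (⊙-cong cv (≈-trans
             (Σ-map {X = Label × Vec ℕ n} (λ l → ((l , ent u i) , swapPos i j u)) (range i (j ∸ 1)) _) (labels i j (ent u i ≡ᵇ b) x (<ᵇ⇒< i j t))))) ⟩
      (i <ᵇ j) ⊙ cv ⊙ gt ⊙ x ≈⟨ ⊙-∧ (i <ᵇ j) cv _ ⟨
      up u i j ⊙ gt ⊙ x ≈⟨ ⊙-swap (up u i j) gt x ⟩
      gt ⊙ up u i j ⊙ x ≈⟨ ⊙-cong gt (τ-def i j h u) ⟨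
      gt ⊙ τ i j h u ∎
      where
      cv = coverᵇ u i j
      gt = T-gate k b i j u
      x = h (swapPos i j u)

  -- Transfer operator: for each label of the list in turn, a chain either skips it or takes an edge
  -- with it. The chains are thus sorted by construction, and `G` sees the labels taken together
  -- with the end point.
  W : List Label → (List Label → Fn) → Fn
  W [] G = G []
  W ((k , b) ∷ Λ) G u = W Λ G u + Tᵇ k b (W Λ (λ γ → G ((k , b) ∷ γ))) u

  T-local : ∀ {k b f g u} → Good u → (∀ {v} → Good v → len v ≡ suc (len u) → f v ≈ g v) → Tᵇ k b f u ≈ Tᵇ k b g u
  T-local {k} {b} {f} {g} {u} G h = Σ-cong (Ps n) (λ {i} mi → Σ-cong (Ps n) (λ {j} mj → ⊙-cong (T-gate k b i j u)
    (≈-trans (τ-def i j f u) (≈-trans (⊙-congT (up u i j) (λ t → let (i<j , c) = up⁻ u t in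
      h (Good-swap (∈⇒In mi) (∈⇒In mj) G) (len-cover u G (∈⇒In mi) (∈⇒In mj) i<j c))) (≈-sym (τ-def i j g u))))))

  -- The integrands need to agree only at pairs that can occur: labels from the list, and an end
  -- point whose length has grown by the number of labels.
  W-cong : ∀ (P : Label → Set) Λ {G H u} → Good u → (∀ {x} → x ∈ Λ → P x) →
    (∀ γ {v} → All P γ → Good v → len v ≡ len u ℕ.+ length γ → G γ v ≈ H γ v) → W Λ G u ≈ W Λ H u
  W-cong P [] Gu p e = e [] [] Gu (sym (ℕP.+-identityʳ _))
  W-cong P ((k , b) ∷ Λ) {u = u} Gu p e = +-cong (W-cong P Λ Gu (p ∘ there) e) (T-local Gu (λ Gv lv →
    W-cong P Λ Gv (p ∘ there) (λ γ a Gx lx → e ((k , b) ∷ γ) (p (here refl) ∷ a) Gx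
      (trans lx (trans (cong (ℕ._+ length γ) lv) (sym (ℕP.+-suc (len u) (length γ))))))))

  W-zero : ∀ Λ {G u} → Good u → (∀ γ v → G γ v ≈ 0#) → W Λ G u ≈ 0#
  W-zero [] Gu h = h [] _
  W-zero ((k , b) ∷ Λ) Gu h = ≈-trans (+-cong (W-zero Λ Gu h)
    (zeroᴸ (Linear-T k b) (λ Gv → W-zero Λ Gv (λ γ → h ((k , b) ∷ γ))) Gu)) (+-identityʳ 0#)

  increasing-∷ : ∀ {x Λ} → (∀ {y} → InGrid y → lexLt x y ≡ y ∈ᵇ Λ) → ∀ {γ} → γ ≡ [] ⊎ (∃ λ y → ∃ λ γ′ → γ ≡ y ∷ γ′ × InGrid y) →
    increasing (x ∷ γ) ≡ increasing γ ∧ headIn Λ γ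
  increasing-∷ h (inj₁ refl) = refl
  increasing-∷ {x} h (inj₂ (y , γ′ , refl , Iy)) = trans (cong (_∧ increasing (y ∷ γ′)) (h Iy)) (∧-comm _ (increasing (y ∷ γ′)))

  lexLt-irrefl : ∀ x → ¬ T (lexLt x x)
  lexLt-irrefl (k , b) t with Equivalence.to (T-∨ {k <ᵇ k}) t
  ... | inj₁ p = <-irrefl refl (<ᵇ⇒< k k p)
  ... | inj₂ p = <-irrefl refl (<ᵇ⇒< b b (proj₂ (∧-elim {k ≡ᵇ k} p)))

  -- Chains are split by whether their first label is the head x of the list. If it is, `Closed`
  -- turns the condition that the second label exceeds x into membership in the tail, so the rest of
  -- the chain is again of the form being counted.
  chain-W : ∀ {Λ} → Closed Λ → ∀ m (G : List Label → Fn) {u} → Good u →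
    Σl (chains m u) (λ c → (increasing (proj₁ c) ∧ headIn Λ (proj₁ c)) ⊙ G (proj₁ c) (proj₂ c)) ≈
    W Λ (λ γ v → (length γ ≡ᵇ m) ⊙ G γ v) u
  chain-W [] zero G Gu = +-identityʳ _
  chain-W [] (suc m) G {u} Gu = ≈-trans (Σ-concatMap _ (edges u) _) (Σ-0 (edges u) (λ {e} _ →
    ≈-trans (Σ-map _ (chains m (proj₂ e)) _) (Σ-0 (chains m (proj₂ e)) (λ {c} _ →
      ⊙-¬ (increasing (proj₁ e ∷ proj₁ c) ∧ false) (λ t → proj₂ (∧-elim {increasing (proj₁ e ∷ proj₁ c)} t))))))
  chain-W {(k , b) ∷ Λ} (_ ∷ cl) zero G {u} Gu = ≈-trans (chain-W cl zero G Gu) (≈-sym (≈-trans (+-congˡ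
    (zeroᴸ (Linear-T k b) (λ Gv → W-zero Λ Gv (λ γ v → ≈-refl)) Gu)) (+-identityʳ _)))
  chain-W {x@(k , b) ∷ Λ} (h ∷ cl) (suc m) G {u} Gu = begin
    Σl (chains (suc m) u) (λ c → (increasing (proj₁ c) ∧ headIn (x ∷ Λ) (proj₁ c)) ⊙ G (proj₁ c) (proj₂ c))
      ≈⟨ expand (x ∷ Λ) ⟩
    Σl (edges u) (λ e → Σl (chains m (proj₂ e)) (λ c → (increasing (proj₁ e ∷ proj₁ c) ∧ (labelEq (proj₁ e) x ∨ proj₁ e ∈ᵇ Λ)) ⊙ G (proj₁ e ∷ proj₁ c) (proj₂ c)))
      ≈⟨ Σ-cong (edges u) (λ {e} me → ≈-trans (Σ-cong (chains m (proj₂ e)) (λ {c} _ → disjoint e (proj₁ (edges-good Gu me)) (increasing (proj₁ e ∷ proj₁ c)) (G (proj₁ e ∷ proj₁ c) (proj₂ c)))) (Σ-+ (chains m (proj₂ e)) _ _)) ⟩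
    Σl (edges u) (λ e → Σl (chains m (proj₂ e)) (λ c → (increasing (proj₁ e ∷ proj₁ c) ∧ proj₁ e ∈ᵇ Λ) ⊙ G (proj₁ e ∷ proj₁ c) (proj₂ c)) +
                        Σl (chains m (proj₂ e)) (λ c → labelEq (proj₁ e) x ⊙ increasing (proj₁ e ∷ proj₁ c) ⊙ G (proj₁ e ∷ proj₁ c) (proj₂ c)))
      ≈⟨ Σ-+ (edges u) _ _ ⟩
    Σl (edges u) (λ e → Σl (chains m (proj₂ e)) (λ c → (increasing (proj₁ e ∷ proj₁ c) ∧ proj₁ e ∈ᵇ Λ) ⊙ G (proj₁ e ∷ proj₁ c) (proj₂ c))) +
    Σl (edges u) (λ e → Σl (chains m (proj₂ e)) (λ c → labelEq (proj₁ e) x ⊙ increasing (proj₁ e ∷ proj₁ c) ⊙ G (proj₁ e ∷ proj₁ c) (proj₂ c)))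
      ≈⟨ +-cong (≈-trans (≈-sym (expand Λ)) (chain-W cl (suc m) G Gu)) (≈-trans (Σ-cong (edges u) (λ {e} me → first e (proj₂ (edges-good Gu me)))) (edge-sum k b _ u)) ⟩
    W Λ (λ γ v → (length γ ≡ᵇ suc m) ⊙ G γ v) u + Tᵇ k b (W Λ (λ γ v → (length γ ≡ᵇ m) ⊙ G (x ∷ γ) v)) u ∎
    where
    expand : ∀ Λ → Σl (chains (suc m) u) (λ c → (increasing (proj₁ c) ∧ headIn Λ (proj₁ c)) ⊙ G (proj₁ c) (proj₂ c)) ≈
      Σl (edges u) (λ e → Σl (chains m (proj₂ e)) (λ c → (increasing (proj₁ e ∷ proj₁ c) ∧ proj₁ e ∈ᵇ Λ) ⊙ G (proj₁ e ∷ proj₁ c) (proj₂ c)))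
    expand Λ = ≈-trans (Σ-concatMap _ (edges u) _) (Σ-cong (edges u) (λ {e} _ → Σ-map {X = List Label × Vec ℕ n} _ (chains m (proj₂ e)) _))
    disjoint : ∀ (e : Label × Vec ℕ n) → InGrid (proj₁ e) → ∀ i z →
      (i ∧ (labelEq (proj₁ e) x ∨ proj₁ e ∈ᵇ Λ)) ⊙ z ≈ (i ∧ proj₁ e ∈ᵇ Λ) ⊙ z + labelEq (proj₁ e) x ⊙ i ⊙ z
    disjoint e Ie false z = ≈-sym (≈-trans (+-identityˡ _) (⊙-0 (labelEq (proj₁ e) x)))
    disjoint e Ie true z = go (labelEq (proj₁ e) x) (proj₁ e ∈ᵇ Λ) (λ t → labelEq⇒≡ (proj₁ e) x t) refl
      where
      go : ∀ p q → (T p → proj₁ e ≡ x) → proj₁ e ∈ᵇ Λ ≡ q → (p ∨ q) ⊙ z ≈ q ⊙ z + p ⊙ z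
      go false q f eq = ≈-sym (+-identityʳ _)
      go true false f eq = ≈-sym (+-identityˡ _)
      -- x cannot occur in the tail, since by `Closed` it would be smaller than itself. Hence the
      -- disjunction becomes a sum.
      go true true f eq = ⊥-elim (lexLt-irrefl x (subst T (sym (trans (h (subst InGrid (f tt) Ie))
        (trans (cong (_∈ᵇ Λ) (sym (f tt))) eq))) tt))
    first : ∀ e → Good (proj₂ e) → Σl (chains m (proj₂ e)) (λ c → labelEq (proj₁ e) x ⊙ increasing (proj₁ e ∷ proj₁ c) ⊙ G (proj₁ e ∷ proj₁ c) (proj₂ c)) ≈
      labelEq (proj₁ e) x ⊙ W Λ (λ γ v → (length γ ≡ᵇ m) ⊙ G (x ∷ γ) v) (proj₂ e)
    first (y , v) Gv = ≈-trans (≈-sym (Σ-⊙ (labelEq y x) (chains m v) _)) (⊙-congT (labelEq y x) (λ t → at y (labelEq⇒≡ y x t)))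
      where
      at : ∀ y → y ≡ x → Σl (chains m v) (λ c → increasing (y ∷ proj₁ c) ⊙ G (y ∷ proj₁ c) (proj₂ c)) ≈ W Λ (λ γ v → (length γ ≡ᵇ m) ⊙ G (x ∷ γ) v) v
      at y refl = ≈-trans (Σ-cong (chains m v) (λ {c} mc → ≈-reflexive (cong (_⊙ G (x ∷ proj₁ c) (proj₂ c)) (increasing-∷ h (chains-head Gv m mc)))))
        (chain-W cl m (λ γ → G (x ∷ γ)) Gv)

  block : ℕ → List ℕ → List Label → List Label
  block k bs Λ = map (k ,_) bs ++ Λ

  grid : ℕ → ℕ → List Label
  grid k zero = []
  grid k (suc r) = block (suc k) (scan n 0) (grid (suc k) r)

  InBlock : ℕ → ℕ → ℕ → Label → Set
  InBlock K b s (k , c) = k ≡ K × b < c × c ≤ b ℕ.+ s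

  any-block⁻ : ∀ K s b Λ x → T (x ∈ᵇ block K (scan s b) Λ) → InBlock K b s x ⊎ T (x ∈ᵇ Λ)
  any-block⁻ K zero b Λ x t = inj₂ t
  any-block⁻ K (suc s) b Λ x t with Equivalence.to (T-∨ {labelEq x (K , suc b)}) t
  ... | inj₁ p with labelEq⇒≡ x (K , suc b) p
  ...   | refl = inj₁ (refl , n<1+n b , subst (suc b ≤_) (sym (ℕP.+-suc b s)) (s≤s (ℕP.m≤m+n b s)))
  any-block⁻ K (suc s) b Λ x t | inj₂ q with any-block⁻ K s (suc b) Λ x q
  ... | inj₁ (e , lt , le) = inj₁ (e , <-trans (n<1+n b) lt , subst (proj₂ x ≤_) (sym (ℕP.+-suc b s)) le)
  ... | inj₂ r = inj₂ r

  any-block⁺ : ∀ K s b Λ x → InBlock K b s x ⊎ T (x ∈ᵇ Λ) → T (x ∈ᵇ block K (scan s b) Λ)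
  any-block⁺ K zero b Λ (k , c) (inj₁ (_ , lt , le)) = ⊥-elim (<⇒≱ lt (subst (c ≤_) (ℕP.+-identityʳ b) le))
  any-block⁺ K zero b Λ x (inj₂ t) = t
  any-block⁺ K (suc s) b Λ (k , c) (inj₁ (refl , lt , le)) with m≤n⇒m<n∨m≡n lt
  ... | inj₂ refl = Equivalence.from (T-∨ {labelEq (K , c) (K , c)}) (inj₁ (labelEq-refl (K , c)))
  ... | inj₁ lt′ = Equivalence.from (T-∨ {labelEq (K , c) (K , suc b)}) (inj₂ (any-block⁺ K s (suc b) Λ (K , c) (inj₁ (refl , lt′ , subst (c ≤_) (ℕP.+-suc b s) le))))
  any-block⁺ K (suc s) b Λ x (inj₂ t) = Equivalence.from (T-∨ {labelEq x (K , suc b)}) (inj₂ (any-block⁺ K s (suc b) Λ x (inj₂ t)))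

  any-grid⁻ : ∀ r k x → T (x ∈ᵇ grid k r) → k < proj₁ x
  any-grid⁻ (suc r) k x t with any-block⁻ (suc k) n 0 (grid (suc k) r) x t
  ... | inj₁ (refl , _) = n<1+n k
  ... | inj₂ q = <-trans (n<1+n k) (any-grid⁻ r (suc k) x q)

  any-grid⁺ : ∀ r k x → k ℕ.+ r ≡ n → InGrid x → k < proj₁ x → T (x ∈ᵇ grid k r)
  any-grid⁺ zero k (l , c) e ((_ , l≤n) , _) lt = ⊥-elim (<⇒≱ lt (subst (l ≤_) (trans (sym e) (ℕP.+-identityʳ k)) l≤n))
  any-grid⁺ (suc r) k (l , c) e Ix lt = any-block⁺ (suc k) n 0 (grid (suc k) r) (l , c) (go (m≤n⇒m<n∨m≡n lt))
    where
    go : suc k < l ⊎ suc k ≡ l → InBlock (suc k) 0 n (l , c) ⊎ T ((l , c) ∈ᵇ grid (suc k) r)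
    go (inj₁ p) = inj₂ (any-grid⁺ r (suc k) (l , c) (trans (sym (ℕP.+-suc k r)) e) Ix p)
    go (inj₂ p) = inj₁ (sym p , proj₂ Ix)

  Closed-block : ∀ s b r k → b ℕ.+ s ≡ n → k ℕ.+ r ≡ n → Closed (grid k r) → Closed (block k (scan s b) (grid k r))
  Closed-block zero b r k e e′ cl = cl
  Closed-block (suc s) b r k e e′ cl = step ∷ Closed-block s (suc b) r k e″ e′ cl
    where
    e″ : suc b ℕ.+ s ≡ n
    e″ = trans (sym (ℕP.+-suc b s)) e
    step : ∀ {y} → InGrid y → lexLt (k , suc b) y ≡ y ∈ᵇ block k (scan s (suc b)) (grid k r)
    step {l , c} Iy = T-iff to from
      where
      to : T (lexLt (k , suc b) (l , c)) → T ((l , c) ∈ᵇ block k (scan s (suc b)) (grid k r))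
      to t with Equivalence.to (T-∨ {k <ᵇ l}) t
      ... | inj₁ p = any-block⁺ k s (suc b) (grid k r) (l , c) (inj₂ (any-grid⁺ r k (l , c) e′ Iy (<ᵇ⇒< k l p)))
      ... | inj₂ p = let (q , w) = ∧-elim {k ≡ᵇ l} p in any-block⁺ k s (suc b) (grid k r) (l , c)
              (inj₁ (sym (≡ᵇ⇒≡ k l q) , <ᵇ⇒< (suc b) c w , subst (c ≤_) (sym e″) (proj₂ (proj₂ Iy))))
      from : T ((l , c) ∈ᵇ block k (scan s (suc b)) (grid k r)) → T (lexLt (k , suc b) (l , c))
      from t with any-block⁻ k s (suc b) (grid k r) (l , c) t
      ... | inj₁ (refl , lt , _) = Equivalence.from (T-∨ {k <ᵇ k}) (inj₂ (∧-intro (≡⇒≡ᵇ k k refl) (<⇒<ᵇ lt)))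
      ... | inj₂ q = Equivalence.from (T-∨ {k <ᵇ l}) (inj₁ (<⇒<ᵇ (any-grid⁻ r k (l , c) q)))

  Closed-grid : ∀ r k → k ℕ.+ r ≡ n → Closed (grid k r)
  Closed-grid zero k e = []
  Closed-grid (suc r) k e = Closed-block n 0 r (suc k) refl e′ (Closed-grid r (suc k) e′)
    where
    e′ : suc k ℕ.+ r ≡ n
    e′ = trans (sym (ℕP.+-suc k r)) e

  ∈⇒∈ᵇ : ∀ {x Λ} → x ∈ Λ → T (x ∈ᵇ Λ)
  ∈⇒∈ᵇ {x} (here refl) = Equivalence.from (T-∨ {labelEq x x}) (inj₁ (labelEq-refl x))
  ∈⇒∈ᵇ {x} (there {y} m) = Equivalence.from (T-∨ {labelEq x y}) (inj₂ (∈⇒∈ᵇ m))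

  -- The labels of the block enter the integrand only through their number m, with weight `ω m`.
  -- Grouping by m leaves the unweighted count, which is `S`; `B` is any bound above the possible m.
  W-block : ∀ K bs Λ (P : Label → Set) {H} B (ω : ℕ → Carrier) {G u} → Good u → length bs < B → (∀ {x} → x ∈ Λ → P x) →
    (∀ s γ {v} → All (λ x → proj₁ x ≡ K) s → All P γ → Good v → G (s ++ γ) v ≈ ω (length s) * H γ v) →
    W (block K bs Λ) G u ≈ Σl (upTo B) (λ m → ω m * S K bs m (W Λ H) u)
  W-block K [] Λ P {H} (suc B) ω {G} {u} Gu lt p e = ≈-trans (W-cong P Λ Gu p (λ γ a Gv _ → e [] γ [] a Gv))
    (≈-trans (W-scale Λ (ω 0) Gu) (≈-sym (≈-trans (+-congˡ (≈-trans
      (≈-trans (≈-reflexive (cong (λ l → Σl l (λ m → ω m * S K [] m (W Λ H) u)) (sym (map-upTo suc B)))) (Σ-map suc (upTo B) _))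
      (Σ-0 (upTo B) (λ _ → zeroʳ _)))) (+-identityʳ _))))
    where
    W-scale : ∀ Λ c {H u} → Good u → W Λ (λ γ v → c * H γ v) u ≈ c * W Λ H u
    W-scale [] c Gu = ≈-refl
    W-scale ((k , b) ∷ Λ) c {H} Gu = ≈-trans (+-cong (W-scale Λ c Gu)
      (≈-trans (Linear-T k b .congᴸ (λ Gv → W-scale Λ c Gv) Gu) (Linear-T k b .scaleᴸ c _ Gu))) (≈-sym (distribˡ c _ _))
  W-block K (b ∷ bs) Λ P {H} (suc B) ω {G} {u} Gu (s≤s lt) p e = begin
    W (block K bs Λ) G u + Tᵇ K b (W (block K bs Λ) (λ γ → G ((K , b) ∷ γ))) u
      ≈⟨ +-cong (W-block K bs Λ P (suc B) ω Gu (≤-trans lt (ℕP.n≤1+n B)) p e)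
           -- Taking the label (K , b) raises the count by one, hence the shifted weight and the
           -- smaller bound.
           (≈-trans (Linear-T K b .congᴸ (λ Gv → W-block K bs Λ P B (ω ∘ suc) Gv lt p (λ s γ a a′ Gx → e ((K , b) ∷ s) γ (refl ∷ a) a′ Gx)) Gu)
             (≈-trans (sumᴸ (Linear-T K b) (upTo B) _ Gu) (Σ-cong (upTo B) (λ {m} _ → Linear-T K b .scaleᴸ (ω (suc m)) _ Gu)))) ⟩
    Σl (upTo (suc B)) (λ m → ω m * S K bs m f u) + Σl (upTo B) (λ m → ω (suc m) * Tᵇ K b (S K bs m f) u)
      ≈⟨ +-congʳ (+-congˡ (shift _)) ⟩
    (ω 0 * f u + Σl (upTo B) (λ m → ω (suc m) * S K bs (suc m) f u)) + Σl (upTo B) (λ m → ω (suc m) * Tᵇ K b (S K bs m f) u)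
      ≈⟨ ≈-trans (+-assoc _ _ _) (+-congˡ (≈-trans (≈-sym (Σ-+ (upTo B) _ _)) (Σ-cong (upTo B) (λ {m} _ → ≈-sym (distribˡ _ _ _))))) ⟩
    ω 0 * f u + Σl (upTo B) (λ m → ω (suc m) * S K (b ∷ bs) (suc m) f u) ≈⟨ +-congˡ (≈-sym (shift _)) ⟩
    Σl (upTo (suc B)) (λ m → ω m * S K (b ∷ bs) m f u) ∎
    where
    f = W Λ H
    shift : ∀ (t : ℕ → Carrier) → Σl (applyUpTo suc B) t ≈ Σl (upTo B) (t ∘ suc)
    shift t = ≈-trans (≈-reflexive (cong (λ l → Σl l t) (sym (map-upTo suc B)))) (Σ-map suc (upTo B) t)

  -- Used twice: with powers of x_k, to produce x^δ/x^γ, and with 0-1 weights in ℤ, to detect chains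
  -- that repeat an index too often.
  module Weighted (ω : ℕ → ℕ → Carrier) where
    wt : ℕ → ℕ → List Label → Carrier
    wt k zero γ = 1#
    wt k (suc r) γ = ω (suc k) (count (suc k) γ) * wt (suc k) r γ

    TlΩ : ℕ → ℕ → Fn → Fn
    TlΩ k zero f = f
    TlΩ k (suc r) f u = Σl (upTo (suc n)) (λ m → ω (suc k) m * C (suc k) m (TlΩ (suc k) r f) u)

    count-block : ∀ K s γ → All (λ x → proj₁ x ≡ K) s → All (λ x → K < proj₁ x) γ → count K (s ++ γ) ≡ length s
    count-block K [] [] a a′ = refl
    count-block K [] (x ∷ γ) a (p ∷ a′) with proj₁ x ≡ᵇ K in eq
    ... | true = ⊥-elim (<⇒≢ p (sym (≡ᵇ⇒≡ (proj₁ x) K (subst T (sym eq) tt))))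
    ... | false = count-block K [] γ [] a′
    count-block K (x ∷ s) γ (refl ∷ a) a′ with proj₁ x ≡ᵇ proj₁ x in eq
    ... | true = cong suc (count-block K s γ a a′)
    ... | false = ⊥-elim (subst T eq (≡⇒≡ᵇ (proj₁ x) _ refl))

    count-later : ∀ {K k} s γ → All (λ x → proj₁ x ≡ K) s → K < k → count k (s ++ γ) ≡ count k γ
    count-later [] γ a lt = refl
    count-later {K} {k} (x ∷ s) γ (refl ∷ a) lt with proj₁ x ≡ᵇ k in eq
    ... | true = ⊥-elim (<⇒≢ lt (≡ᵇ⇒≡ (proj₁ x) k (subst T (sym eq) tt)))
    ... | false = count-later s γ a lt

    wt-later : ∀ {K} k r s γ → All (λ x → proj₁ x ≡ K) s → K ≤ k → wt k r (s ++ γ) ≡ wt k r γ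
    wt-later k zero s γ a le = refl
    wt-later k (suc r) s γ a le = cong₂ (λ c w → ω (suc k) c * w) (count-later s γ a (s≤s le)) (wt-later (suc k) r s γ a (≤-trans le (ℕP.n≤1+n k)))

    scan-length : ∀ r b → length (scan r b) ≡ r
    scan-length zero b = refl
    scan-length (suc r) b = cong suc (scan-length r (suc b))

    W-grid : ∀ k r f → W (grid k r) (λ γ v → wt k r γ * f v) ≐ TlΩ k r f
    W-grid k zero f G = *-identityˡ _
    W-grid k (suc r) f {u} G = ≈-trans (W-block (suc k) (scan n 0) (grid (suc k) r) (λ x → suc k < proj₁ x) {λ γ v → wt (suc k) r γ * f v} (suc n) (ω (suc k)) G
        (subst (_< suc n) (sym (scan-length n 0)) ≤-refl) (λ {x} m → any-grid⁻ r (suc k) x (∈⇒∈ᵇ m))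
        (λ s γ a a′ _ → ≈-trans (*-congʳ (*-cong (≈-reflexive (cong (ω (suc k)) (count-block (suc k) s γ a a′))) (≈-reflexive (wt-later (suc k) r s γ a ≤-refl)))) (*-assoc _ _ _)))
      (Σ-cong (upTo (suc n)) (λ {m} _ → *-congˡ (Linear-C (suc k) m .congᴸ (W-grid (suc k) r f) G)))

    chain-sum : ∀ {u w : Vec ℕ n} → Good u → Σl (incChains u w) (wt 0 n) ≈ TlΩ 0 n (indicator w) u
    chain-sum {u} {w} G = begin
      Σl (incChains u w) (wt 0 n) ≈⟨ ≈-trans (Σ-map proj₁ (filterᵇ good (chains m u)) _) (Σ-filter good (chains m u) _) ⟩
      Σl (chains m u) (λ c → (increasing (proj₁ c) ∧ does (proj₂ c ≟ᵛ w)) ⊙ wt 0 n (proj₁ c)) ≈⟨ Σ-cong (chains m u) (λ {c} mc → regate c mc) ⟩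
      Σl (chains m u) (λ c → (increasing (proj₁ c) ∧ headIn (grid 0 n) (proj₁ c)) ⊙ F (proj₁ c) (proj₂ c)) ≈⟨ chain-W (Closed-grid n 0 refl) m F G ⟩
      W (grid 0 n) (λ γ v → (length γ ≡ᵇ m) ⊙ F γ v) u
        ≈⟨ W-cong (λ _ → ⊤) (grid 0 n) G (λ _ → tt) (λ γ {v} _ _ lv → degate γ v lv) ⟩
      W (grid 0 n) F u ≈⟨ W-grid 0 n (indicator w) G ⟩
      TlΩ 0 n (indicator w) u ∎
      where
      m = len w ∸ len u
      good : List Label × Vec ℕ n → Bool
      good c = increasing (proj₁ c) ∧ does (proj₂ c ≟ᵛ w)
      F : List Label → Fn
      F γ v = wt 0 n γ * indicator w v
      F-ind : ∀ d x → d ⊙ x ≈ x * (d ⊙ 1#)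
      F-ind true x = ≈-sym (*-identityʳ x)
      F-ind false x = ≈-sym (zeroʳ x)
      head-true : ∀ {γ} → γ ≡ [] ⊎ (∃ λ y → ∃ λ γ′ → γ ≡ y ∷ γ′ × InGrid y) → headIn (grid 0 n) γ ≡ true
      head-true (inj₁ refl) = refl
      head-true (inj₂ (y , γ′ , refl , Iy)) = T⇒≡ (any-grid⁺ n 0 y refl Iy (proj₁ (proj₁ Iy)))
      regate : ∀ c → c ∈ chains m u → (increasing (proj₁ c) ∧ does (proj₂ c ≟ᵛ w)) ⊙ wt 0 n (proj₁ c) ≈
        (increasing (proj₁ c) ∧ headIn (grid 0 n) (proj₁ c)) ⊙ F (proj₁ c) (proj₂ c)
      regate c mc = ≈-trans (⊙-∧ (increasing (proj₁ c)) _ _) (≈-trans (⊙-cong (increasing (proj₁ c)) (F-ind (does (proj₂ c ≟ᵛ w)) _))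
        (≈-sym (≈-trans (⊙-∧ (increasing (proj₁ c)) _ _) (⊙-cong (increasing (proj₁ c)) (≈-reflexive (cong (_⊙ F (proj₁ c) (proj₂ c)) (head-true (chains-head G m mc))))))))
      degate : ∀ γ v → len v ≡ len u ℕ.+ length γ → (length γ ≡ᵇ m) ⊙ F γ v ≈ F γ v
      degate γ v lv with v ≟ᵛ w
      ... | no _ = ≈-trans (⊙-zero (length γ ≡ᵇ m) (λ _ → zeroʳ _)) (≈-sym (zeroʳ _))
      ... | yes refl = ⊙-T (length γ ≡ᵇ m) (≡⇒≡ᵇ (length γ) m (sym (trans (cong (_∸ len u) lv) (ℕP.m+n∸m≡n (len u) (length γ)))))

-- The quotient by the elementary symmetric polynomials

module PolyRing (n : ℕ) where
  open Sums ℤ-ring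
  open LinearForms ℤ-ring

  infix 4 _≗_
  -- Equality tested by all linear functionals on monomials. It is equivalent to `≈P`, and it
  -- reduces the ring laws for term lists to identities between finite sums of integers.
  _≗_ : Poly n → Poly n → Set
  p ≗ q = ∀ (χ : Mono n → ℤ) → lin χ p ≡ lin χ q

  ≈P⇒≗ : ∀ {p q} → p ≈P q → p ≗ q
  ≈P⇒≗ {p} {q} e χ = lin-resp χ {p} {q} e

  coeff-lin : ∀ (p : Poly n) β → coeff p β ≡ lin (λ α → does (α ≟ᵛ β) ⊙ 1ℤ) p
  coeff-lin p β = trans (ι-coeff p β) (Σ-cong p (λ {t} _ → sym (trans (⊙-* (does (proj₂ t ≟ᵛ β)) (proj₁ t) 1ℤ)
    (⊙-cong (does (proj₂ t ≟ᵛ β)) (ℤP.*-identityʳ (proj₁ t))))))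

  ≗⇒≈P : ∀ {p q} → p ≗ q → p ≈P q
  ≗⇒≈P {p} {q} e β = trans (coeff-lin p β) (trans (e _) (sym (coeff-lin q β)))

  lin-+ : ∀ χ (p q : Poly n) → lin χ (p +P q) ≡ lin χ p ℤ.+ lin χ q
  lin-+ χ p q = Σ-++ p q _

  lin-cong : ∀ {χ ψ : Mono n → ℤ} (p : Poly n) → (∀ α → χ α ≡ ψ α) → lin χ p ≡ lin ψ p
  lin-cong p e = Σ-cong p (λ {t} _ → cong (proj₁ t ℤ.*_) (e (proj₂ t)))

  lin-add : ∀ (χ ψ : Mono n → ℤ) p → lin (λ α → χ α ℤ.+ ψ α) p ≡ lin χ p ℤ.+ lin ψ p
  lin-add χ ψ p = trans (Σ-cong p (λ {t} _ → ℤP.*-distribˡ-+ (proj₁ t) _ _)) (Σ-+ p _ _)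

  lin-scale : ∀ c (χ : Mono n → ℤ) p → lin (λ α → c ℤ.* χ α) p ≡ c ℤ.* lin χ p
  lin-scale c χ p = trans (Σ-cong p (λ {t} _ → trans (sym (ℤP.*-assoc (proj₁ t) c _)) (trans (cong (ℤ._* χ (proj₂ t)) (ℤP.*-comm (proj₁ t) c)) (ℤP.*-assoc c _ _))))
    (sym (Σ-* c p _))

  lin-Σ : ∀ {X : Set} (xs : List X) (χ : X → Mono n → ℤ) p → lin (λ α → Σl xs (λ x → χ x α)) p ≡ Σl xs (λ x → lin (χ x) p)
  lin-Σ xs χ p = trans (Σ-cong p (λ {t} _ → Σ-* (proj₁ t) xs _)) (Σ-swap p xs _)

  conv : (Mono n → ℤ) → Poly n → Mono n → ℤ
  conv χ q α = lin (λ β → χ (zipWith ℕ._+_ α β)) q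

  lin-* : ∀ χ (p q : Poly n) → lin χ (p *P q) ≡ lin (conv χ q) p
  lin-* χ p q = lin-*P χ p q

  zipWith-comm : ∀ {k} (α β : Vec ℕ k) → zipWith ℕ._+_ α β ≡ zipWith ℕ._+_ β α
  zipWith-comm [] [] = refl
  zipWith-comm (a ∷ α) (b ∷ β) = cong₂ _∷_ (ℕP.+-comm a b) (zipWith-comm α β)

  zipWith-assoc : ∀ {k} (α β γ : Vec ℕ k) → zipWith ℕ._+_ (zipWith ℕ._+_ α β) γ ≡ zipWith ℕ._+_ α (zipWith ℕ._+_ β γ)
  zipWith-assoc [] [] [] = refl
  zipWith-assoc (a ∷ α) (b ∷ β) (c ∷ γ) = cong₂ _∷_ (ℕP.+-assoc a b c) (zipWith-assoc α β γ)

  zipWith-0 : ∀ {k} (α : Vec ℕ k) → zipWith ℕ._+_ (replicate k 0) α ≡ α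
  zipWith-0 [] = refl
  zipWith-0 (a ∷ α) = cong (a ∷_) (zipWith-0 α)

  *P-comm : ∀ p q → p *P q ≗ q *P p
  *P-comm p q χ = trans (lin-* χ p q) (trans (Σ-cong p (λ {s} _ → Σ-* (proj₁ s) q _))
    (trans (Σ-swap p q _) (trans (Σ-cong q (λ {t} _ → trans (Σ-cong p (λ {s} _ → swap s t)) (sym (Σ-* (proj₁ t) p _)))) (sym (lin-* χ q p)))))
    where
    swap : ∀ (s t : ℤ × Mono n) → proj₁ s ℤ.* (proj₁ t ℤ.* χ (zipWith ℕ._+_ (proj₂ s) (proj₂ t))) ≡
      proj₁ t ℤ.* (proj₁ s ℤ.* χ (zipWith ℕ._+_ (proj₂ t) (proj₂ s)))
    swap (a , α) (b , β) = trans (cong (λ z → a ℤ.* (b ℤ.* χ z)) (zipWith-comm α β))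
      (solve 3 (λ x y z → x :* (y :* z) := y :* (x :* z)) refl a b (χ (zipWith ℕ._+_ β α)))

  *P-assoc : ∀ p q r → (p *P q) *P r ≗ p *P (q *P r)
  *P-assoc p q r χ = trans (lin-* χ (p *P q) r) (trans (lin-* (conv χ r) p q)
    (trans (lin-cong p (λ α → trans (lin-cong q (λ β → lin-cong r (λ γ → cong χ (zipWith-assoc α β γ)))) (sym (lin-* _ q r))))
      (sym (lin-* χ p (q *P r)))))

  *P-distribʳ : ∀ r p q → (p +P q) *P r ≗ (p *P r) +P (q *P r)
  *P-distribʳ r p q χ = trans (lin-* χ (p +P q) r) (trans (lin-+ (conv χ r) p q)
    (trans (cong₂ ℤ._+_ (sym (lin-* χ p r)) (sym (lin-* χ q r))) (sym (lin-+ χ (p *P r) (q *P r)))))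

  *P-negˡ : ∀ p q → (-P p) *P q ≗ -P (p *P q)
  *P-negˡ p q χ = trans (lin-* χ (-P p) q) (trans (lin-neg (conv χ q) p) (trans (cong ℤ.-_ (sym (lin-* χ p q))) (sym (lin-neg χ (p *P q)))))

  ≗-trans : ∀ {p q r} → p ≗ q → q ≗ r → p ≗ r
  ≗-trans e f χ = trans (e χ) (f χ)

  const : ℤ → Poly n
  const c = (c , replicate n 0) ∷ []

  lin-const-* : ∀ c p χ → lin χ (const c *P p) ≡ c ℤ.* lin χ p
  lin-const-* c p χ = trans (lin-* χ (const c) p) (trans (ℤP.+-identityʳ _) (cong (c ℤ.*_) (lin-cong p (λ α → cong χ (zipWith-0 α)))))

  combination : (Fin n → Poly n) → List (Fin n) → Poly n
  combination cs = foldr (λ p acc → (cs p *P esym n (pos p)) +P acc) []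

  lin-combination : ∀ cs L χ → lin χ (combination cs L) ≡ Σl L (λ p → lin χ (cs p *P esym n (pos p)))
  lin-combination cs [] χ = refl
  lin-combination cs (p ∷ L) χ = trans (lin-+ χ (cs p *P esym n (pos p)) _) (cong (ℤ._+_ (lin χ (cs p *P esym n (pos p)))) (lin-combination cs L χ))

  Ideal : Poly n → Set
  Ideal f = Σ (Fin n → Poly n) λ cs → ∀ χ → lin χ f ≡ Σl (allFin n) (λ p → lin χ (cs p *P esym n (pos p)))

  Ideal⇒InIdeal : ∀ {f} → Ideal f → InIdeal f
  Ideal⇒InIdeal {f} (cs , e) = cs , ≗⇒≈P {f} {combination cs (allFin n)} (λ χ → trans (e χ) (sym (lin-combination cs (allFin n) χ)))

  InIdeal⇒Ideal : ∀ {f} → InIdeal f → Ideal f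
  InIdeal⇒Ideal {f} (cs , e) = cs , λ χ → trans (≈P⇒≗ {f} {combination cs (allFin n)} e χ) (lin-combination cs (allFin n) χ)

  Ideal-resp : ∀ {f g} → f ≗ g → Ideal f → Ideal g
  Ideal-resp e (cs , h) = cs , λ χ → trans (sym (e χ)) (h χ)

  Ideal-0 : Ideal []
  Ideal-0 = (λ _ → []) , λ χ → sym (Σ-0 (allFin n) (λ _ → refl))

  Ideal-+ : ∀ {f g} → Ideal f → Ideal g → Ideal (f +P g)
  Ideal-+ {f} {g} (cs , h) (ds , k) = (λ p → cs p +P ds p) , λ χ → trans (lin-+ χ f g) (trans (cong₂ ℤ._+_ (h χ) (k χ))
    (trans (sym (Σ-+ (allFin n) _ _)) (Σ-cong (allFin n) (λ {p} _ → sym (trans (*P-distribʳ (esym n (pos p)) (cs p) (ds p) χ)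
      (lin-+ χ (cs p *P esym n (pos p)) _))))))

  Ideal-neg : ∀ {f} → Ideal f → Ideal (-P f)
  Ideal-neg {f} (cs , h) = (λ p → -P (cs p)) , λ χ → trans (lin-neg χ f) (trans (cong ℤ.-_ (h χ))
    (trans (sym (Σ-neg (allFin n) _)) (Σ-cong (allFin n) (λ {p} _ → sym (trans (*P-negˡ (cs p) (esym n (pos p)) χ) (lin-neg χ (cs p *P esym n (pos p))))))))

  Ideal-* : ∀ g {f} → Ideal f → Ideal (g *P f)
  Ideal-* g {f} (cs , h) = (λ p → g *P cs p) , λ χ → trans (lin-* χ g f) (trans (lin-cong g (λ α → h _))
    (trans (lin-Σ (allFin n) (λ p α → lin (λ β → χ (zipWith ℕ._+_ α β)) (cs p *P esym n (pos p))) g)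
      (Σ-cong (allFin n) (λ {p} _ → trans (sym (lin-* χ g (cs p *P esym n (pos p)))) (sym (*P-assoc g (cs p) (esym n (pos p)) χ))))))

  Ideal-e : ∀ (p : Fin n) → Ideal (esym n (pos p))
  Ideal-e p = cs , λ χ → sym (trans (Σ-single (UniqP.allFin⁺ n) (∈-allFin p) (λ {q} _ ne → off q ne χ)) (at χ))
    where
    cs : Fin n → Poly n
    cs q = if does (q FinP.≟ p) then const 1ℤ else []
    off : ∀ q → q ≢ p → ∀ χ → lin χ (cs q *P esym n (pos q)) ≡ 0ℤ
    off q ne χ with q FinP.≟ p
    ... | yes e = ⊥-elim (ne e)
    ... | no _ = refl
    at : ∀ χ → lin χ (cs p *P esym n (pos p)) ≡ lin χ (esym n (pos p))
    at χ with p FinP.≟ p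
    ... | yes _ = trans (lin-const-* 1ℤ (esym n (pos p)) χ) (ℤP.*-identityˡ _)
    ... | no ne = ⊥-elim (ne refl)

  infix 4 _∼_
  _∼_ : Poly n → Poly n → Set
  p ∼ q = Ideal (p +P (-P q))

  lin-∼ : ∀ χ (p q : Poly n) → lin χ (p +P (-P q)) ≡ lin χ p ℤ.- lin χ q
  lin-∼ χ p q = trans (lin-+ χ p (-P q)) (cong (ℤ._+_ (lin χ p)) (lin-neg χ q))

  ≗⇒∼ : ∀ {p q} → p ≗ q → p ∼ q
  ≗⇒∼ {p} {q} e = Ideal-resp {[]} {p +P (-P q)} (λ χ → sym (trans (lin-∼ χ p q) (trans (cong (ℤ._- lin χ q) (e χ)) (ℤP.+-inverseʳ (lin χ q))))) Ideal-0

  ∼-refl : ∀ {p} → p ∼ p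
  ∼-refl {p} = ≗⇒∼ {p} {p} (λ _ → refl)

  ∼-sym : ∀ {p q} → p ∼ q → q ∼ p
  ∼-sym {p} {q} e = Ideal-resp { -P (p +P (-P q))} {q +P (-P p)}
    (λ χ → trans (lin-neg χ (p +P (-P q))) (trans (cong ℤ.-_ (lin-∼ χ p q)) (trans
      (solve 2 (λ a b → :- (a :- b) := b :- a) refl (lin χ p) (lin χ q)) (sym (lin-∼ χ q p))))) (Ideal-neg {p +P (-P q)} e)

  ∼-trans : ∀ {p q r} → p ∼ q → q ∼ r → p ∼ r
  ∼-trans {p} {q} {r} e f = Ideal-resp {(p +P (-P q)) +P (q +P (-P r))} {p +P (-P r)}
    (λ χ → trans (lin-+ χ (p +P (-P q)) (q +P (-P r))) (trans (cong₂ ℤ._+_ (lin-∼ χ p q) (lin-∼ χ q r)) (trans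
      (solve 3 (λ a b c → (a :- b) :+ (b :- c) := a :- c) refl (lin χ p) (lin χ q) (lin χ r)) (sym (lin-∼ χ p r)))))
    (Ideal-+ {p +P (-P q)} {q +P (-P r)} e f)

  +P-cong : ∀ {p p′ q q′} → p ∼ p′ → q ∼ q′ → (p +P q) ∼ (p′ +P q′)
  +P-cong {p} {p′} {q} {q′} e f = Ideal-resp {(p +P (-P p′)) +P (q +P (-P q′))} {(p +P q) +P (-P (p′ +P q′))}
    (λ χ → trans (lin-+ χ (p +P (-P p′)) (q +P (-P q′))) (trans (cong₂ ℤ._+_ (lin-∼ χ p p′) (lin-∼ χ q q′)) (trans
      (solve 4 (λ a b c d → (a :- b) :+ (c :- d) := (a :+ c) :- (b :+ d)) refl (lin χ p) (lin χ p′) (lin χ q) (lin χ q′))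
      (sym (trans (lin-∼ χ (p +P q) (p′ +P q′)) (cong₂ ℤ._-_ (lin-+ χ p q) (lin-+ χ p′ q′))))))) (Ideal-+ {p +P (-P p′)} {q +P (-P q′)} e f)

  -P-cong : ∀ {p q} → p ∼ q → (-P p) ∼ (-P q)
  -P-cong {p} {q} e = Ideal-resp { -P (p +P (-P q))} {(-P p) +P (-P (-P q))}
    (λ χ → trans (lin-neg χ (p +P (-P q))) (trans (cong ℤ.-_ (lin-∼ χ p q)) (trans (ℤP.neg-distrib-+ (lin χ p) _)
      (sym (trans (lin-∼ χ (-P p) (-P q)) (cong₂ ℤ._-_ (lin-neg χ p) (lin-neg χ q))))))) (Ideal-neg {p +P (-P q)} e)

  *P-congʳ∼ : ∀ r {p q} → p ∼ q → (r *P p) ∼ (r *P q)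
  *P-congʳ∼ r {p} {q} e = Ideal-resp {r *P (p +P (-P q))} {(r *P p) +P (-P (r *P q))}
    (λ χ → trans (lin-* χ r (p +P (-P q))) (trans (lin-cong r (λ α → lin-∼ _ p q)) (trans
      (trans (lin-add (conv χ p) (λ α → ℤ.- conv χ q α) r) (cong (ℤ._+_ (lin (conv χ p) r))
        (trans (trans (lin-cong r (λ α → sym (ℤP.-1*i≡-i (conv χ q α)))) (lin-scale (ℤ.- 1ℤ) (conv χ q) r)) (ℤP.-1*i≡-i _))))
      (sym (trans (lin-∼ χ (r *P p) (r *P q)) (cong₂ ℤ._-_ (lin-* χ r p) (lin-* χ r q))))))) (Ideal-* r {p +P (-P q)} e)

  *P-cong : ∀ {p p′ q q′} → p ∼ p′ → q ∼ q′ → (p *P q) ∼ (p′ *P q′)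
  *P-cong {p} {p′} {q} {q′} e f = ∼-trans {p *P q} {p *P q′} {p′ *P q′} (*P-congʳ∼ p {q} {q′} f)
    (∼-trans {p *P q′} {q′ *P p} {p′ *P q′} (≗⇒∼ {p *P q′} {q′ *P p} (*P-comm p q′))
      (∼-trans {q′ *P p} {q′ *P p′} {p′ *P q′} (*P-congʳ∼ q′ {p} {p′} e) (≗⇒∼ {q′ *P p′} {p′ *P q′} (*P-comm q′ p′))))

  -- The carrier stays the type of term lists, with congruence modulo the ideal as equality.
  -- Addition is concatenation, so a sum of monomials in this ring is the term list itself and its
  -- coefficients remain accessible.
  quotient : RingOverℤ
  quotient = record
    { ring = record
      { Carrier = Poly n ; _≈_ = _∼_ ; _+_ = _+P_ ; _*_ = _*P_ ; -_ = -P_ ; 0# = [] ; 1# = const 1ℤ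
      ; isCommutativeRing = record
        { isRing = record
          { +-isAbelianGroup = record
            { isGroup = record
              { isMonoid = record
                { isSemigroup = record
                  { isMagma = record
                    { isEquivalence = record { refl = λ {p} → ∼-refl {p} ; sym = λ {p} {q} → ∼-sym {p} {q} ; trans = λ {p} {q} {r} → ∼-trans {p} {q} {r} }
                    ; ∙-cong = λ {p} {p′} {q} {q′} → +P-cong {p} {p′} {q} {q′} }
                  ; assoc = λ p q r → ≗⇒∼ {(p +P q) +P r} {p +P (q +P r)} (λ χ → trans (trans (lin-+ χ (p +P q) r) (cong (ℤ._+ lin χ r) (lin-+ χ p q)))
                      (trans (ℤP.+-assoc (lin χ p) _ _) (sym (trans (lin-+ χ p (q +P r)) (cong (ℤ._+_ (lin χ p)) (lin-+ χ q r)))))) }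
                ; identity = (λ p → ∼-refl {p}) , (λ p → ≗⇒∼ {p +P []} {p} (λ χ → trans (lin-+ χ p []) (ℤP.+-identityʳ _))) }
              ; inverse = (λ p → ≗⇒∼ {(-P p) +P p} {[]} (λ χ → trans (lin-+ χ (-P p) p) (trans (cong (ℤ._+ lin χ p) (lin-neg χ p)) (ℤP.+-inverseˡ (lin χ p)))))
                        , (λ p → ≗⇒∼ {p +P (-P p)} {[]} (λ χ → trans (lin-∼ χ p p) (ℤP.+-inverseʳ (lin χ p))))
              ; ⁻¹-cong = λ {p} {q} → -P-cong {p} {q} }
            ; comm = λ p q → ≗⇒∼ {p +P q} {q +P p} (λ χ → trans (lin-+ χ p q) (trans (ℤP.+-comm (lin χ p) _) (sym (lin-+ χ q p)))) }
          ; *-cong = λ {p} {p′} {q} {q′} → *P-cong {p} {p′} {q} {q′}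
          ; *-assoc = λ p q r → ≗⇒∼ {(p *P q) *P r} {p *P (q *P r)} (*P-assoc p q r)
          ; *-identity = (λ p → ≗⇒∼ {const 1ℤ *P p} {p} (one p))
                       , (λ p → ≗⇒∼ {p *P const 1ℤ} {p} (≗-trans {p *P const 1ℤ} {const 1ℤ *P p} {p} (*P-comm p (const 1ℤ)) (one p)))
          ; distrib = (λ r p q → ≗⇒∼ {r *P (p +P q)} {(r *P p) +P (r *P q)} (λ χ → trans (*P-comm r (p +P q) χ) (trans (*P-distribʳ r p q χ)
                        (trans (lin-+ χ (p *P r) (q *P r)) (trans (cong₂ ℤ._+_ (*P-comm p r χ) (*P-comm q r χ)) (sym (lin-+ χ (r *P p) (r *P q))))))))
                    , (λ r p q → ≗⇒∼ {(p +P q) *P r} {(p *P r) +P (q *P r)} (*P-distribʳ r p q)) }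
        ; *-comm = λ p q → ≗⇒∼ {p *P q} {q *P p} (*P-comm p q) } }
    ; ι = const
    ; ι-+ = λ a b → ≗⇒∼ {const (a ℤ.+ b)} {const a +P const b} (λ χ → trans (cst (a ℤ.+ b) χ) (trans (ℤP.*-distribʳ-+ _ a b)
        (sym (trans (lin-+ χ (const a) (const b)) (cong₂ ℤ._+_ (cst a χ) (cst b χ))))))
    ; ι-* = λ a b → ≗⇒∼ {const (a ℤ.* b)} {const a *P const b} (λ χ → trans (cst (a ℤ.* b) χ) (trans (ℤP.*-assoc a b _)
        (sym (trans (lin-const-* a (const b) χ) (cong (a ℤ.*_) (cst b χ))))))
    ; ι-neg = λ a → ∼-refl {const (ℤ.- a)}
    ; ι-0 = ≗⇒∼ {const 0ℤ} {[]} (λ χ → cst 0ℤ χ)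
    ; ι-1 = ∼-refl {const 1ℤ}
    }
    where
    cst : ∀ c χ → lin χ (const c) ≡ c ℤ.* χ (replicate n 0)
    cst c χ = ℤP.+-identityʳ _
    one : ∀ p → const 1ℤ *P p ≗ p
    one p χ = trans (lin-const-* 1ℤ p χ) (ℤP.*-identityˡ _)

-- Permutations as good vectors, and the classes of the variables

ent-∈ : ∀ {n} (v : Vec ℕ n) {p} → In n p → ent v p ∈ toList v
ent-∈ (x ∷ v) {suc zero} _ = here refl
ent-∈ (x ∷ v) {suc (suc p)} (_ , s≤s le) = there (ent-∈ v {suc p} (s≤s z≤n , le))

ent-injective : ∀ {n} (v : Vec ℕ n) → Unique (toList v) → ∀ {p q} → In n p → In n q → ent v p ≡ ent v q → p ≡ q
ent-injective (x ∷ v) _ {suc zero} {suc zero} _ _ _ = refl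
ent-injective (x ∷ v) (d ∷ _) {suc zero} {suc (suc q)} _ (_ , s≤s le) e = ⊥-elim (All.lookup d (ent-∈ v {suc q} (s≤s z≤n , le)) e)
ent-injective (x ∷ v) (d ∷ _) {suc (suc p)} {suc zero} (_ , s≤s le) _ e = ⊥-elim (All.lookup d (ent-∈ v {suc p} (s≤s z≤n , le)) (sym e))
ent-injective (x ∷ v) (_ ∷ u) {suc (suc p)} {suc (suc q)} (_ , s≤s le) (_ , s≤s le′) e =
  cong suc (ent-injective v u {suc p} {suc q} (s≤s z≤n , le) (s≤s z≤n , le′) e)

IsPerm⇒Good : ∀ {n} {v : Vec ℕ n} → IsPerm v → Good v
IsPerm⇒Good {n} {v} π .bound Ip with ∈-applyUpTo⁻ suc (∈-resp-↭ π (ent-∈ v Ip))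
... | i , i<n , e = subst (In n) (sym e) (s≤s z≤n , i<n)
IsPerm⇒Good {n} {v} π .inj = ent-injective v (PermS.Unique-resp-↭ (≡.setoid ℕ) (↭⇒↭ₛ (↭-sym π))
  (UniqP.applyUpTo⁺₁ suc n (λ i<j _ e → <⇒≢ i<j (suc-injective e))))

module EvalClass (n : ℕ) where
  open PolyRing n
  open Sums quotient
  open LinearForms quotient using (lin)

  X : ℕ → Poly n
  X k = mono (single k 1)

  open Substitution quotient X

  mono-* : ∀ (α β : Mono n) {γ} → zipWith ℕ._+_ α β ≡ γ → mono α * mono β ≈ mono γ
  mono-* α β refl = ≈-refl {mono (zipWith ℕ._+_ α β)}

  ent-single : ∀ k a {p} → In n p → ent (single {n} k a) p ≡ (if p ≡ᵇ k then a else 0)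
  ent-single k a {p} Ip = ent-tabulate (λ p → if p ≡ᵇ k then a else 0) p Ip

  pw-mono : ∀ k a → pw k a ≈ mono (single k a)
  pw-mono k zero = ≈-reflexive (cong mono (ent-ext {u = replicate n 0} {single k 0} (λ p Ip → trans (zeros n p) (sym (trans (ent-single k 0 Ip) (same (p ≡ᵇ k)))))))
    where
    zeros : ∀ m p → ent (replicate m 0) p ≡ 0
    zeros zero p = refl
    zeros (suc m) zero = refl
    zeros (suc m) (suc zero) = refl
    zeros (suc m) (suc (suc p)) = zeros m (suc p)
    same : ∀ b → (if b then 0 else 0) ≡ 0
    same true = refl
    same false = refl
  pw-mono k (suc a) = ≈-trans {X k * pw k a} {X k * mono (single k a)} {mono (single k (suc a))} (*-congˡ {X k} {pw k a} {mono (single k a)} (pw-mono k a)) (mono-* (single k 1) (single k a)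
    (ent-ext λ p Ip → trans (ent-zipWith-+ (single {n} k 1) (single k a) p) (trans (cong₂ ℕ._+_ (ent-single k 1 Ip) (ent-single k a Ip))
      (trans (same (p ≡ᵇ k)) (sym (ent-single k (suc a) Ip))))))
    where
    same : ∀ b → (if b then 1 else 0) ℕ.+ (if b then a else 0) ≡ (if b then suc a else 0)
    same true = refl
    same false = refl

  embFun : ∀ {r} → ℕ → Vec ℕ r → ℕ → ℕ
  embFun o α p = if o <ᵇ p then ent α (p ∸ o) else 0

  -- Exponents of the variables from o+1 on, padded with zeros. An entry for a variable beyond n is
  -- dropped, in agreement with `X k`, which is 1 there.
  emb : ∀ {r} → ℕ → Vec ℕ r → Mono n
  emb o α = tabulate (λ p → embFun o α (pos p))

  ent-emb : ∀ {r} o (α : Vec ℕ r) {p} → In n p → ent (emb o α) p ≡ embFun o α p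
  ent-emb o α {p} Ip = ent-tabulate (embFun o α) p Ip

  monomial-mono : ∀ {r} o (α : Vec ℕ r) → monomial o α ≈ mono (emb o α)
  monomial-mono o [] = ≈-trans {const 1ℤ} {mono (single 0 0)} {mono (emb o [])} (pw-mono 0 0) (≈-reflexive (cong mono (ent-ext {u = single 0 0} {emb o []} λ p Ip →
    trans (ent-single 0 0 Ip) (trans (same (p ≡ᵇ 0)) (sym (trans (ent-emb o [] Ip) (same (o <ᵇ p))))))))
    where
    same : ∀ b → (if b then 0 else 0) ≡ 0
    same true = refl
    same false = refl
  monomial-mono o (a ∷ α) = ≈-trans {pw (suc o) a * monomial (suc o) α} {mono (single (suc o) a) * mono (emb (suc o) α)} {mono (emb o (a ∷ α))}
    (*-cong {pw (suc o) a} {mono (single (suc o) a)} {monomial (suc o) α} {mono (emb (suc o) α)} (pw-mono (suc o) a) (monomial-mono (suc o) α))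
    (mono-* (single (suc o) a) (emb (suc o) α) (ent-ext λ p Ip → trans (ent-zipWith-+ (single {n} (suc o) a) (emb (suc o) α) p)
      (trans (cong₂ ℕ._+_ (ent-single (suc o) a Ip) (ent-emb (suc o) α Ip)) (trans (add p) (sym (ent-emb o (a ∷ α) Ip))))))
    where
    add : ∀ p → (if p ≡ᵇ suc o then a else 0) ℕ.+ embFun (suc o) α p ≡ embFun o (a ∷ α) p
    add p with <-cmp p (suc o)
    ... | tri< lt ne _ = trans (cong₂ ℕ._+_ (if-¬T (p ≡ᵇ suc o) (ne ∘ ≡ᵇ⇒≡ p (suc o))) (if-¬T (suc o <ᵇ p) (λ t → <-asym lt (<ᵇ⇒< (suc o) p t))))
            (sym (if-¬T (o <ᵇ p) (λ t → <⇒≱ lt (<ᵇ⇒< o p t))))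
    ... | tri≈ nlt refl _ = trans (cong₂ ℕ._+_ (if-T (p ≡ᵇ p) (≡⇒≡ᵇ p p refl)) (if-¬T (p <ᵇ p) (λ t → <-irrefl refl (<ᵇ⇒< p p t))))
            (trans (ℕP.+-identityʳ a) (sym (trans (if-T (o <ᵇ suc o) (<⇒<ᵇ (n<1+n o))) (cong (ent (a ∷ α)) (ℕP.m+n∸n≡m 1 o)))))
    ... | tri> _ ne gt = trans (cong₂ ℕ._+_ (if-¬T (p ≡ᵇ suc o) (ne ∘ ≡ᵇ⇒≡ p (suc o))) (if-T (suc o <ᵇ p) (<⇒<ᵇ gt)))
            (sym (trans (if-T (o <ᵇ p) (<⇒<ᵇ (<-trans (n<1+n o) gt))) (tail (p ∸ o) (p ∸ suc o) (ℕP.+-∸-assoc 1 {p} {suc o} (<⇒≤ gt)) (ℕP.m<n⇒0<n∸m gt))))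
      where
      tail : ∀ x y → x ≡ suc y → 0 < y → ent (a ∷ α) x ≡ ent α y
      tail x (suc y) refl _ = refl

  emb-0 : ∀ (α : Mono n) → emb 0 α ≡ α
  emb-0 α = ent-ext {u = emb 0 α} {α} λ p Ip → trans (ent-emb 0 α Ip) (if-T (0 <ᵇ p) (<⇒<ᵇ (proj₁ Ip)))

  -- Substituting for each variable its own class gives back the class of the polynomial. This
  -- converts the kernel formula for scalars X into an identity between classes.
  eval-class : ∀ p → eval p ≈ p
  eval-class p = ≈-trans {eval p} {Σl p (λ t → t ∷ [])} {p} (Σ-cong p (λ {t} _ → term t)) (≈-reflexive (flat p))
    where
    flat : ∀ p → Σl p (λ t → t ∷ []) ≡ p
    flat [] = refl
    flat (t ∷ p) = cong (t ∷_) (flat p)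
    term : ∀ t → const (proj₁ t) * monomial 0 (proj₂ t) ≈ t ∷ []
    term (c , α) = ≈-trans {const c * monomial 0 α} {const c * mono α} {(c , α) ∷ []} (*-congˡ {const c} {monomial 0 α} {mono α}
        (≈-trans {monomial 0 α} {mono (emb 0 α)} {mono α} (monomial-mono 0 α) (≈-reflexive (cong mono (emb-0 α)))))
      (≗⇒∼ {const c *P mono α} {(c , α) ∷ []} (λ χ → trans (lin-const-* c (mono α) χ) (cst χ)))
      where
      cst : ∀ χ → c ℤ.* (1ℤ ℤ.* χ α ℤ.+ 0ℤ) ≡ c ℤ.* χ α ℤ.+ 0ℤ
      cst χ = trans (cong (c ℤ.*_) (trans (ℤP.+-identityʳ _) (ℤP.*-identityˡ _))) (sym (ℤP.+-identityʳ _))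

  open Complete quotient n
  open Kernel X

  e-class : ∀ m → m < n → eval (esym n (suc m)) ≈ 0#
  e-class m lt = ≈-trans {eval (esym n (suc m))} {esym n (suc m)} {0#} (eval-class (esym n (suc m)))
    (Ideal-resp {esym n (suc m)} {esym n (suc m) +P []} (λ χ → sym (trans (lin-+ χ (esym n (suc m)) []) (ℤP.+-identityʳ _)))
      (subst (λ z → Ideal (esym n z)) (cong suc (FinP.toℕ-fromℕ< lt)) (Ideal-e (fromℕ< lt))))

  class-formula : ∀ {u w : Vec ℕ n} → Good u → Good w → Tl 0 n (Evaluation.indicator quotient n w) u ≈ schub (w0mul w) * schub u
  class-formula {u} {w} G H = ≈-trans {Tl 0 n (Evaluation.indicator quotient n w) u} {eval (schub (w0mul w)) * eval (schub u)} {schub (w0mul w) * schub u}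
    (kernel-formula (esX-vanish e-class) G H)
    (*-cong {eval (schub (w0mul w))} {schub (w0mul w)} {eval (schub u)} {schub u} (eval-class (schub (w0mul w))) (eval-class (schub u)))

-- The sum over chains as the kernel

module ChainKernel (A : RingOverℤ) (n : ℕ) (X : ℕ → Sums.Carrier A) where
  open Sums A
  open Operators A n
  open Complete A n
  open Chains A n
  open Kernel X
  open Substitution A X
  open Evaluation A n

  weight : ℕ → ℕ → Carrier
  weight k m = pw k (n ∸ k ∸ m)

  open Weighted weight public

  Y-sum : ∀ k N f {u} → Σl (upTo (suc N)) (λ m → pw k (N ∸ m) * C k m f u) ≈ Y (X k) k N f u
  Y-sum k zero f = ≈-trans (+-identityʳ _) (*-identityˡ _)
  Y-sum k (suc N) f {u} = begin
    Σl (upTo (suc (suc N))) t′ ≡⟨ cong (λ l → Σl l t′) (upTo-∷ʳ (suc N)) ⟨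
    Σl (upTo (suc N) ++ suc N ∷ []) t′ ≈⟨ Σ-++ (upTo (suc N)) (suc N ∷ []) t′ ⟩
    Σl (upTo (suc N)) t′ + (t′ (suc N) + 0#)
      ≈⟨ +-cong (Σ-cong (upTo (suc N)) (λ {m} i → factor m (∈-upTo⁻ i))) (≈-trans (+-identityʳ _) last) ⟩
    Σl (upTo (suc N)) (λ m → X k * (pw k (N ∸ m) * C k m f u)) + C k (suc N) f u ≈⟨ +-congʳ (Σ-* (X k) (upTo (suc N)) _) ⟨
    X k * Σl (upTo (suc N)) (λ m → pw k (N ∸ m) * C k m f u) + C k (suc N) f u ≈⟨ +-congʳ (*-congˡ (Y-sum k N f)) ⟩
    X k * Y (X k) k N f u + C k (suc N) f u ∎
    where
    t′ : ℕ → Carrier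
    t′ m = pw k (suc N ∸ m) * C k m f u
    factor : ∀ m → m < suc N → t′ m ≈ X k * (pw k (N ∸ m) * C k m f u)
    factor m (s≤s le) = ≈-trans (*-congʳ (≈-reflexive (cong (pw k) (ℕP.+-∸-assoc 1 {N} {m} le)))) (*-assoc _ _ _)
    last : t′ (suc N) ≈ C k (suc N) f u
    last = ≈-trans (*-congʳ (≈-reflexive (cong (pw k) (ℕP.n∸n≡0 N)))) (*-identityˡ _)

  -- The weighted sum runs over all m up to n, where the exponent n-k-m may be truncated. Beyond
  -- n-k, however, `C k m` vanishes, so only exact exponents contribute.
  TlΩ-Tl : ∀ k r f → k ℕ.+ r ≡ n → TlΩ k r f ≐ Tl k r f
  TlΩ-Tl k zero f e G = ≈-refl
  TlΩ-Tl k (suc r) f e {u} G = begin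
    Σl (upTo (suc n)) (λ m → weight (suc k) m * C (suc k) m (TlΩ (suc k) r f) u)
      ≈⟨ Σ-cong (upTo (suc n)) (λ {m} _ → *-congˡ (Linear-C (suc k) m .congᴸ (TlΩ-Tl (suc k) r f e′) G)) ⟩
    Σl (upTo (suc n)) (λ m → weight (suc k) m * C (suc k) m g u)
      ≈⟨ Σ-subset _≟_ (UniqP.upTo⁺ (suc N)) (UniqP.upTo⁺ (suc n))
           (λ i → ∈-upTo⁺ (≤-trans (∈-upTo⁻ i) (s≤s (ℕP.m∸n≤m n (suc k)))))
           (λ {m} _ out → ≈-trans (*-congˡ (C-vanish N (suc k) m sucN (≰⇒> (λ le → out (∈-upTo⁺ (s≤s le)))) g G)) (zeroʳ _)) ⟨
    Σl (upTo (suc N)) (λ m → weight (suc k) m * C (suc k) m g u) ≈⟨ Y-sum (suc k) N g ⟩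
    Y (X (suc k)) (suc k) N g u ∎
    where
    N = n ∸ suc k
    g = Tl (suc k) r f
    e′ : suc k ℕ.+ r ≡ n
    e′ = trans (sym (ℕP.+-suc k r)) e
    sucN : suc k ℕ.+ N ≡ n
    sucN = ℕP.m+[n∸m]≡n (subst (suc k ≤_) e′ (ℕP.m≤m+n (suc k) r))

  exponents : ℕ → (r : ℕ) → List Label → Vec ℕ r
  exponents k zero γ = []
  exponents k (suc r) γ = (n ∸ suc k ∸ count (suc k) γ) ∷ exponents (suc k) r γ

  wt-monomial : ∀ k r γ → wt k r γ ≡ monomial k (exponents k r γ)
  wt-monomial k zero γ = refl
  wt-monomial k (suc r) γ = cong (pw (suc k) (n ∸ suc k ∸ count (suc k) γ) *_) (wt-monomial (suc k) r γ)

  exponents-∸ : ∀ γ → exponents 0 n γ ≡ zipWith _∸_ (δ n) (chainExp γ)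
  exponents-∸ γ = general n 0 (λ p → suc p) refl
    where
    general : ∀ r k (h : ℕ → ℕ) → (h ≡ λ p → suc (k ℕ.+ p)) → exponents k r γ ≡
      zipWith _∸_ (tabulate (λ (p : Fin r) → n ∸ h (toℕ p))) (tabulate (λ p → count (h (toℕ p)) γ))
    general zero k h e = refl
    general (suc r) k h refl = cong₂ _∷_ (cong (λ z → n ∸ z ∸ count z γ) (cong suc (sym (ℕP.+-identityʳ k))))
      (trans (general r (suc k) (λ p → suc (suc k ℕ.+ p)) refl) (cong₂ (zipWith _∸_)
        (tab (λ z → n ∸ z)) (tab (λ z → count z γ))))
      where
      tab : ∀ {r} (φ : ℕ → ℕ) → tabulate (λ (p : Fin r) → φ (suc (suc k ℕ.+ toℕ p))) ≡ tabulate (λ p → φ (suc (k ℕ.+ suc (toℕ p))))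
      tab φ = tabulate-cong (λ p → cong (φ ∘ suc) (sym (ℕP.+-suc k (toℕ p))))

module ChainClass (n : ℕ) where
  open PolyRing n
  open Sums quotient
  open EvalClass n
  open Substitution quotient X
  open ChainKernel quotient n X
  open Evaluation quotient n
  open Complete quotient n
  open Kernel X

  chainSum-class : ∀ {u w : Vec ℕ n} → Good u → Good w → chainSum u w ≈ schub u * schub (w0mul w)
  chainSum-class {u} {w} G H = begin
    chainSum u w ≡⟨ flat (incChains u w) ⟩
    Σl (incChains u w) (λ γ → mono (zipWith _∸_ (δ n) (chainExp γ))) ≈⟨ Σ-cong (incChains u w) (λ {γ} _ → ≈-sym {wt 0 n γ} {mono (zipWith _∸_ (δ n) (chainExp γ))} (step γ)) ⟩
    Σl (incChains u w) (wt 0 n) ≈⟨ chain-sum G ⟩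
    TlΩ 0 n (indicator w) u ≈⟨ TlΩ-Tl 0 n (indicator w) refl G ⟩
    Tl 0 n (indicator w) u ≈⟨ class-formula G H ⟩
    schub (w0mul w) * schub u ≈⟨ *-comm (schub (w0mul w)) (schub u) ⟩
    schub u * schub (w0mul w) ∎
    where
    flat : ∀ Γ → map (λ γ → (1ℤ , zipWith _∸_ (δ n) (chainExp γ))) Γ ≡ Σl Γ (λ γ → mono (zipWith _∸_ (δ n) (chainExp γ)))
    flat [] = refl
    flat (γ ∷ Γ) = cong (_ ∷_) (flat Γ)
    step : ∀ γ → wt 0 n γ ≈ mono (zipWith _∸_ (δ n) (chainExp γ))
    step γ = ≈-trans {wt 0 n γ} {monomial 0 (zipWith _∸_ (δ n) (chainExp γ))} {mono (zipWith _∸_ (δ n) (chainExp γ))}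
      (≈-reflexive (trans (wt-monomial 0 n γ) (cong (monomial 0) (exponents-∸ γ))))
      (≈-trans {monomial 0 (zipWith _∸_ (δ n) (chainExp γ))} {mono (emb 0 (zipWith _∸_ (δ n) (chainExp γ)))} {mono (zipWith _∸_ (δ n) (chainExp γ))}
        (monomial-mono 0 (zipWith _∸_ (δ n) (chainExp γ))) (≈-reflexive (cong mono (emb-0 (zipWith _∸_ (δ n) (chainExp γ))))))

-- Exponents of increasing chains are bounded by δ

module Bounds (n : ℕ) where
  open Sums ℤ-ring
  open Operators ℤ-ring n
  open Complete ℤ-ring n
  open Chains ℤ-ring n
  open Evaluation ℤ-ring n

  module _ (k₀ : ℕ) where
    -- With these weights `chain-sum` counts the chains in which k₀ occurs more than n-k₀ times.
    excess : ℕ → ℕ → ℤ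
    excess k m = if k ≡ᵇ k₀ then ((n ∸ k₀) <ᵇ m) ⊙ 1ℤ else 1ℤ

    open Weighted excess

    excess-at : ∀ m → excess k₀ m ≡ ((n ∸ k₀) <ᵇ m) ⊙ 1ℤ
    excess-at m = if-T (k₀ ≡ᵇ k₀) (≡⇒≡ᵇ k₀ k₀ refl)

    excess-off : ∀ {k} m → k ≢ k₀ → excess k m ≡ 1ℤ
    excess-off {k} m ne = if-¬T (k ≡ᵇ k₀) (ne ∘ ≡ᵇ⇒≡ k k₀)

    TlΩ-zero : ∀ k r f → k ℕ.+ r ≡ n → k < k₀ → k₀ ≤ n → TlΩ k r f ≐ (λ _ → 0ℤ)
    TlΩ-zero k zero f e lt le G = ⊥-elim (<⇒≱ lt (subst (k₀ ≤_) (trans (sym e) (ℕP.+-identityʳ k)) le))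
    TlΩ-zero k (suc r) f e lt le {u} G = Σ-0 (upTo (suc n)) (λ {m} _ → term m (suc k ≟ k₀))
      where
      e′ : suc k ℕ.+ r ≡ n
      e′ = trans (sym (ℕP.+-suc k r)) e
      g = TlΩ (suc k) r f
      term : ∀ m → Dec (suc k ≡ k₀) → excess (suc k) m ℤ.* C (suc k) m g u ≡ 0ℤ
      term m (no ne) = trans (cong (ℤ._*_ (excess (suc k) m)) (zeroᴸ (Linear-C (suc k) m) (TlΩ-zero (suc k) r f e′ (≤∧≢⇒< lt ne) le) G)) (ℤP.*-zeroʳ (excess (suc k) m))
      term m (yes refl) with (n ∸ suc k) <? m
      ... | yes big = trans (cong (ℤ._*_ (excess (suc k) m)) (C-vanish (n ∸ suc k) (suc k) m (ℕP.m+[n∸m]≡n le) big g G)) (ℤP.*-zeroʳ (excess (suc k) m))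
      ... | no small = trans (cong (ℤ._* C (suc k) m g u) (trans (excess-at m) (⊙-¬ ((n ∸ suc k) <ᵇ m) (λ t → small (<ᵇ⇒< _ m t))))) (ℤP.*-zeroˡ (C (suc k) m g u))

    wt-one : ∀ k r γ → k₀ ≤ k → wt k r γ ≡ 1ℤ
    wt-one k zero γ le = refl
    wt-one k (suc r) γ le = cong₂ ℤ._*_ (excess-off (count (suc k) γ) (λ e → <⇒≱ (s≤s le) (ℕP.≤-reflexive e))) (wt-one (suc k) r γ (≤-trans le (ℕP.n≤1+n k)))

    wt-excess : ∀ k r γ → k < k₀ → k₀ ≤ k ℕ.+ r → wt k r γ ≡ ((n ∸ k₀) <ᵇ count k₀ γ) ⊙ 1ℤ
    wt-excess k zero γ lt le = ⊥-elim (<⇒≱ lt (subst (k₀ ≤_) (ℕP.+-identityʳ k) le))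
    wt-excess k (suc r) γ lt le with suc k ≟ k₀
    ... | yes refl = trans (cong₂ ℤ._*_ (excess-at (count (suc k) γ)) (wt-one (suc k) r γ ≤-refl)) (ℤP.*-identityʳ _)
    ... | no ne = trans (cong₂ ℤ._*_ (excess-off (count (suc k) γ) ne) (wt-excess (suc k) r γ (≤∧≢⇒< lt ne) (subst (k₀ ≤_) (ℕP.+-suc k r) le))) (ℤP.*-identityˡ _)

    -- Here the values have to lie in ℤ: the sum is a cardinality, and it vanishes only when nothing
    -- is counted.
    Σ-gates-zero : ∀ {Z : Set} (b : Z → Bool) xs → Σl xs (λ x → b x ⊙ 1ℤ) ≡ 0ℤ → ∀ {x} → x ∈ xs → ¬ T (b x)
    Σ-gates-zero b xs e {x} m t = nonempty (∈-filter⁺ (λ x → T? (b x)) m t) (ℤP.+-injective (trans (Length.length-filterᵇ b xs) e))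
      where
      nonempty : ∀ {Z : Set} {ys : List Z} {y} → y ∈ ys → length ys ≢ 0
      nonempty (here _) ()
      nonempty (there _) ()

    -- Increasing chains with too many labels k₀ are counted by C k₀ m with m > n - k₀, which vanishes.
    count-bound : ∀ {u w : Vec ℕ n} → Good u → In n k₀ → ∀ {γ} → γ ∈ incChains u w → count k₀ γ ≤ n ∸ k₀
    count-bound {u} {w} G Ik {γ} m = ≮⇒≥ (λ lt → Σ-gates-zero (λ γ → (n ∸ k₀) <ᵇ count k₀ γ) (incChains u w)
      (trans (Σ-cong (incChains u w) (λ {γ} _ → sym (wt-excess 0 n γ (proj₁ Ik) (proj₂ Ik))))
        (trans (chain-sum G) (TlΩ-zero 0 n (indicator w) refl (proj₁ Ik) (proj₂ Ik) G))) m (<⇒<ᵇ lt))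

  exponent-bound : ∀ {u w : Vec ℕ n} → Good u → ∀ {γ} → γ ∈ incChains u w → ∀ p → lookup (chainExp γ) p ≤ lookup (δ n) p
  exponent-bound {u} {w} G {γ} m p = subst₂ _≤_ (sym (lookup∘tabulate (λ p → count (pos p) γ) p)) (sym (lookup∘tabulate (λ p → n ∸ pos p) p))
    (count-bound (pos p) {u} {w} G (s≤s z≤n , FinP.toℕ<n p) m)

-- Divisors of x^δ are standard

module StandardMonomials (n : ℕ) where
  open Sums ℤ-ring
  open LinearForms ℤ-ring
  open Operators ℤ-ring n
  open HeckeAction ℤ-ring n
  open Complete ℤ-ring n
  open Evaluation ℤ-ring n
  open Staircase n
  open PolyRing n using (Ideal; InIdeal⇒Ideal; coeff-lin)

  ideal-acts-zero : ∀ {f} → InIdeal f → ∀ g → act f g ≐ (λ _ → 0ℤ)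
  ideal-acts-zero {f} i g {u} G = let (cs , e) = InIdeal⇒Ideal {f} i in trans (e (λ α → actM 0 α g u)) (Σ-0 (allFin n) (λ {p} _ →
    trans (act-*P (cs p) (esym n (pos p)) g G) (zeroᴸ (Linear-act (cs p)) (act-esym-zero (toℕ p) g) G)))

  sum-+ : ∀ {k} (α β : Vec ℕ k) → V.sum (zipWith ℕ._+_ α β) ≡ V.sum α ℕ.+ V.sum β
  sum-+ [] [] = refl
  sum-+ (a ∷ α) (b ∷ β) = trans (cong (a ℕ.+ b ℕ.+_) (sum-+ α β)) (ℕS.solve 4 (λ a b c d → (a ℕS.:+ b) ℕS.:+ (c ℕS.:+ d) ℕS.:= (a ℕS.:+ c) ℕS.:+ (b ℕS.:+ d)) refl a b _ _)
    where
    module ℕS = Data.Nat.Solver.+-*-Solver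

  firstDiffGt-+ : ∀ {k} (β α κ : Vec ℕ k) → firstDiffGt β α → firstDiffGt (zipWith ℕ._+_ β κ) (zipWith ℕ._+_ α κ)
  firstDiffGt-+ [] [] [] ()
  firstDiffGt-+ (b ∷ β) (a ∷ α) (c ∷ κ) (inj₁ lt) = inj₁ (ℕP.+-monoˡ-< c lt)
  firstDiffGt-+ (b ∷ β) (a ∷ α) (c ∷ κ) (inj₂ (e , h)) = inj₂ (cong (ℕ._+ c) e , firstDiffGt-+ β α κ h)

  -- Pairing with x^κ, where α + κ = δ, extracts the coefficient of the leading monomial x^α.
  module _ {α κ : Mono n} (αδ : zipWith ℕ._+_ α κ ≡ δ n) where
    pairing : Mono n → ℤ
    pairing β = actM 0 β (actM 0 κ (indicator w₀)) idPerm

    pairing-+ : ∀ β → pairing β ≡ actM 0 (zipWith ℕ._+_ β κ) (indicator w₀) idPerm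
    pairing-+ β = sym (actM-+ {n} {0} β κ (indicator w₀) ≤-refl Good-id)

    pairing-α : pairing α ≡ 1ℤ
    pairing-α = trans (pairing-+ α) (trans (cong (λ z → actM 0 z (indicator w₀) idPerm) αδ) (trans (xδ-at-id (indicator w₀)) (indicator-at w₀)))

    -- In lower degree, β + κ allows fewer than ℓ(w₀) steps from the identity. In equal degree, as
    -- x_1 is the smallest variable, β - α begins with a positive entry; so β + κ exceeds δ at the
    -- first place where they differ, and the staircase walk overshoots.
    pairing-below : ∀ β → β <ᵈ α → pairing β ≡ 0ℤ
    pairing-below β (inj₁ lt) = trans (pairing-+ β) (Supp-actM {g = indicator w₀} (zipWith ℕ._+_ β κ) ≤-refl (Supp-indicator w₀) (Good-id {n})
      (λ e → <⇒≢ smaller (trans (sym (ℕP.+-identityʳ (V.sum (zipWith ℕ._+_ β κ)))) (trans (cong (ℕ._+ (V.sum (zipWith ℕ._+_ β κ) ℕ.+ 0)) (sym (len-id {n}))) (trans e len-w₀)))))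
      where
      smaller : V.sum (zipWith ℕ._+_ β κ) < V.sum (δ n)
      smaller = subst₂ _<_ (sym (sum-+ β κ)) (trans (sym (sum-+ α κ)) (cong V.sum αδ)) (ℕP.+-monoˡ-< (V.sum κ) lt)
    pairing-below β (inj₂ (_ , h)) = trans (pairing-+ β) (trans (cong (actM 0 (zipWith ℕ._+_ β κ) (indicator w₀)) (sym staircase-id))
      (actM-above-δ {0} (zipWith ℕ._+_ β κ) (indicator w₀) refl (subst (firstDiffGt (zipWith ℕ._+_ β κ)) αδ (firstDiffGt-+ β α κ h))))

    -- The pairing is 1 at α and 0 at every other monomial of f, so it extracts the leading
    -- coefficient of f exactly, whether or not that is a unit. It also kills the ideal, which
    -- forces this coefficient to be 0.
    standard : Standard α
    standard (f , i , nz , lead) = nz (trans (coeff-lin f α) (trans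
        (lin-support _ f uniq inSupp) (trans (Σ-cong supp (λ {β} _ → sym (agree β (coeff f β ℤP.≟ 0ℤ)))) (trans
        (sym (lin-support pairing f uniq inSupp)) (ideal-acts-zero {f} i (actM 0 κ (indicator w₀)) Good-id)))))
      where
      supp = deduplicate _≟ᵛ_ (map proj₂ f)
      uniq = DecUniq.deduplicate-! _≟ᵛ_ (map proj₂ f)
      inSupp : ∀ {t} → t ∈ f → proj₂ t ∈ supp
      inSupp m = ∈-deduplicate⁺ _≟ᵛ_ (∈-map⁺ proj₂ m)
      agree : ∀ β → Dec (coeff f β ≡ 0ℤ) → coeff f β ℤ.* pairing β ≡ coeff f β ℤ.* (does (β ≟ᵛ α) ⊙ 1ℤ)
      agree β (yes z) = trans (cong (ℤ._* pairing β) z) (trans (ℤP.*-zeroˡ (pairing β)) (sym (trans (cong (ℤ._* (does (β ≟ᵛ α) ⊙ 1ℤ)) z) (ℤP.*-zeroˡ (does (β ≟ᵛ α) ⊙ 1ℤ)))))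
      agree β (no nz′) = cong (ℤ._*_ (coeff f β)) (same (lead β nz′) (β ≟ᵛ α))
        where
        same : (β ≡ α) ⊎ (β <ᵈ α) → (q : Dec (β ≡ α)) → pairing β ≡ does q ⊙ 1ℤ
        same _ (yes refl) = pairing-α
        same (inj₁ e) (no ne) = ⊥-elim (ne e)
        same (inj₂ lt) (no ne) = pairing-below β lt

-- The normal form

coeff-support : ∀ {n} (p : Poly n) α → ¬ (coeff p α ≡ 0ℤ) → ∃ λ t → t ∈ p × proj₂ t ≡ α
coeff-support [] α nz = ⊥-elim (nz refl)
coeff-support (t ∷ p) α nz with proj₂ t ≟ᵛ α
... | yes e = t , here refl , e
... | no _ = let (s , m , e) = coeff-support p α nz in s , there m , e

∸-complement : ∀ {n} (d c : Vec ℕ n) → (∀ p → lookup c p ≤ lookup d p) → zipWith ℕ._+_ (zipWith _∸_ d c) c ≡ d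
∸-complement [] [] h = refl
∸-complement (a ∷ d) (b ∷ c) h = cong₂ _∷_ (ℕP.m∸n+n≡m (h Fin.zero)) (∸-complement d c (λ p → h (Fin.suc p)))

-- The first component says that the truncated subtraction in `chainSum` is exact, so that its
-- monomials really are the quotients x^δ/x^γ.
theorem1p2 : (n : ℕ) (u w : Vec ℕ n) → IsPerm u → IsPerm w → u ≤B w →
    All (λ γ → (p : Fin n) → lookup (chainExp γ) p ≤ lookup (δ n) p) (incChains u w)
    × IsNormalForm (chainSum u w) (schub u *P schub (w0mul w))
theorem1p2 n u w πu πw _ = All.tabulate (λ {γ} m p → bound′ m p) , ideal , standard′
  where
  Gu = IsPerm⇒Good πu
  Gw = IsPerm⇒Good πw
  bound′ : ∀ {γ} → γ ∈ incChains u w → ∀ p → lookup (chainExp γ) p ≤ lookup (δ n) p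
  bound′ = Bounds.exponent-bound n {u} {w} Gu
  ideal : InIdeal ((schub u *P schub (w0mul w)) +P (-P chainSum u w))
  ideal = PolyRing.Ideal⇒InIdeal n {(schub u *P schub (w0mul w)) +P (-P chainSum u w)}
    (PolyRing.∼-sym n {chainSum u w} {schub u *P schub (w0mul w)} (ChainClass.chainSum-class n Gu Gw))
  standard′ : ∀ α → ¬ (coeff (chainSum u w) α ≡ 0ℤ) → Standard α
  standard′ α nz with coeff-support (chainSum u w) α nz
  ... | t , m , refl with ∈-map⁻ (λ γ → (1ℤ , zipWith _∸_ (δ n) (chainExp γ))) m
  -- The complementary exponent κ is `chainExp γ` itself; by the bound the two add up to δ.
  ... | γ , mγ , refl = StandardMonomials.standard n (∸-complement (δ n) (chainExp γ) (bound′ mγ))
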